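{- Fix $\varepsilon>0$. Then for every sufficiently large prime $p$ there is a $\Gamma$-orbit $\mathcal{C}(p)\subseteq X^*(p)$ such that $$|X^*(p)\setminus \mathcal{C}(p)|\le p^{\varepsilon},$$ and every $\Gamma$-orbit $\mathcal{D}(p)\subseteq X^*(p)$ satisfies $|\mathcal{D}(p)|\gg (\log p)^{1/3}$ (with an absolute implied constant).
   Context: The Markoff surface is $\mathcal{M}: x_1^2+x_2^2+x_3^2-3x_1x_2x_3=0$. For a prime $p$, let $X^*(p)=\mathcal{M}(\mathbb{Z}/p\mathbb{Z})\setminus\{(0,0,0)\}$ be the set of nonzero solutions in $(\mathbb{Z}/p\mathbb{Z})^3$. Let $\Gamma$ be the group of affine morphisms of $\mathbb{A}^3$ generated by the permutations of the coordinates and the Vieta involutions $R_1,R_2,R_3$, where $R_3(x_1,x_2,x_3)=(x_1,x_2,3x_1x_2-x_3)$, $R_2(x_1,x_2,x_3)=(x_1,3x_1x_3-x_2,x_3)$, $R_1(x_1,x_2,x_3)=(3x_2x_3-x_1,x_2,x_3)$. These preserve $\mathcal{M}$ and $(0,0,0)$, so $\Gamma$ acts by permutations on $X^*(p)$; its orbits are called $\Gamma$-orbits. Note $|X^*(p)|\sim p^2$. -}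

module Defs where

open import Data.Nat using (ℕ; zero; suc; _+_; _*_; _∸_; _^_; _≤_; _<_)
open import Data.Nat.DivMod using (_%_)
open import Data.Product using (_×_; _,_)
open import Data.List using (List; length)
open import Data.List.Relation.Unary.All using (All)
open import Data.List.Relation.Unary.Unique.Propositional using (Unique)
open import Relation.Binary.PropositionalEquality using (_≡_; _≢_)
open import Relation.Binary.Construct.Closure.ReflexiveTransitive using (Star)

-- Points of A^3 over Z/pZ, represented by triples of residues 0 ≤ x < p.
Pt : Set
Pt = ℕ × ℕ × ℕ

-- reduction mod p (only used for p prime, hence p ≥ 1)
modp : ℕ → ℕ → ℕ
modp zero    x = x
modp (suc n) x = x % suc n

OnMarkoff : ℕ → Pt → Set
OnMarkoff p (a , b , c) =
  a < p × b < p × c < p × modp p (a * a + b * b + c * c) ≡ modp p (3 * a * b * c)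

Xstar : ℕ → Pt → Set
Xstar p x = OnMarkoff p x × x ≢ (0 , 0 , 0)

-- Vieta involutions (p ∸ c represents -c mod p for residues c < p)
R1 R2 R3 : ℕ → Pt → Pt
R1 p (a , b , c) = (modp p (3 * b * c + (p ∸ a)) , b , c)
R2 p (a , b , c) = (a , modp p (3 * a * c + (p ∸ b)) , c)
R3 p (a , b , c) = (a , b , modp p (3 * a * b + (p ∸ c)))

-- transpositions (they generate all coordinate permutations)
σ12 σ13 σ23 : Pt → Pt
σ12 (a , b , c) = (b , a , c)
σ13 (a , b , c) = (c , b , a)
σ23 (a , b , c) = (a , c , b)

data Step (p : ℕ) : Pt → Pt → Set where
  stepR1  : ∀ x → Step p x (R1 p x)
  stepR2  : ∀ x → Step p x (R2 p x)
  stepR3  : ∀ x → Step p x (R3 p x)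
  step12 : ∀ x → Step p x (σ12 x)
  step13 : ∀ x → Step p x (σ13 x)
  step23 : ∀ x → Step p x (σ23 x)

-- y lies in the Γ-orbit of x (all generators are involutions, so the
-- reflexive-transitive closure of Step is the orbit relation)
Reach : ℕ → Pt → Pt → Set
Reach p = Star (Step p)

-- "|S|^b ≤ m" for a subset S of Pt: every duplicate-free list of
-- elements of S has length ℓ with ℓ^b ≤ m.
CardPowLe : (Pt → Set) → ℕ → ℕ → Set
CardPowLe S b m = (xs : List Pt) → Unique xs → All S xs → length xs ^ b ≤ m

{-# OPTIONS --safe #-}
-- For large p all of X*(p) is a single Γ-orbit, so the exceptional set is empty, and every orbit has at least p points.
--
-- (1) The ratios u₁ = x₁ / (x₂ x₃), u₂, u₃ add up to 3 on the surface, while the Vieta involution R₁ gives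
-- 2 ∑ u₁ = 3 #{x₂ x₃ ≠ 0} over an orbit O. Comparing the two sums, 3 |O| = 0 in F_p: the size of O is divisible by p.
--
-- (2) On the conic x₁ = a the rotation (x₂ , x₃) ↦ (x₃ , 3 a x₃ − x₂) is multiplication by θ with θ² = 3 a θ − 1. Its order
-- divides p² − 1, so only τ(p² − 1) = p^o(1) orders occur, and all a of one order n arise from the powers of a single θ.
-- Let A be the set of coordinates of O. By (1) and the pigeonhole principle there are, up to factors p^o(1), an order
-- n ≈ |A| and a set V ⊆ A × A with |V| ≈ |A|² on which n / 8 different linear forms only take values in A.
--
-- (3) The Balog–Szemerédi–Gowers argument turns V into an approximate group Y that is nearly preserved by many multipliers.
-- Such multipliers form an approximate subring, and F_p, being generated by 1, has none of intermediate size. Hence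
-- |A| ≥ p^(1 − o(1)), and by Cauchy–Schwarz for the lines defined by the forms A misses only p^o(1) elements of F_p.
--
-- (4) If a = (x + 1/x) / 3 with x a primitive root, then the rotation is transitive on the conic x₁ = a. There are
-- p^(1 − o(1)) such a, so two orbits have one of them in common as a coordinate, and therefore they are equal.
module Submission where

open import Defs
open import Algebra.Bundles using (CommutativeRing; RawRing)
import Algebra.Properties.Ring as RingProps
import Algebra.Solver.Ring as RingSolver
open import Algebra.Solver.Ring.AlmostCommutativeRing using (AlmostCommutativeRing; fromCommutativeRing; _-Raw-AlmostCommutative⟶_; Induced-equivalence)
open import Algebra.Structures using (IsCommutativeRing)
open import Data.Empty using (⊥; ⊥-elim)
open import Data.Fin using (Fin; toℕ; fromℕ<)
open import Data.Fin.Properties as Fin using (toℕ-fromℕ<; toℕ-injective; toℕ<n)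
open import Data.Integer as ℤ using (ℤ; -[1+_]; _◃_; _⊖_) renaming (+_ to ⁺_)
import Data.Integer.Properties as ℤₚ
open import Data.List using (List; []; _∷_; [_]; length; map; _++_; filter; cartesianProduct; cartesianProductWith; deduplicate; upTo; applyUpTo; allFin)
open import Data.List.Properties using (length-map; length-++; length-upTo; length-filter; length-applyUpTo; length-tabulate)
import Data.List.Membership.DecPropositional as DecMembership
open import Data.List.Membership.Propositional using (_∈_; find; lose)
open import Data.List.Membership.Propositional.Properties
open import Data.List.Relation.Unary.All as All using (All; []; _∷_; all?)
open import Data.List.Relation.Unary.All.Properties using (¬All⇒Any¬)
open import Data.List.Relation.Unary.AllPairs using ([]; _∷_)
open import Data.List.Relation.Unary.Any using (Any; here; there; any?)
import Data.List.Relation.Unary.Unique.DecPropositional.Properties as UniqDec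
open import Data.List.Relation.Unary.Unique.Propositional using (Unique)
import Data.List.Relation.Unary.Unique.Propositional.Properties as Uniq
open import Data.Maybe using (just; nothing)
open import Data.Nat using (ℕ; zero; suc; _+_; _*_; _^_; _∸_; _≤_; _<_; z≤n; s≤s; NonZero; >-nonZero; nonTrivial⇒n>1)
open import Data.Nat.Coprimality as Coprimality using (Coprime; coprime-divisor; coprime-Bézout; gcd≡1⇒coprime; prime⇒coprime)
open import Data.Nat.DivMod using (_/_; _%_; m≡m%n+[m/n]*n; m%n<n; m*[n/m]≡n; m/n*n≤m; %-distribˡ-+; %-distribˡ-*; m<n⇒m%n≡m; n%n≡0; [m+kn]%n≡m%n)
open import Data.Nat.Divisibility
open import Data.Nat.GCD using (gcd; gcd[m,n]∣m; gcd[m,n]∣n; c*gcd[m,n]≡gcd[cm,cn]; module Bézout)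
open import Data.Nat.Induction using (<-rec)
open import Data.Nat.ListAction using (product)
open import Data.Nat.Logarithm using (⌊log₂_⌋; ⌊log₂⌋-mono-≤; ⌊log₂[2^n]⌋≡n)
open import Data.Nat.Primality using (Prime; prime⇒irreducible; prime⇒nonTrivial; prime⇒nonZero; euclidsLemma)
open import Data.Nat.Primality.Factorisation using (factorise)
open import Data.Nat.Properties
open import Data.Nat.Tactic.RingSolver using (solve-∀)
open import Data.Product using (Σ; ∃; _×_; _,_; proj₁; proj₂)
open import Data.Product.Properties using (≡-dec)
import Data.Sign as Sign
open import Data.Sum as Sum using (_⊎_; inj₁; inj₂)
open import Data.Unit using (⊤)
open import Function using (_∘_; id)
open import Level using (0ℓ)
open import Relation.Binary.Construct.Closure.ReflexiveTransitive using (ε; _◅_; _◅◅_)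
open import Relation.Binary.Definitions using (DecidableEquality; WeaklyDecidable; Tri; tri<; tri≈; tri>)
open import Relation.Binary.PropositionalEquality using (_≡_; _≢_; refl; sym; trans; cong; cong₂; subst; subst₂; isEquivalence; module ≡-Reasoning)
open import Relation.Nullary using (¬_; Dec; yes; no; ¬?; _×-dec_)
open import Relation.Nullary.Decidable using (decidable-stable)
open import Relation.Unary using (Decidable)

-- Sums and counting over lists

-- The obstacle in (2) is that the rotation, and with it every linear form on (x₂ , x₃), depends on
-- a = x₁. It is removed by fixing one trace t₀ of order n. Every a of order n has an exponent l for
-- which θ^l has trace t₀, and (x₂ , x₃) is replaced by (x₂ , y), where y is the term l rotations
-- further on. The new pairs follow the recurrence with parameter t₀, so the same forms, the
-- coefficients of the powers of one θ₀, serve all a at once. Little is lost, since such a pair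
-- determines a² and hence the point up to two choices.
--
-- (1) enters through p ≤ |O| ≤ 2 |A|²: it makes A large enough for the inequalities with factors
-- τ(p² - 1) to have content.
--
-- Every loss is a polynomial in τ(p² - 1), and its degree is irrelevant. The degree E is found
-- first, and the divisor bound is invoked afterwards with the exponent 4 E + 1; this is why
-- polynomial growth is recorded separately from the inequalities themselves.

private variable
  𝐴 𝐵 : Set

∑ : List 𝐴 → (𝐴 → ℕ) → ℕ
∑ []       f = 0
∑ (x ∷ xs) f = f x + ∑ xs f

∑-mono : ∀ (xs : List 𝐴) {f g : 𝐴 → ℕ} → (∀ {x} → x ∈ xs → f x ≤ g x) → ∑ xs f ≤ ∑ xs g
∑-mono []       h = z≤n
∑-mono (x ∷ xs) h = +-mono-≤ (h (here refl)) (∑-mono xs (h ∘ there))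

∑-cong : ∀ (xs : List 𝐴) {f g : 𝐴 → ℕ} → (∀ {x} → x ∈ xs → f x ≡ g x) → ∑ xs f ≡ ∑ xs g
∑-cong []       h = refl
∑-cong (x ∷ xs) h = cong₂ _+_ (h (here refl)) (∑-cong xs (h ∘ there))

∑-+ : ∀ (xs : List 𝐴) (f g : 𝐴 → ℕ) → ∑ xs (λ x → f x + g x) ≡ ∑ xs f + ∑ xs g
∑-+ []       f g = refl
∑-+ (x ∷ xs) f g rewrite ∑-+ xs f g = lem (f x) (g x) (∑ xs f) (∑ xs g)
  where
  lem : ∀ a b c d → a + b + (c + d) ≡ a + c + (b + d)
  lem = solve-∀

∑-*ˡ : ∀ (xs : List 𝐴) c (f : 𝐴 → ℕ) → ∑ xs (λ x → c * f x) ≡ c * ∑ xs f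
∑-*ˡ []       c f = sym (*-zeroʳ c)
∑-*ˡ (x ∷ xs) c f rewrite ∑-*ˡ xs c f = sym (*-distribˡ-+ c (f x) _)

∑-const : ∀ (xs : List 𝐴) c → ∑ xs (λ _ → c) ≡ length xs * c
∑-const []       c = refl
∑-const (x ∷ xs) c = cong (c +_) (∑-const xs c)

∑-swap : ∀ (xs : List 𝐴) (ys : List 𝐵) (f : 𝐴 → 𝐵 → ℕ) →
         ∑ xs (λ x → ∑ ys (f x)) ≡ ∑ ys (λ y → ∑ xs (λ x → f x y))
∑-swap []       ys f = sym (trans (∑-const ys 0) (*-zeroʳ (length ys)))
∑-swap (x ∷ xs) ys f rewrite ∑-swap xs ys f = sym (∑-+ ys (f x) _)

∑-++ : ∀ (xs ys : List 𝐴) (f : 𝐴 → ℕ) → ∑ (xs ++ ys) f ≡ ∑ xs f + ∑ ys f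
∑-++ []       ys f = refl
∑-++ (x ∷ xs) ys f rewrite ∑-++ xs ys f = sym (+-assoc (f x) _ _)

∑-map : ∀ (g : 𝐴 → 𝐵) (xs : List 𝐴) (f : 𝐵 → ℕ) → ∑ (map g xs) f ≡ ∑ xs (f ∘ g)
∑-map g []       f = refl
∑-map g (x ∷ xs) f = cong (f (g x) +_) (∑-map g xs f)

∑-× : ∀ (xs : List 𝐴) (ys : List 𝐵) (f : 𝐴 × 𝐵 → ℕ) →
      ∑ (cartesianProduct xs ys) f ≡ ∑ xs (λ x → ∑ ys (λ y → f (x , y)))
∑-× []       ys f = refl
∑-× (x ∷ xs) ys f = trans (∑-++ (map (x ,_) ys) (cartesianProduct xs ys) f)
  (cong₂ _+_ (∑-map (x ,_) ys f) (∑-× xs ys f))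

length≡∑ : ∀ (xs : List 𝐴) → length xs ≡ ∑ xs (λ _ → 1)
length≡∑ xs = trans (sym (*-identityʳ _)) (sym (∑-const xs 1))

length-× : ∀ (xs : List 𝐴) (ys : List 𝐵) → length (cartesianProduct xs ys) ≡ length xs * length ys
length-× xs ys = begin
  length (cartesianProduct xs ys)          ≡⟨ length≡∑ (cartesianProduct xs ys) ⟩
  ∑ (cartesianProduct xs ys) (λ _ → 1)     ≡⟨ ∑-× xs ys _ ⟩
  ∑ xs (λ _ → ∑ ys (λ _ → 1))              ≡⟨ ∑-const xs _ ⟩
  length xs * ∑ ys (λ _ → 1)               ≡⟨ cong (length xs *_) (sym (length≡∑ ys)) ⟩
  length xs * length ys                    ∎
  where open ≡-Reasoning

2ab≤a²+b² : ∀ a b → 2 * a * b ≤ a * a + b * b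
2ab≤a²+b² a b with ≤-total a b
... | inj₁ a≤b with k , refl ← m≤n⇒∃[o]m+o≡n a≤b = subst (2 * a * (a + k) ≤_) (lem a k) (m≤m+n _ (k * k))
  where
  lem : ∀ a k → 2 * a * (a + k) + k * k ≡ a * a + (a + k) * (a + k)
  lem = solve-∀
... | inj₂ b≤a with k , refl ← m≤n⇒∃[o]m+o≡n b≤a = subst (2 * (b + k) * b ≤_) (lem b k) (m≤m+n _ (k * k))
  where
  lem : ∀ b k → 2 * (b + k) * b + k * k ≡ (b + k) * (b + k) + b * b
  lem = solve-∀

cauchy-schwarz : ∀ (xs : List 𝐴) (f : 𝐴 → ℕ) →
                 ∑ xs f * ∑ xs f ≤ length xs * ∑ xs (λ x → f x * f x)
cauchy-schwarz []       f = z≤n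
cauchy-schwarz (x ∷ xs) f = begin
  (a + S) * (a + S)                     ≡⟨ lem a S ⟩
  a * a + 2 * a * S + S * S             ≤⟨ +-mono-≤ (+-monoʳ-≤ (a * a) cross) (cauchy-schwarz xs f) ⟩
  a * a + (n * (a * a) + Q) + n * Q     ≡⟨ lem′ a n Q ⟩
  suc n * (a * a + Q)                   ∎
  where
  open ≤-Reasoning
  a = f x
  S = ∑ xs f
  Q = ∑ xs (λ x → f x * f x)
  n = length xs
  lem : ∀ a S → (a + S) * (a + S) ≡ a * a + 2 * a * S + S * S
  lem = solve-∀
  lem′ : ∀ a n Q → a * a + (n * (a * a) + Q) + n * Q ≡ suc n * (a * a + Q)
  lem′ = solve-∀
  cross : 2 * a * S ≤ n * (a * a) + Q
  cross = begin
    2 * a * S                               ≡⟨ sym (∑-*ˡ xs (2 * a) f) ⟩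
    ∑ xs (λ y → 2 * a * f y)                ≤⟨ ∑-mono xs (λ {y} _ → 2ab≤a²+b² a (f y)) ⟩
    ∑ xs (λ y → a * a + f y * f y)          ≡⟨ ∑-+ xs _ _ ⟩
    ∑ xs (λ _ → a * a) + Q                  ≡⟨ cong (_+ Q) (∑-const xs _) ⟩
    n * (a * a) + Q                         ∎

-- The averaging principle behind every choice of a pivot. Requirements that are added up on the two
-- sides are met by one and the same `y`, as in `pivot`.
∃-≤ : ∀ (ys : List 𝐴) (f g : 𝐴 → ℕ) → 0 < length ys → ∑ ys f ≤ ∑ ys g →
      ∃ λ y → y ∈ ys × f y ≤ g y
∃-≤ (y ∷ ys) f g _ h = go y ys h
  where
  go : ∀ y ys → ∑ (y ∷ ys) f ≤ ∑ (y ∷ ys) g → ∃ λ w → w ∈ y ∷ ys × f w ≤ g w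
  go y []       h = y , here refl , subst (_≤ g y) (+-identityʳ _) (≤-trans h (≤-reflexive (+-identityʳ _)))
  go y (z ∷ ys) h with f y ≤? g y
  ... | yes fy≤gy = y , here refl , fy≤gy
  ... | no  fy≰gy =
    let w , w∈ , le = go z ys (+-cancelˡ-≤ (g y) _ _ (≤-trans (+-monoˡ-≤ _ (<⇒≤ (≰⇒> fy≰gy))) h))
    in w , there w∈ , le

argmax : ∀ (f : 𝐴 → ℕ) (xs : List 𝐴) → 0 < length xs → ∃ λ x → x ∈ xs × (∀ {y} → y ∈ xs → f y ≤ f x)
argmax f (x ∷ []) _ = x , here refl , λ { (here refl) → ≤-refl }
argmax f (x ∷ z ∷ xs) _ with w , w∈ , mx ← argmax f (z ∷ xs) (s≤s z≤n) with ≤-total (f x) (f w)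
... | inj₁ le = w , there w∈ , λ { (here refl) → le ; (there y∈) → mx y∈ }
... | inj₂ ge = x , here refl , λ { (here refl) → ≤-refl ; (there y∈) → ≤-trans (mx y∈) ge }

𝟙 : {P : Set} → Dec P → ℕ
𝟙 (yes _) = 1
𝟙 (no  _) = 0

𝟙≤1 : {P : Set} (d : Dec P) → 𝟙 d ≤ 1
𝟙≤1 (yes _) = ≤-refl
𝟙≤1 (no  _) = z≤n

𝟙-yes : {P : Set} (d : Dec P) → P → 𝟙 d ≡ 1
𝟙-yes (yes _) p = refl
𝟙-yes (no ¬p) p = ⊥-elim (¬p p)

𝟙-no : {P : Set} (d : Dec P) → ¬ P → 𝟙 d ≡ 0
𝟙-no (yes p) ¬p = ⊥-elim (¬p p)
𝟙-no (no  _) _  = refl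

𝟙-¬× : {P Q : Set} (d : Dec P) (e : Dec Q) → 𝟙 (¬? (d ×-dec e)) ≤ 𝟙 (¬? d) + 𝟙 (¬? e)
𝟙-¬× (yes _) (yes _) = z≤n
𝟙-¬× (yes _) (no  _) = ≤-refl
𝟙-¬× (no  _) (yes _) = s≤s z≤n
𝟙-¬× (no  _) (no  _) = s≤s z≤n

length-filter≡∑ : {P : 𝐴 → Set} (P? : Decidable P) (xs : List 𝐴) →
                  length (filter P? xs) ≡ ∑ xs (λ x → 𝟙 (P? x))
length-filter≡∑ P? [] = refl
length-filter≡∑ P? (x ∷ xs) with P? x
... | yes _ = cong suc (length-filter≡∑ P? xs)
... | no  _ = length-filter≡∑ P? xs

length-filter-split : {P : 𝐴 → Set} (P? : Decidable P) (xs : List 𝐴) →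
                      length xs ≡ length (filter P? xs) + length (filter (¬? ∘ P?) xs)
length-filter-split P? [] = refl
length-filter-split P? (x ∷ xs) with P? x
... | yes _ = cong suc (length-filter-split P? xs)
... | no  _ = trans (cong suc (length-filter-split P? xs)) (sym (+-suc _ _))

∑-filter-split : {P : 𝐴 → Set} (P? : Decidable P) (xs : List 𝐴) (f : 𝐴 → ℕ) →
                 ∑ xs f ≡ ∑ (filter P? xs) f + ∑ (filter (¬? ∘ P?) xs) f
∑-filter-split P? [] f = refl
∑-filter-split P? (x ∷ xs) f with P? x
... | yes _ = trans (cong (f x +_) (∑-filter-split P? xs f)) (sym (+-assoc (f x) _ _))
... | no  _ = trans (cong (f x +_) (∑-filter-split P? xs f)) (lem (f x) (∑ (filter P? xs) f) (∑ (filter (¬? ∘ P?) xs) f))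
  where
  lem : ∀ a b c → a + (b + c) ≡ b + (a + c)
  lem = solve-∀

unique-⊆-length : ∀ {xs ys : List 𝐴} → Unique xs → (∀ {x} → x ∈ xs → x ∈ ys) → length xs ≤ length ys
unique-⊆-length {xs = []}     _        _ = z≤n
unique-⊆-length {xs = x ∷ xs} (x# ∷ u) h with us , vs , refl ← ∈-∃++ (h (here refl)) = begin
  suc (length xs)                 ≤⟨ s≤s (unique-⊆-length u sub) ⟩
  suc (length (us ++ vs))         ≡⟨ cong suc (length-++ us) ⟩
  suc (length us + length vs)     ≡⟨ sym (+-suc _ _) ⟩
  length us + suc (length vs)     ≡⟨ sym (length-++ us) ⟩
  length (us ++ x ∷ vs)           ∎
  where
  open ≤-Reasoning
  sub : ∀ {y} → y ∈ xs → y ∈ us ++ vs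
  sub {y} y∈ with ∈-++⁻ us (h (there y∈))
  ... | inj₁ y∈us         = ∈-++⁺ˡ y∈us
  ... | inj₂ (here refl)  = ⊥-elim (All.lookup x# y∈ refl)
  ... | inj₂ (there y∈vs) = ∈-++⁺ʳ us y∈vs

map-unique : ∀ {f : 𝐴 → 𝐵} {xs : List 𝐴} → (∀ {x y} → x ∈ xs → y ∈ xs → f x ≡ f y → x ≡ y) →
             Unique xs → Unique (map f xs)
map-unique {xs = []}     inj []       = []
map-unique {f = f} {xs = x ∷ xs} inj (x# ∷ u) = All.tabulate new ∷ map-unique (λ p q → inj (there p) (there q)) u
  where
  new : ∀ {y} → y ∈ map f xs → f x ≢ y
  new y∈ eq with z , z∈ , refl ← ∈-map⁻ f y∈ = All.lookup x# z∈ (inj (here refl) (there z∈) eq)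

length-inj : ∀ {f : 𝐴 → 𝐵} {xs : List 𝐴} {ys : List 𝐵} → Unique xs → (∀ {x} → x ∈ xs → f x ∈ ys) →
             (∀ {x y} → x ∈ xs → y ∈ xs → f x ≡ f y → x ≡ y) → length xs ≤ length ys
length-inj {f = f} {xs} {ys} u into inj = subst (_≤ length ys) (length-map f xs) (unique-⊆-length (map-unique inj u) sub)
  where
  sub : ∀ {y} → y ∈ map f xs → y ∈ ys
  sub y∈ with z , z∈ , refl ← ∈-map⁻ f y∈ = into z∈

-- The fibres over distinct `y` are disjoint, so joining the lists `Z` gives a duplicate-free part
-- of `xs`. The factor `T` expresses a fibre size of at least m / T without fractions.
fibre-lower : ∀ (f : 𝐴 → 𝐵) (T : ℕ) {xs : List 𝐴} {ys : List 𝐵} {m} → Unique ys →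
              (∀ {y} → y ∈ ys → Σ (List 𝐴) λ Z → Unique Z × (∀ {z} → z ∈ Z → z ∈ xs × f z ≡ y) × m ≤ T * length Z) →
              length ys * m ≤ T * length xs
fibre-lower {𝐴 = 𝐴} f T {xs} {ys} {m} u h =
  let W , uW , W⊆ , le = build ys u h in ≤-trans le (*-monoʳ-≤ T (unique-⊆-length uW (proj₁ ∘ W⊆)))
  where
  build : ∀ ys → Unique ys →
          (∀ {y} → y ∈ ys → Σ (List 𝐴) λ Z → Unique Z × (∀ {z} → z ∈ Z → z ∈ xs × f z ≡ y) × m ≤ T * length Z) →
          Σ (List 𝐴) λ W → Unique W × (∀ {w} → w ∈ W → w ∈ xs × f w ∈ ys) × length ys * m ≤ T * length W
  build []       _        h = [] , [] , (λ ()) , z≤n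
  build (y ∷ ys) (y# ∷ u) h with Z , uZ , Z⊆ , le ← h (here refl) | W , uW , W⊆ , le′ ← build ys u (h ∘ there)
    = Z ++ W , Uniq.++⁺ uZ uW disj , both ,
      subst (m + length ys * m ≤_) (trans (sym (*-distribˡ-+ T _ _)) (cong (T *_) (sym (length-++ Z)))) (+-mono-≤ le le′)
    where
    disj : ∀ {v} → ¬ (v ∈ Z × v ∈ W)
    disj (v∈Z , v∈W) = All.lookup y# (subst (_∈ ys) (proj₂ (Z⊆ v∈Z)) (proj₂ (W⊆ v∈W))) refl
    both : ∀ {w} → w ∈ Z ++ W → w ∈ xs × f w ∈ y ∷ ys
    both w∈ with ∈-++⁻ Z w∈
    ... | inj₁ w∈Z = proj₁ (Z⊆ w∈Z) , here (proj₂ (Z⊆ w∈Z))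
    ... | inj₂ w∈W = proj₁ (W⊆ w∈W) , there (proj₂ (W⊆ w∈W))

∑-𝟙-∈ : (_≟_ : DecidableEquality 𝐵) → ∀ {y} (ys : List 𝐵) → y ∈ ys → 1 ≤ ∑ ys (λ z → 𝟙 (y ≟ z))
∑-𝟙-∈ _≟_ {y} (.y ∷ ys) (here refl) rewrite 𝟙-yes (y ≟ y) refl = s≤s z≤n
∑-𝟙-∈ _≟_ {y} (z ∷ ys) (there y∈) = ≤-trans (∑-𝟙-∈ _≟_ ys y∈) (m≤n+m _ _)

length≤∑fibres : (_≟_ : DecidableEquality 𝐵) (f : 𝐴 → 𝐵) (xs : List 𝐴) (ys : List 𝐵) →
                 (∀ {x} → x ∈ xs → f x ∈ ys) →
                 length xs ≤ ∑ ys (λ y → length (filter (λ x → f x ≟ y) xs))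
length≤∑fibres _≟_ f xs ys into = begin
  length xs                                             ≡⟨ length≡∑ xs ⟩
  ∑ xs (λ _ → 1)                                        ≤⟨ ∑-mono xs (λ x∈ → ∑-𝟙-∈ _≟_ ys (into x∈)) ⟩
  ∑ xs (λ x → ∑ ys (λ y → 𝟙 (f x ≟ y)))                 ≡⟨ ∑-swap xs ys _ ⟩
  ∑ ys (λ y → ∑ xs (λ x → 𝟙 (f x ≟ y)))                 ≡⟨ ∑-cong ys (λ {y} _ → sym (length-filter≡∑ (λ x → f x ≟ y) xs)) ⟩
  ∑ ys (λ y → length (filter (λ x → f x ≟ y) xs))       ∎
  where open ≤-Reasoning

fibre-upper : (_≟_ : DecidableEquality 𝐵) (f : 𝐴 → 𝐵) {xs : List 𝐴} {ys : List 𝐵} {m : ℕ} →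
              (∀ {x} → x ∈ xs → f x ∈ ys) →
              (∀ {y} → y ∈ ys → length (filter (λ x → f x ≟ y) xs) ≤ m) →
              length xs ≤ length ys * m
fibre-upper _≟_ f {xs} {ys} {m} into h =
  ≤-trans (length≤∑fibres _≟_ f xs ys into) (≤-trans (∑-mono ys h) (≤-reflexive (∑-const ys m)))

pigeonhole : (_≟_ : DecidableEquality 𝐵) (f : 𝐴 → 𝐵) (xs : List 𝐴) (ys : List 𝐵) →
             (∀ {x} → x ∈ xs → f x ∈ ys) → 0 < length ys →
             ∃ λ y → y ∈ ys × length xs ≤ length ys * length (filter (λ x → f x ≟ y) xs)
pigeonhole _≟_ f xs ys into 0<ys = ∃-≤ ys (λ _ → length xs) (λ y → length ys * size y) 0<ys le
  where
  open ≤-Reasoning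
  size = λ y → length (filter (λ x → f x ≟ y) xs)
  le : ∑ ys (λ _ → length xs) ≤ ∑ ys (λ y → length ys * size y)
  le = begin
    ∑ ys (λ _ → length xs)              ≡⟨ ∑-const ys _ ⟩
    length ys * length xs               ≤⟨ *-monoʳ-≤ (length ys) (length≤∑fibres _≟_ f xs ys into) ⟩
    length ys * ∑ ys size               ≡⟨ sym (∑-*ˡ ys (length ys) size) ⟩
    ∑ ys (λ y → length ys * size y)     ∎

∑-filter : {P : 𝐴 → Set} (P? : Decidable P) (xs : List 𝐴) (f : 𝐴 → ℕ) →
           ∑ (filter P? xs) f ≡ ∑ xs (λ x → 𝟙 (P? x) * f x)
∑-filter P? [] f = refl
∑-filter P? (x ∷ xs) f with P? x
... | yes _ = cong₂ _+_ (sym (*-identityˡ (f x))) (∑-filter P? xs f)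
... | no  _ = ∑-filter P? xs f

∑-𝟙-unique : {P : 𝐴 → Set} (P? : Decidable P) {xs : List 𝐴} → Unique xs →
             (∀ {x y} → x ∈ xs → y ∈ xs → P x → P y → x ≡ y) → ∑ xs (λ x → 𝟙 (P? x)) ≤ 1
∑-𝟙-unique P? [] _ = z≤n
∑-𝟙-unique P? {x ∷ xs} (x# ∷ u) h with P? x
... | no  _  = ∑-𝟙-unique P? u (λ p q → h (there p) (there q))
... | yes px = s≤s (≤-trans (∑-mono xs (λ {y} y∈ → ≤-reflexive (𝟙-no (P? y) (λ py → All.lookup x# y∈ (h (here refl) (there y∈) px py)))))
                            (≤-reflexive (trans (∑-const xs 0) (*-zeroʳ (length xs)))))

collisions : DecidableEquality 𝐵 → (𝐴 → 𝐵) → List 𝐴 → ℕ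
collisions _≟_ f xs = ∑ xs (λ x → ∑ xs (λ x′ → 𝟙 (f x ≟ f x′)))

-- Cauchy-Schwarz for the fibre sizes `c y`: they add up to at least `length xs`, and their squares
-- count the pairs with the same value. A map with few values thus has many collisions.
length²≤collisions : (_≟_ : DecidableEquality 𝐵) (f : 𝐴 → 𝐵) (xs : List 𝐴) {ys : List 𝐵} → Unique ys →
                     (∀ {x} → x ∈ xs → f x ∈ ys) →
                     length xs * length xs ≤ length ys * collisions _≟_ f xs
length²≤collisions _≟_ f xs {ys} u into = begin
  length xs * length xs
    ≤⟨ *-mono-≤ le le ⟩
  ∑ ys c * ∑ ys c
    ≤⟨ cauchy-schwarz ys c ⟩
  length ys * ∑ ys (λ y → c y * c y)
    ≤⟨ *-monoʳ-≤ (length ys) inner ⟩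
  length ys * collisions _≟_ f xs
    ∎
  where
  open ≤-Reasoning
  c = λ y → ∑ xs (λ x → 𝟙 (f x ≟ y))
  le : length xs ≤ ∑ ys c
  le = ≤-trans (length≤∑fibres _≟_ f xs ys into)
    (≤-reflexive (∑-cong ys (λ {y} _ → length-filter≡∑ (λ x → f x ≟ y) xs)))
  both : ∀ x x′ y → 𝟙 (f x ≟ y) * 𝟙 (f x′ ≟ y) ≤ 𝟙 (f x ≟ f x′) * 𝟙 (f x ≟ y)
  both x x′ y with f x ≟ y | f x′ ≟ y
  ... | no  _    | _         = z≤n
  ... | yes _    | no  _     = z≤n
  ... | yes refl | yes eq rewrite 𝟙-yes (f x ≟ f x′) (sym eq) = ≤-refl
  one : ∀ x → ∑ ys (λ y → 𝟙 (f x ≟ y)) ≤ 1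
  one x = ∑-𝟙-unique (f x ≟_) u (λ _ _ p q → trans (sym p) q)
  inner : ∑ ys (λ y → c y * c y) ≤ collisions _≟_ f xs
  inner = begin
    ∑ ys (λ y → c y * c y)
      ≡⟨ ∑-cong ys (λ {y} _ → trans (sym (∑-*ˡ xs (c y) _)) (∑-cong xs λ {x} _ →
           trans (*-comm (c y) _) (sym (∑-*ˡ xs (𝟙 (f x ≟ y)) _)))) ⟩
    ∑ ys (λ y → ∑ xs (λ x → ∑ xs (λ x′ → 𝟙 (f x ≟ y) * 𝟙 (f x′ ≟ y))))
      ≡⟨ trans (∑-swap ys xs _) (∑-cong xs (λ _ → ∑-swap ys xs _)) ⟩
    ∑ xs (λ x → ∑ xs (λ x′ → ∑ ys (λ y → 𝟙 (f x ≟ y) * 𝟙 (f x′ ≟ y))))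
      ≤⟨ ∑-mono xs (λ {x} _ → ∑-mono xs (λ {x′} _ → ∑-mono ys (λ {y} _ → both x x′ y))) ⟩
    ∑ xs (λ x → ∑ xs (λ x′ → ∑ ys (λ y → 𝟙 (f x ≟ f x′) * 𝟙 (f x ≟ y))))
      ≤⟨ ∑-mono xs (λ {x} _ → ∑-mono xs (λ {x′} _ → begin
           ∑ ys (λ y → 𝟙 (f x ≟ f x′) * 𝟙 (f x ≟ y))   ≡⟨ ∑-*ˡ ys (𝟙 (f x ≟ f x′)) _ ⟩
           𝟙 (f x ≟ f x′) * ∑ ys (λ y → 𝟙 (f x ≟ y))   ≤⟨ *-monoʳ-≤ (𝟙 (f x ≟ f x′)) (one x) ⟩
           𝟙 (f x ≟ f x′) * 1                          ≡⟨ *-identityʳ _ ⟩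
           𝟙 (f x ≟ f x′)                              ∎)) ⟩
    collisions _≟_ f xs
      ∎

two-distinct : ∀ (xs : List 𝐴) → Unique xs → 2 ≤ length xs → ∃ λ x → ∃ λ y → x ∈ xs × y ∈ xs × x ≢ y
two-distinct (x ∷ y ∷ xs) ((x≢y ∷ _) ∷ _) _ = x , y , here refl , there (here refl) , x≢y
two-distinct (x ∷ [])     _               (s≤s ())

-- The hypothesis compares pairs of entries, so the empty list needs no base point. It is applied to
-- solutions of quadratic equations, `g` being a sign change, an inverse or a Vieta move.
at-most-two : (g : 𝐴 → 𝐴) {xs : List 𝐴} → Unique xs → (∀ {x y} → x ∈ xs → y ∈ xs → y ≡ x ⊎ y ≡ g x) → length xs ≤ 2
at-most-two g {[]}     u h = z≤n
at-most-two g {x ∷ xs} u h = unique-⊆-length {ys = x ∷ g x ∷ []} u (λ y∈ → place (h (here refl) y∈))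
  where
  place : ∀ {y} → y ≡ x ⊎ y ≡ g x → y ∈ x ∷ g x ∷ []
  place (inj₁ eq) = here eq
  place (inj₂ eq) = there (here eq)

-- Prime fields

infixr 5 _⨾_
_⨾_ : {A : Set} {x y z : A} → x ≡ y → y ≡ z → x ≡ z
_⨾_ = trans

iter : {A : Set} → (A → A) → A → ℕ → A
iter f a zero    = a
iter f a (suc n) = f (iter f a n)

-- `nat-surjective` says that 𝟏 generates the additive group; it rules out proper subrings in
-- `Ratios.growth`. `characteristic` turns a count that vanishes in the field into divisibility by
-- p. `inv-𝟘` makes fractions with denominator zero vanish, as the orbit sums require.
record PrimeField (p : ℕ) : Set₁ where
  infixl 6 _⊕_
  infixl 7 _⊗_
  infix  8 ⊝_
  infix  4 _≟ᶠ_
  field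
    F                 : Set
    _⊕_ _⊗_           : F → F → F
    ⊝_ inv            : F → F
    𝟘 𝟏               : F
    isCommutativeRing : IsCommutativeRing _≡_ _⊕_ _⊗_ ⊝_ 𝟘 𝟏
    inverseʳ          : ∀ {x} → x ≢ 𝟘 → x ⊗ inv x ≡ 𝟏
    inv-𝟘             : inv 𝟘 ≡ 𝟘
    𝟏≢𝟘               : 𝟏 ≢ 𝟘
    _≟ᶠ_              : DecidableEquality F
    elems             : List F
    elems-unique      : Unique elems
    ∈-elems           : ∀ x → x ∈ elems
    elems-length      : length elems ≡ p
    nat-surjective    : ∀ x → ∃ λ n → iter (𝟏 ⊕_) 𝟘 n ≡ x
    characteristic    : ∀ n → iter (𝟏 ⊕_) 𝟘 n ≡ 𝟘 → p ∣ n

  nat : ℕ → F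
  nat = iter (𝟏 ⊕_) 𝟘

module FieldTheory {p : ℕ} (K : PrimeField p) where
  open PrimeField K public
  open IsCommutativeRing isCommutativeRing public
    using (distribˡ; distribʳ; zeroˡ; zeroʳ)
    renaming (+-assoc to ⊕-assoc; +-comm to ⊕-comm; +-identityˡ to ⊕-identityˡ; +-identityʳ to ⊕-identityʳ; *-assoc to ⊗-assoc; *-comm to ⊗-comm; *-identityˡ to ⊗-identityˡ; *-identityʳ to ⊗-identityʳ; -‿inverseˡ to ⊝-inverseˡ; -‿inverseʳ to ⊝-inverseʳ)

  commutativeRing : CommutativeRing 0ℓ 0ℓ
  commutativeRing = record { isCommutativeRing = isCommutativeRing }

  open RingProps (CommutativeRing.ring commutativeRing)
    using (-‿distribˡ-*; -‿distribʳ-*; -0#≈0#; -‿involutive; -‿+-comm)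

  open ≡-Reasoning

  nat-+ : ∀ m n → nat (m + n) ≡ nat m ⊕ nat n
  nat-+ zero    n = sym (⊕-identityˡ _)
  nat-+ (suc m) n = trans (cong (𝟏 ⊕_) (nat-+ m n)) (sym (⊕-assoc _ _ _))

  nat-* : ∀ m n → nat (m * n) ≡ nat m ⊗ nat n
  nat-* zero    n = sym (zeroˡ _)
  nat-* (suc m) n = begin
    nat (n + m * n)           ≡⟨ nat-+ n (m * n) ⟩
    nat n ⊕ nat (m * n)         ≡⟨ cong₂ _⊕_ (sym (⊗-identityˡ _)) (nat-* m n) ⟩
    𝟏 ⊗ nat n ⊕ nat m ⊗ nat n     ≡⟨ sym (distribʳ _ _ _) ⟩
    nat (suc m) ⊗ nat n           ∎

  int : ℤ → F
  int (⁺ n)    = nat n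
  int -[1+ n ] = ⊝ nat (suc n)

  int-neg : ∀ i → int (ℤ.- i) ≡ ⊝ int i
  int-neg (⁺ zero)  = sym -0#≈0#
  int-neg (⁺ suc n) = refl
  int-neg -[1+ n ]  = sym (-‿involutive _)

  int-⊖ : ∀ m n → int (m ⊖ n) ≡ nat m ⊕ ⊝ nat n
  int-⊖ m zero = begin
    nat m                ≡⟨ sym (⊕-identityʳ _) ⟩
    nat m ⊕ 𝟘            ≡⟨ cong (nat m ⊕_) (sym -0#≈0#) ⟩
    nat m ⊕ ⊝ 𝟘          ∎
  int-⊖ zero (suc n) = sym (⊕-identityˡ _)
  int-⊖ (suc m) (suc n) = begin
    int (suc m ⊖ suc n)                          ≡⟨ cong int (ℤₚ.[1+m]⊖[1+n]≡m⊖n m n) ⟩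
    int (m ⊖ n)                                  ≡⟨ int-⊖ m n ⟩
    nat m ⊕ ⊝ nat n                              ≡⟨ cong (nat m ⊕_) (sym (⊕-identityˡ _)) ⟩
    nat m ⊕ (𝟘 ⊕ ⊝ nat n)                        ≡⟨ cong (λ z → nat m ⊕ (z ⊕ ⊝ nat n)) (sym (⊝-inverseʳ 𝟏)) ⟩
    nat m ⊕ (𝟏 ⊕ ⊝ 𝟏 ⊕ ⊝ nat n)                  ≡⟨ cong (nat m ⊕_) (⊕-assoc _ _ _) ⟩
    nat m ⊕ (𝟏 ⊕ (⊝ 𝟏 ⊕ ⊝ nat n))                ≡⟨ sym (⊕-assoc _ _ _) ⟩
    nat m ⊕ 𝟏 ⊕ (⊝ 𝟏 ⊕ ⊝ nat n)                  ≡⟨ cong₂ _⊕_ (⊕-comm _ _) (-‿+-comm _ _) ⟩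
    nat (suc m) ⊕ ⊝ nat (suc n)                  ∎

  int-+ : ∀ i j → int (i ℤ.+ j) ≡ int i ⊕ int j
  int-+ (⁺ m)    (⁺ n)    = nat-+ m n
  int-+ (⁺ m)    -[1+ n ] = int-⊖ m (suc n)
  int-+ -[1+ m ] (⁺ n)    = trans (int-⊖ n (suc m)) (⊕-comm _ _)
  int-+ -[1+ m ] -[1+ n ] = begin
    ⊝ nat (suc (suc (m + n)))          ≡⟨ cong (λ k → ⊝ nat (suc k)) (sym (+-suc m n)) ⟩
    ⊝ nat (suc m + suc n)              ≡⟨ cong ⊝_ (nat-+ (suc m) (suc n)) ⟩
    ⊝ (nat (suc m) ⊕ nat (suc n))        ≡⟨ sym (-‿+-comm _ _) ⟩
    ⊝ nat (suc m) ⊕ ⊝ nat (suc n)        ∎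

  int-* : ∀ i j → int (i ℤ.* j) ≡ int i ⊗ int j
  int-* (⁺ m) (⁺ n) = trans (cong int (ℤₚ.+◃n≡+n (m * n))) (nat-* m n)
  int-* (⁺ m) -[1+ n ] = begin
    int (Sign.- ◃ (m * suc n))         ≡⟨ cong int (ℤₚ.-◃n≡-n (m * suc n)) ⟩
    int (ℤ.- (⁺ (m * suc n)))          ≡⟨ int-neg (⁺ (m * suc n)) ⟩
    ⊝ nat (m * suc n)                  ≡⟨ cong ⊝_ (nat-* m (suc n)) ⟩
    ⊝ (nat m ⊗ nat (suc n))              ≡⟨ -‿distribʳ-* _ _ ⟩
    nat m ⊗ ⊝ nat (suc n)                ∎
  int-* -[1+ m ] (⁺ n) = begin
    int (Sign.- ◃ (suc m * n))         ≡⟨ cong int (ℤₚ.-◃n≡-n (suc m * n)) ⟩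
    int (ℤ.- (⁺ (suc m * n)))          ≡⟨ int-neg (⁺ (suc m * n)) ⟩
    ⊝ nat (suc m * n)                  ≡⟨ cong ⊝_ (nat-* (suc m) n) ⟩
    ⊝ (nat (suc m) ⊗ nat n)              ≡⟨ -‿distribˡ-* _ _ ⟩
    ⊝ nat (suc m) ⊗ nat n                ∎
  int-* -[1+ m ] -[1+ n ] = begin
    int (Sign.+ ◃ (suc m * suc n))     ≡⟨ cong int (ℤₚ.+◃n≡+n (suc m * suc n)) ⟩
    nat (suc m * suc n)                ≡⟨ nat-* (suc m) (suc n) ⟩
    nat (suc m) ⊗ nat (suc n)            ≡⟨ sym (-‿involutive _) ⟩
    ⊝ ⊝ (nat (suc m) ⊗ nat (suc n))      ≡⟨ cong ⊝_ (-‿distribˡ-* _ _) ⟩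
    ⊝ (⊝ nat (suc m) ⊗ nat (suc n))      ≡⟨ -‿distribʳ-* _ _ ⟩
    ⊝ nat (suc m) ⊗ ⊝ nat (suc n)        ∎

  lit : ℕ → F
  lit zero          = 𝟘
  lit (suc zero)    = 𝟏
  lit (suc (suc n)) = 𝟏 ⊕ lit (suc n)

  lit≡nat : ∀ n → lit n ≡ nat n
  lit≡nat zero          = refl
  lit≡nat (suc zero)    = sym (⊕-identityʳ 𝟏)
  lit≡nat (suc (suc n)) = cong (𝟏 ⊕_) (lit≡nat (suc n))

  -- agrees with int, but evaluates 1 to 𝟏 rather than to 𝟏 ⊕ 𝟘
  coeff : ℤ → F
  coeff (⁺ n)    = lit n
  coeff -[1+ n ] = ⊝ lit (suc n)

  coeff≡int : ∀ i → coeff i ≡ int i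
  coeff≡int (⁺ n)    = lit≡nat n
  coeff≡int -[1+ n ] = cong ⊝_ (lit≡nat (suc n))

  almostCommutativeRing : AlmostCommutativeRing 0ℓ 0ℓ
  almostCommutativeRing = fromCommutativeRing commutativeRing

  coefficients : RawRing 0ℓ 0ℓ
  coefficients = record { Carrier = ℤ ; _≈_ = _≡_ ; _+_ = ℤ._+_ ; _*_ = ℤ._*_ ; -_ = ℤ.-_ ; 0# = ⁺ 0 ; 1# = ⁺ 1 }

  coeff-morphism : coefficients -Raw-AlmostCommutative⟶ almostCommutativeRing
  coeff-morphism = record
    { ⟦_⟧    = coeff
    ; +-homo = λ i j → trans (coeff≡int (i ℤ.+ j)) (trans (int-+ i j) (sym (cong₂ _⊕_ (coeff≡int i) (coeff≡int j))))
    ; *-homo = λ i j → trans (coeff≡int (i ℤ.* j)) (trans (int-* i j) (sym (cong₂ _⊗_ (coeff≡int i) (coeff≡int j))))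
    ; -‿homo = λ i → trans (coeff≡int (ℤ.- i)) (trans (int-neg i) (cong ⊝_ (sym (coeff≡int i))))
    ; 0-homo = refl
    ; 1-homo = refl
    }

  coeff-weakDec : WeaklyDecidable (Induced-equivalence coeff-morphism)
  coeff-weakDec i j with i ℤₚ.≟ j
  ... | yes refl = just refl
  ... | no  _    = nothing

  open RingSolver coefficients almostCommutativeRing coeff-morphism coeff-weakDec public
    using (solve; _:=_; con; _:+_; _:*_; :-_; _:-_)

  infixl 6 _⊟_
  _⊟_ : F → F → F
  x ⊟ y = x ⊕ ⊝ y

  inverseˡ : ∀ {x} → x ≢ 𝟘 → inv x ⊗ x ≡ 𝟏
  inverseˡ x≢0 = trans (⊗-comm _ _) (inverseʳ x≢0)

  ⊟≡𝟘⇒≡ : ∀ {x y} → x ⊟ y ≡ 𝟘 → x ≡ y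
  ⊟≡𝟘⇒≡ {x} {y} eq = begin
    x              ≡⟨ solve 2 (λ x y → x := (x :- y) :+ y) refl x y ⟩
    (x ⊟ y) ⊕ y    ≡⟨ cong (_⊕ y) eq ⟩
    𝟘 ⊕ y          ≡⟨ ⊕-identityˡ y ⟩
    y              ∎

  ≡⇒⊟≡𝟘 : ∀ {x y} → x ≡ y → x ⊟ y ≡ 𝟘
  ≡⇒⊟≡𝟘 refl = ⊝-inverseʳ _

  cancelˡ : ∀ {x y z} → x ≢ 𝟘 → x ⊗ y ≡ x ⊗ z → y ≡ z
  cancelˡ {x} {y} {z} x≢0 eq = begin
    y                    ≡⟨ sym (⊗-identityˡ y) ⟩
    𝟏 ⊗ y                ≡⟨ cong (_⊗ y) (sym (inverseˡ x≢0)) ⟩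
    inv x ⊗ x ⊗ y        ≡⟨ ⊗-assoc _ _ _ ⟩
    inv x ⊗ (x ⊗ y)      ≡⟨ cong (inv x ⊗_) eq ⟩
    inv x ⊗ (x ⊗ z)      ≡⟨ sym (⊗-assoc _ _ _) ⟩
    inv x ⊗ x ⊗ z        ≡⟨ cong (_⊗ z) (inverseˡ x≢0) ⟩
    𝟏 ⊗ z                ≡⟨ ⊗-identityˡ z ⟩
    z                    ∎

  no-zero-divisors : ∀ {x y} → x ⊗ y ≡ 𝟘 → x ≡ 𝟘 ⊎ y ≡ 𝟘
  no-zero-divisors {x} {y} eq with x ≟ᶠ 𝟘
  ... | yes x≡0 = inj₁ x≡0
  ... | no  x≢0 = inj₂ (cancelˡ x≢0 (trans eq (sym (zeroʳ x))))

  ⊗-≢𝟘 : ∀ {x y} → x ≢ 𝟘 → y ≢ 𝟘 → x ⊗ y ≢ 𝟘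
  ⊗-≢𝟘 x≢0 y≢0 eq with no-zero-divisors eq
  ... | inj₁ x≡0 = x≢0 x≡0
  ... | inj₂ y≡0 = y≢0 y≡0

  inv-≢𝟘 : ∀ {x} → x ≢ 𝟘 → inv x ≢ 𝟘
  inv-≢𝟘 {x} x≢0 eq = 𝟏≢𝟘 (trans (sym (inverseʳ x≢0)) (trans (cong (x ⊗_) eq) (zeroʳ x)))

  squares-≡ : ∀ {x y} → x ⊗ x ≡ y ⊗ y → x ≡ y ⊎ x ≡ ⊝ y
  squares-≡ {x} {y} eq = Sum.map ⊟≡𝟘⇒≡ (λ h → ⊟≡𝟘⇒≡ (trans (solve 2 (λ x y → x :- :- y := x :+ y) refl x y) h))
    (no-zero-divisors {x ⊟ y} {x ⊕ y}
      (trans (solve 2 (λ x y → (x :- y) :* (x :+ y) := x :* x :- y :* y) refl x y) (≡⇒⊟≡𝟘 eq)))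

-- Sumsets, coverings and approximate groups

module AdditiveCombinatorics {p : ℕ} (K : PrimeField p) where
  open FieldTheory K

  lift₂ : (F → F → F) → List F → List F → List F
  lift₂ f X Y = deduplicate _≟ᶠ_ (cartesianProductWith f X Y)

  lift₂-unique : ∀ f X Y → Unique (lift₂ f X Y)
  lift₂-unique f X Y = UniqDec.deduplicate-! _≟ᶠ_ (cartesianProductWith f X Y)

  ∈-lift₂⁺ : ∀ f {X Y x y} → x ∈ X → y ∈ Y → f x y ∈ lift₂ f X Y
  ∈-lift₂⁺ f x∈ y∈ = ∈-deduplicate⁺ _≟ᶠ_ (∈-cartesianProductWith⁺ f x∈ y∈)

  ∈-lift₂⁻ : ∀ f X Y {z} → z ∈ lift₂ f X Y → ∃ λ x → ∃ λ y → x ∈ X × y ∈ Y × z ≡ f x y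
  ∈-lift₂⁻ f X Y z∈ = ∈-cartesianProductWith⁻ f X Y (∈-deduplicate⁻ _≟ᶠ_ _ z∈)

  infixl 6 _∔_ _∸ᶠ_
  _∔_ _∸ᶠ_ : List F → List F → List F
  _∔_  = lift₂ _⊕_
  _∸ᶠ_ = lift₂ _⊟_

  ⊕-cancelˡ : ∀ {x y z} → x ⊕ y ≡ x ⊕ z → y ≡ z
  ⊕-cancelˡ {x} {y} {z} eq = trans (solve 2 (λ x y → y := (:- x) :+ (x :+ y)) refl x y)
    (trans (cong (⊝ x ⊕_) eq) (solve 2 (λ x y → (:- x) :+ (x :+ y) := y) refl x z))

  -- The two equations subtract to (r - r′)(z - z′) = 0. Hence two different pairs (y , z) collide
  -- under y + r z for at most one slope r.
  line-intersection : ∀ {r r′ y z y′ z′} → y ⊕ r ⊗ z ≡ y′ ⊕ r ⊗ z′ → y ⊕ r′ ⊗ z ≡ y′ ⊕ r′ ⊗ z′ → r ≡ r′ ⊎ (y , z) ≡ (y′ , z′)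
  line-intersection {r} {r′} {y} {z} {y′} {z′} eq eq′ = Sum.map ⊟≡𝟘⇒≡ (point ∘ ⊟≡𝟘⇒≡) (no-zero-divisors {r ⊟ r′} {z ⊟ z′}
    (solve 6 (λ r r′ y z y′ z′ → (r :- r′) :* (z :- z′)
        := (y :+ r :* z) :- (y′ :+ r :* z′) :- ((y :+ r′ :* z) :- (y′ :+ r′ :* z′))) refl r r′ y z y′ z′
     ⨾ cong₂ _⊟_ (≡⇒⊟≡𝟘 eq) (≡⇒⊟≡𝟘 eq′) ⨾ ⊝-inverseʳ 𝟘))
    where
    point : z ≡ z′ → (y , z) ≡ (y′ , z′)
    point refl = cong (_, z) (⊕-cancelˡ {r ⊗ z} (⊕-comm _ _ ⨾ eq ⨾ ⊕-comm _ _))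

  -- S is a maximal set of points of X whose translates s + Z are disjoint.
  ruzsa-covering : ∀ (X : List F) {Z : List F} {z₀} → Unique Z → z₀ ∈ Z → Σ (List F) λ S →
                   length S * length Z ≤ length (X ∔ Z) ×
                   (∀ {x} → x ∈ X → ∃ λ s → ∃ λ z → ∃ λ z′ → s ∈ S × z ∈ Z × z′ ∈ Z × x ⊕ z′ ≡ s ⊕ z)
  ruzsa-covering X {Z} {z₀} uZ z₀∈ = let S , uS , S⊆ , sep , cov = greedy X in S , size S uS S⊆ sep , cov
    where
    Separated : List F → Set
    Separated S = ∀ {s s′ z z′} → s ∈ S → s′ ∈ S → z ∈ Z → z′ ∈ Z → s ⊕ z ≡ s′ ⊕ z′ → s ≡ s′
    Meets : List F → F → Set
    Meets S x = ∃ λ s → ∃ λ z → ∃ λ z′ → s ∈ S × z ∈ Z × z′ ∈ Z × x ⊕ z′ ≡ s ⊕ z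
    meets? : ∀ S x → Dec (Meets S x)
    meets? S x with any? (λ szz → x ⊕ proj₂ (proj₂ szz) ≟ᶠ proj₁ szz ⊕ proj₁ (proj₂ szz)) (cartesianProduct S (cartesianProduct Z Z))
    ... | yes h with (s , z , z′) , szz∈ , eq ← find h =
      let s∈ , zz∈ = ∈-cartesianProduct⁻ S (cartesianProduct Z Z) szz∈
          z∈ , z′∈ = ∈-cartesianProduct⁻ Z Z zz∈
      in yes (s , z , z′ , s∈ , z∈ , z′∈ , eq)
    ... | no ¬h = no λ { (s , z , z′ , s∈ , z∈ , z′∈ , eq) → ¬h (lose (∈-cartesianProduct⁺ s∈ (∈-cartesianProduct⁺ z∈ z′∈)) eq) }
    greedy : ∀ X → Σ (List F) λ S → Unique S × (∀ {s} → s ∈ S → s ∈ X) × Separated S × (∀ {x} → x ∈ X → Meets S x)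
    greedy [] = [] , [] , (λ ()) , (λ ()) , (λ ())
    greedy (x ∷ X) with S , uS , S⊆ , sep , cov ← greedy X with meets? S x
    ... | yes m = S , uS , there ∘ S⊆ , sep , λ { (here refl) → m ; (there x∈) → cov x∈ }
    ... | no ¬m = x ∷ S , All.tabulate new ∷ uS , ⊆′ , sep′ , cov′
      where
      new : ∀ {s} → s ∈ S → x ≢ s
      new {s} s∈ refl = ¬m (s , z₀ , z₀ , s∈ , z₀∈ , z₀∈ , refl)
      ⊆′ : ∀ {s} → s ∈ x ∷ S → s ∈ x ∷ X
      ⊆′ (here refl) = here refl
      ⊆′ (there s∈)  = there (S⊆ s∈)
      sep′ : Separated (x ∷ S)
      sep′ (here refl) (here refl) _ _ _ = refl
      sep′ (here refl) (there s′∈) z∈ z′∈ eq = ⊥-elim (¬m (_ , _ , _ , s′∈ , z′∈ , z∈ , eq))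
      sep′ (there s∈) (here refl) z∈ z′∈ eq = ⊥-elim (¬m (_ , _ , _ , s∈ , z∈ , z′∈ , sym eq))
      sep′ (there s∈) (there s′∈) = sep s∈ s′∈
      cov′ : ∀ {y} → y ∈ x ∷ X → Meets (x ∷ S) y
      cov′ (here refl) = x , z₀ , z₀ , here refl , z₀∈ , z₀∈ , refl
      cov′ (there y∈) = let s , z , z′ , s∈ , rest = cov y∈ in s , z , z′ , there s∈ , rest
    size : ∀ S → Unique S → (∀ {s} → s ∈ S → s ∈ X) → Separated S → length S * length Z ≤ length (X ∔ Z)
    size S uS S⊆ sep = subst (_≤ length (X ∔ Z)) (length-× S Z)
      (length-inj {f = λ sz → proj₁ sz ⊕ proj₂ sz} (Uniq.cartesianProduct⁺ uS uZ) into inj)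
      where
      into : ∀ {sz} → sz ∈ cartesianProduct S Z → proj₁ sz ⊕ proj₂ sz ∈ X ∔ Z
      into sz∈ = let s∈ , z∈ = ∈-cartesianProduct⁻ S Z sz∈ in ∈-lift₂⁺ _⊕_ (S⊆ s∈) z∈
      inj : ∀ {u v} → u ∈ cartesianProduct S Z → v ∈ cartesianProduct S Z → proj₁ u ⊕ proj₂ u ≡ proj₁ v ⊕ proj₂ v → u ≡ v
      inj {s , z} {s′ , z′} u∈ v∈ eq
        with s∈ , z∈ ← ∈-cartesianProduct⁻ S Z u∈ | s′∈ , z′∈ ← ∈-cartesianProduct⁻ S Z v∈
        with refl ← sep s∈ s′∈ z∈ z′∈ eq = cong (s ,_) (⊕-cancelˡ eq)

  -- Y is a symmetric set with Y + Y ⊆ S₀ + Y; the multipliers r for which rY is covered by few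
  -- translates of Y form an approximate subring of F.
  module ApproximateGroup
    (Y : List F) (uY : Unique Y) (Y⊝ : ∀ {y} → y ∈ Y → ⊝ y ∈ Y)
    (S₀ : List F) {k₀ : ℕ} (∣S₀∣≤k₀ : length S₀ ≤ k₀) (cover : ∀ {y z} → y ∈ Y → z ∈ Y → ∃ λ s → s ∈ S₀ × (y ⊕ z) ⊟ s ∈ Y)
    (y₀ : F) (y₀∈Y : y₀ ∈ Y) where

    open DecMembership _≟ᶠ_ using (_∈?_)

    ∣Y∣ : ℕ
    ∣Y∣ = length Y

    instance
      ∣Y∣-nonZero : NonZero ∣Y∣
      ∣Y∣-nonZero = >-nonZero (∈-length y₀∈Y)

    Good : ℕ → F → Set
    Good k r = Σ (List F) λ S → length S ≤ k × (∀ {y} → y ∈ Y → ∃ λ s → s ∈ S × (r ⊗ y) ⊟ s ∈ Y)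

    good-𝟏 : Good 1 𝟏
    good-𝟏 = [ 𝟘 ] , ≤-refl , λ {y} y∈ → 𝟘 , here refl , subst (_∈ Y) (solve 1 (λ y → y := con (⁺ 1) :* y :- con (⁺ 0)) refl y) y∈

    good-⊝ : ∀ {k r} → Good k r → Good k (⊝ r)
    good-⊝ {k} {r} (S , le , h) = map ⊝_ S , subst (_≤ k) (sym (length-map ⊝_ S)) le , λ {y} y∈ →
      let s , s∈ , m = h y∈ in ⊝ s , ∈-map⁺ ⊝_ s∈ ,
        subst (_∈ Y) (solve 3 (λ r y s → :- (r :* y :- s) := (:- r) :* y :- (:- s)) refl r y s) (Y⊝ m)

    -- The two coverings leave a remainder in Y + Y, and the return to `Y` costs the factor `k₀`.
    good-⊕ : ∀ {k k′ r r′} → Good k r → Good k′ r′ → Good (k * (k′ * k₀)) (r ⊕ r′)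
    good-⊕ {k} {k′} {r} {r′} (S , le , h) (S′ , le′ , h′) =
      map f L , subst (_≤ k * (k′ * k₀)) (sym len) (*-mono-≤ le (*-mono-≤ le′ ∣S₀∣≤k₀)) , λ {y} y∈ →
        let s  , s∈  , m  = h y∈
            s′ , s′∈ , m′ = h′ y∈
            t  , t∈  , n  = cover m m′
        in s ⊕ (s′ ⊕ t) , ∈-map⁺ f (∈-cartesianProduct⁺ s∈ (∈-cartesianProduct⁺ s′∈ t∈)) ,
           subst (_∈ Y) (solve 6 (λ r r′ y s s′ t → (r :* y :- s) :+ (r′ :* y :- s′) :- t := (r :+ r′) :* y :- (s :+ (s′ :+ t)))
             refl r r′ y s s′ t) n
      where
      L = cartesianProduct S (cartesianProduct S′ S₀)
      f : F × F × F → F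
      f (s , s′ , t) = s ⊕ (s′ ⊕ t)
      len : length (map f L) ≡ length S * (length S′ * length S₀)
      len = trans (length-map f L) (trans (length-× S _) (cong (length S *_) (length-× S′ S₀)))

    good-⊗ : ∀ {k k′ r r′} → Good k r → Good k′ r′ → Good (k * k′) (r ⊗ r′)
    good-⊗ {k} {k′} {r} {r′} (S , le , h) (S′ , le′ , h′) =
      map f L , subst (_≤ k * k′) (sym (trans (length-map f L) (length-× S S′))) (*-mono-≤ le le′) , λ {y} y∈ →
        let s′ , s′∈ , m′ = h′ y∈
            s  , s∈  , m  = h m′
        in r ⊗ s′ ⊕ s , ∈-map⁺ f (∈-cartesianProduct⁺ s∈ s′∈) ,
           subst (_∈ Y) (solve 5 (λ r r′ y s s′ → r :* (r′ :* y :- s′) :- s := r :* r′ :* y :- (r :* s′ :+ s)) refl r r′ y s s′) m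
      where
      L = cartesianProduct S S′
      f : F × F → F
      f (s , s′) = r ⊗ s′ ⊕ s

    -- Some shift `s₁` of the covering of r Y is popular: Z = {y ∈ Y : r y - s₁ ∈ Y} has at least
    -- |Y| / k elements. Multiplication by r carries r⁻¹ Y + Z into a translate of Y + Y, so this
    -- set has size at most k₀ |Y| ≤ k₀ k |Z|. Ruzsa covering places r⁻¹ Y in k₀ k translates of Z -
    -- Z ⊆ Y + Y, and a last factor `k₀` leads back to `Y`.
    good-inv : ∀ {k r} → r ≢ 𝟘 → Good k r → Good (k₀ * k * k₀) (inv r)
    good-inv {k} {r} r≢0 (S , le , h) = map f L , lenL , cov′
      where
      open ≤-Reasoning
      hits : F → List F
      hits s = filter (λ y → ((r ⊗ y) ⊟ s) ∈? Y) Y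
      total : ∑ S (λ _ → ∣Y∣) ≤ ∑ S (λ s → length S * length (hits s))
      total = begin
        ∑ S (λ _ → ∣Y∣)                                              ≡⟨ ∑-const S ∣Y∣ ⟩
        length S * ∣Y∣                                               ≡⟨ cong (length S *_) (length≡∑ Y) ⟩
        length S * ∑ Y (λ _ → 1)                                     ≤⟨ *-monoʳ-≤ (length S) (∑-mono Y some) ⟩
        length S * ∑ Y (λ y → ∑ S (λ s → 𝟙 (((r ⊗ y) ⊟ s) ∈? Y)))    ≡⟨ cong (length S *_) (∑-swap Y S _) ⟩
        length S * ∑ S (λ s → ∑ Y (λ y → 𝟙 (((r ⊗ y) ⊟ s) ∈? Y)))    ≡⟨ sym (∑-*ˡ S (length S) _) ⟩
        ∑ S (λ s → length S * ∑ Y (λ y → 𝟙 (((r ⊗ y) ⊟ s) ∈? Y)))    ≡⟨ ∑-cong S (λ {s} _ → cong (length S *_) (sym (length-filter≡∑ (λ y → ((r ⊗ y) ⊟ s) ∈? Y) Y))) ⟩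
        ∑ S (λ s → length S * length (hits s))                       ∎
        where
        some : ∀ {y} → y ∈ Y → 1 ≤ ∑ S (λ s → 𝟙 (((r ⊗ y) ⊟ s) ∈? Y))
        some {y} y∈ = let s , s∈ , m = h y∈ in go S s∈ m
          where
          go : ∀ S {s} → s ∈ S → (r ⊗ y) ⊟ s ∈ Y → 1 ≤ ∑ S (λ s → 𝟙 (((r ⊗ y) ⊟ s) ∈? Y))
          go (s ∷ S) (here refl) m rewrite 𝟙-yes (((r ⊗ y) ⊟ s) ∈? Y) m = s≤s z≤n
          go (s ∷ S) (there s∈)  m = ≤-trans (go S s∈ m) (m≤n+m _ _)
      popular : ∃ λ s → s ∈ S × ∣Y∣ ≤ length S * length (hits s)
      popular = ∃-≤ S _ _ (∈-length (proj₁ (proj₂ (h y₀∈Y)))) total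
      s₁ = proj₁ popular
      Z = hits s₁
      uZ : Unique Z
      uZ = Uniq.filter⁺ _ uY
      ∣Y∣≤k∣Z∣ : ∣Y∣ ≤ k * length Z
      ∣Y∣≤k∣Z∣ = ≤-trans (proj₂ (proj₂ popular)) (*-monoˡ-≤ (length Z) le)
      nonempty : ∀ (Z : List F) → ∣Y∣ ≤ k * length Z → ∃ λ z → z ∈ Z
      nonempty [] le = ⊥-elim (<⇒≱ (∈-length y₀∈Y) (≤-trans le (≤-reflexive (*-zeroʳ k))))
      nonempty (z ∷ _) _ = z , here refl
      z₀∈Z = proj₂ (nonempty Z ∣Y∣≤k∣Z∣)
      Z⊆ : ∀ {z} → z ∈ Z → z ∈ Y × (r ⊗ z) ⊟ s₁ ∈ Y
      Z⊆ = ∈-filter⁻ (λ y → ((r ⊗ y) ⊟ s₁) ∈? Y)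
      X = map (inv r ⊗_) Y
      covering = ruzsa-covering X uZ z₀∈Z
      S′ = proj₁ covering
      T = map (λ sy → proj₁ sy ⊕ proj₂ sy) (cartesianProduct S₀ Y)
      lenT : length T ≡ length S₀ * ∣Y∣
      lenT = trans (length-map _ (cartesianProduct S₀ Y)) (length-× S₀ Y)
      into : ∀ {w} → w ∈ X ∔ Z → (r ⊗ w) ⊟ s₁ ∈ T
      into w∈ = let x , z , x∈ , z∈ , w≡ = ∈-lift₂⁻ _⊕_ X Z w∈
                    y , y∈ , x≡ = ∈-map⁻ (inv r ⊗_) x∈
                    t , t∈ , n = cover y∈ (proj₂ (Z⊆ z∈))
        in subst (_∈ T) (shift y z t ⨾ cong (λ w → (r ⊗ w) ⊟ s₁) (cong (_⊕ z) (sym x≡) ⨾ sym w≡))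
             (∈-map⁺ (λ sy → proj₁ sy ⊕ proj₂ sy) (∈-cartesianProduct⁺ t∈ n))
        where
        shift : ∀ y z t → t ⊕ ((y ⊕ ((r ⊗ z) ⊟ s₁)) ⊟ t) ≡ (r ⊗ (inv r ⊗ y ⊕ z)) ⊟ s₁
        shift y z t = solve 5 (λ t y r z s → t :+ (y :+ (r :* z :- s) :- t) := con (⁺ 1) :* y :+ r :* z :- s) refl t y r z s₁
          ⨾ cong (λ o → o ⊗ y ⊕ r ⊗ z ⊟ s₁) (sym (inverseʳ r≢0))
          ⨾ solve 5 (λ r i y z s → r :* i :* y :+ r :* z :- s := r :* (i :* y :+ z) :- s) refl r (inv r) y z s₁
      inj : ∀ {u v} → u ∈ X ∔ Z → v ∈ X ∔ Z → (r ⊗ u) ⊟ s₁ ≡ (r ⊗ v) ⊟ s₁ → u ≡ v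
      inj {u} {v} _ _ eq = cancelˡ r≢0 (⊕-cancelˡ (trans (⊕-comm (⊝ s₁) _) (trans eq (⊕-comm _ (⊝ s₁)))))
      lenS′ : length S′ ≤ k₀ * k
      lenS′ = *-cancelʳ-≤ (length S′) (k₀ * k) (length Z) ⦃ >-nonZero (∈-length z₀∈Z) ⦄ (begin
        length S′ * length Z     ≤⟨ proj₁ (proj₂ covering) ⟩
        length (X ∔ Z)           ≤⟨ length-inj (lift₂-unique _⊕_ X Z) into inj ⟩
        length T                 ≡⟨ lenT ⟩
        length S₀ * ∣Y∣          ≤⟨ *-monoˡ-≤ ∣Y∣ ∣S₀∣≤k₀ ⟩
        k₀ * ∣Y∣                 ≤⟨ *-monoʳ-≤ k₀ ∣Y∣≤k∣Z∣ ⟩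
        k₀ * (k * length Z)      ≡⟨ sym (*-assoc k₀ k (length Z)) ⟩
        k₀ * k * length Z        ∎)
      L = cartesianProduct S′ S₀
      f : F × F → F
      f (s , t) = s ⊕ t
      lenL : length (map f L) ≤ k₀ * k * k₀
      lenL = subst (_≤ k₀ * k * k₀) (sym (trans (length-map f L) (length-× S′ S₀))) (*-mono-≤ lenS′ ∣S₀∣≤k₀)
      cov′ : ∀ {y} → y ∈ Y → ∃ λ s → s ∈ map f L × (inv r ⊗ y) ⊟ s ∈ Y
      cov′ {y} y∈ =
        let s , z , z′ , s∈ , z∈ , z′∈ , eq = proj₂ (proj₂ covering) (∈-map⁺ (inv r ⊗_) y∈)
            t , t∈ , n = cover (proj₁ (Z⊆ z∈)) (Y⊝ (proj₁ (Z⊆ z′∈)))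
        in s ⊕ t , ∈-map⁺ f (∈-cartesianProduct⁺ s∈ t∈) , subst (_∈ Y)
             (solve 4 (λ z z′ s t → z :- z′ :- t := (s :+ z) :- z′ :- (s :+ t)) refl z z′ s t
              ⨾ cong (λ w → w ⊟ z′ ⊟ (s ⊕ t)) (sym eq)
              ⨾ solve 4 (λ w z′ s t → w :+ z′ :- z′ :- (s :+ t) := w :- (s :+ t)) refl (inv r ⊗ y) z′ s t) n

    -- For good r the map (y , z) ↦ y + r z has at most e |Y| values on Y × Y, so it has at least
    -- |Y|³ / e collisions. Summed over R, a pair of distinct points collides for at most one r,
    -- which gives ρ |Y| ≤ e (ρ + |Y|²). The assumption 2 e ≤ |Y| absorbs the term e ρ.
    good-count : ∀ {k} (R : List F) → Unique R → (∀ {r} → r ∈ R → Good k r) →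
                 2 * (k * k₀) ≤ ∣Y∣ → length R ≤ 2 * (k * k₀) * ∣Y∣
    good-count {k} R uR good large = *-cancelʳ-≤ ρ (2 * e * ∣Y∣) ∣Y∣ final
      where
      open ≤-Reasoning
      e = k * k₀
      ρ = length R
      Y² = cartesianProduct Y Y
      _≟²_ : DecidableEquality (F × F)
      _≟²_ = ≡-dec _≟ᶠ_ _≟ᶠ_
      u² : Unique Y²
      u² = Uniq.cartesianProduct⁺ uY uY
      val : F → F × F → F
      val r (y , z) = y ⊕ r ⊗ z
      energy : F → ℕ
      energy r = collisions _≟ᶠ_ (val r) Y²
      energy-lower : ∀ {r} → r ∈ R → length Y² * length Y² ≤ e * ∣Y∣ * energy r
      energy-lower {r} r∈ = ≤-trans
        (length²≤collisions _≟ᶠ_ (val r) Y² (UniqDec.deduplicate-! _≟ᶠ_ G) into)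
        (*-monoˡ-≤ (energy r) lenG)
        where
        S = proj₁ (good r∈)
        L = cartesianProduct S (cartesianProduct S₀ Y)
        f : F × F × F → F
        f (s , t , y) = s ⊕ (t ⊕ y)
        G = map f L
        lenG : length (deduplicate _≟ᶠ_ G) ≤ e * ∣Y∣
        lenG = begin
          length (deduplicate _≟ᶠ_ G)          ≤⟨ unique-⊆-length (UniqDec.deduplicate-! _≟ᶠ_ G) (∈-deduplicate⁻ _≟ᶠ_ G) ⟩
          length G                             ≡⟨ length-map f L ⟩
          length L                             ≡⟨ length-× S _ ⟩
          length S * length (cartesianProduct S₀ Y) ≡⟨ cong (length S *_) (length-× S₀ Y) ⟩
          length S * (length S₀ * ∣Y∣)         ≤⟨ *-mono-≤ (proj₁ (proj₂ (good r∈))) (*-monoˡ-≤ ∣Y∣ ∣S₀∣≤k₀) ⟩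
          k * (k₀ * ∣Y∣)                       ≡⟨ sym (*-assoc k k₀ ∣Y∣) ⟩
          e * ∣Y∣                              ∎
        into : ∀ {u} → u ∈ Y² → val r u ∈ deduplicate _≟ᶠ_ G
        into {y , z} u∈ =
          let y∈ , z∈ = ∈-cartesianProduct⁻ Y Y u∈
              s , s∈ , m = proj₂ (proj₂ (good r∈)) z∈
              t , t∈ , n = cover y∈ m
          in ∈-deduplicate⁺ _≟ᶠ_ (subst (_∈ G)
               (solve 5 (λ s t y r z → s :+ (t :+ (y :+ (r :* z :- s) :- t)) := y :+ r :* z) refl s t y r z)
               (∈-map⁺ f (∈-cartesianProduct⁺ s∈ (∈-cartesianProduct⁺ t∈ n))))
      pair-bound : ∀ u v → ∑ R (λ r → 𝟙 (val r u ≟ᶠ val r v)) ≤ 𝟙 (u ≟² v) * ρ + 1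
      pair-bound (y , z) (y′ , z′) with (y , z) ≟² (y′ , z′)
      ... | yes refl = begin
        ∑ R (λ r → 𝟙 (val r (y , z) ≟ᶠ val r (y , z)))   ≤⟨ ∑-mono R (λ {r} _ → 𝟙≤1 (val r (y , z) ≟ᶠ val r (y , z))) ⟩
        ∑ R (λ _ → 1)                                    ≡⟨ sym (length≡∑ R) ⟩
        ρ                                                ≤⟨ ≤-trans (m≤m+n ρ 0) (m≤m+n (1 * ρ) 1) ⟩
        1 * ρ + 1                                        ∎
      ... | no u≢v = ∑-𝟙-unique (λ r → val r (y , z) ≟ᶠ val r (y′ , z′)) uR same
        where
        same : ∀ {r r′} → r ∈ R → r′ ∈ R → y ⊕ r ⊗ z ≡ y′ ⊕ r ⊗ z′ → y ⊕ r′ ⊗ z ≡ y′ ⊕ r′ ⊗ z′ → r ≡ r′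
        same _ _ eq eq′ = Sum.[ id , ⊥-elim ∘ u≢v ]′ (line-intersection eq eq′)
      Σenergy : ∑ R energy ≤ length Y² * (ρ + length Y²)
      Σenergy = begin
        ∑ R energy
          ≡⟨ ∑-swap R Y² _ ⟨≡⟩ ∑-cong Y² (λ _ → ∑-swap R Y² _) ⟩
        ∑ Y² (λ u → ∑ Y² (λ v → ∑ R (λ r → 𝟙 (val r u ≟ᶠ val r v))))
          ≤⟨ ∑-mono Y² (λ {u} _ → row u) ⟩
        ∑ Y² (λ _ → ρ + length Y²)
          ≡⟨ ∑-const Y² _ ⟩
        length Y² * (ρ + length Y²)
          ∎
        where
        _⟨≡⟩_ = trans
        row : ∀ u → ∑ Y² (λ v → ∑ R (λ r → 𝟙 (val r u ≟ᶠ val r v))) ≤ ρ + length Y²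
        row u = begin
          ∑ Y² (λ v → ∑ R (λ r → 𝟙 (val r u ≟ᶠ val r v)))     ≤⟨ ∑-mono Y² (λ {v} _ → pair-bound u v) ⟩
          ∑ Y² (λ v → 𝟙 (u ≟² v) * ρ + 1)                     ≡⟨ ∑-+ Y² _ _ ⟩
          ∑ Y² (λ v → 𝟙 (u ≟² v) * ρ) + ∑ Y² (λ _ → 1)        ≡⟨ cong₂ _+_ (∑-cong Y² (λ {v} _ → *-comm (𝟙 (u ≟² v)) ρ) ⟨≡⟩ ∑-*ˡ Y² ρ _) (sym (length≡∑ Y²)) ⟩
          ρ * ∑ Y² (λ v → 𝟙 (u ≟² v)) + length Y²             ≤⟨ +-monoˡ-≤ _ (*-monoʳ-≤ ρ (∑-𝟙-unique (u ≟²_) u² (λ _ _ p q → trans (sym p) q))) ⟩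
          ρ * 1 + length Y²                                   ≡⟨ cong (_+ length Y²) (*-identityʳ ρ) ⟩
          ρ + length Y²                                       ∎
      n = ∣Y∣
      lenY² : length Y² ≡ n * n
      lenY² = length-× Y Y
      main : ρ * (n * n * (n * n)) ≤ e * n * (n * n * (ρ + n * n))
      main = subst (λ q → ρ * (q * q) ≤ e * n * (q * (ρ + q))) lenY² (begin
        ρ * (length Y² * length Y²)                   ≡⟨ sym (∑-const R _) ⟩
        ∑ R (λ _ → length Y² * length Y²)             ≤⟨ ∑-mono R energy-lower ⟩
        ∑ R (λ r → e * n * energy r)                  ≡⟨ ∑-*ˡ R (e * n) energy ⟩
        e * n * ∑ R energy                            ≤⟨ *-monoʳ-≤ (e * n) Σenergy ⟩
        e * n * (length Y² * (ρ + length Y²))         ∎)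
      reduced : ρ * n ≤ e * (ρ + n * n)
      reduced = *-cancelʳ-≤ (ρ * n) (e * (ρ + n * n)) (n * n * n) ⦃ m*n≢0 (n * n) n ⦃ m*n≢0 n n ⦄ ⦄
        (subst₂ _≤_ (lem₁ ρ n) (lem₂ e n (ρ + n * n)) main)
        where
        lem₁ : ∀ ρ n → ρ * (n * n * (n * n)) ≡ ρ * n * (n * n * n)
        lem₁ = solve-∀
        lem₂ : ∀ e n q → e * n * (n * n * q) ≡ e * q * (n * n * n)
        lem₂ = solve-∀
      final : ρ * n ≤ 2 * e * n * n
      final = +-cancelˡ-≤ (ρ * n) _ _ (begin
        ρ * n + ρ * n                       ≤⟨ +-mono-≤ reduced reduced ⟩
        e * (ρ + n * n) + e * (ρ + n * n)   ≡⟨ lem e ρ n ⟩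
        ρ * (2 * e) + 2 * e * n * n         ≤⟨ +-monoˡ-≤ _ (*-monoʳ-≤ ρ large) ⟩
        ρ * n + 2 * e * n * n               ∎)
        where
        lem : ∀ e ρ n → e * (ρ + n * n) + e * (ρ + n * n) ≡ ρ * (2 * e) + 2 * e * n * n
        lem = solve-∀

    module Ratios (R : List F) (uR : Unique R) {k₁ : ℕ} (good : ∀ {r} → r ∈ R → Good k₁ r)
                  {r₀ r₁ : F} (r₀∈ : r₀ ∈ R) (r₁∈ : r₁ ∈ R) (r₀≢r₁ : r₀ ≢ r₁) where

      -- The covering costs of a difference a - b, of a quotient of two differences, and of x + (q +
      -- 1) y, as the closure lemmas above deliver them.
      kδ kᵠ k* : ℕ
      kδ = k₁ * (k₁ * k₀)
      kᵠ = kδ * (k₀ * kδ * k₀)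
      k* = k₁ * (kᵠ * (1 * k₀) * k₁ * k₀)

      Ratio : F → Set
      Ratio x = ∃ λ a → ∃ λ b → ∃ λ c → ∃ λ d → a ∈ R × b ∈ R × c ∈ R × d ∈ R × c ≢ d × x ⊗ (c ⊟ d) ≡ a ⊟ b

      ratio? : Decidable Ratio
      ratio? x with any? (λ { ((a , b) , (c , d)) → ¬? (c ≟ᶠ d) ×-dec x ⊗ (c ⊟ d) ≟ᶠ a ⊟ b })
                         (cartesianProduct (cartesianProduct R R) (cartesianProduct R R))
      ... | yes h with ((a , b) , (c , d)) , m , ne , eq ← find h =
        let ab∈ , cd∈ = ∈-cartesianProduct⁻ (cartesianProduct R R) (cartesianProduct R R) m
            a∈ , b∈ = ∈-cartesianProduct⁻ R R ab∈
            c∈ , d∈ = ∈-cartesianProduct⁻ R R cd∈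
        in yes (a , b , c , d , a∈ , b∈ , c∈ , d∈ , ne , eq)
      ... | no ¬h = no λ { (a , b , c , d , a∈ , b∈ , c∈ , d∈ , ne , eq) →
        ¬h (lose (∈-cartesianProduct⁺ (∈-cartesianProduct⁺ a∈ b∈) (∈-cartesianProduct⁺ c∈ d∈)) (ne , eq)) }

      ratio-𝟘 : Ratio 𝟘
      ratio-𝟘 = r₀ , r₀ , r₀ , r₁ , r₀∈ , r₀∈ , r₀∈ , r₁∈ , r₀≢r₁ , zeroˡ _ ⨾ sym (⊝-inverseʳ r₀)

      ratio-good : ∀ {x} → Ratio x → Good kᵠ x
      ratio-good {x} (a , b , c , d , a∈ , b∈ , c∈ , d∈ , ne , eq) = subst (Good kᵠ) x≡
        (good-⊗ (good-⊕ (good a∈) (good-⊝ (good b∈)))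
                (good-inv c-d≢0 (good-⊕ (good c∈) (good-⊝ (good d∈)))))
        where
        c-d≢0 : c ⊟ d ≢ 𝟘
        c-d≢0 = ne ∘ ⊟≡𝟘⇒≡
        x≡ : (a ⊟ b) ⊗ inv (c ⊟ d) ≡ x
        x≡ = cong (_⊗ inv (c ⊟ d)) (sym eq) ⨾ ⊗-assoc _ _ _ ⨾ cong (x ⊗_) (inverseʳ c-d≢0) ⨾ ⊗-identityʳ x

      -- A descent from n towards 0, which is a ratio: if the ratios are not everything, adding 𝟏
      -- leads out of them at some point.
      boundary : ∀ n → ¬ Ratio (nat n) → ∃ λ i → Ratio (nat i) × ¬ Ratio (nat (suc i))
      boundary zero    ¬r = ⊥-elim (¬r ratio-𝟘)
      boundary (suc n) ¬r with ratio? (nat n)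
      ... | yes r = n , r , ¬r
      ... | no ¬r′ = boundary n ¬r′

      -- Either every element is a ratio, or q is a ratio and q + 1 is not; then (x , y) ↦ x + (q + 1) y is injective on R × R.
      growth : 2 * (kᵠ * k₀) ≤ ∣Y∣ → 2 * (k* * k₀) ≤ ∣Y∣ →
               p ≤ 2 * (kᵠ * k₀) * ∣Y∣ ⊎ length R * length R ≤ 2 * (k* * k₀) * ∣Y∣
      growth large large′ with all? ratio? elems
      ... | yes all = inj₁ (subst (_≤ 2 * (kᵠ * k₀) * ∣Y∣) elems-length
                        (good-count elems elems-unique (λ x∈ → ratio-good (All.lookup all x∈)) large))
      ... | no ¬all = inj₂ (subst (_≤ 2 * (k* * k₀) * ∣Y∣) (length-map φ R² ⨾ length-× R R)
                        (good-count (map φ R²) (map-unique inj (Uniq.cartesianProduct⁺ uR uR)) φ-good large′))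
        where
        outside : ∃ λ x → ¬ Ratio x
        outside = let x , _ , ¬r = find (¬All⇒Any¬ ratio? elems ¬all) in x , ¬r
        i,q = let x , ¬r = outside
                  n , n≡ = nat-surjective x
              in boundary n (λ r → ¬r (subst Ratio n≡ r))
        q = nat (proj₁ i,q)
        R² = cartesianProduct R R
        φ : F × F → F
        φ (x , y) = x ⊕ (q ⊕ 𝟏) ⊗ y
        φ-good : ∀ {z} → z ∈ map φ R² → Good k* z
        φ-good z∈ with (x , y) , m , refl ← ∈-map⁻ φ z∈ =
          let x∈ , y∈ = ∈-cartesianProduct⁻ R R m
          in good-⊕ (good x∈) (good-⊗ (good-⊕ (ratio-good (proj₁ (proj₂ i,q))) good-𝟏) (good y∈))
        inj : ∀ {u v} → u ∈ R² → v ∈ R² → φ u ≡ φ v → u ≡ v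
        inj {x , y} {x′ , y′} u∈ v∈ eq with y ≟ᶠ y′
        ... | yes refl = cong (_, y) (⊕-cancelˡ (⊕-comm _ x ⨾ eq ⨾ ⊕-comm x′ _))
        -- A collision with y ≠ y′ would exhibit q + 1 as the ratio (x′ - x) / (y - y′).
        ... | no y≢y′ =
          let x∈ , y∈ = ∈-cartesianProduct⁻ R R u∈
              x′∈ , y′∈ = ∈-cartesianProduct⁻ R R v∈
          in ⊥-elim (proj₂ (proj₂ i,q) (x′ , x , y , y′ , x′∈ , x∈ , y∈ , y′∈ , y≢y′ ,
               (solve 5 (λ q x y x′ y′ → (con (⁺ 1) :+ q) :* (y :- y′)
                   := (x′ :- x) :+ ((x :+ (q :+ con (⁺ 1)) :* y) :- (x′ :+ (q :+ con (⁺ 1)) :* y′))) refl q x y x′ y′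
                ⨾ cong ((x′ ⊟ x) ⊕_) (≡⇒⊟≡𝟘 eq) ⨾ ⊕-identityʳ _)))

-- Dense graphs

module DenseGraph {p : ℕ} (𝔽 : PrimeField p)
  (A : List (PrimeField.F 𝔽)) (uA : Unique A) (V : List (PrimeField.F 𝔽 × PrimeField.F 𝔽)) (uV : Unique V)
  (V⊆ : ∀ {x y} → (x , y) ∈ V → x ∈ A × y ∈ A)
  (K : ℕ) (dense : length A * length A ≤ K * length V)
  (a₀ : PrimeField.F 𝔽) (a₀∈A : a₀ ∈ A) where
  open FieldTheory 𝔽
  open AdditiveCombinatorics 𝔽

  _≟²_ : DecidableEquality (F × F)
  _≟²_ = ≡-dec _≟ᶠ_ _≟ᶠ_

  adj? : ∀ x y → Dec ((x , y) ∈ V)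
  adj? x y = DecMembership._∈?_ _≟²_ (x , y) V

  -- The bound α² + T · bad ≤ 2 K² m² at the pivot, with T = 32 K², leaves at most m² / 16 bad pairs
  -- among its m neighbours. This is few enough for two Markov arguments that each lose a factor
  -- four.
  α T : ℕ
  α = length A
  T = 32 * (K * K)

  instance
    α-nonZero : NonZero α
    α-nonZero = >-nonZero (∈-length a₀∈A)

  common : F → F → List F
  common a a′ = filter (λ b → adj? a b ×-dec adj? a′ b) A

  Linked : F → F → Set
  Linked a a′ = α ≤ T * length (common a a′)

  linked? : ∀ a a′ → Dec (Linked a a′)
  linked? a a′ = α ≤? T * length (common a a′)

  bad : F → F → ℕ
  bad a a′ = 𝟙 (¬? (linked? a a′))

  nbrs : F → List F
  nbrs b = filter (λ a → adj? a b) A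

  badPairs : F → ℕ
  badPairs b = ∑ (nbrs b) (λ a → ∑ (nbrs b) (bad a))

  open ≤-Reasoning

  ∣V∣≤∑nbrs : length V ≤ ∑ A (λ b → length (nbrs b))
  ∣V∣≤∑nbrs = ≤-trans (length≤∑fibres _≟ᶠ_ proj₂ V A (proj₂ ∘ V⊆)) (∑-mono A (λ {b} _ →
    length-inj {f = proj₁} (Uniq.filter⁺ _ uV) into inj))
    where
    into : ∀ {b v} → v ∈ filter (λ v → proj₂ v ≟ᶠ b) V → proj₁ v ∈ nbrs b
    into {b} v∈ with v∈V , refl ← ∈-filter⁻ (λ v → proj₂ v ≟ᶠ b) {xs = V} v∈ = ∈-filter⁺ (λ a → adj? a b) (proj₁ (V⊆ v∈V)) v∈V
    inj : ∀ {b v w} → v ∈ filter (λ v → proj₂ v ≟ᶠ b) V → w ∈ filter (λ v → proj₂ v ≟ᶠ b) V → proj₁ v ≡ proj₁ w → v ≡ w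
    inj {b} v∈ w∈ refl with _ , refl ← ∈-filter⁻ (λ v → proj₂ v ≟ᶠ b) {xs = V} v∈ | _ , refl ← ∈-filter⁻ (λ v → proj₂ v ≟ᶠ b) {xs = V} w∈ = refl

  ∑nbrs² : 2 * (α * α * α) ≤ ∑ A (λ b → 2 * (K * K) * (length (nbrs b) * length (nbrs b)))
  ∑nbrs² = *-cancelˡ-≤ α (begin
    α * (2 * (α * α * α))                            ≡⟨ lem₁ α ⟩
    2 * (α * α * (α * α))                            ≤⟨ *-monoʳ-≤ 2 (*-mono-≤ dense dense) ⟩
    2 * (K * length V * (K * length V))              ≡⟨ lem₂ K (length V) ⟩
    2 * (K * K) * (length V * length V)              ≤⟨ *-monoʳ-≤ (2 * (K * K)) (*-mono-≤ ∣V∣≤∑nbrs ∣V∣≤∑nbrs) ⟩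
    2 * (K * K) * (∑ A c * ∑ A c)                    ≤⟨ *-monoʳ-≤ (2 * (K * K)) (cauchy-schwarz A c) ⟩
    2 * (K * K) * (α * ∑ A (λ b → c b * c b))        ≡⟨ lem₃ (2 * (K * K)) α _ ⟩
    α * (2 * (K * K) * ∑ A (λ b → c b * c b))        ≡⟨ cong (α *_) (sym (∑-*ˡ A (2 * (K * K)) _)) ⟩
    α * ∑ A (λ b → 2 * (K * K) * (c b * c b))        ∎)
    where
    c = λ b → length (nbrs b)
    lem₁ : ∀ a → a * (2 * (a * a * a)) ≡ 2 * (a * a * (a * a))
    lem₁ = solve-∀
    lem₂ : ∀ K v → 2 * (K * v * (K * v)) ≡ 2 * (K * K) * (v * v)
    lem₂ = solve-∀
    lem₃ : ∀ k a q → k * (a * q) ≡ a * (k * q)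
    lem₃ = solve-∀

  -- Exchanging the sums counts a bad pair once for each common neighbour, of which it has fewer
  -- than α / T.
  ∑badPairs : T * ∑ A badPairs ≤ α * α * α
  ∑badPairs = begin
    T * ∑ A badPairs
      ≡⟨ cong (T *_) (∑-cong A (λ {b} _ → ∑-filter (λ a → adj? a b) A _ ⨾ ∑-cong A (λ {a} _ →
           cong (𝟙 (adj? a b) *_) (∑-filter (λ a → adj? a b) A _) ⨾ sym (∑-*ˡ A (𝟙 (adj? a b)) _)))) ⟩
    T * ∑ A (λ b → ∑ A (λ a → ∑ A (λ a′ → 𝟙 (adj? a b) * (𝟙 (adj? a′ b) * bad a a′))))
      ≡⟨ cong (T *_) (∑-swap A A _ ⨾ ∑-cong A (λ _ → ∑-swap A A _)) ⟩
    T * ∑ A (λ a → ∑ A (λ a′ → ∑ A (λ b → 𝟙 (adj? a b) * (𝟙 (adj? a′ b) * bad a a′))))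
      ≡⟨ cong (T *_) (∑-cong A (λ {a} _ → ∑-cong A (λ {a′} _ → ∑-cong A (λ {b} _ → regroup a a′ b) ⨾ ∑-*ˡ A (bad a a′) _
           ⨾ cong (bad a a′ *_) (sym (length-filter≡∑ (λ b → adj? a b ×-dec adj? a′ b) A))))) ⟩
    T * ∑ A (λ a → ∑ A (λ a′ → bad a a′ * length (common a a′)))
      ≡⟨ sym (∑-*ˡ A T _) ⨾ ∑-cong A (λ _ → sym (∑-*ˡ A T _)) ⟩
    ∑ A (λ a → ∑ A (λ a′ → T * (bad a a′ * length (common a a′))))
      ≤⟨ ∑-mono A (λ {a} _ → ∑-mono A (λ {a′} _ → small a a′)) ⟩
    ∑ A (λ a → ∑ A (λ a′ → α))
      ≡⟨ ∑-const A _ ⨾ cong (α *_) (∑-const A α) ⨾ sym (*-assoc α α α) ⟩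
    α * α * α
      ∎
    where
    regroup : ∀ a a′ b → 𝟙 (adj? a b) * (𝟙 (adj? a′ b) * bad a a′) ≡ bad a a′ * 𝟙 (adj? a b ×-dec adj? a′ b)
    regroup a a′ b with adj? a b | adj? a′ b
    ... | yes _ | yes _ = lem (bad a a′)
      where
      lem : ∀ x → 1 * (1 * x) ≡ x * 1
      lem = solve-∀
    ... | yes _ | no _ = sym (*-zeroʳ (bad a a′))
    ... | no _ | yes _ = sym (*-zeroʳ (bad a a′))
    ... | no _ | no _ = sym (*-zeroʳ (bad a a′))
    small : ∀ a a′ → T * (bad a a′ * length (common a a′)) ≤ α
    small a a′ with linked? a a′
    ... | yes _ = ≤-trans (≤-reflexive (*-zeroʳ T)) z≤n
    ... | no ¬l = ≤-trans (≤-reflexive (cong (T *_) (*-identityˡ _))) (<⇒≤ (≰⇒> ¬l))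

  abstract
   -- A single inequality carries both properties of the pivot: dropping either term on the left
   -- shows a large neighbourhood or few bad pairs in it.
   pivot : ∃ λ b → b ∈ A × α * α + T * badPairs b ≤ 2 * (K * K) * (length (nbrs b) * length (nbrs b))
   pivot = ∃-≤ A _ _ (∈-length a₀∈A) (begin
    ∑ A (λ b → α * α + T * badPairs b)            ≡⟨ ∑-+ A _ _ ⟩
    ∑ A (λ _ → α * α) + ∑ A (λ b → T * badPairs b) ≡⟨ cong₂ _+_ (∑-const A _) (∑-*ˡ A T badPairs) ⟩
    α * (α * α) + T * ∑ A badPairs                ≤⟨ +-monoʳ-≤ (α * (α * α)) ∑badPairs ⟩
    α * (α * α) + α * α * α                       ≡⟨ lem α ⟩
    2 * (α * α * α)                               ≤⟨ ∑nbrs² ⟩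
    ∑ A (λ b → 2 * (K * K) * (length (nbrs b) * length (nbrs b))) ∎)
    where
    lem : ∀ a → a * (a * a) + a * a * a ≡ 2 * (a * a * a)
    lem = solve-∀

  b₀ : F
  b₀ = proj₁ pivot

  A₀ : List F
  A₀ = nbrs b₀

  uA₀ : Unique A₀
  uA₀ = Uniq.filter⁺ _ uA

  m : ℕ
  m = length A₀

  instance
    2KK-nonZero : NonZero (2 * (K * K))
    2KK-nonZero = lem (2 * (K * K)) (λ eq → <⇒≱ (∈-length a₀∈A) (*-cancelʳ-≤ α 0 α (≤-trans
      (≤-trans (m≤m+n (α * α) _) (proj₂ (proj₂ pivot))) (≤-reflexive (cong (_* (m * m)) eq)))))
      where
      lem : ∀ n → n ≢ 0 → NonZero n
      lem zero    h = ⊥-elim (h refl)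
      lem (suc n) _ = _

  α≤2Km : α ≤ 2 * K * m
  α≤2Km = ≮⇒≥ λ lt → <⇒≱ (*-mono-< lt lt) (begin
    α * α                     ≤⟨ m≤m+n (α * α) _ ⟩
    α * α + T * badPairs b₀    ≤⟨ proj₂ (proj₂ pivot) ⟩
    2 * (K * K) * (m * m)     ≤⟨ *-monoˡ-≤ (m * m) (*-monoˡ-≤ (K * K) (s≤s (s≤s (z≤n {2})))) ⟩
    4 * (K * K) * (m * m)     ≡⟨ lem K m ⟩
    2 * K * m * (2 * K * m)   ∎)
    where
    lem : ∀ K m → 4 * (K * K) * (m * m) ≡ 2 * K * m * (2 * K * m)
    lem = solve-∀

  16bad≤m² : 16 * badPairs b₀ ≤ m * m
  16bad≤m² = *-cancelˡ-≤ (2 * (K * K)) (begin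
    2 * (K * K) * (16 * badPairs b₀)   ≡⟨ lem (K * K) (badPairs b₀) ⟩
    T * badPairs b₀                    ≤⟨ m≤n+m _ (α * α) ⟩
    α * α + T * badPairs b₀            ≤⟨ proj₂ (proj₂ pivot) ⟩
    2 * (K * K) * (m * m)             ∎)
    where
    lem : ∀ k b → 2 * k * (16 * b) ≡ 32 * k * b
    lem = solve-∀

  badDegree : F → ℕ
  badDegree a = ∑ A₀ (bad a)

  typical? : ∀ a → Dec (4 * badDegree a ≤ m)
  typical? a = 4 * badDegree a ≤? m

  A₁ : List F
  A₁ = filter typical? A₀

  uA₁ : Unique A₁
  uA₁ = Uniq.filter⁺ _ uA₀

  A₁⊆A : ∀ {a} → a ∈ A₁ → a ∈ A
  A₁⊆A a∈ = proj₁ (∈-filter⁻ (λ a → adj? a b₀) (proj₁ (∈-filter⁻ typical? a∈)))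

  β : ℕ
  β = length A₁

  m≤2β : m ≤ 2 * β
  m≤2β = *-cancelʳ-≤ m (2 * β) m ⦃ m-nonZero ⦄ (+-cancelʳ-≤ (m * m) _ _ (begin
    m * m + m * m                ≡⟨ cong (λ q → q * m + q * m) (length-filter-split typical? A₀) ⟩
    (β + γ) * m + (β + γ) * m    ≡⟨ lem β γ m ⟩
    2 * β * m + 2 * (γ * m)      ≤⟨ +-monoʳ-≤ (2 * β * m) (≤-trans (*-monoˡ-≤ (γ * m) (s≤s (s≤s (z≤n {2})))) γ-small) ⟩
    2 * β * m + m * m            ∎))
    where
    A₂ = filter (¬? ∘ typical?) A₀
    γ = length A₂
    m-nonZero : NonZero m
    m-nonZero = >-nonZero (n≢0⇒n>0 λ eq → <⇒≱ (∈-length a₀∈A) (≤-trans α≤2Km (≤-reflexive (cong (2 * K *_) eq ⨾ *-zeroʳ (2 * K)))))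
    lem : ∀ b g m → (b + g) * m + (b + g) * m ≡ 2 * b * m + 2 * (g * m)
    lem = solve-∀
    γ-small : 4 * (γ * m) ≤ m * m
    γ-small = begin
      4 * (γ * m)                       ≡⟨ cong (4 *_) (sym (∑-const A₂ m)) ⟩
      4 * ∑ A₂ (λ _ → m)                ≤⟨ *-monoʳ-≤ 4 (∑-mono A₂ (λ a∈ → <⇒≤ (≰⇒> (proj₂ (∈-filter⁻ (¬? ∘ typical?) {xs = A₀} a∈))))) ⟩
      4 * ∑ A₂ (λ a → 4 * badDegree a)  ≡⟨ cong (4 *_) (∑-*ˡ A₂ 4 badDegree) ⟩
      4 * (4 * ∑ A₂ badDegree)          ≤⟨ *-monoʳ-≤ 4 (*-monoʳ-≤ 4 (m≤n+m _ (∑ A₁ badDegree))) ⟩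
      4 * (4 * (∑ A₁ badDegree + ∑ A₂ badDegree)) ≡⟨ cong (λ q → 4 * (4 * q)) (sym (∑-filter-split typical? A₀ badDegree)) ⟩
      4 * (4 * ∑ A₀ badDegree)          ≡⟨ sym (*-assoc 4 4 (∑ A₀ badDegree)) ⟩
      16 * badPairs b₀                   ≤⟨ 16bad≤m² ⟩
      m * m                             ∎

  α≤4Kβ : α ≤ 4 * K * β
  α≤4Kβ = begin
    α                   ≤⟨ α≤2Km ⟩
    2 * K * m           ≤⟨ *-monoʳ-≤ (2 * K) m≤2β ⟩
    2 * K * (2 * β)     ≡⟨ lem K β ⟩
    4 * K * β           ∎
    where
    lem : ∀ K b → 2 * K * (2 * b) ≡ 4 * K * b
    lem = solve-∀

  middle : F → F → List F
  middle a a′ = filter (λ c → linked? a c ×-dec linked? a′ c) A₀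

  -- Each of a and a′ is bad with at most a quarter of `A₀`, so at least half of `A₀` is linked to
  -- both.
  m≤2middle : ∀ {a a′} → a ∈ A₁ → a′ ∈ A₁ → m ≤ 2 * length (middle a a′)
  m≤2middle {a} {a′} a∈ a′∈ = *-cancelˡ-≤ 2 (+-cancelʳ-≤ (2 * m) _ _ (begin
    2 * m + 2 * m                               ≡⟨ lem m ⟩
    4 * m                                       ≡⟨ cong (4 *_) (length-filter-split (λ c → linked? a c ×-dec linked? a′ c) A₀) ⟩
    4 * (length (middle a a′) + length rest)    ≤⟨ *-monoʳ-≤ 4 (+-monoʳ-≤ (length (middle a a′)) rest≤) ⟩
    4 * (length (middle a a′) + (badDegree a + badDegree a′))
                                                ≡⟨ lem′ (length (middle a a′)) (badDegree a) (badDegree a′) ⟩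
    2 * (2 * length (middle a a′)) + (4 * badDegree a + 4 * badDegree a′)
      ≤⟨ +-monoʳ-≤ (2 * (2 * length (middle a a′))) (+-mono-≤ (proj₂ (∈-filter⁻ typical? {a} {A₀} a∈)) (proj₂ (∈-filter⁻ typical? {a′} {A₀} a′∈))) ⟩
    2 * (2 * length (middle a a′)) + (m + m)    ≡⟨ cong (λ q → 2 * (2 * length (middle a a′)) + q) (lem″ m) ⟩
    2 * (2 * length (middle a a′)) + 2 * m      ∎))
    where
    rest = filter (¬? ∘ (λ c → linked? a c ×-dec linked? a′ c)) A₀
    lem : ∀ m → 2 * m + 2 * m ≡ 4 * m
    lem = solve-∀
    lem′ : ∀ x b c → 4 * (x + (b + c)) ≡ 2 * (2 * x) + (4 * b + 4 * c)
    lem′ = solve-∀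
    lem″ : ∀ m → m + m ≡ 2 * m
    lem″ = solve-∀
    rest≤ : length rest ≤ badDegree a + badDegree a′
    rest≤ = begin
      length rest                                                ≡⟨ length-filter≡∑ _ A₀ ⟩
      ∑ A₀ (λ c → 𝟙 (¬? (linked? a c ×-dec linked? a′ c)))       ≤⟨ ∑-mono A₀ (λ {c} _ → 𝟙-¬× (linked? a c) (linked? a′ c)) ⟩
      ∑ A₀ (λ c → bad a c + bad a′ c)                            ≡⟨ ∑-+ A₀ _ _ ⟩
      badDegree a + badDegree a′                                 ∎

  A⁴ : List ((F × F) × (F × F))
  A⁴ = cartesianProduct (cartesianProduct A A) (cartesianProduct A A)

  alt : (F × F) × (F × F) → F
  alt ((s₁ , s₂) , (s₃ , s₄)) = (s₁ ⊟ s₂) ⊟ (s₃ ⊟ s₄)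

  reps : F → List ((F × F) × (F × F))
  reps y = filter (λ s → alt s ≟ᶠ y) A⁴

  uA⁴ : Unique A⁴
  uA⁴ = Uniq.cartesianProduct⁺ (Uniq.cartesianProduct⁺ uA uA) (Uniq.cartesianProduct⁺ uA uA)

  -- There are at least α / (4 K) middle vertices c, and for each of them at least (α / T)² pairs of
  -- common neighbours (b , b′): together at least α³ / K₃ representations.
  K₃ : ℕ
  K₃ = 4 * K * (T * T)

  rich? : ∀ y → Dec (α * α * α ≤ K₃ * length (reps y))
  rich? y = α * α * α ≤? K₃ * length (reps y)

  P : List F
  P = filter rich? elems

  uP : Unique P
  uP = Uniq.filter⁺ _ elems-unique

  ∣P∣≤K₃α : length P ≤ K₃ * α
  ∣P∣≤K₃α = *-cancelʳ-≤ (length P) (K₃ * α) (α * α * α) ⦃ m*n≢0 (α * α) α ⦃ m*n≢0 α α ⦄ ⦄ (begin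
    length P * (α * α * α)     ≤⟨ fibre-lower alt K₃ {xs = A⁴} uP (λ {y} y∈ → reps y , Uniq.filter⁺ _ uA⁴ ,
                                    ∈-filter⁻ (λ s → alt s ≟ᶠ y) , proj₂ (∈-filter⁻ rich? {y} {elems} y∈)) ⟩
    K₃ * length A⁴             ≡⟨ cong (K₃ *_) (length-× (cartesianProduct A A) (cartesianProduct A A) ⨾ cong₂ _*_ (length-× A A) (length-× A A)) ⟩
    K₃ * (α * α * (α * α))     ≡⟨ lem K₃ α ⟩
    K₃ * α * (α * α * α)       ∎)
    where
    lem : ∀ k a → k * (a * a * (a * a)) ≡ k * a * (a * a * a)
    lem = solve-∀

  module _ {lam mu : F} (lam≢0 : lam ≢ 𝟘) (mu≢0 : mu ≢ 𝟘)
           (form : ∀ {x y} → (x , y) ∈ V → lam ⊗ x ⊕ mu ⊗ y ∈ A) where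

    -- For c linked to a and a′, and b, b′ common neighbours of (a , c) and (a′ , c), the difference
    -- lam (a - a′) equals ((lam a + mu b) - (lam c + mu b)) - ((lam a′ + mu b′) - (lam c + mu b′)),
    -- with four terms in `A`. The term recovers c by `label`, then b and b′. Neither `A₁` nor `P`
    -- depends on lam and mu, so one target set serves all forms simultaneously.
    differences-rich : ∀ {a a′} → a ∈ A₁ → a′ ∈ A₁ → lam ⊗ (a ⊟ a′) ∈ P
    differences-rich {a} {a′} a∈ a′∈ = ∈-filter⁺ rich? (∈-elems _) (begin
      α * α * α                              ≡⟨ *-assoc α α α ⟩
      α * (α * α)                            ≤⟨ *-monoˡ-≤ (α * α) (≤-trans α≤2Km (*-monoʳ-≤ (2 * K) (m≤2middle a∈ a′∈))) ⟩
      2 * K * (2 * length M) * (α * α)       ≡⟨ lem K (length M) (α * α) ⟩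
      4 * K * (length M * (α * α))           ≤⟨ *-monoʳ-≤ (4 * K) (fibre-lower label (T * T) {xs = reps y} uM fibre) ⟩
      4 * K * (T * T * length (reps y))      ≡⟨ sym (*-assoc (4 * K) (T * T) _) ⟩
      K₃ * length (reps y)                   ∎)
      where
      lem : ∀ K M q → 2 * K * (2 * M) * q ≡ 4 * K * (M * q)
      lem = solve-∀
      y = lam ⊗ (a ⊟ a′)
      M = middle a a′
      uM : Unique M
      uM = Uniq.filter⁺ _ uA₀
      label : (F × F) × (F × F) → F
      label ((s₁ , s₂) , _) = a ⊟ inv lam ⊗ (s₁ ⊟ s₂)
      fibre : ∀ {c} → c ∈ M → Σ (List ((F × F) × (F × F))) λ Z → Unique Z ×
              (∀ {z} → z ∈ Z → z ∈ reps y × label z ≡ c) × α * α ≤ T * T * length Z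
      fibre {c} c∈ = map f L , map-unique f-inj uL , f-into , size
        where
        L = cartesianProduct (common a c) (common a′ c)
        uL : Unique L
        uL = Uniq.cartesianProduct⁺ (Uniq.filter⁺ _ uA) (Uniq.filter⁺ _ uA)
        f : F × F → (F × F) × (F × F)
        f (b , b′) = (lam ⊗ a ⊕ mu ⊗ b , lam ⊗ c ⊕ mu ⊗ b) , (lam ⊗ a′ ⊕ mu ⊗ b′ , lam ⊗ c ⊕ mu ⊗ b′)
        f-inj : ∀ {u v} → u ∈ L → v ∈ L → f u ≡ f v → u ≡ v
        f-inj {b , b′} {d , d′} _ _ eq = cong₂ _,_
          (cancelˡ mu≢0 (⊕-cancelˡ (cong (proj₁ ∘ proj₁) eq)))
          (cancelˡ mu≢0 (⊕-cancelˡ (cong (proj₁ ∘ proj₂) eq)))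
        ∈common : ∀ {a c b} → b ∈ common a c → (a , b) ∈ V × (c , b) ∈ V
        ∈common {a} {c} b∈ = proj₂ (∈-filter⁻ (λ b → adj? a b ×-dec adj? c b) {xs = A} b∈)
        f-into : ∀ {z} → z ∈ map f L → z ∈ reps y × label z ≡ c
        f-into z∈ with (b , b′) , u∈ , refl ← ∈-map⁻ f z∈ =
          let b∈ , b′∈ = ∈-cartesianProduct⁻ (common a c) (common a′ c) u∈
              ab , cb = ∈common b∈
              a′b′ , cb′ = ∈common b′∈
          in ∈-filter⁺ (λ s → alt s ≟ᶠ y)
               (∈-cartesianProduct⁺ (∈-cartesianProduct⁺ (form ab) (form cb)) (∈-cartesianProduct⁺ (form a′b′) (form cb′)))
               (solve 7 (λ l m a a′ c b b′ → ((l :* a :+ m :* b) :- (l :* c :+ m :* b)) :- ((l :* a′ :+ m :* b′) :- (l :* c :+ m :* b′))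
                   := l :* (a :- a′)) refl lam mu a a′ c b b′) ,
             (solve 6 (λ i l m a c b → a :- i :* ((l :* a :+ m :* b) :- (l :* c :+ m :* b)) := a :- (i :* l) :* (a :- c)) refl (inv lam) lam mu a c b
              ⨾ cong (λ o → a ⊟ o ⊗ (a ⊟ c)) (inverseˡ lam≢0)
              ⨾ solve 2 (λ a c → a :- con (⁺ 1) :* (a :- c) := c) refl a c)
        size : α * α ≤ T * T * length (map f L)
        size = begin
          α * α                                                     ≤⟨ *-mono-≤ (proj₁ (proj₂ (∈-filter⁻ (λ c → linked? a c ×-dec linked? a′ c) {xs = A₀} c∈)))
                                                                               (proj₂ (proj₂ (∈-filter⁻ (λ c → linked? a c ×-dec linked? a′ c) {xs = A₀} c∈))) ⟩
          T * length (common a c) * (T * length (common a′ c))      ≡⟨ lem′ T (length (common a c)) (length (common a′ c)) ⟩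
          T * T * (length (common a c) * length (common a′ c))      ≡⟨ cong (T * T *_) (sym (length-map f L ⨾ length-× (common a c) (common a′ c))) ⟩
          T * T * length (map f L)                                  ∎
          where
          lem′ : ∀ t x y → t * x * (t * y) ≡ t * t * (x * y)
          lem′ = solve-∀

-- Popular differences

module PopularDifferences {p : ℕ} (𝔽 : PrimeField p)
  (A₁ : List (PrimeField.F 𝔽)) (uA₁ : Unique A₁) {a₁ : PrimeField.F 𝔽} (a₁∈ : a₁ ∈ A₁)
  (P : List (PrimeField.F 𝔽)) (uP : Unique P) {K₂ : ℕ} (∣P∣≤ : length P ≤ K₂ * length A₁)
  (Lam : List (PrimeField.F 𝔽)) (uLam : Unique Lam) (Lam≢0 : ∀ {l} → l ∈ Lam → l ≢ PrimeField.𝟘 𝔽)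
  (rich : ∀ {l a a′} → l ∈ Lam → a ∈ A₁ → a′ ∈ A₁ → PrimeField._⊗_ 𝔽 l (PrimeField._⊕_ 𝔽 a (PrimeField.⊝_ 𝔽 a′)) ∈ P)
  {l₁ : PrimeField.F 𝔽} (l₁∈ : l₁ ∈ Lam) where
  open FieldTheory 𝔽
  open AdditiveCombinatorics 𝔽
  open DecMembership _≟ᶠ_ using (_∈?_)
  open ≤-Reasoning

  -- `g` is the price of adding one more copy of `D` in `sum-growth`: 2 K₂ for the popularity of a
  -- difference and K₂ for the size of `W`.
  β ℓ g : ℕ
  β = length A₁
  ℓ = length Lam
  g = 2 * K₂ * K₂

  instance
    β-nonZero : NonZero β
    β-nonZero = >-nonZero (∈-length a₁∈)

    K₂-nonZero : NonZero K₂
    K₂-nonZero = >-nonZero (n≢0⇒n>0 λ eq → <⇒≱ (∈-length (rich l₁∈ a₁∈ a₁∈)) (≤-trans ∣P∣≤ (≤-reflexive (cong (_* β) eq))))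

  W : List F
  W = A₁ ∸ᶠ A₁

  ∣W∣≤ : length W ≤ K₂ * β
  ∣W∣≤ = ≤-trans (length-inj {f = l₁ ⊗_} (lift₂-unique _⊟_ A₁ A₁) into (λ _ _ → cancelˡ (Lam≢0 l₁∈))) ∣P∣≤
    where
    into : ∀ {w} → w ∈ W → l₁ ⊗ w ∈ P
    into w∈ with a , a′ , a∈ , a′∈ , refl ← ∈-lift₂⁻ _⊟_ A₁ A₁ w∈ = rich l₁∈ a∈ a′∈

  diff : F × F → F
  diff (a , a′) = a ⊟ a′

  pairs : List (F × F)
  pairs = cartesianProduct A₁ A₁

  u-pairs : Unique pairs
  u-pairs = Uniq.cartesianProduct⁺ uA₁ uA₁

  diffs : F → List (F × F)
  diffs x = filter (λ aa → diff aa ≟ᶠ x) pairs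

  ∈-diffs : ∀ {x a a′} → (a , a′) ∈ diffs x → a ∈ A₁ × a′ ∈ A₁ × a ⊟ a′ ≡ x
  ∈-diffs {x} h = let h′ , eq = ∈-filter⁻ (λ aa → diff aa ≟ᶠ x) {xs = pairs} h
                      a∈ , a′∈ = ∈-cartesianProduct⁻ A₁ A₁ h′
                  in a∈ , a′∈ , eq

  diffs≤β : ∀ x → length (diffs x) ≤ β
  diffs≤β x = length-inj {f = proj₁} (Uniq.filter⁺ _ u-pairs) (λ h → proj₁ (∈-diffs h)) inj
    where
    inj : ∀ {u v} → u ∈ diffs x → v ∈ diffs x → proj₁ u ≡ proj₁ v → u ≡ v
    inj {a , b} {.a , c} u∈ v∈ refl = cong (a ,_)
      (solve 2 (λ a b → b := a :- (a :- b)) refl a b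
       ⨾ cong (a ⊟_) (proj₂ (proj₂ (∈-diffs u∈)) ⨾ sym (proj₂ (proj₂ (∈-diffs v∈))))
       ⨾ solve 2 (λ a b → a :- (a :- b) := b) refl a c)

  popular? : ∀ x → Dec (β ≤ 2 * K₂ * length (diffs x))
  popular? x = β ≤? 2 * K₂ * length (diffs x)

  D : List F
  D = filter popular? W

  uD : Unique D
  uD = Uniq.filter⁺ _ (lift₂-unique _⊟_ A₁ A₁)

  ∈-D : ∀ {d} → d ∈ D → d ∈ W × β ≤ 2 * K₂ * length (diffs d)
  ∈-D = ∈-filter⁻ popular? {xs = W}

  δ : ℕ
  δ = length D

  -- As |W| ≤ K₂ β, the unpopular differences account for at most half of the β² pairs; each popular
  -- one accounts for at most β pairs.
  β≤2δ : β ≤ 2 * δ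
  β≤2δ = *-cancelʳ-≤ β (2 * δ) β (+-cancelʳ-≤ (β * β) _ _ (begin
    β * β + β * β                       ≡⟨ lem (β * β) ⟩
    2 * (β * β)                         ≡⟨ cong (2 *_) (sym (length-× A₁ A₁)) ⟩
    2 * length pairs                    ≤⟨ *-monoʳ-≤ 2 (length≤∑fibres _≟ᶠ_ diff pairs W into) ⟩
    2 * ∑ W r                           ≡⟨ cong (2 *_) (∑-filter-split popular? W r) ⟩
    2 * (∑ D r + ∑ D′ r)                ≡⟨ *-distribˡ-+ 2 (∑ D r) (∑ D′ r) ⟩
    2 * ∑ D r + 2 * ∑ D′ r              ≤⟨ +-mono-≤ (*-monoʳ-≤ 2 (≤-trans (∑-mono D (λ {x} _ → diffs≤β x)) (≤-reflexive (∑-const D β)))) rest ⟩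
    2 * (δ * β) + β * β                 ≡⟨ cong (_+ β * β) (sym (*-assoc 2 δ β)) ⟩
    2 * δ * β + β * β                   ∎))
    where
    D′ = filter (¬? ∘ popular?) W
    r = λ x → length (diffs x)
    into : ∀ {aa} → aa ∈ pairs → diff aa ∈ W
    into aa∈ = let a∈ , a′∈ = ∈-cartesianProduct⁻ A₁ A₁ aa∈ in ∈-lift₂⁺ _⊟_ a∈ a′∈
    lem : ∀ x → x + x ≡ 2 * x
    lem = solve-∀
    rest : 2 * ∑ D′ r ≤ β * β
    rest = *-cancelˡ-≤ K₂ (begin
      K₂ * (2 * ∑ D′ r)               ≡⟨ lem′ K₂ (∑ D′ r) ⟩
      2 * K₂ * ∑ D′ r                 ≡⟨ sym (∑-*ˡ D′ (2 * K₂) r) ⟩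
      ∑ D′ (λ x → 2 * K₂ * r x)       ≤⟨ ∑-mono D′ (λ x∈ → <⇒≤ (≰⇒> (proj₂ (∈-filter⁻ (¬? ∘ popular?) {xs = W} x∈)))) ⟩
      ∑ D′ (λ _ → β)                  ≡⟨ ∑-const D′ β ⟩
      length D′ * β                   ≤⟨ *-monoˡ-≤ β (≤-trans (m≤n+m (length D′) δ) (≤-reflexive (sym (length-filter-split popular? W)))) ⟩
      length W * β                    ≤⟨ *-monoˡ-≤ β ∣W∣≤ ⟩
      K₂ * β * β                      ≡⟨ *-assoc K₂ β β ⟩
      K₂ * (β * β)                    ∎)
      where
      lem′ : ∀ k x → k * (2 * x) ≡ 2 * k * x
      lem′ = solve-∀

  D⊝ : ∀ {d} → d ∈ D → ⊝ d ∈ D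
  D⊝ {d} d∈ = ∈-filter⁺ popular? ∈W (≤-trans (proj₂ (∈-D d∈)) (*-monoʳ-≤ (2 * K₂)
      (length-inj {f = λ aa → proj₂ aa , proj₁ aa} (Uniq.filter⁺ _ u-pairs) into (λ { _ _ refl → refl }))))
    where
    ∈W : ⊝ d ∈ W
    ∈W with a , a′ , a∈ , a′∈ , refl ← ∈-lift₂⁻ _⊟_ A₁ A₁ (proj₁ (∈-D d∈)) =
      subst (_∈ W) (solve 2 (λ a b → b :- a := :- (a :- b)) refl a a′) (∈-lift₂⁺ _⊟_ a′∈ a∈)
    into : ∀ {aa} → aa ∈ diffs d → (proj₂ aa , proj₁ aa) ∈ diffs (⊝ d)
    into {a , a′} h = let a∈ , a′∈ , eq = ∈-diffs h in ∈-filter⁺ (λ aa → diff aa ≟ᶠ ⊝ d) (∈-cartesianProduct⁺ a′∈ a∈)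
      (solve 2 (λ a b → b :- a := :- (a :- b)) refl a a′ ⨾ cong ⊝_ eq)

  d₀∈ : ∃ λ d → d ∈ D
  d₀∈ = go D (λ eq → <⇒≱ (∈-length a₁∈) (≤-trans β≤2δ (≤-reflexive (cong (2 *_) eq))))
    where
    go : (X : List F) → length X ≢ 0 → ∃ λ x → x ∈ X
    go []      h = ⊥-elim (h refl)
    go (x ∷ X) _ = x , here refl

  instance
    δ-nonZero : NonZero δ
    δ-nonZero = >-nonZero (∈-length (proj₂ d₀∈))

  -- x + d − a = (x − z) + (y − a) for each of the many ways of writing d = y − z.
  sum-growth : ∀ X → length ((X ∔ D) ∸ᶠ A₁) ≤ g * length (X ∸ᶠ A₁)
  sum-growth X = *-cancelʳ-≤ (length Q) (g * length (X ∸ᶠ A₁)) β (begin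
    length Q * β                                        ≤⟨ fibre-lower label (2 * K₂) (lift₂-unique _⊟_ (X ∔ D) A₁) fibre ⟩
    2 * K₂ * length (cartesianProduct (X ∸ᶠ A₁) W)      ≡⟨ cong (2 * K₂ *_) (length-× (X ∸ᶠ A₁) W) ⟩
    2 * K₂ * (length (X ∸ᶠ A₁) * length W)              ≤⟨ *-monoʳ-≤ (2 * K₂) (*-monoʳ-≤ (length (X ∸ᶠ A₁)) ∣W∣≤) ⟩
    2 * K₂ * (length (X ∸ᶠ A₁) * (K₂ * β))              ≡⟨ lem K₂ (length (X ∸ᶠ A₁)) β ⟩
    g * length (X ∸ᶠ A₁) * β                            ∎)
    where
    Q = (X ∔ D) ∸ᶠ A₁
    lem : ∀ k x b → 2 * k * (x * (k * b)) ≡ 2 * k * k * x * b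
    lem = solve-∀
    label : F × F → F
    label (u , v) = u ⊕ v
    fibre : ∀ {q} → q ∈ Q → Σ (List (F × F)) λ Z → Unique Z ×
            (∀ {z} → z ∈ Z → z ∈ cartesianProduct (X ∸ᶠ A₁) W × label z ≡ q) × β ≤ 2 * K₂ * length Z
    fibre q∈ with s , a , s∈ , a∈ , refl ← ∈-lift₂⁻ _⊟_ (X ∔ D) A₁ q∈ with x , d , x∈ , d∈ , refl ← ∈-lift₂⁻ _⊕_ X D s∈ =
      map f (diffs d) , map-unique inj (Uniq.filter⁺ _ u-pairs) , into ,
      subst (λ n → β ≤ 2 * K₂ * n) (sym (length-map f (diffs d))) (proj₂ (∈-D d∈))
      where
      f : F × F → F × F
      f (y , z) = x ⊟ z , y ⊟ a
      inj : ∀ {u v} → u ∈ diffs d → v ∈ diffs d → f u ≡ f v → u ≡ v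
      inj {y , z} {y′ , z′} _ _ eq = cong₂ _,_
        (solve 2 (λ a y → y := a :+ (y :- a)) refl a y ⨾ cong (a ⊕_) (cong proj₂ eq) ⨾ solve 2 (λ a y → a :+ (y :- a) := y) refl a y′)
        (solve 2 (λ x z → z := x :- (x :- z)) refl x z ⨾ cong (x ⊟_) (cong proj₁ eq) ⨾ solve 2 (λ x z → x :- (x :- z) := z) refl x z′)
      into : ∀ {w} → w ∈ map f (diffs d) → w ∈ cartesianProduct (X ∸ᶠ A₁) W × label w ≡ (x ⊕ d) ⊟ a
      into w∈ with (y , z) , h , refl ← ∈-map⁻ f w∈ = let y∈ , z∈ , eq = ∈-diffs h in
        ∈-cartesianProduct⁺ (∈-lift₂⁺ _⊟_ x∈ z∈) (∈-lift₂⁺ _⊟_ y∈ a∈) ,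
        (solve 4 (λ x z y a → (x :- z) :+ (y :- a) := (x :+ (y :- z)) :- a) refl x z y a ⨾ cong (λ d → (x ⊕ d) ⊟ a) eq)

  multiple : ℕ → List F
  multiple zero    = [ 𝟘 ]
  multiple (suc n) = multiple n ∔ D

  -- This takes the place of Plünnecke's inequality. `sum-growth` is iterated from 0 - A₁, a set of
  -- size β, and subtracting the fixed element `a₁` embeds the n-fold sumset of `D` into the set
  -- that is controlled.
  multiple-size : ∀ n {X} → Unique X → (∀ {x} → x ∈ X → x ∈ multiple n) → length X ≤ g ^ n * β
  multiple-size n {X} uX X⊆ = ≤-trans
    (length-inj {f = _⊟ a₁} uX (λ x∈ → ∈-lift₂⁺ _⊟_ (X⊆ x∈) a₁∈) (λ { {x} {y} _ _ eq → ⊕-cancelˡ (⊕-comm (⊝ a₁) x ⨾ eq ⨾ ⊕-comm y (⊝ a₁)) }))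
    (go n)
    where
    go : ∀ n → length (multiple n ∸ᶠ A₁) ≤ g ^ n * β
    go zero = ≤-trans (unique-⊆-length (lift₂-unique _⊟_ [ 𝟘 ] A₁) sub) (≤-reflexive (length-map (𝟘 ⊟_) A₁ ⨾ sym (*-identityˡ β)))
      where
      sub : ∀ {x} → x ∈ [ 𝟘 ] ∸ᶠ A₁ → x ∈ map (𝟘 ⊟_) A₁
      sub x∈ with _ , a , here refl , a∈ , refl ← ∈-lift₂⁻ _⊟_ [ 𝟘 ] A₁ x∈ = ∈-map⁺ (𝟘 ⊟_) a∈
    go (suc n) = begin
      length (multiple (suc n) ∸ᶠ A₁)   ≤⟨ sum-growth (multiple n) ⟩
      g * length (multiple n ∸ᶠ A₁)     ≤⟨ *-monoʳ-≤ g (go n) ⟩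
      g * (g ^ n * β)                   ≡⟨ sym (*-assoc g (g ^ n) β) ⟩
      g ^ suc n * β                     ∎

  multiple-⊕ : ∀ m n {x y} → x ∈ multiple m → y ∈ multiple n → x ⊕ y ∈ multiple (n + m)
  multiple-⊕ m zero {x} x∈ (here refl) = subst (_∈ multiple m) (sym (⊕-identityʳ x)) x∈
  multiple-⊕ m (suc n) {x} x∈ y∈ with y , d , y′∈ , d∈ , refl ← ∈-lift₂⁻ _⊕_ (multiple n) D y∈ =
    subst (_∈ multiple (suc (n + m))) (⊕-assoc x y d) (∈-lift₂⁺ _⊕_ (multiple-⊕ m n x∈ y′∈) d∈)

  multiple-⊝ : ∀ n {x} → x ∈ multiple n → ⊝ x ∈ multiple n
  multiple-⊝ zero (here refl) = here (solve 0 (:- con (⁺ 0) := con (⁺ 0)) refl)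
  multiple-⊝ (suc n) x∈ with y , d , y∈ , d∈ , refl ← ∈-lift₂⁻ _⊕_ (multiple n) D x∈ =
    subst (_∈ multiple (suc n)) (solve 2 (λ y d → :- y :+ :- d := :- (y :+ d)) refl y d) (∈-lift₂⁺ _⊕_ (multiple-⊝ n y∈) (D⊝ d∈))

  D⊆multiple : ∀ {d} → d ∈ D → d ∈ multiple 1
  D⊆multiple {d} d∈ = subst (_∈ multiple 1) (⊕-identityˡ d) (∈-lift₂⁺ _⊕_ {X = [ 𝟘 ]} (here refl) d∈)

  -- By the symmetry of `D` this is also D - D, the kind of set in which a Ruzsa covering leaves its
  -- remainder.
  Y : List F
  Y = multiple 2

  D-D⊆Y : ∀ {d d′} → d ∈ D → d′ ∈ D → d ⊟ d′ ∈ Y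
  D-D⊆Y d∈ d′∈ = multiple-⊕ 1 1 (D⊆multiple d∈) (D⊆multiple (D⊝ d′∈))

  k₀ : ℕ
  k₀ = 2 * g ^ 5

  abstract
    -- (Y + Y) + D lies in the fivefold sumset of `D`, so Y + Y is covered by at most g⁵ β / δ ≤ 2
    -- g⁵ translates of D - D ⊆ Y.
    doubling : Σ (List F) λ S → length S ≤ k₀ × (∀ {y z} → y ∈ Y → z ∈ Y → ∃ λ s → s ∈ S × (y ⊕ z) ⊟ s ∈ Y)
    doubling = let S , le , cov = ruzsa-covering (Y ∔ Y) uD (proj₂ d₀∈) in
      S , *-cancelʳ-≤ (length S) k₀ δ (begin
        length S * δ             ≤⟨ le ⟩
        length ((Y ∔ Y) ∔ D)     ≤⟨ multiple-size 5 (lift₂-unique _⊕_ (Y ∔ Y) D) sub ⟩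
        g ^ 5 * β                ≤⟨ *-monoʳ-≤ (g ^ 5) β≤2δ ⟩
        g ^ 5 * (2 * δ)          ≡⟨ lem (g ^ 5) δ ⟩
        k₀ * δ                   ∎) ,
      λ {y} {z} y∈ z∈ →
        let s , d , d′ , s∈ , d∈ , d′∈ , eq = cov (∈-lift₂⁺ _⊕_ y∈ z∈)
        in s , s∈ , subst (_∈ Y)
             (solve 3 (λ s d d′ → d :- d′ := (s :+ d) :- d′ :- s) refl s d d′
              ⨾ cong (λ w → w ⊟ d′ ⊟ s) (sym eq)
              ⨾ solve 4 (λ y z d′ s → (y :+ z) :+ d′ :- d′ :- s := (y :+ z) :- s) refl y z d′ s)
             (D-D⊆Y d∈ d′∈)
      where
      lem : ∀ x d → x * (2 * d) ≡ 2 * x * d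
      lem = solve-∀
      sub : ∀ {x} → x ∈ (Y ∔ Y) ∔ D → x ∈ multiple 5
      sub x∈ with w , d , w∈ , d∈ , refl ← ∈-lift₂⁻ _⊕_ (Y ∔ Y) D x∈ with y , z , y∈ , z∈ , refl ← ∈-lift₂⁻ _⊕_ Y Y w∈ =
        ∈-lift₂⁺ _⊕_ (multiple-⊕ 2 2 y∈ z∈) d∈

  y₀∈Y : proj₁ d₀∈ ⊟ proj₁ d₀∈ ∈ Y
  y₀∈Y = D-D⊆Y (proj₂ d₀∈) (proj₂ d₀∈)

  open ApproximateGroup Y (lift₂-unique _⊕_ (multiple 1) D) (multiple-⊝ 2) (proj₁ doubling) (proj₁ (proj₂ doubling)) (proj₂ (proj₂ doubling)) (proj₁ d₀∈ ⊟ proj₁ d₀∈) y₀∈Y public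
    using (Good; module Ratios; ∣Y∣)

  δ≤∣Y∣ : δ ≤ ∣Y∣
  δ≤∣Y∣ = length-inj {f = _⊟ proj₁ d₀∈} uD (λ d∈ → D-D⊆Y d∈ (proj₂ d₀∈))
    (λ { {x} {y} _ _ eq → ⊕-cancelˡ (⊕-comm (⊝ proj₁ d₀∈) x ⨾ eq ⨾ ⊕-comm y (⊝ proj₁ d₀∈)) })

  ∣Y∣≤ : ∣Y∣ ≤ g ^ 2 * β
  ∣Y∣≤ = multiple-size 2 (lift₂-unique _⊕_ (multiple 1) D) id

  common-multiples : F → F → ℕ
  common-multiples l l′ = ∑ D (λ d → ∑ D (λ d′ → 𝟙 (l ⊗ d ≟ᶠ l′ ⊗ d′)))

  row≤1 : ∀ {l l′} → l′ ∈ Lam → ∀ d → ∑ D (λ d′ → 𝟙 (l ⊗ d ≟ᶠ l′ ⊗ d′)) ≤ 1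
  row≤1 {l} {l′} l′∈ d = ∑-𝟙-unique (λ d′ → l ⊗ d ≟ᶠ l′ ⊗ d′) uD (λ _ _ e e′ → cancelˡ (Lam≢0 l′∈) (sym e ⨾ e′))

  abstract
    -- All dilates l D lie in the small set `P`. By Cauchy-Schwarz they overlap a lot on average,
    -- and `l₀` is a multiplier whose total overlap with the others is at least average.
    pivot-multiplier : ∃ λ l → l ∈ Lam × ℓ * (δ * δ) ≤ length P * ∑ Lam (common-multiples l)
    pivot-multiplier = ∃-≤ Lam _ _ (∈-length l₁∈) (begin
      ∑ Lam (λ _ → ℓ * (δ * δ))                                   ≡⟨ ∑-const Lam _ ⟩
      ℓ * (ℓ * (δ * δ))                                           ≡⟨ lem ℓ δ ⟩
      ℓ * δ * (ℓ * δ)                                             ≡⟨ cong₂ _*_ (sym (length-× Lam D)) (sym (length-× Lam D)) ⟩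
      length LD * length LD                                       ≤⟨ length²≤collisions _≟ᶠ_ val LD uP into ⟩
      length P * collisions _≟ᶠ_ val LD                           ≡⟨ cong (length P *_) expand ⟩
      length P * ∑ Lam (λ l → ∑ Lam (common-multiples l))         ≡⟨ sym (∑-*ˡ Lam (length P) _) ⟩
      ∑ Lam (λ l → length P * ∑ Lam (common-multiples l))         ∎)
      where
      LD : List (F × F)
      LD = cartesianProduct Lam D
      val : F × F → F
      val (l , d) = l ⊗ d
      lem : ∀ l d → l * (l * (d * d)) ≡ l * d * (l * d)
      lem = solve-∀
      into : ∀ {ld} → ld ∈ LD → val ld ∈ P
      into {l , d} ld∈ with l∈ , d∈ ← ∈-cartesianProduct⁻ Lam D ld∈
        with a , a′ , a∈ , a′∈ , refl ← ∈-lift₂⁻ _⊟_ A₁ A₁ (proj₁ (∈-D d∈)) = rich l∈ a∈ a′∈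
      expand : collisions _≟ᶠ_ val LD ≡ ∑ Lam (λ l → ∑ Lam (common-multiples l))
      expand = ∑-× Lam D _ ⨾ ∑-cong Lam (λ {l} _ →
        ∑-cong D (λ {d} _ → ∑-× Lam D _) ⨾ ∑-swap D Lam (λ d l′ → ∑ D (λ d′ → 𝟙 (l ⊗ d ≟ᶠ l′ ⊗ d′))))

  l₀ : F
  l₀ = proj₁ pivot-multiplier

  ℓδ≤ : ℓ * δ ≤ 2 * K₂ * ∑ Lam (common-multiples l₀)
  ℓδ≤ = *-cancelʳ-≤ (ℓ * δ) (2 * K₂ * ∑ Lam (common-multiples l₀)) δ (begin
    ℓ * δ * δ                                       ≡⟨ *-assoc ℓ δ δ ⟩
    ℓ * (δ * δ)                                     ≤⟨ proj₂ (proj₂ pivot-multiplier) ⟩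
    length P * ∑ Lam (common-multiples l₀)          ≤⟨ *-monoˡ-≤ _ (≤-trans ∣P∣≤ (*-monoʳ-≤ K₂ β≤2δ)) ⟩
    K₂ * (2 * δ) * ∑ Lam (common-multiples l₀)      ≡⟨ lem K₂ δ (∑ Lam (common-multiples l₀)) ⟩
    2 * K₂ * ∑ Lam (common-multiples l₀) * δ        ∎)
    where
    lem : ∀ k d s → k * (2 * d) * s ≡ 2 * k * s * d
    lem = solve-∀

  overlap? : ∀ l → Dec (δ ≤ 4 * K₂ * common-multiples l₀ l)
  overlap? l = δ ≤? 4 * K₂ * common-multiples l₀ l

  Lam′ : List F
  Lam′ = filter overlap? Lam

  ∈-Lam′ : ∀ {l} → l ∈ Lam′ → l ∈ Lam × δ ≤ 4 * K₂ * common-multiples l₀ l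
  ∈-Lam′ = ∈-filter⁻ overlap? {xs = Lam}

  ℓ≤ : ℓ ≤ 4 * K₂ * length Lam′
  ℓ≤ = *-cancelʳ-≤ ℓ (4 * K₂ * length Lam′) δ (+-cancelʳ-≤ (ℓ * δ) _ _ (begin
    ℓ * δ + ℓ * δ                                     ≤⟨ +-mono-≤ ℓδ≤ ℓδ≤ ⟩
    2 * K₂ * ∑ Lam c + 2 * K₂ * ∑ Lam c               ≡⟨ lem K₂ (∑ Lam c) ⟩
    4 * K₂ * ∑ Lam c                                  ≡⟨ cong (4 * K₂ *_) (∑-filter-split overlap? Lam c) ⟩
    4 * K₂ * (∑ Lam′ c + ∑ rest c)                    ≡⟨ *-distribˡ-+ (4 * K₂) (∑ Lam′ c) (∑ rest c) ⟩
    4 * K₂ * ∑ Lam′ c + 4 * K₂ * ∑ rest c             ≤⟨ +-mono-≤ (*-monoʳ-≤ (4 * K₂) inside) outside ⟩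
    4 * K₂ * (length Lam′ * δ) + ℓ * δ                ≡⟨ cong (_+ ℓ * δ) (sym (*-assoc (4 * K₂) (length Lam′) δ)) ⟩
    4 * K₂ * length Lam′ * δ + ℓ * δ                  ∎))
    where
    c = common-multiples l₀
    rest = filter (¬? ∘ overlap?) Lam
    lem : ∀ k s → 2 * k * s + 2 * k * s ≡ 4 * k * s
    lem = solve-∀
    inside : ∑ Lam′ c ≤ length Lam′ * δ
    inside = begin
      ∑ Lam′ c            ≤⟨ ∑-mono Lam′ (λ l∈ → ∑-mono D (λ {d} _ → row≤1 (proj₁ (∈-Lam′ l∈)) d)) ⟩
      ∑ Lam′ (λ _ → ∑ D (λ _ → 1)) ≡⟨ ∑-const Lam′ _ ⨾ cong (length Lam′ *_) (sym (length≡∑ D)) ⟩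
      length Lam′ * δ     ∎
    outside : 4 * K₂ * ∑ rest c ≤ ℓ * δ
    outside = begin
      4 * K₂ * ∑ rest c             ≡⟨ sym (∑-*ˡ rest (4 * K₂) c) ⟩
      ∑ rest (λ l → 4 * K₂ * c l)   ≤⟨ ∑-mono rest (λ l∈ → <⇒≤ (≰⇒> (proj₂ (∈-filter⁻ (¬? ∘ overlap?) {xs = Lam} l∈)))) ⟩
      ∑ rest (λ _ → δ)              ≡⟨ ∑-const rest δ ⟩
      length rest * δ               ≤⟨ *-monoˡ-≤ δ (≤-trans (m≤n+m (length rest) (length Lam′)) (≤-reflexive (sym (length-filter-split overlap? Lam)))) ⟩
      ℓ * δ                         ∎

  k₁ : ℕ
  k₁ = 2 * g ^ 3 * (4 * K₂)

  -- With r = l / l₀, the set Z = {d ∈ D : d / r ∈ D} has the size of the overlap of l₀ D and l D,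
  -- at least δ / (4 K₂). Division by r carries r Y + Z into the threefold sumset of `D`, of size at
  -- most g³ β. Ruzsa covering therefore places r Y in `k₁` translates of Z - Z ⊆ Y.
  multiplier-good : ∀ {l} → l ∈ Lam′ → Good k₁ (l ⊗ inv l₀)
  multiplier-good {l} l∈ = proj₁ covering , lenS , cov
    where
    l≢0 = Lam≢0 (proj₁ (∈-Lam′ l∈))
    l₀≢0 = Lam≢0 (proj₁ (proj₂ pivot-multiplier))
    r r′ : F
    r  = l ⊗ inv l₀
    r′ = l₀ ⊗ inv l
    r′≢0 : r′ ≢ 𝟘
    r′≢0 = ⊗-≢𝟘 l₀≢0 (inv-≢𝟘 l≢0)
    r′r : r′ ⊗ r ≡ 𝟏
    r′r = solve 4 (λ a b c d → (a :* b) :* (c :* d) := (a :* d) :* (b :* c)) refl l₀ (inv l) l (inv l₀)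
          ⨾ cong₂ _⊗_ (inverseʳ l₀≢0) (inverseˡ l≢0) ⨾ ⊗-identityˡ 𝟏
    Z = filter (λ d → (r′ ⊗ d) ∈? D) D
    uZ : Unique Z
    uZ = Uniq.filter⁺ _ uD
    Z⊆ : ∀ {z} → z ∈ Z → z ∈ D × r′ ⊗ z ∈ D
    Z⊆ = ∈-filter⁻ (λ d → (r′ ⊗ d) ∈? D) {xs = D}
    row : ∀ d → ∑ D (λ d′ → 𝟙 (l₀ ⊗ d ≟ᶠ l ⊗ d′)) ≤ 𝟙 ((r′ ⊗ d) ∈? D)
    row d with (r′ ⊗ d) ∈? D
    ... | yes _ = row≤1 (proj₁ (∈-Lam′ l∈)) d
    ... | no ∉D = ≤-trans (∑-mono D none) (≤-reflexive (∑-const D 0 ⨾ *-zeroʳ δ))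
      where
      none : ∀ {d′} → d′ ∈ D → 𝟙 (l₀ ⊗ d ≟ᶠ l ⊗ d′) ≤ 0
      none {d′} d′∈ = ≤-reflexive (𝟙-no (l₀ ⊗ d ≟ᶠ l ⊗ d′) λ eq → ∉D (subst (_∈ D)
        (solve 1 (λ d → d := con (⁺ 1) :* d) refl d′ ⨾ cong (_⊗ d′) (sym (inverseˡ l≢0))
         ⨾ ⊗-assoc _ _ _ ⨾ cong (inv l ⊗_) (sym eq)
         ⨾ solve 3 (λ a b c → a :* (b :* c) := (b :* a) :* c) refl (inv l) l₀ d) d′∈))
    δ≤ : δ ≤ 4 * K₂ * length Z
    δ≤ = ≤-trans (proj₂ (∈-Lam′ l∈)) (*-monoʳ-≤ (4 * K₂) (≤-trans (∑-mono D (λ {d} _ → row d))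
           (≤-reflexive (sym (length-filter≡∑ (λ d → (r′ ⊗ d) ∈? D) D)))))
    nonempty : ∀ (Z : List F) → δ ≤ 4 * K₂ * length Z → ∃ λ z → z ∈ Z
    nonempty [] le = ⊥-elim (<⇒≱ (∈-length (proj₂ d₀∈)) (≤-trans le (≤-reflexive (*-zeroʳ (4 * K₂)))))
    nonempty (z ∷ _) _ = z , here refl
    z₀∈ = proj₂ (nonempty Z δ≤)
    X = map (r ⊗_) Y
    covering = ruzsa-covering X uZ z₀∈
    sub : ∀ {w} → w ∈ map (r′ ⊗_) (X ∔ Z) → w ∈ multiple 3
    sub w∈ with v , v∈ , refl ← ∈-map⁻ (r′ ⊗_) w∈ with x , z , x∈ , z∈ , refl ← ∈-lift₂⁻ _⊕_ X Z v∈ with y , y∈ , refl ← ∈-map⁻ (r ⊗_) x∈ =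
      subst (_∈ multiple 3)
        (solve 3 (λ y r′ z → y :+ r′ :* z := con (⁺ 1) :* y :+ r′ :* z) refl y r′ z
         ⨾ cong (λ o → o ⊗ y ⊕ r′ ⊗ z) (sym r′r)
         ⨾ solve 4 (λ r′ r y z → (r′ :* r) :* y :+ r′ :* z := r′ :* (r :* y :+ z)) refl r′ r y z)
        (∈-lift₂⁺ _⊕_ y∈ (proj₂ (Z⊆ z∈)))
    lenS : length (proj₁ covering) ≤ k₁
    lenS = *-cancelʳ-≤ (length (proj₁ covering)) k₁ (length Z) ⦃ >-nonZero (∈-length z₀∈) ⦄ (begin
      length (proj₁ covering) * length Z        ≤⟨ proj₁ (proj₂ covering) ⟩
      length (X ∔ Z)                            ≡⟨ sym (length-map (r′ ⊗_) (X ∔ Z)) ⟩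
      length (map (r′ ⊗_) (X ∔ Z))              ≤⟨ multiple-size 3 (map-unique (λ _ _ → cancelˡ r′≢0) (lift₂-unique _⊕_ X Z)) sub ⟩
      g ^ 3 * β                                 ≤⟨ *-monoʳ-≤ (g ^ 3) (≤-trans β≤2δ (*-monoʳ-≤ 2 δ≤)) ⟩
      g ^ 3 * (2 * (4 * K₂ * length Z))         ≡⟨ lem (g ^ 3) (4 * K₂) (length Z) ⟩
      k₁ * length Z                             ∎)
      where
      lem : ∀ x k z → x * (2 * (k * z)) ≡ 2 * x * k * z
      lem = solve-∀
    cov : ∀ {y} → y ∈ Y → ∃ λ s → s ∈ proj₁ covering × (r ⊗ y) ⊟ s ∈ Y
    cov {y} y∈ =
      let s , z , z′ , s∈ , z∈ , z′∈ , eq = proj₂ (proj₂ covering) (∈-map⁺ (r ⊗_) y∈)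
      in s , s∈ , subst (_∈ Y)
           (solve 3 (λ s z z′ → z :- z′ := (s :+ z) :- z′ :- s) refl s z z′
            ⨾ cong (λ w → w ⊟ z′ ⊟ s) (sym eq)
            ⨾ solve 3 (λ w z′ s → w :+ z′ :- z′ :- s := w :- s) refl (r ⊗ y) z′ s)
           (D-D⊆Y (proj₁ (Z⊆ z∈)) (proj₁ (Z⊆ z′∈)))

  kᵠ k* : ℕ
  kᵠ = k₁ * (k₁ * k₀) * (k₀ * (k₁ * (k₁ * k₀)) * k₀)
  k* = k₁ * (kᵠ * (1 * k₀) * k₁ * k₀)

  -- The multipliers l / l₀ are the set R of `Ratios.growth`. When |Lam′| is comparable with β the
  -- second alternative fails for large β, and the first makes β comparable with p.
  expansion : 2 ≤ length Lam′ → 4 * (kᵠ * k₀) ≤ β → 4 * (k* * k₀) ≤ β →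
              p ≤ 2 * (kᵠ * k₀) * (g ^ 2 * β) ⊎ length Lam′ * length Lam′ ≤ 2 * (k* * k₀) * (g ^ 2 * β)
  expansion two large large′ =
    let r₀ , r₁ , r₀∈ , r₁∈ , r₀≢r₁ = two-distinct Lam′ (Uniq.filter⁺ _ uLam) two
    in Sum.map (λ le → ≤-trans le (*-monoʳ-≤ (2 * (kᵠ * k₀)) ∣Y∣≤))
               (λ le → ≤-trans (≤-reflexive (sym (cong₂ _*_ len len))) (≤-trans le (*-monoʳ-≤ (2 * (k* * k₀)) ∣Y∣≤)))
               (Ratios.growth R uR R-good (∈-map⁺ f r₀∈) (∈-map⁺ f r₁∈) (r₀≢r₁ ∘ f-inj) (half {kᵠ * k₀} large) (half {k* * k₀} large′))
    where
    f : F → F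
    f = _⊗ inv l₀
    f-inj : ∀ {x y} → f x ≡ f y → x ≡ y
    f-inj eq = cancelˡ (inv-≢𝟘 (Lam≢0 (proj₁ (proj₂ pivot-multiplier)))) (⊗-comm (inv l₀) _ ⨾ eq ⨾ ⊗-comm _ (inv l₀))
    R = map f Lam′
    len : length R ≡ length Lam′
    len = length-map f Lam′
    uR : Unique R
    uR = map-unique (λ _ _ → f-inj) (Uniq.filter⁺ _ uLam)
    R-good : ∀ {r} → r ∈ R → Good k₁ r
    R-good r∈ with l , l∈ , refl ← ∈-map⁻ f r∈ = multiplier-good l∈
    half : ∀ {e} → 4 * e ≤ β → 2 * e ≤ ∣Y∣
    half {e} le = ≤-trans (*-cancelˡ-≤ 2 (≤-trans (≤-reflexive (sym (*-assoc 2 2 e))) (≤-trans le β≤2δ))) δ≤∣Y∣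

-- The sum–product bound

-- For K ≥ 2 all coefficients can be absorbed into the exponent, so a polynomial bound is a single
-- power of K.
PolyBounded : (ℕ → ℕ) → Set
PolyBounded f = Σ ℕ λ e → ∀ K → 2 ≤ K → f K ≤ K ^ e

n≤2^n : ∀ n → n ≤ 2 ^ n
n≤2^n zero    = z≤n
n≤2^n (suc n) = begin
  suc n               ≤⟨ +-mono-≤ (m^n>0 2 n) (n≤2^n n) ⟩
  2 ^ n + 2 ^ n       ≡⟨ cong (2 ^ n +_) (sym (+-identityʳ (2 ^ n))) ⟩
  2 ^ suc n           ∎
  where open ≤-Reasoning

const-poly : ∀ c → PolyBounded (λ _ → c)
const-poly c = c , λ K 2≤K → ≤-trans (n≤2^n c) (^-monoˡ-≤ c 2≤K)

id-poly : PolyBounded (λ K → K)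
id-poly = 1 , λ K _ → ≤-reflexive (sym (*-identityʳ K))

infixl 7 _*-poly_
_*-poly_ : ∀ {f g} → PolyBounded f → PolyBounded g → PolyBounded (λ K → f K * g K)
(e , le) *-poly (e′ , le′) = e + e′ , λ K 2≤K →
  ≤-trans (*-mono-≤ (le K 2≤K) (le′ K 2≤K)) (≤-reflexive (sym (^-distribˡ-+-* K e e′)))

infixl 6 _+-poly_
_+-poly_ : ∀ {f g} → PolyBounded f → PolyBounded g → PolyBounded (λ K → f K + g K)
_+-poly_ {f} {g} (e , le) (e′ , le′) = suc (e + e′) , λ K 2≤K → bound K 2≤K
  where
  open ≤-Reasoning
  bound : ∀ K → 2 ≤ K → f K + g K ≤ K ^ suc (e + e′)
  bound K@(suc _) 2≤K = begin
    f K + g K                       ≤⟨ +-mono-≤ (≤-trans (le K 2≤K) (^-monoʳ-≤ K (m≤m+n e e′))) (≤-trans (le′ K 2≤K) (^-monoʳ-≤ K (m≤n+m e′ e))) ⟩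
    K ^ (e + e′) + K ^ (e + e′)     ≡⟨ cong (K ^ (e + e′) +_) (sym (+-identityʳ _)) ⟩
    2 * K ^ (e + e′)                ≤⟨ *-monoˡ-≤ _ 2≤K ⟩
    K ^ suc (e + e′)                ∎

^-poly : ∀ {f} → PolyBounded f → ∀ n → PolyBounded (λ K → f K ^ n)
^-poly p zero    = const-poly 1
^-poly p (suc n) = p *-poly ^-poly p n

-- `K₃` to `k*` repeat the constants of the preceding modules; the 4 K in `K₂` converts α into β.
-- After the 1, the summands of `B` are: two lower bounds on α that permit `expansion`, one that
-- yields two elements of `Lam′`, the constant of the first alternative, and the one that refutes
-- the second.
module Constants (K : ℕ) where
  K₃ K₂ g k₀ k₁ kᵠ k* B : ℕ
  K₃ = 4 * K * (32 * (K * K) * (32 * (K * K)))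
  K₂ = K₃ * (4 * K)
  g  = 2 * K₂ * K₂
  k₀ = 2 * g ^ 5
  k₁ = 2 * g ^ 3 * (4 * K₂)
  kᵠ = k₁ * (k₁ * k₀) * (k₀ * (k₁ * (k₁ * k₀)) * k₀)
  k* = k₁ * (kᵠ * (1 * k₀) * k₁ * k₀)
  B  = 1 + (4 * K * (4 * (kᵠ * k₀)) + 4 * K * (4 * (k* * k₀)) + K * (4 * K₂)
         + 2 * (kᵠ * k₀) * g ^ 2 + K * K * (4 * K₂ * (4 * K₂)) * (2 * (k* * k₀) * g ^ 2))

B-poly : PolyBounded Constants.B
B-poly = const-poly 1 +-poly (const-poly 4 *-poly id-poly *-poly (const-poly 4 *-poly (kᵠ′ *-poly k₀′))
           +-poly const-poly 4 *-poly id-poly *-poly (const-poly 4 *-poly (k*′ *-poly k₀′))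
           +-poly id-poly *-poly (const-poly 4 *-poly K₂′)
           +-poly const-poly 2 *-poly (kᵠ′ *-poly k₀′) *-poly ^-poly g′ 2
           +-poly id-poly *-poly id-poly *-poly (const-poly 4 *-poly K₂′ *-poly (const-poly 4 *-poly K₂′)) *-poly (const-poly 2 *-poly (k*′ *-poly k₀′) *-poly ^-poly g′ 2))
  where
  T′ : PolyBounded (λ K → 32 * (K * K))
  T′ = const-poly 32 *-poly (id-poly *-poly id-poly)
  K₂′ : PolyBounded Constants.K₂
  K₂′ = const-poly 4 *-poly id-poly *-poly (T′ *-poly T′) *-poly (const-poly 4 *-poly id-poly)
  g′ : PolyBounded Constants.g
  g′ = const-poly 2 *-poly K₂′ *-poly K₂′
  k₀′ : PolyBounded Constants.k₀
  k₀′ = const-poly 2 *-poly ^-poly g′ 5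
  k₁′ : PolyBounded Constants.k₁
  k₁′ = const-poly 2 *-poly ^-poly g′ 3 *-poly (const-poly 4 *-poly K₂′)
  kᵠ′ : PolyBounded Constants.kᵠ
  kᵠ′ = k₁′ *-poly (k₁′ *-poly k₀′) *-poly (k₀′ *-poly (k₁′ *-poly (k₁′ *-poly k₀′)) *-poly k₀′)
  k*′ : PolyBounded Constants.k*
  k*′ = k₁′ *-poly (kᵠ′ *-poly (const-poly 1 *-poly k₀′) *-poly k₁′ *-poly k₀′)

module _ {p : ℕ} (𝔽 : PrimeField p) where
  open FieldTheory 𝔽

  -- All forms share the single set V. The dense graph argument thus runs once and yields `A₁` and
  -- `P`, and every l ∈ Lam then maps A₁ - A₁ into this `P`. With |Lam| ≥ |A| / K there are too many
  -- such multipliers unless |A| is close to p.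
  sum-product-bound :
    ∀ (A : List F) → Unique A → ∀ {a₀} → a₀ ∈ A →
    ∀ (V : List (F × F)) → Unique V → (∀ {x y} → (x , y) ∈ V → x ∈ A × y ∈ A) →
    ∀ K → length A * length A ≤ K * length V →
    ∀ (Lam : List F) → Unique Lam →
    (∀ {l} → l ∈ Lam → l ≢ 𝟘 × Σ F λ μ → μ ≢ 𝟘 × (∀ {x y} → (x , y) ∈ V → l ⊗ x ⊕ μ ⊗ y ∈ A)) →
    length A ≤ K * length Lam → Constants.B K ≤ length A → p ≤ Constants.B K * length A
  sum-product-bound A uA {a₀} a₀∈ V uV V⊆ K dense Lam uLam forms α≤Kℓ B≤α = conclude (expansion two (large {kᵠ * k₀} B₁) (large {k* * k₀} B₂))
    where
    open ≤-Reasoning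
    open Constants K
    module G = DenseGraph 𝔽 A uA V uV V⊆ K dense a₀ a₀∈
    α = length A
    b₁ = 4 * K * (4 * (kᵠ * k₀))
    b₂ = 4 * K * (4 * (k* * k₀))
    b₃ = K * (4 * K₂)
    b₄ = 2 * (kᵠ * k₀) * g ^ 2
    b₅ = K * K * (4 * K₂ * (4 * K₂)) * (2 * (k* * k₀) * g ^ 2)
    B₅ : b₅ < α
    B₅ = ≤-trans (s≤s (m≤n+m b₅ (b₁ + b₂ + b₃ + b₄))) B≤α
    B₃ : b₃ < α
    B₃ = ≤-trans (s≤s (≤-trans (m≤n+m b₃ (b₁ + b₂)) (≤-trans (m≤m+n _ b₄) (m≤m+n _ b₅)))) B≤α
    B₂ : b₂ < α
    B₂ = ≤-trans (s≤s (≤-trans (m≤n+m b₂ b₁) (≤-trans (m≤m+n _ b₃) (≤-trans (m≤m+n _ b₄) (m≤m+n _ b₅))))) B≤α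
    B₁ : b₁ < α
    B₁ = ≤-trans (s≤s (≤-trans (m≤m+n b₁ b₂) (≤-trans (m≤m+n _ b₃) (≤-trans (m≤m+n _ b₄) (m≤m+n _ b₅))))) B≤α
    nonempty : ∀ {c} (X : List F) → α ≤ c * length X → ∃ λ x → x ∈ X
    nonempty {c} []      le = ⊥-elim (<⇒≱ (∈-length a₀∈) (≤-trans le (≤-reflexive (*-zeroʳ c))))
    nonempty     (x ∷ _) _  = x , here refl
    ∣P∣≤ : length G.P ≤ K₂ * G.β
    ∣P∣≤ = begin
      length G.P              ≤⟨ G.∣P∣≤K₃α ⟩
      K₃ * α                  ≤⟨ *-monoʳ-≤ K₃ G.α≤4Kβ ⟩
      K₃ * (4 * K * G.β)      ≡⟨ sym (*-assoc K₃ (4 * K) G.β) ⟩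
      K₂ * G.β                ∎
    rich : ∀ {l a a′} → l ∈ Lam → a ∈ G.A₁ → a′ ∈ G.A₁ → l ⊗ (a ⊟ a′) ∈ G.P
    rich l∈ = let l≢0 , μ , μ≢0 , form = forms l∈ in G.differences-rich l≢0 μ≢0 form
    open PopularDifferences 𝔽 G.A₁ G.uA₁ (proj₂ (nonempty {4 * K} G.A₁ G.α≤4Kβ)) G.P G.uP {K₂} ∣P∣≤ Lam uLam (proj₁ ∘ forms) rich
      (proj₂ (nonempty {K} Lam α≤Kℓ)) using (Lam′; ℓ≤; expansion)
    β = G.β
    ρ = length Lam′
    α≤Kρ : α ≤ K * (4 * K₂ * ρ)
    α≤Kρ = ≤-trans α≤Kℓ (*-monoʳ-≤ K ℓ≤)
    large : ∀ {x} → 4 * K * (4 * x) < α → 4 * x ≤ β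
    large {x} lt = ≮⇒≥ λ β<4x → <⇒≱ lt (≤-trans G.α≤4Kβ (*-monoʳ-≤ (4 * K) (<⇒≤ β<4x)))
    two : 2 ≤ ρ
    two = ≮⇒≥ λ { (s≤s ρ≤1) → <⇒≱ B₃ (≤-trans α≤Kρ (*-monoʳ-≤ K (≤-trans (*-monoʳ-≤ (4 * K₂) ρ≤1) (≤-reflexive (*-identityʳ (4 * K₂)))))) }
    β≤α : β ≤ α
    β≤α = unique-⊆-length G.uA₁ G.A₁⊆A
    conclude : p ≤ 2 * (kᵠ * k₀) * (g ^ 2 * β) ⊎ ρ * ρ ≤ 2 * (k* * k₀) * (g ^ 2 * β) → p ≤ B * α
    conclude (inj₁ le) = begin
      p                                ≤⟨ le ⟩
      2 * (kᵠ * k₀) * (g ^ 2 * β)      ≡⟨ sym (*-assoc (2 * (kᵠ * k₀)) (g ^ 2) β) ⟩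
      b₄ * β                           ≤⟨ *-mono-≤ (≤-trans (≤-trans (m≤n+m b₄ (b₁ + b₂ + b₃)) (m≤m+n _ b₅)) (n≤1+n _)) β≤α ⟩
      B * α                            ∎
    -- ρ is at least α / (4 K K₂), so the second alternative would bound α² by `b₅` α, contrary to
    -- `B₅`.
    conclude (inj₂ le) = ⊥-elim (<⇒≱ B₅ (*-cancelʳ-≤ α b₅ α ⦃ >-nonZero (∈-length a₀∈) ⦄ (begin
      α * α                                                      ≤⟨ *-mono-≤ α≤Kρ α≤Kρ ⟩
      K * (4 * K₂ * ρ) * (K * (4 * K₂ * ρ))                      ≡⟨ lem K (4 * K₂) ρ ⟩
      K * K * (4 * K₂ * (4 * K₂)) * (ρ * ρ)                      ≤⟨ *-monoʳ-≤ (K * K * (4 * K₂ * (4 * K₂))) (≤-trans le (*-monoʳ-≤ (2 * (k* * k₀)) (*-monoʳ-≤ (g ^ 2) β≤α))) ⟩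
      K * K * (4 * K₂ * (4 * K₂)) * (2 * (k* * k₀) * (g ^ 2 * α)) ≡⟨ lem′ (K * K * (4 * K₂ * (4 * K₂))) (2 * (k* * k₀)) (g ^ 2) α ⟩
      b₅ * α                                                     ∎)))
      where
      lem : ∀ K c r → K * (c * r) * (K * (c * r)) ≡ K * K * (c * c) * (r * r)
      lem = solve-∀
      lem′ : ∀ x y z a → x * (y * (z * a)) ≡ x * (y * z) * a
      lem′ = solve-∀

-- Lines missing a set

module _ {p : ℕ} (𝔽 : PrimeField p) where
  open FieldTheory 𝔽

  dot : F × F → F × F → F
  dot (l , μ) (x , y) = l ⊗ x ⊕ μ ⊗ y

  -- Cauchy–Schwarz for the incidences between F² ∖ V and the lines {v : u · v = b}, u ∈ U, b ∈ B, none of which meets V.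
  missed-lines-bound :
    ∀ (V : List (F × F)) → Unique V → (U : List (F × F)) → Unique U → (B : List F) → Unique B →
    (∀ {u} → u ∈ U → proj₂ u ≢ 𝟘) →
    (∀ {u u′} → u ∈ U → u′ ∈ U → u ≢ u′ → proj₁ u ⊗ proj₂ u′ ≢ proj₁ u′ ⊗ proj₂ u) →
    (∀ {u v b} → u ∈ U → v ∈ V → b ∈ B → dot u v ≢ b) →
    length V * (length U * length B) ≤ p * p * p
  missed-lines-bound V uV U uU B uB μ≢0 indep missed = go (n ≟ 0)
    where
    open ≤-Reasoning
    _≟²_ : DecidableEquality (F × F)
    _≟²_ = ≡-dec _≟ᶠ_ _≟ᶠ_
    _≟³_ : DecidableEquality ((F × F) × F)
    _≟³_ = ≡-dec _≟²_ _≟ᶠ_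
    inV? : ∀ v → Dec (v ∈ V)
    inV? v = DecMembership._∈?_ _≟²_ v V
    F² = cartesianProduct elems elems
    uF² : Unique F²
    uF² = Uniq.cartesianProduct⁺ elems-unique elems-unique
    ∈F² : ∀ v → v ∈ F²
    ∈F² (x , y) = ∈-cartesianProduct⁺ (∈-elems x) (∈-elems y)
    lenF² : length F² ≡ p * p
    lenF² = length-× elems elems ⨾ cong₂ _*_ elems-length elems-length
    C = filter (¬? ∘ inV?) F²
    V′ = filter inV? F²
    c = length C
    lines = cartesianProduct U B
    u-lines : Unique lines
    u-lines = Uniq.cartesianProduct⁺ uU uB
    n = length U * length B
    hit? : ∀ (i : (F × F) × F) v → Dec (dot (proj₁ i) v ≡ proj₂ i)
    hit? i v = dot (proj₁ i) v ≟ᶠ proj₂ i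
    N : F × F → ℕ
    N v = ∑ lines (λ i → 𝟙 (hit? i v))
    on-line : (F × F) × F → List (F × F)
    on-line i = filter (hit? i) F²
    line-inj : ∀ {i} → i ∈ lines → ∀ {x y y′} → dot (proj₁ i) (x , y) ≡ proj₂ i → dot (proj₁ i) (x , y′) ≡ proj₂ i → y ≡ y′
    line-inj {(l , μ) , b} i∈ {x} {y} {y′} e e′ = cancelˡ (μ≢0 (proj₁ (∈-cartesianProduct⁻ U B i∈)))
      (solve 2 (λ a b → b := (:- a) :+ (a :+ b)) refl (l ⊗ x) (μ ⊗ y) ⨾ cong (⊝ (l ⊗ x) ⊕_) (e ⨾ sym e′)
       ⨾ solve 2 (λ a b → (:- a) :+ (a :+ b) := b) refl (l ⊗ x) (μ ⊗ y′))
    line≤p : ∀ {i} → i ∈ lines → length (on-line i) ≤ p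
    line≤p {i} i∈ = subst (length (on-line i) ≤_) elems-length
      (length-inj {f = proj₁} (Uniq.filter⁺ _ uF²) (λ _ → ∈-elems _)
        (λ { {x , y} {.x , y′} v∈ w∈ refl → cong (x ,_) (line-inj i∈ (proj₂ (∈-filter⁻ (hit? i) {xs = F²} v∈)) (proj₂ (∈-filter⁻ (hit? i) {xs = F²} w∈))) }))
    p≤line : ∀ {i} → i ∈ lines → p ≤ length (on-line i)
    p≤line {i@((l , μ) , b)} i∈ = subst (_≤ length (on-line i)) elems-length
      (length-inj {f = λ x → x , inv μ ⊗ (b ⊟ l ⊗ x)} elems-unique
        (λ {x} _ → ∈-filter⁺ (hit? i) (∈F² _)
          (solve 5 (λ l x μ i b → l :* x :+ μ :* (i :* (b :- l :* x)) := l :* x :+ (μ :* i) :* (b :- l :* x)) refl l x μ (inv μ) b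
           ⨾ cong (λ o → l ⊗ x ⊕ o ⊗ (b ⊟ l ⊗ x)) (inverseʳ (μ≢0 (proj₁ (∈-cartesianProduct⁻ U B i∈))))
           ⨾ solve 3 (λ l x b → l :* x :+ con (⁺ 1) :* (b :- l :* x) := b) refl l x b))
        (λ _ _ → cong proj₁))
    total : n * p ≤ ∑ F² N
    total = begin
      n * p                                            ≡⟨ cong (_* p) (sym (length-× U B)) ⟩
      length lines * p                                 ≡⟨ sym (∑-const lines p) ⟩
      ∑ lines (λ _ → p)                                ≤⟨ ∑-mono lines p≤line ⟩
      ∑ lines (λ i → length (on-line i))               ≡⟨ ∑-cong lines (λ {i} _ → length-filter≡∑ (hit? i) F²) ⟩
      ∑ lines (λ i → ∑ F² (λ v → 𝟙 (hit? i v)))        ≡⟨ ∑-swap lines F² _ ⟩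
      ∑ F² N                                           ∎
    N≡0 : ∀ {v} → v ∈ V → N v ≡ 0
    N≡0 {v} v∈ = ∑-cong lines (λ {i} i∈ → let u∈ , b∈ = ∈-cartesianProduct⁻ U B i∈ in 𝟙-no (hit? i v) (missed u∈ v∈ b∈))
      ⨾ ∑-const lines 0 ⨾ *-zeroʳ (length lines)
    total′ : n * p ≤ ∑ C N
    total′ = begin
      n * p                    ≤⟨ total ⟩
      ∑ F² N                   ≡⟨ ∑-filter-split inV? F² N ⟩
      ∑ V′ N + ∑ C N           ≡⟨ cong (_+ ∑ C N) (∑-cong V′ (λ v∈ → N≡0 (proj₂ (∈-filter⁻ inV? {xs = F²} v∈))) ⨾ ∑-const V′ 0 ⨾ *-zeroʳ (length V′)) ⟩
      ∑ C N                    ∎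
    pair-bound : ∀ {i j} → i ∈ lines → j ∈ lines → ∑ F² (λ v → 𝟙 (hit? i v) * 𝟙 (hit? j v)) ≤ 𝟙 (i ≟³ j) * p + 1
    pair-bound {i} {j} i∈ j∈ with i ≟³ j
    ... | yes refl = begin
      ∑ F² (λ v → 𝟙 (hit? i v) * 𝟙 (hit? i v))    ≤⟨ ∑-mono F² (λ {v} _ → ≤-trans (*-monoʳ-≤ (𝟙 (hit? i v)) (𝟙≤1 (hit? i v))) (≤-reflexive (*-identityʳ _))) ⟩
      ∑ F² (λ v → 𝟙 (hit? i v))                   ≡⟨ sym (length-filter≡∑ (hit? i) F²) ⟩
      length (on-line i)                          ≤⟨ line≤p i∈ ⟩
      p                                           ≤⟨ ≤-trans (m≤m+n p 0) (m≤m+n (1 * p) 1) ⟩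
      1 * p + 1                                   ∎
    ... | no i≢j = begin
      ∑ F² (λ v → 𝟙 (hit? i v) * 𝟙 (hit? j v))    ≡⟨ ∑-cong F² (λ {v} _ → both v) ⟩
      ∑ F² (λ v → 𝟙 (hit? i v ×-dec hit? j v))    ≤⟨ ∑-𝟙-unique (λ v → hit? i v ×-dec hit? j v) uF² (λ _ _ → meet) ⟩
      1                                           ∎
      where
      both : ∀ v → 𝟙 (hit? i v) * 𝟙 (hit? j v) ≡ 𝟙 (hit? i v ×-dec hit? j v)
      both v with hit? i v | hit? j v
      ... | yes _ | yes _ = refl
      ... | yes _ | no  _ = refl
      ... | no  _ | yes _ = refl
      ... | no  _ | no  _ = refl
      difference : ∀ l μ {x y x′ y′} → l ⊗ x ⊕ μ ⊗ y ≡ l ⊗ x′ ⊕ μ ⊗ y′ → l ⊗ (x ⊟ x′) ⊕ μ ⊗ (y ⊟ y′) ≡ 𝟘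
      difference l μ {x} {y} {x′} {y′} e =
        solve 6 (λ l μ x y x′ y′ → l :* (x :- x′) :+ μ :* (y :- y′) := (l :* x :+ μ :* y) :- (l :* x′ :+ μ :* y′)) refl l μ x y x′ y′
        ⨾ ≡⇒⊟≡𝟘 e
      determinant : ∀ l μ l′ μ′ {x y} → l ⊗ x ⊕ μ ⊗ y ≡ 𝟘 → l′ ⊗ x ⊕ μ′ ⊗ y ≡ 𝟘 → (l ⊗ μ′ ⊟ l′ ⊗ μ) ⊗ x ≡ 𝟘
      determinant l μ l′ μ′ {x} {y} e e′ =
        solve 6 (λ l μ l′ μ′ x y → (l :* μ′ :- l′ :* μ) :* x := μ′ :* (l :* x :+ μ :* y) :- μ :* (l′ :* x :+ μ′ :* y)) refl l μ l′ μ′ x y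
        ⨾ cong₂ (λ a b → μ′ ⊗ a ⊟ μ ⊗ b) e e′
        ⨾ solve 2 (λ μ μ′ → μ′ :* con (⁺ 0) :- μ :* con (⁺ 0) := con (⁺ 0)) refl μ μ′
      meet : ∀ {v w} → dot (proj₁ i) v ≡ proj₂ i × dot (proj₁ j) v ≡ proj₂ j → dot (proj₁ i) w ≡ proj₂ i × dot (proj₁ j) w ≡ proj₂ j → v ≡ w
      meet {x , y} {x′ , y′} (e₁ , e₂) (e₁′ , e₂′) = by-cases (proj₁ i ≟² proj₁ j)
        where
        l = proj₁ (proj₁ i)
        μ = proj₂ (proj₁ i)
        l′ = proj₁ (proj₁ j)
        μ′ = proj₂ (proj₁ j)
        column : x ≡ x′ → (x , y) ≡ (x′ , y′)
        column x≡ = cong₂ _,_ x≡ (line-inj i∈ {x = x} e₁ (subst (λ z → dot (proj₁ i) (z , y′) ≡ proj₂ i) (sym x≡) e₁′))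
        by-cases : Dec (proj₁ i ≡ proj₁ j) → (x , y) ≡ (x′ , y′)
        -- Lines with the same normal vector are parallel: a common point would make their
        -- right-hand sides equal.
        by-cases (yes eq) = ⊥-elim (i≢j (cong₂ _,_ eq (sym e₁ ⨾ cong (λ u → dot u (x , y)) eq ⨾ e₂)))
        by-cases (no u≢u′) = Sum.[ (λ h → ⊥-elim (indep (proj₁ (∈-cartesianProduct⁻ U B i∈)) (proj₁ (∈-cartesianProduct⁻ U B j∈)) u≢u′ (⊟≡𝟘⇒≡ h)))
                                 , (λ h → column (⊟≡𝟘⇒≡ h)) ]
          (no-zero-divisors {l ⊗ μ′ ⊟ l′ ⊗ μ} {x ⊟ x′}
            (determinant l μ l′ μ′ {x ⊟ x′} {y ⊟ y′} (difference l μ (e₁ ⨾ sym e₁′)) (difference l′ μ′ (e₂ ⨾ sym e₂′))))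
    squares : ∑ F² (λ v → N v * N v) ≤ n * (p + n)
    squares = begin
      ∑ F² (λ v → N v * N v)
        ≡⟨ ∑-cong F² (λ {v} _ → sym (∑-*ˡ lines (N v) _) ⨾ ∑-cong lines (λ {i} _ → *-comm (N v) _ ⨾ sym (∑-*ˡ lines (𝟙 (hit? i v)) _))) ⟩
      ∑ F² (λ v → ∑ lines (λ i → ∑ lines (λ j → 𝟙 (hit? i v) * 𝟙 (hit? j v))))
        ≡⟨ ∑-swap F² lines _ ⨾ ∑-cong lines (λ _ → ∑-swap F² lines _) ⟩
      ∑ lines (λ i → ∑ lines (λ j → ∑ F² (λ v → 𝟙 (hit? i v) * 𝟙 (hit? j v))))
        ≤⟨ ∑-mono lines (λ {i} i∈ → ≤-trans (∑-mono lines (λ j∈ → pair-bound i∈ j∈)) (row i)) ⟩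
      ∑ lines (λ _ → p + length lines)
        ≡⟨ ∑-const lines _ ⨾ cong₂ (λ a b → a * (p + b)) (length-× U B) (length-× U B) ⟩
      n * (p + n)
        ∎
      where
      row : ∀ i → ∑ lines (λ j → 𝟙 (i ≟³ j) * p + 1) ≤ p + length lines
      row i = begin
        ∑ lines (λ j → 𝟙 (i ≟³ j) * p + 1)                      ≡⟨ ∑-+ lines _ _ ⟩
        ∑ lines (λ j → 𝟙 (i ≟³ j) * p) + ∑ lines (λ _ → 1)      ≡⟨ cong₂ _+_ (∑-cong lines (λ {j} _ → *-comm (𝟙 (i ≟³ j)) p) ⨾ ∑-*ˡ lines p _) (sym (length≡∑ lines)) ⟩
        p * ∑ lines (λ j → 𝟙 (i ≟³ j)) + length lines           ≤⟨ +-monoˡ-≤ _ (*-monoʳ-≤ p (∑-𝟙-unique (i ≟³_) u-lines (λ _ _ a b → sym a ⨾ b))) ⟩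
        p * 1 + length lines                                    ≡⟨ cong (_+ length lines) (*-identityʳ p) ⟩
        p + length lines                                        ∎
    squares′ : ∑ C (λ v → N v * N v) ≤ n * (p + n)
    squares′ = ≤-trans (≤-trans (m≤n+m _ (∑ V′ (λ v → N v * N v))) (≤-reflexive (sym (∑-filter-split inV? F² _)))) squares
    split : p * p ≡ length V′ + c
    split = sym lenF² ⨾ length-filter-split inV? F²
    V≤V′ : length V ≤ length V′
    V≤V′ = unique-⊆-length uV (λ {v} v∈ → ∈-filter⁺ inV? (∈F² v) v∈)
    go : Dec (n ≡ 0) → length V * n ≤ p * p * p
    go (yes n≡0) = ≤-trans (≤-reflexive (cong (length V *_) n≡0 ⨾ *-zeroʳ (length V))) z≤n
    go (no n≢0) = ≤-trans (*-monoˡ-≤ n V≤V′) (≤-trans main (*-monoˡ-≤ p (≤-trans (m≤n+m c (length V′)) (≤-reflexive (sym split)))))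
      where
      instance
        n-nonZero : NonZero n
        n-nonZero = >-nonZero (n≢0⇒n>0 n≢0)
      -- All n lines have p points each and lie in the complement C; two different lines share at
      -- most one point, which bounds ∑ N² by n (p + n).
      cs : n * (p * p) ≤ c * (p + n)
      cs = *-cancelˡ-≤ n (begin
        n * (n * (p * p))                      ≡⟨ lem n p ⟩
        n * p * (n * p)                        ≤⟨ *-mono-≤ total′ total′ ⟩
        ∑ C N * ∑ C N                          ≤⟨ cauchy-schwarz C N ⟩
        c * ∑ C (λ v → N v * N v)              ≤⟨ *-monoʳ-≤ c squares′ ⟩
        c * (n * (p + n))                      ≡⟨ lem′ c n p ⟩
        n * (c * (p + n))                      ∎)
        where
        lem : ∀ n p → n * (n * (p * p)) ≡ n * p * (n * p)
        lem = solve-∀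
        lem′ : ∀ c n p → c * (n * (p + n)) ≡ n * (c * (p + n))
        lem′ = solve-∀
      -- As |V′| + c = p², adding c n to both sides turns the claim into `cs`.
      main : length V′ * n ≤ c * p
      main = +-cancelʳ-≤ (c * n) _ _ (begin
        length V′ * n + c * n      ≡⟨ lem (length V′) c n ⟩
        n * (length V′ + c)        ≡⟨ cong (n *_) (sym split) ⟩
        n * (p * p)                ≤⟨ cs ⟩
        c * (p + n)                ≡⟨ *-distribˡ-+ c p n ⟩
        c * p + c * n              ∎)
        where
        lem : ∀ v c n → v * n + c * n ≡ n * (v + c)
        lem = solve-∀

-- The divisor bound

divisors : ℕ → List ℕ
divisors m = filter (_∣? m) (upTo (suc m))

τ : ℕ → ℕ
τ m = length (divisors m)

divisors-unique : ∀ m → Unique (divisors m)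
divisors-unique m = Uniq.filter⁺ (_∣? m) (Uniq.upTo⁺ (suc m))

∈-divisors⁺ : ∀ {m d} → 1 ≤ m → d ∣ m → d ∈ divisors m
∈-divisors⁺ {m} 1≤m d∣m = ∈-filter⁺ (_∣? m) (∈-upTo⁺ (s≤s (∣⇒≤ ⦃ >-nonZero 1≤m ⦄ d∣m))) d∣m

∈-divisors⁻ : ∀ {m d} → d ∈ divisors m → d ∣ m
∈-divisors⁻ {m} d∈ = proj₂ (∈-filter⁻ (_∣? m) {xs = upTo (suc m)} d∈)

prime-coprime : ∀ {q d} → Prime q → ¬ q ∣ d → Coprime d q
prime-coprime pq q∤d (c∣d , c∣q) with prime⇒irreducible pq c∣q
... | inj₁ c≡1  = c≡1
... | inj₂ refl = ⊥-elim (q∤d c∣d)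

prime-power-cancel : ∀ {q d} → Prime q → ¬ q ∣ d → ∀ i {m} → d ∣ q ^ i * m → d ∣ m
prime-power-cancel {q} {d} pq q∤d zero {m} h = subst (d ∣_) (*-identityˡ m) h
prime-power-cancel {q} {d} pq q∤d (suc i) {m} h =
  prime-power-cancel pq q∤d i (coprime-divisor (prime-coprime pq q∤d) (subst (d ∣_) (*-assoc q (q ^ i) m) h))

prime≥2 : ∀ {q} → Prime q → 2 ≤ q
prime≥2 pq = nonTrivial⇒n>1 _ ⦃ prime⇒nonTrivial pq ⦄

-- A divisor d of q^(i+1) m is either a multiple of q, and then d / q divides q^i m, or prime to q,
-- and then d divides m.
τ-prime-power : ∀ {q} → Prime q → ∀ i m → 1 ≤ m → τ (q ^ i * m) ≤ suc i * τ m
τ-prime-power {q} pq zero m 1≤m = ≤-reflexive (trans (cong τ (*-identityˡ m)) (sym (*-identityˡ (τ m))))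
τ-prime-power {q} pq (suc i) m 1≤m = begin
  τ (q ^ suc i * m)                                          ≡⟨ cong τ (*-assoc q (q ^ i) m) ⟩
  τ (q * n)                                                  ≡⟨ length-filter-split (q ∣?_) (divisors (q * n)) ⟩
  length (filter (q ∣?_) L) + length (filter (¬? ∘ (q ∣?_)) L) ≤⟨ +-mono-≤ multiples others ⟩
  τ n + τ m                                                  ≤⟨ +-monoˡ-≤ (τ m) (τ-prime-power pq i m 1≤m) ⟩
  suc i * τ m + τ m                                          ≡⟨ +-comm (suc i * τ m) (τ m) ⟩
  suc (suc i) * τ m                                          ∎
  where
  open ≤-Reasoning
  instance
    q-nonZero : NonZero q
    q-nonZero = prime⇒nonZero pq
  n = q ^ i * m
  L = divisors (q * n)
  1≤n : 1 ≤ n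
  1≤n = *-mono-≤ (m^n>0 q i) 1≤m
  multiples : length (filter (q ∣?_) L) ≤ τ n
  multiples = length-inj {f = λ d → d / q} (Uniq.filter⁺ _ (divisors-unique (q * n))) into inj
    where
    mem : ∀ {d} → d ∈ filter (q ∣?_) L → d ∣ q * n × q ∣ d
    mem d∈ = let d∈L , q∣d = ∈-filter⁻ (q ∣?_) {xs = L} d∈ in ∈-divisors⁻ d∈L , q∣d
    into : ∀ {d} → d ∈ filter (q ∣?_) L → d / q ∈ divisors n
    into {d} d∈ = let d∣ , q∣d = mem d∈ in ∈-divisors⁺ 1≤n (*-cancelˡ-∣ q (subst (_∣ q * n) (sym (m*[n/m]≡n q∣d)) d∣))
    inj : ∀ {c d} → c ∈ filter (q ∣?_) L → d ∈ filter (q ∣?_) L → c / q ≡ d / q → c ≡ d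
    inj c∈ d∈ eq = trans (sym (m*[n/m]≡n (proj₂ (mem c∈)))) (trans (cong (q *_) eq) (m*[n/m]≡n (proj₂ (mem d∈))))
  others : length (filter (¬? ∘ (q ∣?_)) L) ≤ τ m
  others = unique-⊆-length (Uniq.filter⁺ _ (divisors-unique (q * n))) λ {d} d∈ →
    let d∈L , q∤d = ∈-filter⁻ (¬? ∘ (q ∣?_)) {xs = L} d∈
    in ∈-divisors⁺ 1≤m (prime-power-cancel pq q∤d (suc i) (subst (d ∣_) (sym (*-assoc q (q ^ i) m)) (∈-divisors⁻ d∈L)))

extract-power : ∀ q → 2 ≤ q → ∀ m → 1 ≤ m → ∃ λ i → ∃ λ m′ → m ≡ q ^ i * m′ × 1 ≤ m′ × ¬ q ∣ m′
extract-power q 2≤q = <-rec _ step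
  where
  step : ∀ m → (∀ {n} → n < m → 1 ≤ n → ∃ λ i → ∃ λ m′ → n ≡ q ^ i * m′ × 1 ≤ m′ × ¬ q ∣ m′) →
         1 ≤ m → ∃ λ i → ∃ λ m′ → m ≡ q ^ i * m′ × 1 ≤ m′ × ¬ q ∣ m′
  step m rec 1≤m with q ∣? m
  ... | no q∤m = 0 , m , sym (*-identityˡ m) , 1≤m , q∤m
  ... | yes (divides k refl) with k
  ...   | zero = ⊥-elim (<⇒≱ 1≤m z≤n)
  ...   | suc k′ = let i , m′ , eq , 1≤m′ , q∤ = rec (m<m*n (suc k′) q 2≤q) (s≤s z≤n)
                   in suc i , m′ , trans (*-comm (suc k′) q) (trans (cong (q *_) eq) (sym (*-assoc q (q ^ i) m′))) , 1≤m′ , q∤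

prime-factor : ∀ m → 2 ≤ m → ∃ λ q → Prime q × q ∣ m
prime-factor m@(suc _) 2≤m with factorise m
... | record { factors = [] ; isFactorisation = eq } = ⊥-elim (<⇒≱ 2≤m (≤-reflexive eq))
... | record { factors = q ∷ qs ; isFactorisation = eq ; factorsPrime = pq ∷ _ } =
  q , pq , subst (q ∣_) (sym eq) (m∣m*n (product qs))

*-^ : ∀ m n k → (m * n) ^ k ≡ m ^ k * n ^ k
*-^ m n zero    = refl
*-^ m n (suc k) = trans (cong (m * n *_) (*-^ m n k)) (lem m n (m ^ k) (n ^ k))
  where
  lem : ∀ a b c d → a * b * (c * d) ≡ a * c * (b * d)
  lem = solve-∀

suc≤2^ : ∀ n → suc n ≤ 2 ^ n
suc≤2^ zero    = ≤-refl
suc≤2^ (suc n) = begin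
  suc (suc n)        ≤⟨ +-mono-≤ (m^n>0 2 n) (suc≤2^ n) ⟩
  2 ^ n + 2 ^ n      ≡⟨ cong (λ q → 2 ^ n + q) (sym (+-identityʳ (2 ^ n))) ⟩
  2 ^ suc n          ∎
  where open ≤-Reasoning

-- With q = ⌊i / e⌋ one has i + 1 ≤ e (q + 1) and q + 1 ≤ 2^q; the e-th power of 2^q is at most 2^i.
suc^≤ : ∀ e .⦃ _ : NonZero e ⦄ i → suc i ^ e ≤ e ^ e * 2 ^ i
suc^≤ e i = begin
  suc i ^ e                    ≤⟨ ^-monoˡ-≤ e bound ⟩
  (e * suc q) ^ e              ≡⟨ *-^ e (suc q) e ⟩
  e ^ e * suc q ^ e            ≤⟨ *-monoʳ-≤ (e ^ e) (^-monoˡ-≤ e (suc≤2^ q)) ⟩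
  e ^ e * (2 ^ q) ^ e          ≡⟨ cong (e ^ e *_) (^-*-assoc 2 q e) ⟩
  e ^ e * 2 ^ (q * e)          ≤⟨ *-monoʳ-≤ (e ^ e) (^-monoʳ-≤ 2 (≤-trans (m≤n+m (q * e) (i % e)) (≤-reflexive (sym (m≡m%n+[m/n]*n i e))))) ⟩
  e ^ e * 2 ^ i                ∎
  where
  open ≤-Reasoning
  q = i / e
  bound : suc i ≤ e * suc q
  bound = begin
    suc i                       ≡⟨ cong suc (m≡m%n+[m/n]*n i e) ⟩
    suc (i % e) + q * e         ≤⟨ +-monoˡ-≤ (q * e) (m%n<n i e) ⟩
    e + q * e                   ≡⟨ *-comm (suc q) e ⟩
    e * suc q                   ∎

module DivisorBound (e : ℕ) .⦃ e≢0 : NonZero e ⦄ where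
  C : ℕ
  C = e ^ e

  instance
    C-nonZero : NonZero C
    C-nonZero = m^n≢0 e e

  -- The list holds every divisor of m from 2 to 2^e + 1, prime or not. The induction uses two
  -- facts: a small prime factor that is split off adds a new entry, and there are at most 2^e
  -- entries.
  smallPrimes : ℕ → List ℕ
  smallPrimes m = filter (_∣? m) (applyUpTo (2 +_) (2 ^ e))

  smallPrimes-unique : ∀ m → Unique (smallPrimes m)
  smallPrimes-unique m = Uniq.filter⁺ _ (Uniq.applyUpTo⁺₁ (2 +_) (2 ^ e) (λ i<j _ eq → <⇒≢ i<j (+-cancelˡ-≡ 2 _ _ eq)))

  open ≤-Reasoning

  -- Each prime q < 2^e costs a factor e^e, a prime q ≥ 2^e costs nothing since (i + 1)^e ≤ 2^(e i) ≤ q^i.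
  τ^e≤ : ∀ m → 1 ≤ m → τ m ^ e ≤ C ^ length (smallPrimes m) * m
  τ^e≤ = <-rec _ step
    where
    step : ∀ m → (∀ {n} → n < m → 1 ≤ n → τ n ^ e ≤ C ^ length (smallPrimes n) * n) → 1 ≤ m → τ m ^ e ≤ C ^ length (smallPrimes m) * m
    step 1 _ _ = begin
      1 ^ e                                      ≡⟨ ^-zeroˡ e ⟩
      1                                          ≤⟨ m^n>0 C (length (smallPrimes 1)) ⟩
      C ^ length (smallPrimes 1)                 ≡⟨ sym (*-identityʳ _) ⟩
      C ^ length (smallPrimes 1) * 1             ∎
    step m@(suc (suc _)) rec 1≤m with q , pq , q∣m ← prime-factor m (s≤s (s≤s z≤n))
      with extract-power q (prime≥2 pq) m 1≤m
    ... | zero  , m′ , eq , 1≤m′ , q∤ = ⊥-elim (q∤ (subst (q ∣_) (trans eq (*-identityˡ m′)) q∣m))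
    ... | suc i , m′ , eq , 1≤m′ , q∤ = begin
      τ m ^ e                                    ≡⟨ cong (λ n → τ n ^ e) eq ⟩
      τ (q ^ suc i * m′) ^ e                     ≤⟨ ^-monoˡ-≤ e (τ-prime-power pq (suc i) m′ 1≤m′) ⟩
      (suc (suc i) * τ m′) ^ e                   ≡⟨ *-^ (suc (suc i)) (τ m′) e ⟩
      suc (suc i) ^ e * τ m′ ^ e                 ≤⟨ *-monoʳ-≤ (suc (suc i) ^ e) (rec m′<m 1≤m′) ⟩
      suc (suc i) ^ e * (C ^ c′ * m′)            ≤⟨ cost (q <? 2 + 2 ^ e) ⟩
      C ^ length (smallPrimes m) * m             ∎
      where
      instance
        q-nonZero : NonZero q
        q-nonZero = prime⇒nonZero pq
        m′-nonZero : NonZero m′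
        m′-nonZero = >-nonZero 1≤m′
      c′ = length (smallPrimes m′)
      m′<m : m′ < m
      m′<m = subst (m′ <_) (sym (trans eq (*-comm (q ^ suc i) m′))) (m<m*n m′ (q ^ suc i)
        (≤-trans (prime≥2 pq) (≤-trans (≤-reflexive (sym (^-identityʳ q))) (^-monoʳ-≤ q {1} {suc i} (s≤s z≤n)))))
      m′∣m : m′ ∣ m
      m′∣m = divides (q ^ suc i) eq
      lift : ∀ {d} → d ∈ smallPrimes m′ → d ∈ smallPrimes m
      lift d∈ = let d∈L , d∣ = ∈-filter⁻ (_∣? m′) {xs = applyUpTo (2 +_) (2 ^ e)} d∈ in ∈-filter⁺ (_∣? m) d∈L (∣-trans d∣ m′∣m)
      lem : ∀ x y z w → x * y * (z * w) ≡ x * z * (y * w)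
      lem = solve-∀
      cost : Dec (q < 2 + 2 ^ e) → suc (suc i) ^ e * (C ^ c′ * m′) ≤ C ^ length (smallPrimes m) * m
      cost (yes q<) = begin
        suc (suc i) ^ e * (C ^ c′ * m′)          ≤⟨ *-monoˡ-≤ (C ^ c′ * m′) (≤-trans (suc^≤ e (suc i)) (*-monoʳ-≤ C (^-monoˡ-≤ (suc i) (prime≥2 pq)))) ⟩
        C * q ^ suc i * (C ^ c′ * m′)            ≡⟨ lem C (q ^ suc i) (C ^ c′) m′ ⟩
        C ^ suc c′ * (q ^ suc i * m′)            ≡⟨ cong (C ^ suc c′ *_) (sym eq) ⟩
        C ^ suc c′ * m                           ≤⟨ *-monoˡ-≤ m (^-monoʳ-≤ C (unique-⊆-length (All.tabulate fresh ∷ smallPrimes-unique m′) sub)) ⟩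
        C ^ length (smallPrimes m) * m           ∎
        where
        fresh : ∀ {d} → d ∈ smallPrimes m′ → q ≢ d
        fresh d∈ refl = q∤ (proj₂ (∈-filter⁻ (_∣? m′) {xs = applyUpTo (2 +_) (2 ^ e)} d∈))
        sub : ∀ {d} → d ∈ q ∷ smallPrimes m′ → d ∈ smallPrimes m
        sub (here refl) = ∈-filter⁺ (_∣? m) (subst (_∈ applyUpTo (2 +_) (2 ^ e)) (m+[n∸m]≡n (prime≥2 pq))
          (∈-applyUpTo⁺ (2 +_) (+-cancelˡ-< 2 _ _ (subst (_< 2 + 2 ^ e) (sym (m+[n∸m]≡n (prime≥2 pq))) q<)))) q∣m
        sub (there d∈) = lift d∈
      cost (no q≮) = begin
        suc (suc i) ^ e * (C ^ c′ * m′)          ≤⟨ *-monoˡ-≤ (C ^ c′ * m′) (^-monoˡ-≤ e (suc≤2^ (suc i))) ⟩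
        (2 ^ suc i) ^ e * (C ^ c′ * m′)          ≡⟨ cong (_* (C ^ c′ * m′)) (trans (^-*-assoc 2 (suc i) e) (trans (cong (2 ^_) (*-comm (suc i) e)) (sym (^-*-assoc 2 e (suc i))))) ⟩
        (2 ^ e) ^ suc i * (C ^ c′ * m′)          ≤⟨ *-monoˡ-≤ (C ^ c′ * m′) (^-monoˡ-≤ (suc i) (≤-trans (m≤n+m (2 ^ e) 2) (≮⇒≥ q≮))) ⟩
        q ^ suc i * (C ^ c′ * m′)                ≡⟨ lem′ (q ^ suc i) (C ^ c′) m′ ⟩
        C ^ c′ * (q ^ suc i * m′)                ≡⟨ cong (C ^ c′ *_) (sym eq) ⟩
        C ^ c′ * m                               ≤⟨ *-monoˡ-≤ m (^-monoʳ-≤ C (unique-⊆-length (smallPrimes-unique m′) lift)) ⟩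
        C ^ length (smallPrimes m) * m           ∎
        where
        lem′ : ∀ x y z → x * (y * z) ≡ y * (x * z)
        lem′ = solve-∀

-- The estimate τ(m) = m^o(1) without real exponents: e is arbitrary, and c depends on e alone.
divisor-bound : ∀ e → Σ ℕ λ c → ∀ m → 1 ≤ m → τ m ^ suc e ≤ c * m
divisor-bound e = C ^ (2 ^ suc e) , λ m 1≤m → ≤-trans (τ^e≤ m 1≤m) (*-monoˡ-≤ m (^-monoʳ-≤ C
  (≤-trans (length-filter (_∣? m) (applyUpTo (2 +_) (2 ^ suc e))) (≤-reflexive (length-applyUpTo (2 +_) (2 ^ suc e))))))
  where
  open DivisorBound (suc e)

-- Rotations of the conics and their orders

-- The remainder of a period modulo the least positive one is again a period, hence zero. The
-- predicate is abstract because the lemma serves both the rotations and the elements of the field.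
least-period : ∀ {Z : ℕ → Set} → Decidable Z → (∀ n k r → Z n → Z (r + k * n) → Z r) →
               ∀ m → 1 ≤ m → Z m → ∃ λ n → 1 ≤ n × Z n × (∀ k → Z k → n ∣ k)
least-period {Z} Z? reduce = <-rec _ search
  where
  Least : Set
  Least = ∃ λ n → 1 ≤ n × Z n × (∀ k → Z k → n ∣ k)
  search : ∀ m → (∀ {k} → k < m → 1 ≤ k → Z k → Least) → 1 ≤ m → Z m → Least
  search m rec 1≤m zm with anyUpTo? (λ k → (1 ≤? k) ×-dec Z? k) m
  ... | yes (k , k<m , 1≤k , zk) = rec k<m 1≤k zk
  ... | no none = m , 1≤m , zm , λ k zk → m%n≡0⇒n∣m k m ⦃ nz ⦄ (zero-rem k zk)
    where
    nz : NonZero m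
    nz = >-nonZero 1≤m
    zero-rem : ∀ k → Z k → (k % m) ⦃ nz ⦄ ≡ 0
    zero-rem k zk with (k % m) ⦃ nz ⦄ ≟ 0
    ... | yes r≡0 = r≡0
    ... | no r≢0 = ⊥-elim (none ((k % m) ⦃ nz ⦄ , m%n<n k m ⦃ nz ⦄ , n≢0⇒n>0 r≢0 ,
                     reduce m ((k / m) ⦃ nz ⦄) ((k % m) ⦃ nz ⦄) zm (subst Z (m≡m%n+[m/n]*n k m ⦃ nz ⦄) zk)))

module ProductOfOrbit {A : Set} (_∙_ : A → A → A) (e : A)
  (assoc : ∀ x y z → (x ∙ y) ∙ z ≡ x ∙ (y ∙ z)) (comm : ∀ x y → x ∙ y ≡ y ∙ x) (idˡ : ∀ x → e ∙ x ≡ x) where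

  Π : {B : Set} → (B → A) → List B → A
  Π f []       = e
  Π f (x ∷ xs) = f x ∙ Π f xs

  swap : ∀ x y z → x ∙ (y ∙ z) ≡ y ∙ (x ∙ z)
  swap x y z = sym (assoc x y z) ⨾ cong (_∙ z) (comm x y) ⨾ assoc y x z

  Π-insert : {B : Set} (f : B → A) → ∀ us x vs → Π f (us ++ x ∷ vs) ≡ f x ∙ Π f (us ++ vs)
  Π-insert f []       x vs = refl
  Π-insert f (u ∷ us) x vs = cong (f u ∙_) (Π-insert f us x vs) ⨾ swap (f u) (f x) (Π f (us ++ vs))

  Π-⊆ : {B : Set} (f : B → A) → ∀ {xs ys} → Unique xs → (∀ {x} → x ∈ xs → x ∈ ys) → length xs ≡ length ys → Π f xs ≡ Π f ys
  Π-⊆ f {[]} {[]} _ _ _ = refl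
  Π-⊆ f {x ∷ xs} (x# ∷ u) h len with us , vs , refl ← ∈-∃++ (h (here refl)) =
    cong (f x ∙_) (Π-⊆ f u sub (suc-injective (len ⨾ length-++ us ⨾ +-suc (length us) (length vs) ⨾ cong suc (sym (length-++ us)))))
    ⨾ sym (Π-insert f us x vs)
    where
    sub : ∀ {y} → y ∈ xs → y ∈ us ++ vs
    sub {y} y∈ with ∈-++⁻ us (h (there y∈))
    ... | inj₁ y∈us         = ∈-++⁺ˡ y∈us
    ... | inj₂ (here refl)  = ⊥-elim (All.lookup x# y∈ refl)
    ... | inj₂ (there y∈vs) = ∈-++⁺ʳ us y∈vs

  Π-∘ : {B C : Set} (f : C → A) (g : B → C) → ∀ xs → Π f (map g xs) ≡ Π (λ x → f (g x)) xs
  Π-∘ f g []       = refl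
  Π-∘ f g (x ∷ xs) = cong (f (g x) ∙_) (Π-∘ f g xs)

  Π-permute : {B : Set} (f : B → A) (g : B → B) → ∀ {xs} → Unique xs → (∀ {x} → x ∈ xs → g x ∈ xs) →
              (∀ {x y} → x ∈ xs → y ∈ xs → g x ≡ g y → x ≡ y) → Π (λ x → f (g x)) xs ≡ Π f xs
  Π-permute f g {xs} u closed inj = sym (Π-∘ f g xs) ⨾ Π-⊆ f (map-unique inj u) sub (length-map g xs)
    where
    sub : ∀ {x} → x ∈ map g xs → x ∈ xs
    sub x∈ with y , y∈ , refl ← ∈-map⁻ g x∈ = closed y∈

  Π-scale : ∀ g xs → Π (g ∙_) xs ≡ iter (g ∙_) e (length xs) ∙ Π id xs
  Π-scale g []       = sym (idˡ e)
  Π-scale g (x ∷ xs) = cong ((g ∙ x) ∙_) (Π-scale g xs) ⨾ assoc g x _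
    ⨾ cong (g ∙_) (swap x _ _) ⨾ sym (assoc g _ _)

  -- Multiplication by g permutes U, so the product over U is unchanged although it acquires the
  -- factor g^|U|.
  power-card : ∀ g {U} → Unique U → (∀ {u} → u ∈ U → g ∙ u ∈ U) →
               (∀ {u v} → u ∈ U → v ∈ U → g ∙ u ≡ g ∙ v → u ≡ v) →
               (∀ x → x ∙ Π id U ≡ Π id U → x ≡ e) → iter (g ∙_) e (length U) ≡ e
  power-card g {U} uU closed inj cancel = cancel _ (sym (Π-scale g U) ⨾ Π-permute id (g ∙_) uU closed inj)

-- Polynomial functions and their roots

module Polynomials {p : ℕ} (𝔽 : PrimeField p) where
  open FieldTheory 𝔽

  -- f is a polynomial function of degree at most d whose coefficient of degree d is c.
  Poly : ℕ → F → (F → F) → Set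
  Poly zero    c f = ∀ x → f x ≡ c
  Poly (suc d) c f = Σ (F → F) λ g → Σ F λ e → Poly d c g × (∀ x → f x ≡ x ⊗ g x ⊕ e)

  poly-⊕ : ∀ d {c c′ f f′} → Poly d c f → Poly d c′ f′ → Poly d (c ⊕ c′) (λ x → f x ⊕ f′ x)
  poly-⊕ zero h h′ x = cong₂ _⊕_ (h x) (h′ x)
  poly-⊕ (suc d) (g , e , pg , h) (g′ , e′ , pg′ , h′) = _ , e ⊕ e′ , poly-⊕ d pg pg′ , λ x →
    cong₂ _⊕_ (h x) (h′ x) ⨾ solve 5 (λ x g e g′ e′ → (x :* g :+ e) :+ (x :* g′ :+ e′) := x :* (g :+ g′) :+ (e :+ e′)) refl x (g x) e (g′ x) e′

  poly-scale : ∀ d {c f} r → Poly d c f → Poly d (r ⊗ c) (λ x → r ⊗ f x)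
  poly-scale zero r h x = cong (r ⊗_) (h x)
  poly-scale (suc d) r (g , e , pg , h) = _ , r ⊗ e , poly-scale d r pg , λ x →
    cong (r ⊗_) (h x) ⨾ solve 4 (λ r x g e → r :* (x :* g :+ e) := x :* (r :* g) :+ r :* e) refl r x (g x) e

  poly-raise : ∀ d {c f} → Poly d c f → Poly (suc d) 𝟘 f
  poly-raise zero {c} h = (λ _ → 𝟘) , c , (λ _ → refl) , λ x → h x ⨾ solve 2 (λ x c → c := x :* con (⁺ 0) :+ c) refl x c
  poly-raise (suc d) (g , e , pg , h) = g , e , poly-raise d pg , h

  poly-x : ∀ d {c f} → Poly d c f → Poly (suc d) c (λ x → x ⊗ f x)
  poly-x d {f = f} h = f , 𝟘 , h , λ x → sym (⊕-identityʳ _)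

  poly-resp : ∀ d {c c′ f f′} → c ≡ c′ → (∀ x → f x ≡ f′ x) → Poly d c f → Poly d c′ f′
  poly-resp zero refl eq h x = sym (eq x) ⨾ h x
  poly-resp (suc d) refl eq (g , e , pg , h) = g , e , pg , λ x → sym (eq x) ⨾ h x

  -- Writing f = x g + e gives f(x) - f(r) = (x - r) g(x) + r (g(x) - g(r)). By induction the second
  -- summand is also divisible by x - r, with a quotient of lower degree, so the leading coefficient
  -- survives.
  poly-quotient : ∀ d {c f} → Poly (suc d) c f → ∀ r → Σ (F → F) λ h → Poly d c h × (∀ x → f x ⊟ f r ≡ (x ⊟ r) ⊗ h x)
  poly-quotient zero {c} {f} (g , e , pg , h) r = g , pg , λ x →
    cong₂ _⊟_ (h x) (h r ⨾ cong (λ z → r ⊗ z ⊕ e) (pg r ⨾ sym (pg x)))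
    ⨾ solve 4 (λ x r g e → (x :* g :+ e) :- (r :* g :+ e) := (x :- r) :* g) refl x r (g x) e
  poly-quotient (suc d) {c} {f} (g , e , pg , h) r =
    let h′ , ph′ , eq = poly-quotient d pg r in
    (λ x → g x ⊕ r ⊗ h′ x) ,
    poly-resp (suc d) (⊕-identityʳ c) (λ _ → refl) (poly-⊕ (suc d) pg (poly-raise d (poly-scale d r ph′))) , λ x →
      cong₂ _⊟_ (h x) (h r)
      ⨾ solve 5 (λ x r g g′ e → (x :* g :+ e) :- (r :* g′ :+ e) := (x :- r) :* g :+ r :* (g :- g′)) refl x r (g x) (g r) e
      ⨾ cong (λ z → (x ⊟ r) ⊗ g x ⊕ r ⊗ z) (eq x)
      ⨾ solve 4 (λ x r g h → (x :- r) :* g :+ r :* ((x :- r) :* h) := (x :- r) :* (g :+ r :* h)) refl x r (g x) (h′ x)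

  poly-roots : ∀ d {c f} → Poly d c f → c ≢ 𝟘 → ∀ {X} → Unique X → (∀ {x} → x ∈ X → f x ≡ 𝟘) → length X ≤ d
  poly-roots d       h c≢0 {[]}    _ _ = z≤n
  poly-roots zero    h c≢0 {x ∷ _} _ root = ⊥-elim (c≢0 (sym (h x) ⨾ root (here refl)))
  poly-roots (suc d) {f = f} h c≢0 {r ∷ X} (r# ∷ u) root =
    let h′ , ph′ , eq = poly-quotient d h r in
    s≤s (poly-roots d ph′ c≢0 u (λ {x} x∈ → Sum.[ (λ z → ⊥-elim (All.lookup r# x∈ (sym (⊟≡𝟘⇒≡ z)))) , id ]
      (no-zero-divisors (sym (eq x) ⨾ cong₂ _⊟_ (root (there x∈)) (root (here refl)) ⨾ ⊝-inverseʳ 𝟘))))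

module Rotations {q : ℕ} (𝔽 : PrimeField (suc q)) (2≢0 : FieldTheory.lit 𝔽 2 ≢ PrimeField.𝟘 𝔽) where
  open FieldTheory 𝔽
  open Polynomials 𝔽

  _≟²_ : DecidableEquality (F × F)
  _≟²_ = ≡-dec _≟ᶠ_ _≟ᶠ_

  -- The pair (x , y) stands for x + y θ, where θ² = t θ − 1.
  one : F × F
  one = 𝟏 , 𝟘

  mul : F → F × F → F × F → F × F
  mul t (x , y) (x′ , y′) = x ⊗ x′ ⊟ y ⊗ y′ , x ⊗ y′ ⊕ y ⊗ x′ ⊕ t ⊗ (y ⊗ y′)

  step : F → F × F → F × F
  step t (x , y) = ⊝ y , x ⊕ t ⊗ y

  pow : F → ℕ → F × F
  pow t = iter (step t) one

  conj : F → F × F → F × F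
  conj t (x , y) = x ⊕ t ⊗ y , ⊝ y

  norm trace : F → F × F → F
  norm t (x , y) = x ⊗ x ⊕ t ⊗ (x ⊗ y) ⊕ y ⊗ y
  trace t (x , y) = lit 2 ⊗ x ⊕ t ⊗ y

  disc : F → F
  disc t = t ⊗ t ⊟ lit 4

  mul-one : ∀ t u → mul t one u ≡ u
  mul-one t (x , y) = cong₂ _,_ (solve 2 (λ x y → con (⁺ 1) :* x :- con (⁺ 0) :* y := x) refl x y)
    (solve 3 (λ x y t → con (⁺ 1) :* y :+ con (⁺ 0) :* x :+ t :* (con (⁺ 0) :* y) := y) refl x y t)

  mul-comm : ∀ t u v → mul t u v ≡ mul t v u
  mul-comm t (x , y) (x′ , y′) = cong₂ _,_ (solve 4 (λ x y x′ y′ → x :* x′ :- y :* y′ := x′ :* x :- y′ :* y) refl x y x′ y′)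
    (solve 5 (λ x y x′ y′ t → x :* y′ :+ y :* x′ :+ t :* (y :* y′) := x′ :* y :+ y′ :* x :+ t :* (y′ :* y)) refl x y x′ y′ t)

  mul-assoc : ∀ t u v w → mul t (mul t u v) w ≡ mul t u (mul t v w)
  mul-assoc t (a , b) (c , d) (x , y) = cong₂ _,_
    (solve 7 (λ t a b c d x y → (a :* c :- b :* d) :* x :- (a :* d :+ b :* c :+ t :* (b :* d)) :* y
       := a :* (c :* x :- d :* y) :- b :* (c :* y :+ d :* x :+ t :* (d :* y))) refl t a b c d x y)
    (solve 7 (λ t a b c d x y → (a :* c :- b :* d) :* y :+ (a :* d :+ b :* c :+ t :* (b :* d)) :* x :+ t :* ((a :* d :+ b :* c :+ t :* (b :* d)) :* y)
       := a :* (c :* y :+ d :* x :+ t :* (d :* y)) :+ b :* (c :* x :- d :* y) :+ t :* (b :* (c :* y :+ d :* x :+ t :* (d :* y)))) refl t a b c d x y)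

  step-mul : ∀ t u v → step t (mul t u v) ≡ mul t (step t u) v
  step-mul t (x , y) (x′ , y′) = cong₂ _,_
    (solve 5 (λ x y x′ y′ t → :- (x :* y′ :+ y :* x′ :+ t :* (y :* y′)) := (:- y) :* x′ :- (x :+ t :* y) :* y′) refl x y x′ y′ t)
    (solve 5 (λ x y x′ y′ t → (x :* x′ :- y :* y′) :+ t :* (x :* y′ :+ y :* x′ :+ t :* (y :* y′))
        := (:- y) :* y′ :+ (x :+ t :* y) :* x′ :+ t :* ((x :+ t :* y) :* y′)) refl x y x′ y′ t)

  pow-+ : ∀ t i j → pow t (i + j) ≡ mul t (pow t i) (pow t j)
  pow-+ t zero    j = sym (mul-one t (pow t j))
  pow-+ t (suc i) j = cong (step t) (pow-+ t i j) ⨾ step-mul t (pow t i) (pow t j)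

  norm-step : ∀ t u → norm t (step t u) ≡ norm t u
  norm-step t (x , y) = solve 3 (λ t x y → (:- y) :* (:- y) :+ t :* ((:- y) :* (x :+ t :* y)) :+ (x :+ t :* y) :* (x :+ t :* y)
    := x :* x :+ t :* (x :* y) :+ y :* y) refl t x y

  norm-pow : ∀ t k → norm t (pow t k) ≡ 𝟏
  norm-pow t zero    = solve 1 (λ t → con (⁺ 1) :* con (⁺ 1) :+ t :* (con (⁺ 1) :* con (⁺ 0)) :+ con (⁺ 0) :* con (⁺ 0) := con (⁺ 1)) refl t
  norm-pow t (suc k) = norm-step t (pow t k) ⨾ norm-pow t k

  norm-mul : ∀ t u v → norm t (mul t u v) ≡ norm t u ⊗ norm t v
  norm-mul t (x , y) (x′ , y′) = solve 5 (λ t x y x′ y′ →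
    (x :* x′ :- y :* y′) :* (x :* x′ :- y :* y′) :+ t :* ((x :* x′ :- y :* y′) :* (x :* y′ :+ y :* x′ :+ t :* (y :* y′)))
      :+ (x :* y′ :+ y :* x′ :+ t :* (y :* y′)) :* (x :* y′ :+ y :* x′ :+ t :* (y :* y′))
    := (x :* x :+ t :* (x :* y) :+ y :* y) :* (x′ :* x′ :+ t :* (x′ :* y′) :+ y′ :* y′)) refl t x y x′ y′

  mul-conj : ∀ t u v → mul t (mul t u v) (conj t v) ≡ (norm t v ⊗ proj₁ u , norm t v ⊗ proj₂ u)
  mul-conj t (a , b) (x , y) = cong₂ _,_
    (solve 5 (λ t a b x y → (a :* x :- b :* y) :* (x :+ t :* y) :- (a :* y :+ b :* x :+ t :* (b :* y)) :* (:- y)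
       := (x :* x :+ t :* (x :* y) :+ y :* y) :* a) refl t a b x y)
    (solve 5 (λ t a b x y → (a :* x :- b :* y) :* (:- y) :+ (a :* y :+ b :* x :+ t :* (b :* y)) :* (x :+ t :* y) :+ t :* ((a :* y :+ b :* x :+ t :* (b :* y)) :* (:- y))
       := (x :* x :+ t :* (x :* y) :+ y :* y) :* b) refl t a b x y)

  mul-cancelʳ : ∀ t u u′ v → norm t v ≢ 𝟘 → mul t u v ≡ mul t u′ v → u ≡ u′
  mul-cancelʳ t u u′ v n≢0 eq = let h = sym (mul-conj t u v) ⨾ cong (λ w → mul t w (conj t v)) eq ⨾ mul-conj t u′ v in
    cong₂ _,_ (cancelˡ n≢0 (cong proj₁ h)) (cancelˡ n≢0 (cong proj₂ h))

  norm-pow≢𝟘 : ∀ t k → norm t (pow t k) ≢ 𝟘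
  norm-pow≢𝟘 t k eq = 𝟏≢𝟘 (sym (norm-pow t k) ⨾ eq)

  mul-conj-self : ∀ t v → norm t v ≡ 𝟏 → mul t (conj t v) v ≡ one
  mul-conj-self t (x , y) n≡1 = cong₂ _,_
    (solve 3 (λ t x y → (x :+ t :* y) :* x :- (:- y) :* y := x :* x :+ t :* (x :* y) :+ y :* y) refl t x y ⨾ n≡1)
    (solve 3 (λ t x y → (x :+ t :* y) :* y :+ (:- y) :* x :+ t :* ((:- y) :* y) := con (⁺ 0)) refl t x y)

  pow-conj : ∀ t i j → pow t (i + j) ≡ one → pow t i ≡ conj t (pow t j)
  pow-conj t i j eq = mul-cancelʳ t _ _ (pow t j) (norm-pow≢𝟘 t j)
    (sym (pow-+ t i j) ⨾ eq ⨾ sym (mul-conj-self t (pow t j) (norm-pow t j)))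

  pow-cancel : ∀ t i j → pow t (j + i) ≡ pow t i → pow t j ≡ one
  pow-cancel t i j eq = mul-cancelʳ t _ _ (pow t i) (norm-pow≢𝟘 t i)
    (sym (pow-+ t j i) ⨾ eq ⨾ sym (mul-one t (pow t i)))

  pow-multiple : ∀ t n k → pow t n ≡ one → pow t (k * n) ≡ one
  pow-multiple t n zero    eq = refl
  pow-multiple t n (suc k) eq = pow-+ t n (k * n) ⨾ cong₂ (mul t) eq (pow-multiple t n k eq) ⨾ mul-one t one

  IsOrder : F → ℕ → Set
  IsOrder t n = 1 ≤ n × pow t n ≡ one × (∀ k → pow t k ≡ one → n ∣ k)

  order-exists : ∀ t m → 1 ≤ m → pow t m ≡ one → ∃ (IsOrder t)
  order-exists t = least-period (λ k → pow t k ≟² one) (λ n k r eq eq′ →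
    pow-cancel t (k * n) r (eq′ ⨾ sym (pow-multiple t n k eq)))

  pow-injective : ∀ {t n i j} → IsOrder t n → i < j → j < n → pow t i ≢ pow t j
  pow-injective {t} {n} {i} {j} (_ , _ , divs) i<j j<n eq =
    <⇒≱ (≤-<-trans (m∸n≤m j i) j<n) (∣⇒≤ ⦃ >-nonZero (m<n⇒0<n∸m i<j) ⦄ (divs (j ∸ i)
      (pow-cancel t i (j ∸ i) (cong (pow t) (m∸n+n≡m (<⇒≤ i<j)) ⨾ sym eq))))

  pow-small : ∀ {t n k} → IsOrder t n → 1 ≤ k → k < n → pow t k ≢ one
  pow-small (_ , _ , divs) 1≤k k<n eq = <⇒≱ k<n (∣⇒≤ ⦃ >-nonZero 1≤k ⦄ (divs _ eq))

  -- The identity trace² - 4 norm = disc · y² for x + y θ.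
  trace² : ∀ t u → norm t u ≡ 𝟏 → disc t ⊗ (proj₂ u ⊗ proj₂ u) ≡ trace t u ⊗ trace t u ⊟ lit 4
  trace² t (x , y) n≡1 =
    solve 3 (λ t x y → (t :* t :- con (⁺ 4)) :* (y :* y) := (con (⁺ 2) :* x :+ t :* y) :* (con (⁺ 2) :* x :+ t :* y) :- con (⁺ 4) :* (x :* x :+ t :* (x :* y) :+ y :* y)) refl t x y
    ⨾ cong (λ n → trace t (x , y) ⊗ trace t (x , y) ⊟ lit 4 ⊗ n) n≡1
    ⨾ cong (λ n → trace t (x , y) ⊗ trace t (x , y) ⊟ n) (⊗-identityʳ (lit 4))

  -- The trace determines y² by `trace²`, hence y up to sign; the two signs belong to v and its
  -- conjugate.
  same-trace : ∀ {t} → disc t ≢ 𝟘 → ∀ {u v} → norm t u ≡ 𝟏 → norm t v ≡ 𝟏 → trace t u ≡ trace t v → u ≡ v ⊎ u ≡ conj t v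
  same-trace {t} D≢0 {u@(x , y)} {v@(x′ , y′)} nu nv eq = Sum.map plus minus
    (squares-≡ (cancelˡ D≢0 (trace² t u nu ⨾ cong (λ c → c ⊗ c ⊟ lit 4) eq ⨾ sym (trace² t v nv))))
    where
    plus : y ≡ y′ → u ≡ v
    plus y≡ = cong₂ _,_ (cancelˡ 2≢0 (solve 3 (λ t x y → con (⁺ 2) :* x := (con (⁺ 2) :* x :+ t :* y) :- t :* y) refl t x y
      ⨾ cong₂ (λ c z → c ⊟ t ⊗ z) eq y≡ ⨾ solve 3 (λ t x y → (con (⁺ 2) :* x :+ t :* y) :- t :* y := con (⁺ 2) :* x) refl t x′ y′)) y≡
    minus : y ≡ ⊝ y′ → u ≡ conj t v
    minus y≡ = cong₂ _,_ (cancelˡ 2≢0 (solve 3 (λ t x y → con (⁺ 2) :* x := (con (⁺ 2) :* x :+ t :* y) :- t :* y) refl t x y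
      ⨾ cong₂ (λ c z → c ⊟ t ⊗ z) eq y≡ ⨾ solve 3 (λ t x y → (con (⁺ 2) :* x :+ t :* y) :- t :* (:- y) := con (⁺ 2) :* (x :+ t :* y)) refl t x′ y′)) y≡

  y≡𝟘⇒pow-double : ∀ t k → proj₂ (pow t k) ≡ 𝟘 → pow t (k + k) ≡ one
  y≡𝟘⇒pow-double t k y≡0 = pow-+ t k k ⨾ lem (pow t k) y≡0 (norm-pow t k)
    where
    lem : ∀ u → proj₂ u ≡ 𝟘 → norm t u ≡ 𝟏 → mul t u u ≡ one
    lem (x , _) refl n≡1 = cong₂ _,_
      (solve 2 (λ t x → x :* x :- con (⁺ 0) :* con (⁺ 0) := x :* x :+ t :* (x :* con (⁺ 0)) :+ con (⁺ 0) :* con (⁺ 0)) refl t x ⨾ n≡1)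
      (solve 2 (λ t x → x :* con (⁺ 0) :+ con (⁺ 0) :* x :+ t :* (con (⁺ 0) :* con (⁺ 0)) := con (⁺ 0)) refl t x)

  y≢𝟘 : ∀ {t n k} → IsOrder t n → 1 ≤ k → k + k < n → proj₂ (pow t k) ≢ 𝟘
  y≢𝟘 {t} {n} {k} ord 1≤k 2k<n y≡0 = pow-small ord (≤-trans 1≤k (m≤m+n k k)) 2k<n (y≡𝟘⇒pow-double t k y≡0)

  -- Equal y-coefficients make the traces agree up to sign. Equal traces give θ^i = θ^j. For
  -- opposite traces, 2 y(θ^(i+j)) = y (trace + trace′) = 0, and then θ^(2(i+j)) = 1; this is why
  -- the exponents are kept so small.
  y-distinct : ∀ {t n i j} → disc t ≢ 𝟘 → IsOrder t n → 1 ≤ i → i < j → (i + j) + (i + j) < n → proj₂ (pow t i) ≢ proj₂ (pow t j)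
  y-distinct {t} {n} {i} {j} D≢0 ord 1≤i i<j small eq = Sum.[ equal , opposite ]′
      (squares-≡ (⊟-cancelʳ (sym (trace² t (pow t i) (norm-pow t i)) ⨾ cong (λ y → disc t ⊗ (y ⊗ y)) eq ⨾ trace² t (pow t j) (norm-pow t j))))
    where
    ⊟-cancelʳ : ∀ {x y z} → x ⊟ z ≡ y ⊟ z → x ≡ y
    ⊟-cancelʳ {x} {y} {z} e = solve 2 (λ x z → x := (x :- z) :+ z) refl x z ⨾ cong (_⊕ z) e ⨾ solve 2 (λ y z → (y :- z) :+ z := y) refl y z
    equal : trace t (pow t i) ≢ trace t (pow t j)
    equal e = pow-injective ord i<j (≤-<-trans (≤-trans (m≤n+m j i) (m≤m+n (i + j) (i + j))) small) (cong₂ _,_ (same-x (proj₁ (pow t i)) (proj₁ (pow t j)) eq e) eq)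
      where
      same-x : ∀ x x′ {y y′} → y ≡ y′ → lit 2 ⊗ x ⊕ t ⊗ y ≡ lit 2 ⊗ x′ ⊕ t ⊗ y′ → x ≡ x′
      same-x x x′ {y} refl e = cancelˡ 2≢0 (solve 2 (λ a b → a := (a :+ b) :- b) refl (lit 2 ⊗ x) (t ⊗ y) ⨾ cong (_⊟ t ⊗ y) e ⨾ solve 2 (λ a b → (a :+ b) :- b := a) refl (lit 2 ⊗ x′) (t ⊗ y))
    opposite : trace t (pow t i) ≢ ⊝ trace t (pow t j)
    opposite e = pow-small ord (≤-trans 1≤i (≤-trans (m≤m+n i j) (m≤m+n (i + j) (i + j)))) small
      (y≡𝟘⇒pow-double t (i + j) (cong proj₂ (pow-+ t i j) ⨾ vanish (proj₁ (pow t i)) (proj₁ (pow t j)) eq e))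
      where
      vanish : ∀ x x′ {y y′} → y ≡ y′ → lit 2 ⊗ x ⊕ t ⊗ y ≡ ⊝ (lit 2 ⊗ x′ ⊕ t ⊗ y′) → x ⊗ y′ ⊕ y ⊗ x′ ⊕ t ⊗ (y ⊗ y′) ≡ 𝟘
      vanish x x′ {y} refl e = cancelˡ 2≢0 (solve 4 (λ t x x′ y → con (⁺ 2) :* (x :* y :+ y :* x′ :+ t :* (y :* y)) := y :* ((con (⁺ 2) :* x :+ t :* y) :+ (con (⁺ 2) :* x′ :+ t :* y))) refl t x x′ y
        ⨾ cong (λ z → y ⊗ (z ⊕ (lit 2 ⊗ x′ ⊕ t ⊗ y))) e
        ⨾ solve 2 (λ y z → y :* (:- z :+ z) := con (⁺ 2) :* con (⁺ 0)) refl y (lit 2 ⊗ x′ ⊕ t ⊗ y))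

  -- The determinant of the coordinates of v and u v is norm v times the y-coefficient of u, here
  -- for u = θ^(j-i) and v = θ^i.
  pow-independent : ∀ {t n i j} → IsOrder t n → i < j → (j ∸ i) + (j ∸ i) < n → proj₁ (pow t i) ⊗ proj₂ (pow t j) ≢ proj₁ (pow t j) ⊗ proj₂ (pow t i)
  pow-independent {t} {n} {i} {j} ord i<j small eq = y≢𝟘 ord (m<n⇒0<n∸m i<j) small
      (determinant (pow t (j ∸ i)) (pow t i) (norm-pow t i) (cong (pow t) (sym (m∸n+n≡m (<⇒≤ i<j))) ⨾ pow-+ t (j ∸ i) i) eq)
    where
    determinant : ∀ u v {w} → norm t v ≡ 𝟏 → w ≡ mul t u v → proj₁ v ⊗ proj₂ w ≡ proj₁ w ⊗ proj₂ v → proj₂ u ≡ 𝟘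
    determinant (a , b) (x , y) n≡1 refl e = solve 1 (λ b → b := b :* con (⁺ 1)) refl b ⨾ cong (b ⊗_) (sym n≡1)
      ⨾ solve 5 (λ t a b x y → b :* (x :* x :+ t :* (x :* y) :+ y :* y) := x :* (a :* y :+ b :* x :+ t :* (b :* y)) :- (a :* x :- b :* y) :* y) refl t a b x y
      ⨾ ≡⇒⊟≡𝟘 e

  -- (x , y) ↦ x + y θ^l
  comb : F × F → F × F → F × F
  comb (x , y) (a , b) = x ⊕ y ⊗ a , y ⊗ b

  -- θ^l has norm 1, so it is a root of X² = s X - 1 with s its trace. Its powers have the same
  -- coordinates with respect to 1 and θ^l as those of the rotation with parameter s have with
  -- respect to 1 and its own root.
  pow-subsample : ∀ t l k → pow t (k * l) ≡ comb (pow (trace t (pow t l)) k) (pow t l)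
  pow-subsample t l zero = cong₂ _,_ (solve 1 (λ a → con (⁺ 1) := con (⁺ 1) :+ con (⁺ 0) :* a) refl (proj₁ (pow t l)))
    (solve 1 (λ a → con (⁺ 0) := con (⁺ 0) :* a) refl (proj₂ (pow t l)))
  pow-subsample t l (suc k) = pow-+ t l (k * l) ⨾ cong (mul t (pow t l)) (pow-subsample t l k)
    ⨾ lem (pow (trace t (pow t l)) k) (pow t l) (norm-pow t l)
    where
    lem : ∀ v u → norm t u ≡ 𝟏 → mul t u (comb v u) ≡ comb (step (trace t u) v) u
    lem (x , y) (a , b) n≡1 = cong₂ _,_
      (solve 5 (λ t x y a b → a :* (x :+ y :* a) :- b :* (y :* b)
         := (:- y) :* (a :* a :+ t :* (a :* b) :+ b :* b) :+ (x :+ (con (⁺ 2) :* a :+ t :* b) :* y) :* a) refl t x y a b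
       ⨾ cong (λ n → (⊝ y) ⊗ n ⊕ (x ⊕ trace t (a , b) ⊗ y) ⊗ a) n≡1
       ⨾ cong (_⊕ (x ⊕ trace t (a , b) ⊗ y) ⊗ a) (⊗-identityʳ (⊝ y)))
      (solve 5 (λ t x y a b → a :* (y :* b) :+ b :* (x :+ y :* a) :+ t :* (b :* (y :* b)) := (x :+ (con (⁺ 2) :* a :+ t :* b) :* y) :* b) refl t x y a b)

  -- Every l-th term of the recurrence with parameter t obeys the recurrence whose parameter is the
  -- trace of θ^l. This transfers forms from one coordinate to another.
  dot-subsample : ∀ t l k b c → dot 𝔽 (pow t (k * l)) (b , c) ≡ dot 𝔽 (pow (trace t (pow t l)) k) (b , dot 𝔽 (pow t l) (b , c))
  dot-subsample t l k b c = cong (λ u → dot 𝔽 u (b , c)) (pow-subsample t l k) ⨾ lem (pow (trace t (pow t l)) k) (pow t l)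
    where
    lem : ∀ v u → dot 𝔽 (comb v u) (b , c) ≡ dot 𝔽 v (b , dot 𝔽 u (b , c))
    lem (x , y) (a , d) = solve 6 (λ x y a d b c → (x :+ y :* a) :* b :+ (y :* d) :* c := x :* b :+ y :* (a :* b :+ d :* c)) refl x y a d b c

  pow-trace : ∀ {t n l} → IsOrder t n → 1 ≤ l → l + l < n → pow (trace t (pow t l)) n ≡ one
  pow-trace {t} {n} {l} ord 1≤l 2l<n = lem (pow (trace t (pow t l)) n) (pow t l) (y≢𝟘 ord 1≤l 2l<n)
      (sym (pow-subsample t l n) ⨾ cong (pow t) (*-comm n l) ⨾ pow-multiple t n l (proj₁ (proj₂ ord)))
    where
    lem : ∀ v u → proj₂ u ≢ 𝟘 → comb v u ≡ one → v ≡ one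
    lem (x , y) (a , b) b≢0 eq = cong₂ _,_
      (solve 2 (λ x a → x := x :+ con (⁺ 0) :* a) refl x a ⨾ cong (λ z → x ⊕ z ⊗ a) (sym y≡0) ⨾ cong proj₁ eq) y≡0
      where
      y≡0 : y ≡ 𝟘
      y≡0 = Sum.[ id , ⊥-elim ∘ b≢0 ] (no-zero-divisors (cong proj₂ eq))

  -- These are the Chebyshev polynomials of the second kind in t / 2, made monic, with the recursion
  -- y(k+2) = t y(k+1) - y(k).
  y-poly : ∀ k → Poly k 𝟏 (λ t → proj₂ (pow t (suc k)))
  y-poly zero t = solve 1 (λ t → con (⁺ 1) :+ t :* con (⁺ 0) := con (⁺ 1)) refl t
  y-poly (suc zero) = (λ _ → 𝟏) , 𝟘 , (λ _ → refl) , λ t →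
    solve 1 (λ t → :- con (⁺ 0) :+ t :* (con (⁺ 1) :+ t :* con (⁺ 0)) := t :* con (⁺ 1) :+ con (⁺ 0)) refl t
  y-poly (suc (suc k)) = poly-resp (suc (suc k)) (⊕-identityʳ 𝟏)
    (λ t → lem t (proj₂ (pow t (suc (suc k)))) (proj₂ (pow t (suc k))))
    (poly-⊕ (suc (suc k)) (poly-x (suc k) (y-poly (suc k))) (poly-raise (suc k) (poly-raise k (poly-scale k (⊝ 𝟏) (y-poly k)))))
    where
    lem : ∀ t y y′ → t ⊗ y ⊕ ⊝ 𝟏 ⊗ y′ ≡ ⊝ y′ ⊕ t ⊗ y
    lem = solve 3 (λ t y y′ → t :* y :+ (:- con (⁺ 1)) :* y′ := :- y′ :+ t :* y) refl

  -- θ^n = 1 means that θ^i and θ^j are conjugate for n = i + j.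
  half-sum : ∀ {t} i j → pow t (i + j) ≡ one → proj₂ (pow t i) ⊕ proj₂ (pow t j) ≡ 𝟘
  half-sum {t} i j eq = cong (λ u → proj₂ u ⊕ proj₂ (pow t j)) (pow-conj t i j eq) ⨾ ⊝-inverseˡ _

  -- Splitting n into two nearly equal exponents lowers the degree to h, about n / 2. This is sharp
  -- enough for `same-order`, where the traces of θ, ..., θ^h already exhaust the roots.
  half-roots : ∀ h {n} → n ≡ suc h + suc h ⊎ n ≡ suc h + h → ∀ {X} → Unique X → (∀ {t} → t ∈ X → pow t n ≡ one) → length X ≤ h
  half-roots h (inj₁ refl) u root = poly-roots h (poly-⊕ h (y-poly h) (y-poly h)) 2≢0 u (λ t∈ → half-sum (suc h) (suc h) (root t∈))
  half-roots zero (inj₂ refl) u root = poly-roots zero {f = λ t → proj₂ (pow t 1) ⊕ proj₂ (pow t 0)}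
    (λ t → cong (_⊕ 𝟘) (y-poly zero t) ⨾ ⊕-identityʳ 𝟏) 𝟏≢𝟘 u (λ t∈ → half-sum 1 0 (root t∈))
  half-roots (suc h) (inj₂ refl) u root = poly-roots (suc h) (poly-resp (suc h) (⊕-identityʳ 𝟏) (λ _ → refl)
    (poly-⊕ (suc h) (y-poly (suc h)) (poly-raise h (y-poly h)))) 𝟏≢𝟘 u (λ t∈ → half-sum (suc (suc h)) (suc h) (root t∈))

  halve : ∀ n → 1 ≤ n → ∃ λ h → n ≡ suc h + suc h ⊎ n ≡ suc h + h
  halve (suc zero) _ = 0 , inj₂ refl
  halve (suc (suc zero)) _ = 0 , inj₁ refl
  halve (suc (suc (suc n))) _ with halve (suc n) (s≤s z≤n)
  ... | h , inj₁ eq = suc h , inj₁ (cong (suc ∘ suc) eq ⨾ cong suc (sym (+-suc (suc h) (suc h))))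
  ... | h , inj₂ eq = suc h , inj₂ (cong (suc ∘ suc) eq ⨾ cong suc (sym (+-suc (suc h) h)))

  order-count : ∀ {n} → 1 ≤ n → ∀ {X} → Unique X → (∀ {t} → t ∈ X → pow t n ≡ one) → length X ≤ n
  order-count {n} 1≤n u root with halve n 1≤n
  ... | h , inj₁ refl = ≤-trans (half-roots h (inj₁ refl) u root) (≤-trans (n≤1+n h) (m≤m+n (suc h) (suc h)))
  ... | h , inj₂ refl = ≤-trans (half-roots h (inj₂ refl) u root) (m≤n+m h (suc h))

  -- The traces of θ, ..., θ^h are distinct: by `same-trace` a coincidence would give equal or
  -- mutually inverse powers, with exponents too small for that. They all satisfy the equation that
  -- has at most h solutions, so t′ is one of them.
  same-order : ∀ {t n} → disc t ≢ 𝟘 → IsOrder t n → ∀ {t′} → pow t′ n ≡ one → ∃ λ l → 1 ≤ l × l + l < n × trace t (pow t l) ≡ t′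
  same-order {t} {n} D≢0 ord {t′} root′ = search (DecMembership._∈?_ _≟ᶠ_ t′ R)
    where
    h = proj₁ (halve n (proj₁ ord))
    n≡ = proj₂ (halve n (proj₁ ord))
    f : ℕ → F
    f i = trace t (pow t (suc i))
    R = map f (upTo h)
    small : ∀ {i} → i < h → suc i + suc i < n
    small {i} i<h = Sum.[ (λ eq → subst (suc i + suc i <_) (sym eq) (+-mono-<-≤ (s≤s i<h) (≤-trans i<h (n≤1+n h))))
                          , (λ eq → subst (suc i + suc i <_) (sym eq) (+-mono-<-≤ (s≤s i<h) i<h)) ] n≡
    inj< : ∀ {i j} → i < j → j < h → f i ≢ f j
    inj< {i} {j} i<j j<h eq = Sum.[ pow-injective ord (s≤s i<j) (≤-<-trans (m≤m+n (suc j) (suc j)) (small j<h))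
                                  , (λ c → pow-small ord (s≤s z≤n) (<-trans (+-monoˡ-< (suc j) (s≤s i<j)) (small j<h))
                                       (pow-+ t (suc i) (suc j) ⨾ cong (λ u → mul t u (pow t (suc j))) c ⨾ mul-conj-self t _ (norm-pow t (suc j)))) ]
                              (same-trace D≢0 (norm-pow t (suc i)) (norm-pow t (suc j)) eq)
    uR : Unique R
    uR = map-unique (λ {i} {j} i∈ j∈ eq → inj i j (∈-upTo⁻ i∈) (∈-upTo⁻ j∈) eq) (Uniq.upTo⁺ h)
      where
      inj : ∀ i j → i < h → j < h → f i ≡ f j → i ≡ j
      inj i j i<h j<h eq with <-cmp i j
      ... | tri< i<j _ _ = ⊥-elim (inj< i<j j<h eq)
      ... | tri≈ _ i≡j _ = i≡j
      ... | tri> _ _ j<i = ⊥-elim (inj< j<i i<h (sym eq))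
    rootR : ∀ {s} → s ∈ t′ ∷ R → pow s n ≡ one
    rootR (here refl) = root′
    rootR (there s∈) with i , i∈ , refl ← ∈-map⁻ f s∈ = pow-trace ord (s≤s z≤n) (small (∈-upTo⁻ i∈))
    search : Dec (t′ ∈ R) → ∃ λ l → 1 ≤ l × l + l < n × trace t (pow t l) ≡ t′
    search (yes t′∈) with i , i∈ , eq ← ∈-map⁻ f t′∈ = suc i , s≤s z≤n , small (∈-upTo⁻ i∈) , sym eq
    search (no t′∉) = ⊥-elim (<-irrefl refl (subst (λ k → suc k ≤ h) (length-map f (upTo h) ⨾ length-upTo h)
      (half-roots h n≡ (All.tabulate (λ { s∈ refl → t′∉ s∈ }) ∷ uR) rootR)))

-- Orders divide p² - 1

module FermatTheory {q : ℕ} (𝔽 : PrimeField (suc q)) (2≢0 : FieldTheory.lit 𝔽 2 ≢ PrimeField.𝟘 𝔽) where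
  open FieldTheory 𝔽
  open Polynomials 𝔽
  open Rotations 𝔽 2≢0

  nonzeros : List F
  nonzeros = filter (¬? ∘ (_≟ᶠ 𝟘)) elems

  nonzeros-unique : Unique nonzeros
  nonzeros-unique = Uniq.filter⁺ _ elems-unique

  ∈-nonzeros⁺ : ∀ {x} → x ≢ 𝟘 → x ∈ nonzeros
  ∈-nonzeros⁺ {x} x≢0 = ∈-filter⁺ (¬? ∘ (_≟ᶠ 𝟘)) (∈-elems x) x≢0

  ∈-nonzeros⁻ : ∀ {x} → x ∈ nonzeros → x ≢ 𝟘
  ∈-nonzeros⁻ x∈ = proj₂ (∈-filter⁻ (¬? ∘ (_≟ᶠ 𝟘)) {xs = elems} x∈)

  length-remove-one : {A : Set} {P : A → Set} (P? : Decidable P) {xs : List A} → Unique xs → ∀ {a} → a ∈ xs → P a →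
                      (∀ {x} → P x → x ≡ a) → length xs ≡ suc (length (filter (¬? ∘ P?) xs))
  length-remove-one P? {xs} u {a} a∈ pa only = length-filter-split P? xs ⨾ cong (_+ length (filter (¬? ∘ P?) xs))
    (≤-antisym (unique-⊆-length {ys = a ∷ []} (Uniq.filter⁺ P? u) (λ x∈ → here (only (proj₂ (∈-filter⁻ P? {xs = xs} x∈)))))
               (∈-length (∈-filter⁺ P? a∈ pa)))

  length-nonzeros : length nonzeros ≡ q
  length-nonzeros = suc-injective (sym (length-remove-one (_≟ᶠ 𝟘) elems-unique (∈-elems 𝟘) refl id) ⨾ elems-length)

  _^ᶠ_ : F → ℕ → F
  x ^ᶠ k = iter (x ⊗_) 𝟏 k

  fermat : ∀ {x} → x ≢ 𝟘 → x ^ᶠ q ≡ 𝟏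
  fermat {x} x≢0 = cong (x ^ᶠ_) (sym length-nonzeros) ⨾ power-card x {nonzeros} nonzeros-unique
      (λ u∈ → ∈-nonzeros⁺ (⊗-≢𝟘 x≢0 (∈-nonzeros⁻ u∈))) (λ _ _ → cancelˡ x≢0)
      (λ z eq → cancelˡ (Π≢0 nonzeros ∈-nonzeros⁻) (⊗-comm (Π id nonzeros) z ⨾ eq ⨾ sym (⊗-identityʳ (Π id nonzeros))))
    where
    open ProductOfOrbit _⊗_ 𝟏 ⊗-assoc ⊗-comm ⊗-identityˡ
    Π≢0 : ∀ X → (∀ {x} → x ∈ X → x ≢ 𝟘) → Π id X ≢ 𝟘
    Π≢0 []      _ = 𝟏≢𝟘
    Π≢0 (x ∷ X) h = ⊗-≢𝟘 (h (here refl)) (Π≢0 X (h ∘ there))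

  eval-pow : ∀ t r → r ⊗ r ≡ t ⊗ r ⊟ 𝟏 → ∀ k → proj₁ (pow t k) ⊕ r ⊗ proj₂ (pow t k) ≡ r ^ᶠ k
  eval-pow t r eq zero = solve 1 (λ r → con (⁺ 1) :+ r :* con (⁺ 0) := con (⁺ 1)) refl r
  eval-pow t r eq (suc k) = lem (proj₁ (pow t k)) (proj₂ (pow t k)) ⨾ cong (r ⊗_) (eval-pow t r eq k)
    where
    lem : ∀ x y → ⊝ y ⊕ r ⊗ (x ⊕ t ⊗ y) ≡ r ⊗ (x ⊕ r ⊗ y)
    lem x y = solve 4 (λ t r x y → :- y :+ r :* (x :+ t :* y) := r :* x :+ (t :* r :- con (⁺ 1)) :* y) refl t r x y
      ⨾ cong (λ z → r ⊗ x ⊕ z ⊗ y) (sym eq) ⨾ solve 3 (λ r x y → r :* x :+ (r :* r) :* y := r :* (x :+ r :* y)) refl r x y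

  interpolate : ∀ r r′ x y → r ⊟ r′ ≢ 𝟘 → x ⊕ r ⊗ y ≡ 𝟏 → x ⊕ r′ ⊗ y ≡ 𝟏 → (x , y) ≡ one
  interpolate r r′ x y r≢r′ e₁ e₂ = cong₂ _,_ x≡1 y≡0
    where
    y≡0 : y ≡ 𝟘
    y≡0 = Sum.[ ⊥-elim ∘ r≢r′ , id ] (no-zero-divisors {r ⊟ r′} {y}
      (solve 4 (λ r r′ x y → (r :- r′) :* y := (x :+ r :* y) :- (x :+ r′ :* y)) refl r r′ x y ⨾ ≡⇒⊟≡𝟘 (e₁ ⨾ sym e₂)))
    x≡1 : x ≡ 𝟏
    x≡1 = solve 2 (λ x r → x := x :+ r :* con (⁺ 0)) refl x r ⨾ cong (λ z → x ⊕ r ⊗ z) (sym y≡0) ⨾ e₁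

  -- The substitutions θ ↦ r and θ ↦ t - r send θ^q to q-th powers of nonzero elements, hence to 1
  -- as q = p - 1. A nonzero discriminant makes the two roots distinct, and two values determine x +
  -- y θ.
  split-order : ∀ {t r} → disc t ≢ 𝟘 → r ⊗ r ≡ t ⊗ r ⊟ 𝟏 → pow t q ≡ one
  split-order {t} {r} D≢0 eq = interpolate r r′ (proj₁ (pow t q)) (proj₂ (pow t q)) r≢r′
      (eval-pow t r eq q ⨾ fermat (nonzero eq)) (eval-pow t r′ eq′ q ⨾ fermat (nonzero eq′))
    where
    r′ = t ⊟ r
    eq′ : r′ ⊗ r′ ≡ t ⊗ r′ ⊟ 𝟏
    eq′ = solve 2 (λ t r → (t :- r) :* (t :- r) := t :* t :- con (⁺ 2) :* (t :* r) :+ r :* r) refl t r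
      ⨾ cong (λ z → t ⊗ t ⊟ lit 2 ⊗ (t ⊗ r) ⊕ z) eq
      ⨾ solve 2 (λ t r → t :* t :- con (⁺ 2) :* (t :* r) :+ (t :* r :- con (⁺ 1)) := t :* (t :- r) :- con (⁺ 1)) refl t r
    nonzero : ∀ {s} → s ⊗ s ≡ t ⊗ s ⊟ 𝟏 → s ≢ 𝟘
    nonzero e refl = 𝟏≢𝟘 (solve 1 (λ t → con (⁺ 1) := :- (t :* con (⁺ 0) :- con (⁺ 1))) refl t ⨾ cong ⊝_ (sym e)
      ⨾ solve 0 (:- (con (⁺ 0) :* con (⁺ 0)) := con (⁺ 0)) refl)
    r≢r′ : r ⊟ r′ ≢ 𝟘
    r≢r′ z = D≢0 (solve 2 (λ t r → t :* t :- con (⁺ 4) := (r :- (t :- r)) :* (r :- (t :- r)) :- con (⁺ 4) :* (r :* r :- (t :* r :- con (⁺ 1)))) refl t r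
      ⨾ cong₂ (λ a b → a ⊗ a ⊟ lit 4 ⊗ b) z (≡⇒⊟≡𝟘 eq)
      ⨾ solve 0 (con (⁺ 0) :* con (⁺ 0) :- con (⁺ 4) :* con (⁺ 0) := con (⁺ 0)) refl)

  -- Without roots the norm vanishes only at zero, so multiplication by θ permutes the p² - 1 = q (q
  -- + 2) nonzero pairs and `power-card` applies.
  inert-order : ∀ {t} → (∀ r → r ⊗ r ≢ t ⊗ r ⊟ 𝟏) → pow t (q * (q + 2)) ≡ one
  inert-order {t} inert = cong (pow t) (sym lenU) ⨾ pow≡iter (length U) ⨾ power-card θ {U} uU closed inj cancel
    where
    open ProductOfOrbit (mul t) one (mul-assoc t) (mul-comm t) (mul-one t)
    θ : F × F
    θ = 𝟘 , 𝟏
    step≡mul : ∀ u → step t u ≡ mul t θ u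
    step≡mul (x , y) = cong₂ _,_ (solve 2 (λ x y → :- y := con (⁺ 0) :* x :- con (⁺ 1) :* y) refl x y)
      (solve 3 (λ t x y → x :+ t :* y := con (⁺ 0) :* y :+ con (⁺ 1) :* x :+ t :* (con (⁺ 1) :* y)) refl t x y)
    pow≡iter : ∀ k → pow t k ≡ iter (mul t θ) one k
    pow≡iter zero    = refl
    pow≡iter (suc k) = step≡mul (pow t k) ⨾ cong (mul t θ) (pow≡iter k)
    F² = cartesianProduct elems elems
    U = filter (¬? ∘ (_≟² (𝟘 , 𝟘))) F²
    uF² : Unique F²
    uF² = Uniq.cartesianProduct⁺ elems-unique elems-unique
    uU : Unique U
    uU = Uniq.filter⁺ _ uF²
    ∈F² : ∀ u → u ∈ F²
    ∈F² (x , y) = ∈-cartesianProduct⁺ (∈-elems x) (∈-elems y)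
    ∈U⁻ : ∀ {u} → u ∈ U → u ≢ (𝟘 , 𝟘)
    ∈U⁻ u∈ = proj₂ (∈-filter⁻ (¬? ∘ (_≟² (𝟘 , 𝟘))) {xs = F²} u∈)
    lenU : length U ≡ q * (q + 2)
    lenU = suc-injective (sym (length-remove-one (_≟² (𝟘 , 𝟘)) uF² (∈F² (𝟘 , 𝟘)) refl id) ⨾ length-× elems elems
      ⨾ cong₂ _*_ elems-length elems-length ⨾ arith q)
      where
      arith : ∀ q → suc q * suc q ≡ suc (q * (q + 2))
      arith = solve-∀
    norm≢0 : ∀ {u} → u ≢ (𝟘 , 𝟘) → norm t u ≢ 𝟘
    norm≢0 {x , y} u≢0 n≡0 with y ≟ᶠ 𝟘
    ... | yes refl = u≢0 (cong (_, 𝟘) (Sum.[ id , id ] (no-zero-divisors {x} {x}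
            (solve 2 (λ t x → x :* x := x :* x :+ t :* (x :* con (⁺ 0)) :+ con (⁺ 0) :* con (⁺ 0)) refl t x ⨾ n≡0))))
    -- An element of norm zero with y ≠ 0 would make -x / y a root of r² = t r - 1.
    ... | no y≢0 = inert (⊝ (x ⊗ inv y)) (⊟≡𝟘⇒≡ (
            solve 4 (λ t x i o → (:- (x :* i)) :* (:- (x :* i)) :- (t :* (:- (x :* i)) :- o) := x :* x :* (i :* i) :+ t :* (x :* i) :+ o) refl t x (inv y) 𝟏
            ⨾ cong (λ o → x ⊗ x ⊗ (inv y ⊗ inv y) ⊕ t ⊗ (x ⊗ inv y) ⊕ o) (sym (cong₂ _⊗_ (inverseʳ y≢0) (inverseʳ y≢0) ⨾ ⊗-identityʳ 𝟏))
            ⨾ cong (λ o → x ⊗ x ⊗ (inv y ⊗ inv y) ⊕ o ⊕ (y ⊗ inv y) ⊗ (y ⊗ inv y)) (sym (⊗-identityʳ _ ) ⨾ cong ((t ⊗ (x ⊗ inv y)) ⊗_) (sym (inverseʳ y≢0)))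
            ⨾ solve 4 (λ t x y i → x :* x :* (i :* i) :+ t :* (x :* i) :* (y :* i) :+ (y :* i) :* (y :* i) := (x :* x :+ t :* (x :* y) :+ y :* y) :* (i :* i)) refl t x y (inv y)
            ⨾ cong (_⊗ (inv y ⊗ inv y)) n≡0 ⨾ zeroˡ _))
    norm-𝟘 : ∀ {u} → norm t u ≢ 𝟘 → u ≢ (𝟘 , 𝟘)
    norm-𝟘 n≢0 refl = n≢0 (solve 1 (λ t → con (⁺ 0) :* con (⁺ 0) :+ t :* (con (⁺ 0) :* con (⁺ 0)) :+ con (⁺ 0) :* con (⁺ 0) := con (⁺ 0)) refl t)
    normθ : norm t θ ≢ 𝟘
    normθ eq = 𝟏≢𝟘 (solve 1 (λ t → con (⁺ 1) := con (⁺ 0) :* con (⁺ 0) :+ t :* (con (⁺ 0) :* con (⁺ 1)) :+ con (⁺ 1) :* con (⁺ 1)) refl t ⨾ eq)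
    closed : ∀ {u} → u ∈ U → mul t θ u ∈ U
    closed {u} u∈ = ∈-filter⁺ (¬? ∘ (_≟² (𝟘 , 𝟘))) (∈F² _)
      (norm-𝟘 (λ eq → ⊗-≢𝟘 normθ (norm≢0 (∈U⁻ u∈)) (sym (norm-mul t θ u) ⨾ eq)))
    inj : ∀ {u v} → u ∈ U → v ∈ U → mul t θ u ≡ mul t θ v → u ≡ v
    inj {u} {v} _ _ eq = mul-cancelʳ t u v θ normθ (mul-comm t u θ ⨾ eq ⨾ mul-comm t θ v)
    normΠ : ∀ X → (∀ {u} → u ∈ X → u ≢ (𝟘 , 𝟘)) → norm t (Π id X) ≢ 𝟘
    normΠ [] _ eq = 𝟏≢𝟘 (sym (norm-pow t 0) ⨾ eq)
    normΠ (u ∷ X) h eq = ⊗-≢𝟘 (norm≢0 (h (here refl))) (normΠ X (h ∘ there)) (sym (norm-mul t u (Π id X)) ⨾ eq)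
    cancel : ∀ z → mul t z (Π id U) ≡ Π id U → z ≡ one
    cancel z eq = mul-cancelʳ t z one (Π id U) (normΠ U ∈U⁻) (eq ⨾ sym (mul-one t (Π id U)))

  order-divides : ∀ {t} → disc t ≢ 𝟘 → pow t (q * (q + 2)) ≡ one
  order-divides {t} D≢0 with any? (λ r → r ⊗ r ≟ᶠ t ⊗ r ⊟ 𝟏) elems
  ... | yes h = let r , _ , eq = find h in
    cong (pow t) (*-comm q (q + 2)) ⨾ pow-multiple t q (q + 2) (split-order D≢0 eq)
  ... | no ¬h = inert-order (λ r eq → ¬h (lose (∈-elems r) eq))

-- Orbits on the Markoff surface

module MarkoffOrbits {p : ℕ} (𝔽 : PrimeField p) where
  open FieldTheory 𝔽

  Point : Set
  Point = F × F × F

  origin : Point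
  origin = 𝟘 , 𝟘 , 𝟘

  Markoff : Point → Set
  Markoff (a , b , c) = a ⊗ a ⊕ b ⊗ b ⊕ c ⊗ c ≡ lit 3 ⊗ (a ⊗ (b ⊗ c))

  vieta swap₁₂ swap₁₃ swap₂₃ : Point → Point
  vieta  (a , b , c) = lit 3 ⊗ (b ⊗ c) ⊟ a , b , c
  swap₁₂ (a , b , c) = b , a , c
  swap₁₃ (a , b , c) = c , b , a
  swap₂₃ (a , b , c) = a , c , b

  -- One Vieta involution is enough: the other two are its conjugates under the swaps. Any union of
  -- orbits qualifies.
  record Invariant (O : List Point) : Set where
    field
      unique   : Unique O
      markoff  : ∀ {x} → x ∈ O → Markoff x
      nonzero  : ∀ {x} → x ∈ O → x ≢ origin
      vieta∈   : ∀ {x} → x ∈ O → vieta x ∈ O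
      swap₁₂∈  : ∀ {x} → x ∈ O → swap₁₂ x ∈ O
      swap₁₃∈  : ∀ {x} → x ∈ O → swap₁₃ x ∈ O
      swap₂₃∈  : ∀ {x} → x ∈ O → swap₂₃ x ∈ O

  markoff-form : ∀ a b c → Markoff (a , b , c) → b ⊗ b ⊕ c ⊗ c ⊟ (lit 3 ⊗ a) ⊗ (b ⊗ c) ≡ ⊝ (a ⊗ a)
  markoff-form a b c e = solve 4 (λ t a b c → b :* b :+ c :* c :- (t :* a) :* (b :* c) := (a :* a :+ b :* b :+ c :* c) :- t :* (a :* (b :* c)) :- a :* a) refl (lit 3) a b c
    ⨾ cong (λ w → w ⊟ lit 3 ⊗ (a ⊗ (b ⊗ c)) ⊟ a ⊗ a) e
    ⨾ solve 2 (λ w s → w :- w :- s := :- s) refl (lit 3 ⊗ (a ⊗ (b ⊗ c))) (a ⊗ a)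

  vieta-injective : ∀ {x y} → vieta x ≡ vieta y → x ≡ y
  vieta-injective {a , b , c} {a′ , b′ , c′} eq with cong proj₂ eq
  ... | refl = cong (_, b , c) (solve 2 (λ n a → a := n :- (n :- a)) refl (lit 3 ⊗ (b ⊗ c)) a
      ⨾ cong (lit 3 ⊗ (b ⊗ c) ⊟_) (cong proj₁ eq) ⨾ solve 2 (λ n a → n :- (n :- a) := a) refl (lit 3 ⊗ (b ⊗ c)) a′)

  moves : List (Point → Point)
  moves = vieta ∷ swap₁₂ ∷ swap₁₃ ∷ swap₂₃ ∷ []

  vieta-involutive : ∀ x → vieta (vieta x) ≡ x
  vieta-involutive (a , b , c) = cong (_, b , c) (solve 2 (λ n a → n :- (n :- a) := a) refl (lit 3 ⊗ (b ⊗ c)) a)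

  move-involutive : ∀ {f} → f ∈ moves → ∀ z → f (f z) ≡ z
  move-involutive (here refl) = vieta-involutive
  move-involutive (there (here refl)) _ = refl
  move-involutive (there (there (here refl))) _ = refl
  move-involutive (there (there (there (here refl)))) _ = refl

  markoff-move : ∀ {f z} → f ∈ moves → Markoff z → Markoff (f z)
  markoff-move {z = a , b , c} (here refl) e = lem (lit 3) a b c e
    where
    lem : ∀ t a b c → a ⊗ a ⊕ b ⊗ b ⊕ c ⊗ c ≡ t ⊗ (a ⊗ (b ⊗ c)) →
          (t ⊗ (b ⊗ c) ⊟ a) ⊗ (t ⊗ (b ⊗ c) ⊟ a) ⊕ b ⊗ b ⊕ c ⊗ c ≡ t ⊗ ((t ⊗ (b ⊗ c) ⊟ a) ⊗ (b ⊗ c))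
    lem t a b c e = solve 4 (λ t a b c → (t :* (b :* c) :- a) :* (t :* (b :* c) :- a) :+ b :* b :+ c :* c
        := t :* ((t :* (b :* c) :- a) :* (b :* c)) :+ ((a :* a :+ b :* b :+ c :* c) :- t :* (a :* (b :* c)))) refl t a b c
      ⨾ cong (t ⊗ ((t ⊗ (b ⊗ c) ⊟ a) ⊗ (b ⊗ c)) ⊕_) (≡⇒⊟≡𝟘 e) ⨾ ⊕-identityʳ _
  markoff-move {z = a , b , c} (there (here refl)) e = solve 3 (λ a b c → b :* b :+ a :* a :+ c :* c := a :* a :+ b :* b :+ c :* c) refl a b c ⨾ e
    ⨾ solve 4 (λ t a b c → t :* (a :* (b :* c)) := t :* (b :* (a :* c))) refl (lit 3) a b c
  markoff-move {z = a , b , c} (there (there (here refl))) e = solve 3 (λ a b c → c :* c :+ b :* b :+ a :* a := a :* a :+ b :* b :+ c :* c) refl a b c ⨾ e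
    ⨾ solve 4 (λ t a b c → t :* (a :* (b :* c)) := t :* (c :* (b :* a))) refl (lit 3) a b c
  markoff-move {z = a , b , c} (there (there (there (here refl)))) e = solve 3 (λ a b c → a :* a :+ c :* c :+ b :* b := a :* a :+ b :* b :+ c :* c) refl a b c ⨾ e
    ⨾ solve 4 (λ t a b c → t :* (a :* (b :* c)) := t :* (a :* (c :* b))) refl (lit 3) a b c

  origin-move : ∀ {f} → f ∈ moves → f origin ≡ origin
  origin-move (here refl) = cong (_, 𝟘 , 𝟘) (solve 1 (λ t → t :* (con (⁺ 0) :* con (⁺ 0)) :- con (⁺ 0) := con (⁺ 0)) refl (lit 3))
  origin-move (there (here refl)) = refl
  origin-move (there (there (here refl))) = refl
  origin-move (there (there (there (here refl)))) = refl

  nonzero-move : ∀ {f z} → f ∈ moves → z ≢ origin → f z ≢ origin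
  nonzero-move {f} {z} f∈ z≢0 e = z≢0 (sym (move-involutive f∈ z) ⨾ cong f e ⨾ origin-move f∈)

  open ProductOfOrbit _⊕_ 𝟘 ⊕-assoc ⊕-comm ⊕-identityˡ renaming (Π to ∑ᶠ; Π-permute to ∑ᶠ-permute) using ()

  ∑ᶠ-⊕ : ∀ {A : Set} (f g : A → F) xs → ∑ᶠ (λ x → f x ⊕ g x) xs ≡ ∑ᶠ f xs ⊕ ∑ᶠ g xs
  ∑ᶠ-⊕ f g []       = sym (⊕-identityˡ 𝟘)
  ∑ᶠ-⊕ f g (x ∷ xs) = cong (f x ⊕ g x ⊕_) (∑ᶠ-⊕ f g xs)
    ⨾ solve 4 (λ a b c d → a :+ b :+ (c :+ d) := a :+ c :+ (b :+ d)) refl (f x) (g x) (∑ᶠ f xs) (∑ᶠ g xs)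

  ∑ᶠ-⊗ : ∀ {A : Set} r (f : A → F) xs → ∑ᶠ (λ x → r ⊗ f x) xs ≡ r ⊗ ∑ᶠ f xs
  ∑ᶠ-⊗ r f []       = sym (zeroʳ r)
  ∑ᶠ-⊗ r f (x ∷ xs) = cong (r ⊗ f x ⊕_) (∑ᶠ-⊗ r f xs) ⨾ sym (distribˡ r (f x) _)

  ∑ᶠ-const : ∀ {A : Set} r (xs : List A) → ∑ᶠ (λ _ → r) xs ≡ nat (length xs) ⊗ r
  ∑ᶠ-const r []       = sym (zeroˡ r)
  ∑ᶠ-const r (x ∷ xs) = cong₂ _⊕_ (sym (⊗-identityˡ r)) (∑ᶠ-const r xs) ⨾ sym (distribʳ r 𝟏 (nat (length xs)))

  ∑ᶠ-cong : ∀ {A : Set} {f g : A → F} xs → (∀ {x} → x ∈ xs → f x ≡ g x) → ∑ᶠ f xs ≡ ∑ᶠ g xs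
  ∑ᶠ-cong []       h = refl
  ∑ᶠ-cong (x ∷ xs) h = cong₂ _⊕_ (h (here refl)) (∑ᶠ-cong xs (h ∘ there))

  indicator : F → F
  indicator x = x ⊗ inv x

  indicator-≢ : ∀ {x} → x ≢ 𝟘 → indicator x ≡ 𝟏
  indicator-≢ = inverseʳ

  -- The fraction u₁ = x₁ / (x₂ x₃), read as zero if x₂ x₃ = 0, and the indicator of x₂ x₃ ≠ 0 as a
  -- field element.
  ratio weight : Point → F
  ratio  (a , b , c) = a ⊗ inv (b ⊗ c)
  weight (a , b , c) = indicator (b ⊗ c)

  ratio-vieta : ∀ x → ratio (vieta x) ≡ lit 3 ⊗ weight x ⊕ ⊝ 𝟏 ⊗ ratio x
  ratio-vieta (a , b , c) = solve 4 (λ t n i a → (t :* n :- a) :* i := t :* (n :* i) :+ (:- con (⁺ 1)) :* (a :* i)) refl (lit 3) (b ⊗ c) (inv (b ⊗ c)) a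

  balance : Point → F
  balance x = lit 2 ⊗ (ratio x ⊕ ratio (swap₁₂ x) ⊕ ratio (swap₁₃ x)) ⊕ ⊝ lit 3 ⊗ (weight x ⊕ weight (swap₁₂ x) ⊕ weight (swap₁₃ x))

  square≡𝟘 : ∀ {x} → x ⊗ x ≡ 𝟘 → x ≡ 𝟘
  square≡𝟘 eq = Sum.[ id , id ] (no-zero-divisors eq)

  -- Without zero coordinates the value is 2 · 3 - 3 · 3. With exactly one, all three ratios vanish
  -- and one weight remains, again giving -3. Two zero coordinates force the origin.
  balance-constant : ∀ x → Markoff x → x ≢ origin → balance x ≡ ⊝ lit 3
  balance-constant (a , b , c) eq ≢0 = by-cases (a ≟ᶠ 𝟘) (b ≟ᶠ 𝟘) (c ≟ᶠ 𝟘)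
    where
    two-zeros : ∀ x y z → x ⊗ x ⊕ y ⊗ y ⊕ z ⊗ z ≡ lit 3 ⊗ (x ⊗ (y ⊗ z)) → x ≡ 𝟘 → y ≡ 𝟘 → z ≡ 𝟘
    two-zeros x y z e refl refl = square≡𝟘 (solve 1 (λ z → z :* z := con (⁺ 0) :* con (⁺ 0) :+ con (⁺ 0) :* con (⁺ 0) :+ z :* z) refl z
      ⨾ e ⨾ solve 1 (λ z → con (⁺ 3) :* (con (⁺ 0) :* (con (⁺ 0) :* z)) := con (⁺ 0)) refl z)
    value : ∀ i j k w₁ w₂ w₃ → inv (b ⊗ c) ≡ i → inv (a ⊗ c) ≡ j → inv (b ⊗ a) ≡ k → weight (a , b , c) ≡ w₁ → weight (b , a , c) ≡ w₂ → weight (c , b , a) ≡ w₃ →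
            balance (a , b , c) ≡ lit 2 ⊗ (a ⊗ i ⊕ b ⊗ j ⊕ c ⊗ k) ⊕ ⊝ lit 3 ⊗ (w₁ ⊕ w₂ ⊕ w₃)
    value _ _ _ _ _ _ refl refl refl e₁ e₂ e₃ rewrite e₁ | e₂ | e₃ = refl
    inv-zero : ∀ {x} → x ≡ 𝟘 → inv x ≡ 𝟘
    inv-zero refl = inv-𝟘
    ind-zero : ∀ {x} → x ≡ 𝟘 → indicator x ≡ 𝟘
    ind-zero refl = zeroˡ _
    by-cases : Dec (a ≡ 𝟘) → Dec (b ≡ 𝟘) → Dec (c ≡ 𝟘) → balance (a , b , c) ≡ ⊝ lit 3
    by-cases (yes a≡0) (yes b≡0) _ = ⊥-elim (≢0 (cong₂ _,_ a≡0 (cong₂ _,_ b≡0 (two-zeros a b c eq a≡0 b≡0))))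
    by-cases (yes a≡0) (no b≢0) (yes c≡0) = ⊥-elim (b≢0 (two-zeros a c b
      (solve 3 (λ a b c → a :* a :+ c :* c :+ b :* b := a :* a :+ b :* b :+ c :* c) refl a b c ⨾ eq
       ⨾ solve 4 (λ t a b c → t :* (a :* (b :* c)) := t :* (a :* (c :* b))) refl (lit 3) a b c) a≡0 c≡0))
    by-cases (no a≢0) (yes b≡0) (yes c≡0) = ⊥-elim (a≢0 (two-zeros b c a
      (solve 3 (λ a b c → b :* b :+ c :* c :+ a :* a := a :* a :+ b :* b :+ c :* c) refl a b c ⨾ eq
       ⨾ solve 4 (λ t a b c → t :* (a :* (b :* c)) := t :* (b :* (c :* a))) refl (lit 3) a b c) b≡0 c≡0))
    by-cases (yes a≡0) (no b≢0) (no c≢0) =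
      value _ 𝟘 𝟘 𝟏 𝟘 𝟘 refl (inv-zero (cong (_⊗ c) a≡0 ⨾ zeroˡ c)) (inv-zero (cong (b ⊗_) a≡0 ⨾ zeroʳ b))
        (indicator-≢ (⊗-≢𝟘 b≢0 c≢0)) (ind-zero (cong (_⊗ c) a≡0 ⨾ zeroˡ c)) (ind-zero (cong (b ⊗_) a≡0 ⨾ zeroʳ b))
      ⨾ cong (λ z → lit 2 ⊗ (z ⊗ inv (b ⊗ c) ⊕ b ⊗ 𝟘 ⊕ c ⊗ 𝟘) ⊕ ⊝ lit 3 ⊗ (𝟏 ⊕ 𝟘 ⊕ 𝟘)) a≡0
      ⨾ solve 3 (λ i b c → con (⁺ 2) :* (con (⁺ 0) :* i :+ b :* con (⁺ 0) :+ c :* con (⁺ 0)) :+ (:- con (⁺ 3)) :* (con (⁺ 1) :+ con (⁺ 0) :+ con (⁺ 0)) := :- con (⁺ 3)) refl (inv (b ⊗ c)) b c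
    by-cases (no a≢0) (yes b≡0) (no c≢0) =
      value 𝟘 _ 𝟘 𝟘 𝟏 𝟘 (inv-zero (cong (_⊗ c) b≡0 ⨾ zeroˡ c)) refl (inv-zero (cong (_⊗ a) b≡0 ⨾ zeroˡ a))
        (ind-zero (cong (_⊗ c) b≡0 ⨾ zeroˡ c)) (indicator-≢ (⊗-≢𝟘 a≢0 c≢0)) (ind-zero (cong (_⊗ a) b≡0 ⨾ zeroˡ a))
      ⨾ cong (λ z → lit 2 ⊗ (a ⊗ 𝟘 ⊕ z ⊗ inv (a ⊗ c) ⊕ c ⊗ 𝟘) ⊕ ⊝ lit 3 ⊗ (𝟘 ⊕ 𝟏 ⊕ 𝟘)) b≡0
      ⨾ solve 3 (λ i a c → con (⁺ 2) :* (a :* con (⁺ 0) :+ con (⁺ 0) :* i :+ c :* con (⁺ 0)) :+ (:- con (⁺ 3)) :* (con (⁺ 0) :+ con (⁺ 1) :+ con (⁺ 0)) := :- con (⁺ 3)) refl (inv (a ⊗ c)) a c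
    by-cases (no a≢0) (no b≢0) (yes c≡0) =
      value 𝟘 𝟘 _ 𝟘 𝟘 𝟏 (inv-zero (cong (b ⊗_) c≡0 ⨾ zeroʳ b)) (inv-zero (cong (a ⊗_) c≡0 ⨾ zeroʳ a)) refl
        (ind-zero (cong (b ⊗_) c≡0 ⨾ zeroʳ b)) (ind-zero (cong (a ⊗_) c≡0 ⨾ zeroʳ a)) (indicator-≢ (⊗-≢𝟘 b≢0 a≢0))
      ⨾ cong (λ z → lit 2 ⊗ (a ⊗ 𝟘 ⊕ b ⊗ 𝟘 ⊕ z ⊗ inv (b ⊗ a)) ⊕ ⊝ lit 3 ⊗ (𝟘 ⊕ 𝟘 ⊕ 𝟏)) c≡0
      ⨾ solve 3 (λ i a b → con (⁺ 2) :* (a :* con (⁺ 0) :+ b :* con (⁺ 0) :+ con (⁺ 0) :* i) :+ (:- con (⁺ 3)) :* (con (⁺ 0) :+ con (⁺ 0) :+ con (⁺ 1)) := :- con (⁺ 3)) refl (inv (b ⊗ a)) a b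
    by-cases (no a≢0) (no b≢0) (no c≢0) =
      value _ _ _ 𝟏 𝟏 𝟏 refl refl refl (indicator-≢ bc≢0) (indicator-≢ ac≢0) (indicator-≢ ba≢0)
      ⨾ cong (λ z → lit 2 ⊗ z ⊕ ⊝ lit 3 ⊗ (𝟏 ⊕ 𝟏 ⊕ 𝟏)) sum≡3
      ⨾ solve 0 (con (⁺ 2) :* con (⁺ 3) :+ (:- con (⁺ 3)) :* (con (⁺ 1) :+ con (⁺ 1) :+ con (⁺ 1)) := :- con (⁺ 3)) refl
      where
      bc≢0 = ⊗-≢𝟘 b≢0 c≢0
      ac≢0 = ⊗-≢𝟘 a≢0 c≢0
      ba≢0 = ⊗-≢𝟘 b≢0 a≢0
      clear : ∀ a b c i j k → (a ⊗ (b ⊗ c)) ⊗ (a ⊗ i ⊕ b ⊗ j ⊕ c ⊗ k)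
              ≡ a ⊗ a ⊗ ((b ⊗ c) ⊗ i) ⊕ b ⊗ b ⊗ ((a ⊗ c) ⊗ j) ⊕ c ⊗ c ⊗ ((b ⊗ a) ⊗ k)
      clear = solve 6 (λ a b c i j k → (a :* (b :* c)) :* (a :* i :+ b :* j :+ c :* k)
              := a :* a :* ((b :* c) :* i) :+ b :* b :* ((a :* c) :* j) :+ c :* c :* ((b :* a) :* k)) refl
      ones : ∀ a b c {x y z} → x ≡ 𝟏 → y ≡ 𝟏 → z ≡ 𝟏 → a ⊗ a ⊗ x ⊕ b ⊗ b ⊗ y ⊕ c ⊗ c ⊗ z ≡ a ⊗ a ⊕ b ⊗ b ⊕ c ⊗ c
      ones a b c refl refl refl = cong₂ _⊕_ (cong₂ _⊕_ (⊗-identityʳ _) (⊗-identityʳ _)) (⊗-identityʳ _)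
      sum≡3 : a ⊗ inv (b ⊗ c) ⊕ b ⊗ inv (a ⊗ c) ⊕ c ⊗ inv (b ⊗ a) ≡ lit 3
      sum≡3 = cancelˡ {a ⊗ (b ⊗ c)} (⊗-≢𝟘 a≢0 bc≢0) (clear a b c (inv (b ⊗ c)) (inv (a ⊗ c)) (inv (b ⊗ a))
        ⨾ ones a b c (inverseʳ bc≢0) (inverseʳ ac≢0) (inverseʳ ba≢0) ⨾ eq ⨾ ⊗-comm (lit 3) (a ⊗ (b ⊗ c)))

  -- Summing the balance over O: the Vieta involution gives 2 ∑ ratio = 3 ∑ weight, and the balance is constant.
  orbit-size-divisible : lit 3 ≢ 𝟘 → ∀ {O} → Invariant O → p ∣ length O
  orbit-size-divisible 3≢0 {O} inv-O = characteristic (length O) (Sum.[ id , (λ h → ⊥-elim (3≢0 h)) ]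
      (no-zero-divisors {nat (length O)} {lit 3} (negate (nat (length O)) (lit 3) (sym total ⨾ vanish (∑ᶠ ratio O) (∑ᶠ weight O) relation))))
    where
    open Invariant inv-O
    negate : ∀ n t → n ⊗ ⊝ t ≡ 𝟘 → n ⊗ t ≡ 𝟘
    negate n t e = solve 2 (λ n t → n :* t := :- (n :* (:- t))) refl n t ⨾ cong ⊝_ e ⨾ solve 0 (:- con (⁺ 0) := con (⁺ 0)) refl
    permuted : ∀ f g → (∀ {x} → x ∈ O → g x ∈ O) → (∀ {x y} → g x ≡ g y → x ≡ y) → ∑ᶠ (λ x → f (g x)) O ≡ ∑ᶠ f O
    permuted f g closed inj = ∑ᶠ-permute f g unique closed (λ _ _ → inj)
    relation : ∑ᶠ ratio O ≡ lit 3 ⊗ ∑ᶠ weight O ⊕ ⊝ 𝟏 ⊗ ∑ᶠ ratio O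
    relation = sym (permuted ratio vieta vieta∈ vieta-injective) ⨾ ∑ᶠ-cong O (λ {x} _ → ratio-vieta x)
      ⨾ ∑ᶠ-⊕ _ _ O ⨾ cong₂ _⊕_ (∑ᶠ-⊗ (lit 3) weight O) (∑ᶠ-⊗ (⊝ 𝟏) ratio O)
    thrice : ∀ f → ∑ᶠ (λ x → f x ⊕ f (swap₁₂ x) ⊕ f (swap₁₃ x)) O ≡ lit 3 ⊗ ∑ᶠ f O
    thrice f = ∑ᶠ-⊕ _ _ O ⨾ cong₂ _⊕_ (∑ᶠ-⊕ _ _ O ⨾ cong (∑ᶠ f O ⊕_) (permuted f swap₁₂ swap₁₂∈ (λ { refl → refl })))
        (permuted f swap₁₃ swap₁₃∈ (λ { refl → refl }))
      ⨾ solve 1 (λ s → s :+ s :+ s := con (⁺ 3) :* s) refl (∑ᶠ f O)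
    total : lit 2 ⊗ (lit 3 ⊗ ∑ᶠ ratio O) ⊕ ⊝ lit 3 ⊗ (lit 3 ⊗ ∑ᶠ weight O) ≡ nat (length O) ⊗ ⊝ lit 3
    total = sym (∑ᶠ-⊕ _ _ O ⨾ cong₂ _⊕_ (∑ᶠ-⊗ (lit 2) _ O ⨾ cong (lit 2 ⊗_) (thrice ratio)) (∑ᶠ-⊗ (⊝ lit 3) _ O ⨾ cong (⊝ lit 3 ⊗_) (thrice weight)))
      ⨾ ∑ᶠ-cong O (λ {x} x∈ → balance-constant x (markoff x∈) (nonzero x∈)) ⨾ ∑ᶠ-const (⊝ lit 3) O
    vanish : ∀ r w → r ≡ lit 3 ⊗ w ⊕ ⊝ 𝟏 ⊗ r → lit 2 ⊗ (lit 3 ⊗ r) ⊕ ⊝ lit 3 ⊗ (lit 3 ⊗ w) ≡ 𝟘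
    vanish r w e = solve 2 (λ r w → con (⁺ 2) :* (con (⁺ 3) :* r) :+ (:- con (⁺ 3)) :* (con (⁺ 3) :* w) := con (⁺ 3) :* (r :- (con (⁺ 3) :* w :+ (:- con (⁺ 1)) :* r))) refl r w
      ⨾ cong (lit 3 ⊗_) (≡⇒⊟≡𝟘 e) ⨾ zeroʳ (lit 3)

  orbit-size : lit 3 ≢ 𝟘 → ∀ {O x} → Invariant O → x ∈ O → p ≤ length O
  orbit-size 3≢0 inv-O x∈ = ∣⇒≤ ⦃ >-nonZero (∈-length x∈) ⦄ (orbit-size-divisible 3≢0 inv-O)

-- Slices of an invariant set and the orders of their rotations

module OrbitSlices {q : ℕ} (𝔽 : PrimeField (suc q)) (1≤q : 1 ≤ q) (2≢0 : FieldTheory.lit 𝔽 2 ≢ PrimeField.𝟘 𝔽) (3≢0 : FieldTheory.lit 𝔽 3 ≢ PrimeField.𝟘 𝔽)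
  (O : List (PrimeField.F 𝔽 × PrimeField.F 𝔽 × PrimeField.F 𝔽)) (inv-O : MarkoffOrbits.Invariant 𝔽 O) where
  open FieldTheory 𝔽
  open Rotations 𝔽 2≢0
  open FermatTheory 𝔽 2≢0 using (order-divides)
  open MarkoffOrbits 𝔽
  open Invariant inv-O

  tr : F → F
  tr a = lit 3 ⊗ a

  A : List F
  A = deduplicate _≟ᶠ_ (map proj₁ O)

  uA : Unique A
  uA = UniqDec.deduplicate-! _≟ᶠ_ (map proj₁ O)

  first∈A : ∀ {x} → x ∈ O → proj₁ x ∈ A
  first∈A x∈ = ∈-deduplicate⁺ _≟ᶠ_ (∈-map⁺ proj₁ x∈)

  second∈A : ∀ {x} → x ∈ O → proj₁ (proj₂ x) ∈ A
  second∈A x∈ = first∈A (swap₁₂∈ x∈)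

  A⁻ : ∀ {a} → a ∈ A → ∃ λ b → ∃ λ c → (a , b , c) ∈ O
  A⁻ a∈ with (a , b , c) , x∈ , refl ← ∈-map⁻ proj₁ (∈-deduplicate⁻ _≟ᶠ_ (map proj₁ O) a∈) = b , c , x∈

  dot-step : ∀ t u b c → dot 𝔽 (step t u) (b , c) ≡ dot 𝔽 u (c , t ⊗ c ⊟ b)
  dot-step t (x , y) b c = solve 5 (λ t x y b c → (:- y) :* b :+ (x :+ t :* y) :* c := x :* c :+ y :* (t :* c :- b)) refl t x y b c

  rotate∈ : ∀ {a b c} → (a , b , c) ∈ O → (a , c , tr a ⊗ c ⊟ b) ∈ O
  rotate∈ {a} {b} {c} x∈ = subst (λ z → (a , c , z) ∈ O) (cong (_⊟ b) (sym (⊗-assoc (lit 3) a c)))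
    (swap₂₃∈ (swap₁₂∈ (vieta∈ (swap₁₂∈ x∈))))

  dot-one : ∀ b c → dot 𝔽 one (b , c) ≡ b
  dot-one = solve 2 (λ b c → con (⁺ 1) :* b :+ con (⁺ 0) :* c := b) refl

  seq : F → F → F → ℕ → F
  seq a b c k = dot 𝔽 (pow (tr a) k) (b , c)

  seq∈ : ∀ k {a b c} → (a , b , c) ∈ O → (a , seq a b c k , seq a b c (suc k)) ∈ O
  seq∈ zero {a} {b} {c} x∈ = subst₂ (λ y z → (a , y , z) ∈ O) (sym (dot-one b c)) (sym (dot-step (tr a) one b c ⨾ dot-one c _)) x∈
  seq∈ (suc k) {a} {b} {c} x∈ = subst₂ (λ y z → (a , y , z) ∈ O) (sym (dot-step (tr a) (pow (tr a) k) b c)) (sym (dot-step (tr a) (pow (tr a) (suc k)) b c))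
    (seq∈ k (rotate∈ x∈))

  seq-shift : ∀ a m i b c → seq a b c (m + i) ≡ seq a (seq a b c i) (seq a b c (suc i)) m
  seq-shift a m zero b c = cong (seq a b c) (+-identityʳ m)
    ⨾ cong₂ (λ y z → seq a y z m) (sym (dot-one b c)) (sym (dot-step (tr a) one b c ⨾ dot-one c _))
  seq-shift a m (suc i) b c = cong (seq a b c) (+-suc m i) ⨾ dot-step (tr a) (pow (tr a) (m + i)) b c
    ⨾ seq-shift a m i c (tr a ⊗ c ⊟ b)
    ⨾ cong₂ (λ y z → seq a y z m) (sym (dot-step (tr a) (pow (tr a) i) b c)) (sym (dot-step (tr a) (pow (tr a) (suc i)) b c))

  annihilator : ∀ d x y → (x , y) ≢ (𝟘 , 𝟘) → d ⊗ x ≡ 𝟘 → d ⊗ y ≡ 𝟘 → d ≡ 𝟘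
  annihilator d x y ≢0 dx dy with no-zero-divisors dx | no-zero-divisors dy
  ... | inj₁ d≡0 | _        = d≡0
  ... | inj₂ _   | inj₁ d≡0 = d≡0
  ... | inj₂ x≡0 | inj₂ y≡0 = ⊥-elim (≢0 (cong₂ _,_ x≡0 y≡0))

  cancel-zero : ∀ d x → d ≢ 𝟘 → d ⊗ x ≡ 𝟘 → x ≡ 𝟘
  cancel-zero d x d≢0 e with no-zero-divisors e
  ... | inj₁ d≡0 = ⊥-elim (d≢0 d≡0)
  ... | inj₂ x≡0 = x≡0

  -- det (θ^m − 1) = norm − trace + 1
  fixed-vector : ∀ t e x y → norm t e ≡ 𝟏 → disc t ≢ 𝟘 → (x , y) ≢ (𝟘 , 𝟘) → dot 𝔽 e (x , y) ≡ x → dot 𝔽 (step t e) (x , y) ≡ y → e ≡ one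
  fixed-vector t (u , v) x y n≡1 D≢0 ≢0 e₁ e₂ = cong₂ _,_ u≡1 v≡0
    where
    δ : F
    δ = norm t (u , v) ⊟ trace t (u , v) ⊕ 𝟏
    δx : δ ⊗ x ≡ 𝟘
    δx = solve 5 (λ t u v x y → (u :* u :+ t :* (u :* v) :+ v :* v :- (con (⁺ 2) :* u :+ t :* v) :+ con (⁺ 1)) :* x
          := (u :+ t :* v :- con (⁺ 1)) :* ((u :* x :+ v :* y) :- x) :- v :* (((:- v) :* x :+ (u :+ t :* v) :* y) :- y)) refl t u v x y
      ⨾ cong₂ (λ a b → (u ⊕ t ⊗ v ⊟ 𝟏) ⊗ a ⊟ v ⊗ b) (≡⇒⊟≡𝟘 e₁) (≡⇒⊟≡𝟘 e₂)
      ⨾ solve 2 (λ a b → a :* con (⁺ 0) :- b :* con (⁺ 0) := con (⁺ 0)) refl (u ⊕ t ⊗ v ⊟ 𝟏) v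
    δy : δ ⊗ y ≡ 𝟘
    δy = solve 5 (λ t u v x y → (u :* u :+ t :* (u :* v) :+ v :* v :- (con (⁺ 2) :* u :+ t :* v) :+ con (⁺ 1)) :* y
          := (u :- con (⁺ 1)) :* (((:- v) :* x :+ (u :+ t :* v) :* y) :- y) :+ v :* ((u :* x :+ v :* y) :- x)) refl t u v x y
      ⨾ cong₂ (λ a b → (u ⊟ 𝟏) ⊗ a ⊕ v ⊗ b) (≡⇒⊟≡𝟘 e₂) (≡⇒⊟≡𝟘 e₁)
      ⨾ solve 2 (λ a b → a :* con (⁺ 0) :+ b :* con (⁺ 0) := con (⁺ 0)) refl (u ⊟ 𝟏) v
    δ≡0 : δ ≡ 𝟘
    δ≡0 = annihilator δ x y ≢0 δx δy
    trace≡2 : trace t (u , v) ≡ lit 2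
    trace≡2 = lem (norm t (u , v)) (trace t (u , v)) n≡1 δ≡0
      where
      lem : ∀ n τ → n ≡ 𝟏 → n ⊟ τ ⊕ 𝟏 ≡ 𝟘 → τ ≡ lit 2
      lem n τ refl e = solve 1 (λ τ → τ := con (⁺ 2) :- (con (⁺ 1) :- τ :+ con (⁺ 1))) refl τ ⨾ cong (lit 2 ⊟_) e ⨾ solve 0 (con (⁺ 2) :- con (⁺ 0) := con (⁺ 2)) refl
    v≡0 : v ≡ 𝟘
    v≡0 = square≡𝟘 (cancel-zero (disc t) (v ⊗ v) D≢0 (trace² t (u , v) n≡1 ⨾ cong (λ τ → τ ⊗ τ ⊟ lit 4) trace≡2
      ⨾ solve 0 (con (⁺ 2) :* con (⁺ 2) :- con (⁺ 4) := con (⁺ 0)) refl))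
    u≡1 : u ≡ 𝟏
    u≡1 = cancelˡ 2≢0 (solve 3 (λ t u v → con (⁺ 2) :* u := (con (⁺ 2) :* u :+ t :* v) :- t :* v) refl t u v
      ⨾ cong₂ (λ a b → a ⊟ t ⊗ b) trace≡2 v≡0 ⨾ solve 1 (λ t → con (⁺ 2) :- t :* con (⁺ 0) := con (⁺ 2) :* con (⁺ 1)) refl t)

  α ω : ℕ
  α = length A
  ω = length O

  slice : F → List Point
  slice a = filter (λ x → proj₁ x ≟ᶠ a) O

  u-slice : ∀ a → Unique (slice a)
  u-slice a = Uniq.filter⁺ _ unique

  ∈-slice : ∀ {a x} → x ∈ slice a → x ∈ O × proj₁ x ≡ a
  ∈-slice {a} = ∈-filter⁻ (λ x → proj₁ x ≟ᶠ a) {xs = O}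

  two-thirds : ∀ {a b c c′} → Markoff (a , b , c) → Markoff (a , b , c′) → c′ ≡ c ⊎ c′ ≡ lit 3 ⊗ (a ⊗ b) ⊟ c
  two-thirds {a} {b} {c} {c′} e e′ = Sum.map ⊟≡𝟘⇒≡ (λ h → solve 3 (λ n c c′ → c′ := (c′ :- (n :- c)) :+ (n :- c)) refl n c c′ ⨾ cong (_⊕ (n ⊟ c)) h ⨾ ⊕-identityˡ _)
    (no-zero-divisors {c′ ⊟ c} {c′ ⊟ (n ⊟ c)}
      (solve 5 (λ t a b c c′ → (c′ :- c) :* (c′ :- (t :* (a :* b) :- c)) := (a :* a :+ b :* b :+ c′ :* c′ :- t :* (a :* (b :* c′))) :- (a :* a :+ b :* b :+ c :* c :- t :* (a :* (b :* c)))) refl (lit 3) a b c c′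
       ⨾ cong₂ _⊟_ (≡⇒⊟≡𝟘 e′) (≡⇒⊟≡𝟘 e) ⨾ ⊝-inverseʳ 𝟘))
    where n = lit 3 ⊗ (a ⊗ b)

  -- Fixing a and b leaves a quadratic equation for the third coordinate, whose roots are exchanged
  -- by a Vieta involution.
  slice≤ : ∀ a {X} → (∀ {x} → x ∈ slice a → proj₁ (proj₂ x) ∈ X) → length (slice a) ≤ length X * 2
  slice≤ a {X} into = fibre-upper _≟ᶠ_ (λ x → proj₁ (proj₂ x)) into λ {b} _ →
    at-most-two (λ { (a , b , c) → a , b , lit 3 ⊗ (a ⊗ b) ⊟ c }) (Uniq.filter⁺ _ (u-slice a)) (λ x∈ y∈ → pair b (mem b x∈) (mem b y∈))
    where
    mem : ∀ b {x} → x ∈ filter (λ x → proj₁ (proj₂ x) ≟ᶠ b) (slice a) → x ∈ O × proj₁ x ≡ a × proj₁ (proj₂ x) ≡ b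
    mem b x∈ = let x∈s , eb = ∈-filter⁻ (λ x → proj₁ (proj₂ x) ≟ᶠ b) {xs = slice a} x∈
                   x∈O , ea = ∈-slice x∈s in x∈O , ea , eb
    pair : ∀ b {x y} → x ∈ O × proj₁ x ≡ a × proj₁ (proj₂ x) ≡ b → y ∈ O × proj₁ y ≡ a × proj₁ (proj₂ y) ≡ b →
           y ≡ x ⊎ y ≡ (proj₁ x , proj₁ (proj₂ x) , lit 3 ⊗ (proj₁ x ⊗ proj₁ (proj₂ x)) ⊟ proj₂ (proj₂ x))
    pair b {_ , _ , c} {_ , _ , c′} (x∈ , refl , refl) (y∈ , refl , refl) = Sum.map (cong (λ z → a , b , z)) (cong (λ z → a , b , z)) (two-thirds (markoff x∈) (markoff y∈))

  slice≤2α : ∀ a → length (slice a) ≤ α * 2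
  slice≤2α a = slice≤ a (λ x∈ → second∈A (proj₁ (∈-slice x∈)))

  ω≤2α² : ω ≤ α * (α * 2)
  ω≤2α² = fibre-upper _≟ᶠ_ proj₁ first∈A (λ {a} _ → slice≤2α a)

  -- The first n rotations of one point of the slice are distinct, because a power of θ that fixes a
  -- nonzero vector is the identity. The vector is nonzero since b = c = 0 would force a = 0.
  slice≥order : ∀ {a n} → a ∈ A → disc (tr a) ≢ 𝟘 → IsOrder (tr a) n → n ≤ length (slice a)
  slice≥order {a} {n} a∈ D≢0 ord = subst (_≤ length (slice a)) (length-upTo n) (length-inj {f = f} (Uniq.upTo⁺ n) into inj)
    where
    b = proj₁ (A⁻ a∈)
    c = proj₁ (proj₂ (A⁻ a∈))
    x∈ = proj₂ (proj₂ (A⁻ a∈))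
    f : ℕ → Point
    f k = a , seq a b c k , seq a b c (suc k)
    into : ∀ {k} → k ∈ upTo n → f k ∈ slice a
    into {k} _ = ∈-filter⁺ (λ x → proj₁ x ≟ᶠ a) (seq∈ k x∈) refl
    v≢0 : ∀ i → (seq a b c i , seq a b c (suc i)) ≢ (𝟘 , 𝟘)
    v≢0 i eq = nonzero (seq∈ i x∈) (cong₂ _,_ (a≡0 _ _ (markoff (seq∈ i x∈)) (cong proj₁ eq) (cong proj₂ eq)) eq)
      where
      a≡0 : ∀ y z → Markoff (a , y , z) → y ≡ 𝟘 → z ≡ 𝟘 → a ≡ 𝟘
      a≡0 y z e refl refl = square≡𝟘 (solve 1 (λ a → a :* a := a :* a :+ con (⁺ 0) :* con (⁺ 0) :+ con (⁺ 0) :* con (⁺ 0)) refl a ⨾ e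
        ⨾ solve 1 (λ a → con (⁺ 3) :* (a :* (con (⁺ 0) :* con (⁺ 0))) := con (⁺ 0)) refl a)
    inj< : ∀ {i j} → i < j → j < n → f i ≢ f j
    inj< {i} {j} i<j j<n eq = pow-small ord (m<n⇒0<n∸m i<j) (≤-<-trans (m∸n≤m j i) j<n)
      (fixed-vector (tr a) (pow (tr a) m) _ _ (norm-pow (tr a) m) D≢0 (v≢0 i)
        (sym (seq-shift a m i b c) ⨾ cong (seq a b c) m+i≡j ⨾ cong (λ x → proj₁ (proj₂ x)) (sym eq))
        (sym (seq-shift a (suc m) i b c) ⨾ cong (seq a b c) (cong suc m+i≡j) ⨾ cong (λ x → proj₂ (proj₂ x)) (sym eq)))
      where
      m = j ∸ i
      m+i≡j : m + i ≡ j
      m+i≡j = m∸n+n≡m (<⇒≤ i<j)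
    inj : ∀ {i j} → i ∈ upTo n → j ∈ upTo n → f i ≡ f j → i ≡ j
    inj {i} {j} i∈ j∈ eq = compare (<-cmp i j)
      where
      compare : Tri (i < j) (i ≡ j) (j < i) → i ≡ j
      compare (tri< i<j _ _) = ⊥-elim (inj< i<j (∈-upTo⁻ j∈) eq)
      compare (tri≈ _ i≡j _) = i≡j
      compare (tri> _ _ j<i) = ⊥-elim (inj< j<i (∈-upTo⁻ i∈) (sym eq))

  m : ℕ
  m = q * (q + 2)

  1≤m : 1 ≤ m
  1≤m = *-mono-≤ 1≤q (≤-trans 1≤q (m≤m+n q 2))

  abstract
    -- The number depends on a alone; the proof that it is the order comes afterwards. It is a
    -- placeholder 0 if the discriminant vanishes.
    order : ∀ a → Σ ℕ λ n → disc (tr a) ≢ 𝟘 → IsOrder (tr a) n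
    order a = go (disc (tr a) ≟ᶠ 𝟘)
      where
      go : Dec (disc (tr a) ≡ 𝟘) → Σ ℕ λ n → disc (tr a) ≢ 𝟘 → IsOrder (tr a) n
      go (yes D≡0) = 0 , λ D≢0 → ⊥-elim (D≢0 D≡0)
      go (no D≢0)  = let n , ord = order-exists (tr a) m 1≤m (order-divides D≢0) in n , λ _ → ord

  ordOf : F → ℕ
  ordOf a = proj₁ (order a)

  isOrder : ∀ {a} → disc (tr a) ≢ 𝟘 → IsOrder (tr a) (ordOf a)
  isOrder {a} = proj₂ (order a)

  ordOf∈ : ∀ {a} → disc (tr a) ≢ 𝟘 → ordOf a ∈ divisors m
  ordOf∈ D≢0 = ∈-divisors⁺ 1≤m (proj₂ (proj₂ (isOrder D≢0)) m (order-divides D≢0))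

  regular? : ∀ a → Dec (disc (tr a) ≢ 𝟘)
  regular? a = ¬? (disc (tr a) ≟ᶠ 𝟘)

  -- The discriminant vanishes exactly if 9 a² = 4, which leaves two opposite values.
  irregular≤2 : ∀ {X} → Unique X → length (filter (¬? ∘ regular?) X) ≤ 2
  irregular≤2 {X} uX = at-most-two ⊝_ (Uniq.filter⁺ _ uX) (λ x∈ y∈ → Sum.map sym (λ e → solve 1 (λ y → y := :- (:- y)) refl _ ⨾ cong ⊝_ (sym e)) (squares-≡ (nine (zero-disc x∈) (zero-disc y∈))))
    where
    zero-disc : ∀ {x} → x ∈ filter (¬? ∘ regular?) X → disc (tr x) ≡ 𝟘
    zero-disc {x} x∈ = decidable-stable (disc (tr x) ≟ᶠ 𝟘) (proj₂ (∈-filter⁻ (¬? ∘ regular?) {xs = X} x∈))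
    nine : ∀ {x y} → disc (tr x) ≡ 𝟘 → disc (tr y) ≡ 𝟘 → x ⊗ x ≡ y ⊗ y
    nine {x} {y} e e′ = cancelˡ {lit 3 ⊗ lit 3} (⊗-≢𝟘 3≢0 3≢0)
      (solve 1 (λ x → con (⁺ 3) :* con (⁺ 3) :* (x :* x) := ((con (⁺ 3) :* x) :* (con (⁺ 3) :* x) :- con (⁺ 4)) :+ con (⁺ 4)) refl x
       ⨾ cong (_⊕ lit 4) (e ⨾ sym e′)
       ⨾ solve 1 (λ x → ((con (⁺ 3) :* x) :* (con (⁺ 3) :* x) :- con (⁺ 4)) :+ con (⁺ 4) := con (⁺ 3) :* con (⁺ 3) :* (x :* x)) refl y)

  tr-injective : ∀ {a a′} → tr a ≡ tr a′ → a ≡ a′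
  tr-injective = cancelˡ 3≢0

  same-order-count : ∀ n {X} → Unique X → (∀ {a} → a ∈ X → disc (tr a) ≢ 𝟘 × ordOf a ≡ n) → length X ≤ n
  same-order-count n {[]} _ _ = z≤n
  same-order-count n {X@(x ∷ _)} uX h = subst (_≤ n) (length-map tr X)
    (order-count 1≤n (map-unique (λ _ _ → tr-injective) uX) root)
    where
    1≤n : 1 ≤ n
    1≤n = subst (1 ≤_) (proj₂ (h (here refl))) (proj₁ (isOrder (proj₁ (h (here refl)))))
    root : ∀ {t} → t ∈ map tr X → pow t n ≡ one
    root t∈ with a , a∈ , refl ← ∈-map⁻ tr t∈ = cong (pow (tr a)) (sym (proj₂ (h a∈))) ⨾ proj₁ (proj₂ (isOrder (proj₁ (h a∈))))

  τ₀ : ℕ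
  τ₀ = τ m

  1≤τ₀ : 1 ≤ τ₀
  1≤τ₀ = ∈-length (∈-divisors⁺ 1≤m (1∣ m))

  -- Only `τ₀` orders occur, and each order n ≤ x belongs to at most n coordinates.
  small-orders : ∀ x {X} → Unique X → (∀ {a} → a ∈ X → disc (tr a) ≢ 𝟘 × ordOf a ≤ x) → length X ≤ τ₀ * x
  small-orders x {X} uX h = fibre-upper _≟_ ordOf (λ a∈ → ordOf∈ (proj₁ (h a∈))) (λ {n} _ → bound n (n ≤? x))
    where
    fib : ℕ → List F
    fib n = filter (λ a → ordOf a ≟ n) X
    mem : ∀ n {a} → a ∈ fib n → a ∈ X × ordOf a ≡ n
    mem n = ∈-filter⁻ (λ a → ordOf a ≟ n) {xs = X}
    bound : ∀ n → Dec (n ≤ x) → length (fib n) ≤ x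
    bound n (yes n≤x) = ≤-trans (same-order-count n (Uniq.filter⁺ _ uX) (λ a∈ → proj₁ (h (proj₁ (mem n a∈))) , proj₂ (mem n a∈))) n≤x
    bound n (no n≰x) = ≤-trans (unique-⊆-length {ys = []} (Uniq.filter⁺ (λ a → ordOf a ≟ n) uX)
      (λ a∈ → ⊥-elim (n≰x (subst (_≤ x) (proj₂ (mem n a∈)) (proj₂ (h (proj₁ (mem n a∈)))))))) z≤n

-- Linear forms with values in the coordinate set

module LargeOrbit {q : ℕ} (𝔽 : PrimeField (suc q)) (1≤q : 1 ≤ q) (2≢0 : FieldTheory.lit 𝔽 2 ≢ PrimeField.𝟘 𝔽) (3≢0 : FieldTheory.lit 𝔽 3 ≢ PrimeField.𝟘 𝔽)
  (O : List (PrimeField.F 𝔽 × PrimeField.F 𝔽 × PrimeField.F 𝔽)) (inv-O : MarkoffOrbits.Invariant 𝔽 O)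
  {x₀ : PrimeField.F 𝔽 × PrimeField.F 𝔽 × PrimeField.F 𝔽} (x₀∈O : x₀ ∈ O)
  (K : ℕ) (K≡ : τ (q * (q + 2)) * τ (q * (q + 2)) * (τ (q * (q + 2)) * τ (q * (q + 2))) * 8192 ≡ K) where
  open FieldTheory 𝔽
  open Rotations 𝔽 2≢0
  open MarkoffOrbits 𝔽
  open Invariant inv-O
  open OrbitSlices 𝔽 1≤q 2≢0 3≢0 O inv-O
  open ≤-Reasoning

  τ⁴ : ℕ
  τ⁴ = τ₀ * τ₀ * (τ₀ * τ₀)

  -- 8192 = 512 · 16: the factor 512 τ⁴ is lost between α and the popular order n in `α≤512τ⁴n`, and
  -- 16 between n and L = ⌊n / 8⌋ in `n≤16L`.
  K≡8192τ⁴ : τ⁴ * 8192 ≡ K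
  K≡8192τ⁴ = K≡

  instance
    τ₀-nonZero : NonZero τ₀
    τ₀-nonZero = >-nonZero 1≤τ₀

    8τ₀-nonZero : NonZero (8 * τ₀)
    8τ₀-nonZero = m*n≢0 8 τ₀

  module _ (K≤α : K ≤ α) where

    τ₀≤τ⁴ : τ₀ ≤ τ⁴
    τ₀≤τ⁴ = ≤-trans (m≤m*n τ₀ τ₀) (m≤m*n (τ₀ * τ₀) (τ₀ * τ₀) ⦃ m*n≢0 τ₀ τ₀ ⦄)

    1024τ³≤α : τ₀ * τ₀ * τ₀ * 1024 ≤ α
    1024τ³≤α = begin
      τ₀ * τ₀ * τ₀ * 1024       ≤⟨ *-mono-≤ (≤-trans (m≤m*n (τ₀ * τ₀ * τ₀) τ₀) (≤-reflexive (*-assoc (τ₀ * τ₀) τ₀ τ₀))) (m≤m+n 1024 7168) ⟩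
      τ⁴ * 8192                 ≡⟨ K≡8192τ⁴ ⟩
      K                         ≤⟨ K≤α ⟩
      α                         ∎

    2+16τ₀<α : 2 + τ₀ * 16 < α
    2+16τ₀<α = begin-strict
      2 + τ₀ * 16            <⟨ +-monoˡ-< (τ₀ * 16) (s≤s (s≤s (s≤s (z≤n {0})))) ⟩
      3 + τ₀ * 16            ≤⟨ +-monoˡ-≤ (τ₀ * 16) (m≤n*m 3 τ₀) ⟩
      τ₀ * 3 + τ₀ * 16       ≡⟨ sym (*-distribˡ-+ τ₀ 3 16) ⟩
      τ₀ * 19                ≤⟨ *-mono-≤ τ₀≤τ⁴ (m≤m+n 19 8173) ⟩
      τ⁴ * 8192              ≡⟨ K≡8192τ⁴ ⟩
      K                      ≤⟨ K≤α ⟩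
      α                      ∎

    A* : List F
    A* = filter regular? A

    α≤2+A* : α ≤ 2 + length A*
    α≤2+A* = begin
      α                                                      ≡⟨ length-filter-split regular? A ⟩
      length A* + length (filter (¬? ∘ regular?) A)          ≤⟨ +-monoʳ-≤ (length A*) (irregular≤2 uA) ⟩
      length A* + 2                                          ≡⟨ +-comm (length A*) 2 ⟩
      2 + length A*                                          ∎

    abstract
      -- The coordinate of largest order d shows that the invariant set has nearly α² points. Its
      -- slice supplies at least d / 2 further coordinates; most of these have order at least about
      -- d / τ₀, hence slices of that size. By `small-orders`, d is at least about α / τ₀.
      largest : ∃ λ a → a ∈ A* × (∀ {b} → b ∈ A* → ordOf b ≤ ordOf a)
      largest = argmax ordOf A* (n≢0⇒n>0 λ eq → <⇒≱ 2+16τ₀<α (≤-trans α≤2+A* (≤-trans (≤-reflexive (cong (λ k → 2 + k) eq)) (m≤m+n 2 (τ₀ * 16)))))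

    a* : F
    a* = proj₁ largest

    a*∈ : a* ∈ A × disc (tr a*) ≢ 𝟘
    a*∈ = ∈-filter⁻ regular? {xs = A} (proj₁ (proj₂ largest))

    d : ℕ
    d = ordOf a*

    α≤2+τd : α ≤ 2 + τ₀ * d
    α≤2+τd = ≤-trans α≤2+A* (+-monoʳ-≤ 2 (small-orders d (Uniq.filter⁺ _ uA)
      (λ {a} a∈ → proj₂ (∈-filter⁻ regular? {xs = A} a∈) , proj₂ (proj₂ largest) a∈)))

    16≤d : 16 ≤ d
    16≤d = ≮⇒≥ λ d<16 → <⇒≱ 2+16τ₀<α (≤-trans α≤2+τd (+-monoʳ-≤ 2 (*-monoʳ-≤ τ₀ (<⇒≤ d<16))))

    B : List F
    B = deduplicate _≟ᶠ_ (map (λ x → proj₁ (proj₂ x)) (slice a*))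

    uB : Unique B
    uB = UniqDec.deduplicate-! _≟ᶠ_ _

    B⊆A : ∀ {b} → b ∈ B → b ∈ A
    B⊆A b∈ with y , y∈ , refl ← ∈-map⁻ (λ x → proj₁ (proj₂ x)) (∈-deduplicate⁻ _≟ᶠ_ (map (λ x → proj₁ (proj₂ x)) (slice a*)) b∈) = second∈A (proj₁ (∈-slice y∈))

    d≤2B : d ≤ length B * 2
    d≤2B = ≤-trans (slice≥order (proj₁ a*∈) (proj₂ a*∈) (isOrder (proj₂ a*∈)))
      (slice≤ a* (λ y∈ → ∈-deduplicate⁺ _≟ᶠ_ (∈-map⁺ (λ x → proj₁ (proj₂ x)) y∈)))

    -- At most τ₀ x ≤ d / 8 regular coordinates have order at most x, so discarding them and the
    -- irregular ones leaves d / 4 of the d / 2 elements of `B`.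
    x : ℕ
    x = d / (8 * τ₀)

    8τx≤d : 8 * (τ₀ * x) ≤ d
    8τx≤d = ≤-trans (≤-reflexive (lem τ₀ x)) (m/n*n≤m d (8 * τ₀))
      where
      lem : ∀ t x → 8 * (t * x) ≡ x * (8 * t)
      lem = solve-∀

    d≤8τsx : d ≤ 8 * τ₀ * suc x
    d≤8τsx = begin
      d                                    ≡⟨ m≡m%n+[m/n]*n d (8 * τ₀) ⟩
      d % (8 * τ₀) + x * (8 * τ₀)          ≤⟨ +-monoˡ-≤ (x * (8 * τ₀)) (<⇒≤ (m%n<n d (8 * τ₀))) ⟩
      8 * τ₀ + x * (8 * τ₀)                ≡⟨ *-comm (suc x) (8 * τ₀) ⟩
      8 * τ₀ * suc x                       ∎

    Bᵣ B′ B″ : List F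
    Bᵣ = filter regular? B
    B′ = filter (λ b → x <? ordOf b) Bᵣ
    B″ = filter (¬? ∘ (λ b → x <? ordOf b)) Bᵣ

    B≤ : length B ≤ length B′ + (τ₀ * x + 2)
    B≤ = begin
      length B                                           ≡⟨ length-filter-split regular? B ⟩
      length Bᵣ + length (filter (¬? ∘ regular?) B)      ≤⟨ +-mono-≤ (≤-reflexive (length-filter-split (λ b → x <? ordOf b) Bᵣ)) (irregular≤2 uB) ⟩
      length B′ + length B″ + 2                          ≤⟨ +-monoˡ-≤ 2 (+-monoʳ-≤ (length B′) (small-orders x (Uniq.filter⁺ _ (Uniq.filter⁺ _ uB)) low)) ⟩
      length B′ + τ₀ * x + 2                             ≡⟨ +-assoc (length B′) (τ₀ * x) 2 ⟩
      length B′ + (τ₀ * x + 2)                           ∎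
      where
      low : ∀ {b} → b ∈ B″ → disc (tr b) ≢ 𝟘 × ordOf b ≤ x
      low b∈ = let b∈r , ≮ = ∈-filter⁻ (¬? ∘ (λ b → x <? ordOf b)) {xs = Bᵣ} b∈
               in proj₂ (∈-filter⁻ regular? {xs = B} b∈r) , ≮⇒≥ ≮

    d≤4B′ : d ≤ 4 * length B′
    d≤4B′ = *-cancelˡ-≤ 2 (+-cancelʳ-≤ (2 * d) _ _ (begin
      2 * d + 2 * d                                   ≡⟨ lem₁ d ⟩
      4 * d                                           ≤⟨ *-monoʳ-≤ 4 (≤-trans d≤2B (*-monoˡ-≤ 2 B≤)) ⟩
      4 * ((length B′ + (τ₀ * x + 2)) * 2)            ≡⟨ lem₂ (length B′) (τ₀ * x) ⟩
      2 * (4 * length B′) + (8 * (τ₀ * x) + 16)       ≤⟨ +-monoʳ-≤ (2 * (4 * length B′)) (+-mono-≤ 8τx≤d 16≤d) ⟩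
      2 * (4 * length B′) + (d + d)                   ≡⟨ lem₃ (2 * (4 * length B′)) d ⟩
      2 * (4 * length B′) + 2 * d                     ∎))
      where
      lem₁ : ∀ d → 2 * d + 2 * d ≡ 4 * d
      lem₁ = solve-∀
      lem₂ : ∀ b t → 4 * ((b + (t + 2)) * 2) ≡ 2 * (4 * b) + (8 * t + 16)
      lem₂ = solve-∀
      lem₃ : ∀ b d → b + (d + d) ≡ b + 2 * d
      lem₃ = solve-∀

    d²≤32τω : d * d ≤ 32 * τ₀ * ω
    d²≤32τω = begin
      d * d                          ≤⟨ *-monoˡ-≤ d d≤4B′ ⟩
      4 * length B′ * d              ≡⟨ *-assoc 4 (length B′) d ⟩
      4 * (length B′ * d)            ≤⟨ *-monoʳ-≤ 4 (fibre-lower proj₁ (8 * τ₀) {xs = O} (Uniq.filter⁺ _ (Uniq.filter⁺ _ uB)) fibre) ⟩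
      4 * (8 * τ₀ * ω)               ≡⟨ lem τ₀ ω ⟩
      32 * τ₀ * ω                    ∎
      where
      lem : ∀ t w → 4 * (8 * t * w) ≡ 32 * t * w
      lem = solve-∀
      fibre : ∀ {b} → b ∈ B′ → Σ (List Point) λ Z → Unique Z × (∀ {z} → z ∈ Z → z ∈ O × proj₁ z ≡ b) × d ≤ 8 * τ₀ * length Z
      fibre {b} b∈ = let b∈r , x<o = ∈-filter⁻ (λ b → x <? ordOf b) {xs = Bᵣ} b∈
                         b∈B , D≢0 = ∈-filter⁻ regular? {xs = B} b∈r
                     in slice b , u-slice b , ∈-slice ,
                        ≤-trans d≤8τsx (*-monoʳ-≤ (8 * τ₀) (≤-trans x<o (slice≥order (B⊆A b∈B) D≢0 (isOrder D≢0))))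

    α²≤128τ³ω : α * α ≤ 128 * (τ₀ * τ₀ * τ₀) * ω
    α²≤128τ³ω = begin
      α * α                               ≤⟨ *-mono-≤ α≤2τd α≤2τd ⟩
      2 * (τ₀ * d) * (2 * (τ₀ * d))       ≡⟨ lem₁ τ₀ d ⟩
      4 * (τ₀ * τ₀) * (d * d)             ≤⟨ *-monoʳ-≤ (4 * (τ₀ * τ₀)) d²≤32τω ⟩
      4 * (τ₀ * τ₀) * (32 * τ₀ * ω)       ≡⟨ lem₂ τ₀ ω ⟩
      128 * (τ₀ * τ₀ * τ₀) * ω            ∎
      where
      lem₁ : ∀ t d → 2 * (t * d) * (2 * (t * d)) ≡ 4 * (t * t) * (d * d)
      lem₁ = solve-∀
      lem₂ : ∀ t w → 4 * (t * t) * (32 * t * w) ≡ 128 * (t * t * t) * w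
      lem₂ = solve-∀
      α≤2τd : α ≤ 2 * (τ₀ * d)
      α≤2τd = ≤-trans α≤2+τd (≤-trans (+-monoˡ-≤ (τ₀ * d) (≤-trans (≤-trans (m≤m+n 2 14) 16≤d) (m≤n*m d τ₀)))
        (≤-reflexive (cong (λ k → τ₀ * d + k) (sym (+-identityʳ (τ₀ * d))))))

    -- This makes the irregular points negligible: they fill at most two slices of size 2 α, hence
    -- at most half of the points.
    8α≤ω : 8 * α ≤ ω
    8α≤ω = *-cancelˡ-≤ (128 * (τ₀ * τ₀ * τ₀)) ⦃ m*n≢0 128 (τ₀ * τ₀ * τ₀) ⦃ _ ⦄ ⦃ m*n≢0 (τ₀ * τ₀) τ₀ ⦃ m*n≢0 τ₀ τ₀ ⦄ ⦄ ⦄ (begin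
      128 * (τ₀ * τ₀ * τ₀) * (8 * α)      ≡⟨ lem (τ₀ * τ₀ * τ₀) α ⟩
      τ₀ * τ₀ * τ₀ * 1024 * α             ≤⟨ *-monoˡ-≤ α 1024τ³≤α ⟩
      α * α                               ≤⟨ α²≤128τ³ω ⟩
      128 * (τ₀ * τ₀ * τ₀) * ω            ∎)
      where
      lem : ∀ t a → 128 * t * (8 * a) ≡ t * 1024 * a
      lem = solve-∀

    O* : List Point
    O* = filter (regular? ∘ proj₁) O

    ω≤2O* : ω ≤ 2 * length O*
    ω≤2O* = +-cancelʳ-≤ ω _ _ (begin
      ω + ω                                         ≡⟨ lem₁ ω ⟩
      2 * ω                                         ≡⟨ cong (2 *_) (length-filter-split (regular? ∘ proj₁) O) ⟩
      2 * (length O* + length Oᵢ)                   ≤⟨ *-monoʳ-≤ 2 (+-monoʳ-≤ (length O*) few) ⟩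
      2 * (length O* + 2 * (α * 2))                 ≡⟨ lem₂ (length O*) α ⟩
      2 * length O* + 8 * α                         ≤⟨ +-monoʳ-≤ (2 * length O*) 8α≤ω ⟩
      2 * length O* + ω                             ∎)
      where
      Oᵢ = filter (¬? ∘ (regular? ∘ proj₁)) O
      lem₁ : ∀ w → w + w ≡ 2 * w
      lem₁ = solve-∀
      lem₂ : ∀ o a → 2 * (o + 2 * (a * 2)) ≡ 2 * o + 8 * a
      lem₂ = solve-∀
      few : length Oᵢ ≤ 2 * (α * 2)
      few = ≤-trans (fibre-upper _≟ᶠ_ proj₁ {ys = filter (¬? ∘ regular?) A} into (λ {a} _ → ≤-trans (sub a) (slice≤2α a)))
        (*-monoˡ-≤ (α * 2) (irregular≤2 uA))
        where
        mem : ∀ {y} → y ∈ Oᵢ → y ∈ O × ¬ (disc (tr (proj₁ y)) ≢ 𝟘)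
        mem = ∈-filter⁻ (¬? ∘ (regular? ∘ proj₁)) {xs = O}
        into : ∀ {y} → y ∈ Oᵢ → proj₁ y ∈ filter (¬? ∘ regular?) A
        into y∈ = ∈-filter⁺ (¬? ∘ regular?) (first∈A (proj₁ (mem y∈))) (proj₂ (mem y∈))
        sub : ∀ a → length (filter (λ y → proj₁ y ≟ᶠ a) Oᵢ) ≤ length (slice a)
        sub a = unique-⊆-length (Uniq.filter⁺ _ (Uniq.filter⁺ _ unique)) (λ y∈ →
          let y∈i , e = ∈-filter⁻ (λ y → proj₁ y ≟ᶠ a) {xs = Oᵢ} y∈ in ∈-filter⁺ (λ y → proj₁ y ≟ᶠ a) (proj₁ (mem y∈i)) e)

    abstract
      popular-order : ∃ λ n → n ∈ divisors m × length O* ≤ τ₀ * length (filter (λ y → ordOf (proj₁ y) ≟ n) O*)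
      popular-order = pigeonhole _≟_ (ordOf ∘ proj₁) O* (divisors m) (λ y∈ → ordOf∈ (proj₂ (∈-filter⁻ (regular? ∘ proj₁) {xs = O} y∈))) 1≤τ₀

    n : ℕ
    n = proj₁ popular-order

    Oₙ : List Point
    Oₙ = filter (λ y → ordOf (proj₁ y) ≟ n) O*

    uOₙ : Unique Oₙ
    uOₙ = Uniq.filter⁺ _ (Uniq.filter⁺ _ unique)

    ∈-Oₙ : ∀ {y} → y ∈ Oₙ → y ∈ O × disc (tr (proj₁ y)) ≢ 𝟘 × ordOf (proj₁ y) ≡ n
    ∈-Oₙ y∈ = let y∈* , e = ∈-filter⁻ (λ y → ordOf (proj₁ y) ≟ n) {xs = O*} y∈
                  y∈O , r = ∈-filter⁻ (regular? ∘ proj₁) {xs = O} y∈*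
              in y∈O , r , e

    ω≤2τOₙ : ω ≤ 2 * τ₀ * length Oₙ
    ω≤2τOₙ = ≤-trans ω≤2O* (≤-trans (*-monoʳ-≤ 2 (proj₂ (proj₂ popular-order))) (≤-reflexive (sym (*-assoc 2 τ₀ (length Oₙ)))))

    Oₙ≤2αn : length Oₙ ≤ n * (α * 2)
    Oₙ≤2αn = ≤-trans (fibre-upper _≟ᶠ_ proj₁ {ys = Aₙ} into (λ {a} _ → ≤-trans (sub a) (slice≤2α a)))
        (*-monoˡ-≤ (α * 2) (same-order-count n (Uniq.filter⁺ _ uA) (λ {a} a∈ → proj₂ (∈-filter⁻ sel? {xs = A} a∈))))
      where
      sel? : ∀ a → Dec (disc (tr a) ≢ 𝟘 × ordOf a ≡ n)
      sel? a = regular? a ×-dec (ordOf a ≟ n)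
      Aₙ = filter sel? A
      into : ∀ {y} → y ∈ Oₙ → proj₁ y ∈ Aₙ
      into y∈ = let y∈O , re = ∈-Oₙ y∈ in ∈-filter⁺ sel? (first∈A y∈O) re
      sub : ∀ a → length (filter (λ y → proj₁ y ≟ᶠ a) Oₙ) ≤ length (slice a)
      sub a = unique-⊆-length (Uniq.filter⁺ _ uOₙ) (λ y∈ →
        let y∈i , e = ∈-filter⁻ (λ y → proj₁ y ≟ᶠ a) {xs = Oₙ} y∈ in ∈-filter⁺ (λ y → proj₁ y ≟ᶠ a) (proj₁ (∈-Oₙ y∈i)) e)

    1≤α : 1 ≤ α
    1≤α = ∈-length (first∈A x₀∈O)

    -- At most n coordinates have order n, each with a slice of size at most 2 α. Nearly α² points
    -- can lie over them only if n is itself nearly α.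
    α≤512τ⁴n : α ≤ τ⁴ * 512 * n
    α≤512τ⁴n = *-cancelˡ-≤ α ⦃ >-nonZero 1≤α ⦄ (begin
      α * α                                                     ≤⟨ α²≤128τ³ω ⟩
      128 * (τ₀ * τ₀ * τ₀) * ω                                  ≤⟨ *-monoʳ-≤ (128 * (τ₀ * τ₀ * τ₀)) (≤-trans ω≤2τOₙ (*-monoʳ-≤ (2 * τ₀) Oₙ≤2αn)) ⟩
      128 * (τ₀ * τ₀ * τ₀) * (2 * τ₀ * (n * (α * 2)))           ≡⟨ lem τ₀ n α ⟩
      α * (τ⁴ * 512 * n)                                        ∎)
      where
      lem : ∀ t n a → 128 * (t * t * t) * (2 * t * (n * (a * 2))) ≡ a * (t * t * (t * t) * 512 * n)
      lem = solve-∀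

    abstract
      base : ∃ λ y → y ∈ Oₙ
      base = go Oₙ (λ e → <⇒≱ (∈-length x₀∈O) (≤-trans ω≤2τOₙ (≤-reflexive (cong (2 * τ₀ *_) e ⨾ *-zeroʳ (2 * τ₀)))))
        where
        go : (X : List Point) → length X ≢ 0 → ∃ λ y → y ∈ X
        go []      h = ⊥-elim (h refl)
        go (y ∷ X) _ = y , here refl

    t₀ : F
    t₀ = tr (proj₁ (proj₁ base))

    E≢0 : disc t₀ ≢ 𝟘
    E≢0 = proj₁ (proj₂ (∈-Oₙ (proj₂ base)))

    ord₀ : IsOrder t₀ n
    ord₀ = subst (IsOrder t₀) (proj₂ (proj₂ (∈-Oₙ (proj₂ base)))) (isOrder E≢0)

    abstract
      -- The exponent is found by a search, so that it is a function of a and ψ is well defined; the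
      -- value 0 is returned only when the search fails, which the two hypotheses exclude by
      -- `same-order`.
      exponent : ∀ a → Σ ℕ λ l → disc (tr a) ≢ 𝟘 → ordOf a ≡ n → trace (tr a) (pow (tr a) l) ≡ t₀
      exponent a = go (anyUpTo? (λ l → trace (tr a) (pow (tr a) l) ≟ᶠ t₀) n)
        where
        go : Dec (∃ λ l → l < n × trace (tr a) (pow (tr a) l) ≡ t₀) → Σ ℕ λ l → disc (tr a) ≢ 𝟘 → ordOf a ≡ n → trace (tr a) (pow (tr a) l) ≡ t₀
        go (yes (l , _ , e)) = l , λ _ _ → e
        go (no none) = 0 , λ D≢0 o≡n →
          let l , _ , 2l<n , e = same-order D≢0 (subst (IsOrder (tr a)) o≡n (isOrder D≢0)) (proj₁ (proj₂ ord₀))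
          in ⊥-elim (none (l , ≤-<-trans (m≤m+n l l) 2l<n , e))

    el : F → F × F
    el a = pow (tr a) (proj₁ (exponent a))

    -- The second entry is the term l rotations after b, where l is the exponent of a. The pair
    -- therefore consists of neighbouring terms of a sequence with parameter `t₀`, whatever a is.
    ψ : Point → F × F
    ψ (a , b , c) = b , dot 𝔽 (el a) (b , c)

    el-trace : ∀ {a} → disc (tr a) ≢ 𝟘 → ordOf a ≡ n → trace (tr a) (el a) ≡ t₀
    el-trace {a} = proj₂ (exponent a)

    -- b² + y² − t₀ b y = − (disc t₀ / disc t) a² for y = ψ₂, so (b , y) determines a².
    form-value : ∀ t a u v b c → norm t (u , v) ≡ 𝟏 → b ⊗ b ⊕ c ⊗ c ⊟ t ⊗ (b ⊗ c) ≡ ⊝ (a ⊗ a) →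
                 ∀ {s y} → trace t (u , v) ≡ s → dot 𝔽 (u , v) (b , c) ≡ y →
                 disc t ⊗ (b ⊗ b ⊕ y ⊗ y ⊟ s ⊗ (b ⊗ y)) ≡ ⊝ (disc s ⊗ (a ⊗ a))
    form-value t a u v b c n≡1 e refl refl =
      cong (disc t ⊗_) (expand t u v b c ⨾ cong (λ n → v ⊗ v ⊗ (b ⊗ b ⊕ c ⊗ c ⊟ t ⊗ (b ⊗ c)) ⊕ (b ⊗ b) ⊗ (𝟏 ⊟ n)) n≡1
        ⨾ cong (λ w → v ⊗ v ⊗ w ⊕ (b ⊗ b) ⊗ (𝟏 ⊟ 𝟏)) e)
      ⨾ solve 4 (λ D v a b → D :* (v :* v :* (:- (a :* a)) :+ (b :* b) :* (con (⁺ 1) :- con (⁺ 1))) := :- ((D :* (v :* v)) :* (a :* a))) refl (disc t) v a b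
      ⨾ cong (λ w → ⊝ (w ⊗ (a ⊗ a))) (trace² t (u , v) n≡1)
      where
      expand : ∀ t u v b c → b ⊗ b ⊕ (u ⊗ b ⊕ v ⊗ c) ⊗ (u ⊗ b ⊕ v ⊗ c) ⊟ (lit 2 ⊗ u ⊕ t ⊗ v) ⊗ (b ⊗ (u ⊗ b ⊕ v ⊗ c))
        ≡ v ⊗ v ⊗ (b ⊗ b ⊕ c ⊗ c ⊟ t ⊗ (b ⊗ c)) ⊕ (b ⊗ b) ⊗ (𝟏 ⊟ (u ⊗ u ⊕ t ⊗ (u ⊗ v) ⊕ v ⊗ v))
      expand = solve 5 (λ t u v b c → b :* b :+ (u :* b :+ v :* c) :* (u :* b :+ v :* c) :- (con (⁺ 2) :* u :+ t :* v) :* (b :* (u :* b :+ v :* c))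
        := v :* v :* (b :* b :+ c :* c :- t :* (b :* c)) :+ (b :* b) :* (con (⁺ 1) :- (u :* u :+ t :* (u :* v) :+ v :* v))) refl

    -- With disc (3 a) = 9 a² - 4, cross-multiplying the two equations cancels 9 a² a′² and leaves 4
    -- E a² = 4 E a′².
    same-square : ∀ a a′ w E → E ≢ 𝟘 → disc (tr a) ⊗ w ≡ ⊝ (E ⊗ (a ⊗ a)) → disc (tr a′) ⊗ w ≡ ⊝ (E ⊗ (a′ ⊗ a′)) → a ⊗ a ≡ a′ ⊗ a′
    same-square a a′ w E E≢0 e e′ = cancelˡ {lit 2 ⊗ lit 2 ⊗ E} (⊗-≢𝟘 (⊗-≢𝟘 2≢0 2≢0) E≢0) (sym (⊟≡𝟘⇒≡
      (solve 3 (λ E a a′ → con (⁺ 2) :* con (⁺ 2) :* E :* (a′ :* a′) :- con (⁺ 2) :* con (⁺ 2) :* E :* (a :* a)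
          := ((con (⁺ 3) :* a) :* (con (⁺ 3) :* a) :- con (⁺ 4)) :* (:- (E :* (a′ :* a′))) :- ((con (⁺ 3) :* a′) :* (con (⁺ 3) :* a′) :- con (⁺ 4)) :* (:- (E :* (a :* a)))) refl E a a′
       ⨾ ≡⇒⊟≡𝟘 cross)))
      where
      cross : disc (tr a) ⊗ ⊝ (E ⊗ (a′ ⊗ a′)) ≡ disc (tr a′) ⊗ ⊝ (E ⊗ (a ⊗ a))
      cross = cong (disc (tr a) ⊗_) (sym e′) ⨾ solve 3 (λ x y w → x :* (y :* w) := y :* (x :* w)) refl (disc (tr a)) (disc (tr a′)) w ⨾ cong (disc (tr a′) ⊗_) e

    V : List (F × F)
    V = deduplicate _≟²_ (map ψ Oₙ)

    uV : Unique V
    uV = UniqDec.deduplicate-! _≟²_ _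

    V⁻ : ∀ {v} → v ∈ V → ∃ λ y → y ∈ Oₙ × v ≡ ψ y
    V⁻ v∈ = ∈-map⁻ ψ (∈-deduplicate⁻ _≟²_ (map ψ Oₙ) v∈)

    point-value : ∀ {a b c} → (a , b , c) ∈ Oₙ → ∀ {y} → dot 𝔽 (el a) (b , c) ≡ y →
                  disc (tr a) ⊗ (b ⊗ b ⊕ y ⊗ y ⊟ t₀ ⊗ (b ⊗ y)) ≡ ⊝ (disc t₀ ⊗ (a ⊗ a))
    point-value {a} {b} {c} x∈ = let x∈O , D≢0 , o≡n = ∈-Oₙ x∈ in
      form-value (tr a) a (proj₁ (el a)) (proj₂ (el a)) b c (norm-pow (tr a) (proj₁ (exponent a))) (markoff-form a b c (markoff x∈O)) (el-trace D≢0 o≡n)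

    ψ-square : ∀ {x y} → x ∈ Oₙ → y ∈ Oₙ → ψ x ≡ ψ y → proj₁ x ⊗ proj₁ x ≡ proj₁ y ⊗ proj₁ y
    ψ-square {a , b , c} {a′ , b′ , c′} x∈ y∈ eq = same-square a a′ (b′ ⊗ b′ ⊕ z ⊗ z ⊟ t₀ ⊗ (b′ ⊗ z)) (disc t₀) E≢0
      (cong (λ w → disc (tr a) ⊗ (w ⊗ w ⊕ z ⊗ z ⊟ t₀ ⊗ (w ⊗ z))) (sym (cong proj₁ eq)) ⨾ point-value x∈ (cong proj₂ eq)) (point-value y∈ refl)
      where z = dot 𝔽 (el a′) (b′ , c′)

    -- If this coefficient vanished, the trace `t₀` would have square 4 by `trace²`, and its
    -- discriminant would be zero.
    el₂≢0 : ∀ {a} → disc (tr a) ≢ 𝟘 → ordOf a ≡ n → proj₂ (el a) ≢ 𝟘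
    el₂≢0 {a} D≢0 o≡n v≡0 = E≢0 (sym (trace² (tr a) (el a) (norm-pow (tr a) (proj₁ (exponent a))) ⨾ cong (λ s → s ⊗ s ⊟ lit 4) (el-trace D≢0 o≡n))
      ⨾ cong (λ v → disc (tr a) ⊗ (v ⊗ v)) v≡0 ⨾ solve 1 (λ D → D :* (con (⁺ 0) :* con (⁺ 0)) := con (⁺ 0)) refl (disc (tr a)))

    ψ-injective : ∀ {x y} → x ∈ Oₙ → ψ x ≡ ψ y → proj₁ x ≡ proj₁ y → x ≡ y
    ψ-injective {a , b , c} {.a , b′ , c′} x∈ eq refl = cong (a ,_) (cong₂ _,_ (cong proj₁ eq) (third (proj₁ (el a)) (proj₂ (el a)) v≢0 (cong proj₁ eq) (cong proj₂ eq)))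
      where
      v≢0 = let _ , D≢0 , o≡n = ∈-Oₙ x∈ in el₂≢0 D≢0 o≡n
      third : ∀ u v → v ≢ 𝟘 → b ≡ b′ → u ⊗ b ⊕ v ⊗ c ≡ u ⊗ b′ ⊕ v ⊗ c′ → c ≡ c′
      third u v v≢0 refl e = cancelˡ v≢0 (solve 2 (λ s w → w := (:- s) :+ (s :+ w)) refl (u ⊗ b) (v ⊗ c) ⨾ cong (⊝ (u ⊗ b) ⊕_) e
        ⨾ solve 2 (λ s w → (:- s) :+ (s :+ w) := w) refl (u ⊗ b) (v ⊗ c′))

    Oₙ≤2V : length Oₙ ≤ length V * 2
    Oₙ≤2V = fibre-upper _≟²_ ψ {xs = Oₙ} {ys = V} (λ x∈ → ∈-deduplicate⁺ _≟²_ (∈-map⁺ ψ x∈)) (λ {v} _ → fibre v)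
      where
      fib : F × F → List Point
      fib v = filter (λ x → ψ x ≟² v) Oₙ
      mem : ∀ v {x} → x ∈ fib v → x ∈ Oₙ × ψ x ≡ v
      mem v = ∈-filter⁻ (λ x → ψ x ≟² v) {xs = Oₙ}
      fibre : ∀ v → length (fib v) ≤ 2
      fibre v = subst (_≤ 2) (length-map proj₁ (fib v)) (at-most-two ⊝_
        (map-unique (λ x∈ y∈ → ψ-injective (proj₁ (mem v x∈)) (proj₂ (mem v x∈) ⨾ sym (proj₂ (mem v y∈)))) (Uniq.filter⁺ _ uOₙ)) pair)
        where
        pair : ∀ {a a′} → a ∈ map proj₁ (fib v) → a′ ∈ map proj₁ (fib v) → a′ ≡ a ⊎ a′ ≡ ⊝ a
        pair a∈ a′∈ with x , x∈ , refl ← ∈-map⁻ proj₁ a∈ | y , y∈ , refl ← ∈-map⁻ proj₁ a′∈ =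
          squares-≡ (ψ-square (proj₁ (mem v y∈)) (proj₁ (mem v x∈)) (proj₂ (mem v y∈) ⨾ sym (proj₂ (mem v x∈))))

    α²≤KV : α * α ≤ K * length V
    α²≤KV = begin
      α * α                                                      ≤⟨ α²≤128τ³ω ⟩
      128 * (τ₀ * τ₀ * τ₀) * ω                                   ≤⟨ *-monoʳ-≤ (128 * (τ₀ * τ₀ * τ₀)) (≤-trans ω≤2τOₙ (*-monoʳ-≤ (2 * τ₀) Oₙ≤2V)) ⟩
      128 * (τ₀ * τ₀ * τ₀) * (2 * τ₀ * (length V * 2))           ≡⟨ lem τ₀ (length V) ⟩
      τ⁴ * 512 * length V                                        ≤⟨ *-monoˡ-≤ (length V) (≤-trans (*-monoʳ-≤ τ⁴ (m≤m+n 512 7680)) (≤-reflexive K≡8192τ⁴)) ⟩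
      K * length V                                               ∎
      where
      lem : ∀ t v → 128 * (t * t * t) * (2 * t * (v * 2)) ≡ t * t * (t * t) * 512 * v
      lem = solve-∀

    -- By `dot-subsample` this value is the second coordinate of the point over v after k l
    -- rotations.
    form∈A : ∀ k {v} → v ∈ V → dot 𝔽 (pow t₀ k) v ∈ A
    form∈A k v∈ with (a , b , c) , x∈ , refl ← V⁻ v∈ = let x∈O , D≢0 , o≡n = ∈-Oₙ x∈ in
      subst (_∈ A) (dot-subsample (tr a) (proj₁ (exponent a)) k b c ⨾ cong (λ s → dot 𝔽 (pow s k) (b , dot 𝔽 (el a) (b , c))) (el-trace D≢0 o≡n))
        (second∈A (seq∈ (k * proj₁ (exponent a)) x∈O))

    V⊆A : ∀ {x y} → (x , y) ∈ V → x ∈ A × y ∈ A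
    V⊆A {x} {y} v∈ = subst (_∈ A) (dot-one x y) (form∈A 0 v∈) ,
      subst (_∈ A) (dot-step t₀ one x y ⨾ dot-one y _) (form∈A 1 v∈)

    16≤n : 16 ≤ n
    16≤n = ≮⇒≥ λ n<16 → <⇒≱ (begin-strict
      τ⁴ * 512 * n          <⟨ *-monoʳ-< (τ⁴ * 512) ⦃ m*n≢0 τ⁴ 512 ⦃ τ⁴-nonZero ⦄ ⦃ _ ⦄ ⦄ n<16 ⟩
      τ⁴ * 512 * 16         ≡⟨ lem τ⁴ ⨾ K≡8192τ⁴ ⟩
      K                     ≤⟨ K≤α ⟩
      α                     ∎) α≤512τ⁴n
      where
      τ⁴-nonZero : NonZero τ⁴
      τ⁴-nonZero = m*n≢0 (τ₀ * τ₀) (τ₀ * τ₀) ⦃ m*n≢0 τ₀ τ₀ ⦄ ⦃ m*n≢0 τ₀ τ₀ ⦄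
      lem : ∀ t → t * 512 * 16 ≡ t * 8192
      lem = solve-∀

    -- The divisor 8 keeps the exponents in the range required by the lemmas on powers of θ: twice
    -- an exponent up to L + 1, and twice the sum of two exponents up to L, stay below n.
    L : ℕ
    L = n / 8

    L*8≤n : L * 8 ≤ n
    L*8≤n = m/n*n≤m n 8

    n≤16L : n ≤ 16 * L
    n≤16L = begin
      n                    ≡⟨ m≡m%n+[m/n]*n n 8 ⟩
      n % 8 + L * 8        ≤⟨ +-monoˡ-≤ (L * 8) (<⇒≤ (m%n<n n 8)) ⟩
      8 + L * 8            ≤⟨ +-monoˡ-≤ (L * 8) (≤-trans (≤-reflexive (sym (*-identityˡ 8))) (*-monoˡ-≤ 8 1≤L)) ⟩
      L * 8 + L * 8        ≡⟨ lem L ⟩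
      16 * L               ∎
      where
      lem : ∀ l → l * 8 + l * 8 ≡ 16 * l
      lem = solve-∀
      1≤L : 1 ≤ L
      1≤L = n≢0⇒n>0 λ L≡0 → <⇒≱ (m%n<n n 8) (≤-trans (≤-trans (m≤m+n 8 8) 16≤n)
        (≤-reflexive (m≡m%n+[m/n]*n n 8 ⨾ cong (λ l → n % 8 + l * 8) L≡0 ⨾ +-identityʳ (n % 8))))

    α≤KL : α ≤ K * L
    α≤KL = begin
      α                        ≤⟨ α≤512τ⁴n ⟩
      τ⁴ * 512 * n             ≤⟨ *-monoʳ-≤ (τ⁴ * 512) n≤16L ⟩
      τ⁴ * 512 * (16 * L)      ≡⟨ lem τ⁴ L ⨾ cong (_* L) K≡8192τ⁴ ⟩
      K * L                    ∎
      where
      lem : ∀ t l → t * 512 * (16 * l) ≡ t * 8192 * l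
      lem = solve-∀

    -- The exponents start at 2, as θ⁰ has no θ-part and θ¹ no constant part. The first coefficient
    -- of θ^(k+2) is minus the second one of θ^(k+1), so `y≢𝟘` and `y-distinct` control it.
    u : ℕ → F × F
    u k = pow t₀ (suc (suc k))

    U : List (F × F)
    U = map u (upTo L)

    double< : ∀ {i} → i ≤ suc L → i + i < n
    double< {i} i≤ = *-cancelˡ-< 4 (i + i) n (begin-strict
      4 * (i + i)              ≤⟨ *-monoʳ-≤ 4 (+-mono-≤ i≤ i≤) ⟩
      4 * (suc L + suc L)      ≡⟨ lem₁ L ⟩
      L * 8 + 8                ≤⟨ +-monoˡ-≤ 8 L*8≤n ⟩
      n + 8                    <⟨ +-monoʳ-< n (≤-trans (m≤m+n 9 39) (*-monoʳ-≤ 3 16≤n)) ⟩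
      n + 3 * n                ≡⟨ refl ⟩
      4 * n                    ∎)
      where
      lem₁ : ∀ l → 4 * (suc l + suc l) ≡ l * 8 + 8
      lem₁ = solve-∀

    quadruple< : ∀ {i j} → i ≤ L → j ≤ L → (i + j) + (i + j) < n
    quadruple< {i} {j} i≤ j≤ = *-cancelˡ-< 2 ((i + j) + (i + j)) n (begin-strict
      2 * ((i + j) + (i + j))          ≤⟨ *-monoʳ-≤ 2 (+-mono-≤ (+-mono-≤ i≤ j≤) (+-mono-≤ i≤ j≤)) ⟩
      2 * ((L + L) + (L + L))          ≡⟨ lem₁ L ⟩
      L * 8                            ≤⟨ L*8≤n ⟩
      n                                <⟨ m<n+m n {n} (≤-trans (m≤m+n 1 15) 16≤n) ⟩
      n + n                            ≡⟨ cong (λ k → n + k) (sym (+-identityʳ n)) ⟩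
      2 * n                            ∎)
      where
      lem₁ : ∀ l → 2 * ((l + l) + (l + l)) ≡ l * 8
      lem₁ = solve-∀

    lam : ℕ → F
    lam k = proj₁ (u k)

    Lam : List F
    Lam = map lam (upTo L)

    ⊝-injective : ∀ {x y} → ⊝ x ≡ ⊝ y → x ≡ y
    ⊝-injective {x} {y} e = solve 1 (λ x → x := :- (:- x)) refl x ⨾ cong ⊝_ e ⨾ solve 1 (λ x → :- (:- x) := x) refl y

    lam-injective : ∀ {i j} → i ∈ upTo L → j ∈ upTo L → lam i ≡ lam j → i ≡ j
    lam-injective {i} {j} i∈ j∈ eq = compare (<-cmp i j)
      where
      compare : Tri (i < j) (i ≡ j) (j < i) → i ≡ j
      compare (tri< i<j _ _) = ⊥-elim (y-distinct E≢0 ord₀ (s≤s z≤n) (s≤s i<j) (quadruple< (∈-upTo⁻ i∈) (∈-upTo⁻ j∈)) (⊝-injective eq))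
      compare (tri≈ _ i≡j _) = i≡j
      compare (tri> _ _ j<i) = ⊥-elim (y-distinct E≢0 ord₀ (s≤s z≤n) (s≤s j<i) (quadruple< (∈-upTo⁻ j∈) (∈-upTo⁻ i∈)) (⊝-injective (sym eq)))

    uLam : Unique Lam
    uLam = map-unique lam-injective (Uniq.upTo⁺ L)

    lenLam : length Lam ≡ L
    lenLam = length-map lam (upTo L) ⨾ length-upTo L

    uU : Unique U
    uU = map-unique (λ i∈ j∈ eq → lam-injective i∈ j∈ (cong proj₁ eq)) (Uniq.upTo⁺ L)

    lenU : length U ≡ L
    lenU = length-map u (upTo L) ⨾ length-upTo L

    μ≢0 : ∀ {k} → k < L → proj₂ (u k) ≢ 𝟘
    μ≢0 {k} k<L = y≢𝟘 {k = suc (suc k)} ord₀ (s≤s z≤n) (double< {suc (suc k)} (s≤s k<L))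

    lam≢0 : ∀ {k} → k < L → lam k ≢ 𝟘
    lam≢0 {k} k<L e = y≢𝟘 {k = suc k} ord₀ (s≤s z≤n) (double< {suc k} (≤-trans k<L (n≤1+n L))) (⊝-injective (e ⨾ solve 0 (con (⁺ 0) := :- con (⁺ 0)) refl))

    Lam-forms : ∀ {l} → l ∈ Lam → l ≢ 𝟘 × Σ F λ μ → μ ≢ 𝟘 × (∀ {x y} → (x , y) ∈ V → l ⊗ x ⊕ μ ⊗ y ∈ A)
    Lam-forms l∈ with k , k∈ , refl ← ∈-map⁻ lam l∈ =
      lam≢0 (∈-upTo⁻ k∈) , proj₂ (u k) , μ≢0 (∈-upTo⁻ k∈) , λ v∈ → form∈A (suc (suc k)) v∈

    U-independent : ∀ {w w′} → w ∈ U → w′ ∈ U → w ≢ w′ → proj₁ w ⊗ proj₂ w′ ≢ proj₁ w′ ⊗ proj₂ w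
    U-independent w∈ w′∈ w≢w′ eq with i , i∈ , refl ← ∈-map⁻ u w∈ | j , j∈ , refl ← ∈-map⁻ u w′∈ = compare (<-cmp i j)
      where
      diff< : ∀ {i j} → j < L → (j ∸ i) + (j ∸ i) < n
      diff< {i} {j} j<L = double< (≤-trans (m∸n≤m j i) (≤-trans (<⇒≤ j<L) (n≤1+n L)))
      compare : Tri (i < j) (i ≡ j) (j < i) → ⊥
      compare (tri< i<j _ _) = pow-independent ord₀ (s≤s (s≤s i<j)) (diff< {i} {j} (∈-upTo⁻ j∈)) eq
      compare (tri≈ _ refl _) = w≢w′ refl
      compare (tri> _ _ j<i) = pow-independent ord₀ (s≤s (s≤s j<i)) (diff< {j} {i} (∈-upTo⁻ i∈)) (sym eq)

    Bₖ : ℕ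
    Bₖ = Constants.B K

    missing : List F
    missing = filter (λ x → ¬? (DecMembership._∈?_ _≟ᶠ_ x A)) elems

    -- If b ∉ A, no line w · v = b with w ∈ U meets V, since all values of the forms on V lie in A.
    -- Hence |V| |U| |missing| ≤ p³, whereas |V| ≥ α² / K, |U| ≥ α / K, and α ≥ p / Bₖ by the
    -- sum-product bound.
    few-missing : Bₖ ≤ α → length missing ≤ Bₖ * Bₖ * Bₖ * (K * K)
    few-missing B≤α = *-cancelʳ-≤ (length missing) (Bₖ * Bₖ * Bₖ * (K * K)) (p * p * p) ⦃ m*n≢0 (p * p) p ⦃ m*n≢0 p p ⦄ ⦄ (begin
      g * (p * p * p)                                        ≤⟨ *-monoʳ-≤ g (*-mono-≤ (*-mono-≤ p≤Bα p≤Bα) (≤-trans p≤Bα (*-monoʳ-≤ Bₖ α≤KL))) ⟩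
      g * (Bₖ * α * (Bₖ * α) * (Bₖ * (K * L)))               ≡⟨ lem₁ g Bₖ α K L ⟩
      Bₖ * Bₖ * Bₖ * K * (α * α) * (L * g)                   ≤⟨ *-monoˡ-≤ (L * g) (*-monoʳ-≤ (Bₖ * Bₖ * Bₖ * K) α²≤KV) ⟩
      Bₖ * Bₖ * Bₖ * K * (K * length V) * (L * g)            ≡⟨ lem₂ (Bₖ * Bₖ * Bₖ) K (length V) (L * g) ⟩
      Bₖ * Bₖ * Bₖ * (K * K) * (length V * (L * g))          ≤⟨ *-monoʳ-≤ (Bₖ * Bₖ * Bₖ * (K * K)) lines ⟩
      Bₖ * Bₖ * Bₖ * (K * K) * (p * p * p)                   ∎)
      where
      p = suc q
      g = length missing
      lem₁ : ∀ g b a k l → g * (b * a * (b * a) * (b * (k * l))) ≡ b * b * b * k * (a * a) * (l * g)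
      lem₁ = solve-∀
      lem₂ : ∀ b k v x → b * k * (k * v) * x ≡ b * (k * k) * (v * x)
      lem₂ = solve-∀
      p≤Bα : p ≤ Bₖ * α
      p≤Bα = sum-product-bound 𝔽 A uA (first∈A x₀∈O) V uV V⊆A K α²≤KV Lam uLam Lam-forms
        (≤-trans α≤KL (≤-reflexive (cong (K *_) (sym lenLam)))) B≤α
      lines : length V * (L * g) ≤ p * p * p
      lines = subst (λ l → length V * (l * g) ≤ p * p * p) lenU
        (missed-lines-bound 𝔽 V uV U uU missing (Uniq.filter⁺ _ elems-unique)
          (λ w∈ → second (∈-map⁻ u w∈)) U-independent
          (λ w∈ v∈ b∈ e → proj₂ (∈-filter⁻ (λ x → ¬? (DecMembership._∈?_ _≟ᶠ_ x A)) {xs = elems} b∈) (subst (_∈ A) e (value (∈-map⁻ u w∈) v∈))))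
        where
        second : ∀ {w} → (∃ λ k → k ∈ upTo L × w ≡ u k) → proj₂ w ≢ 𝟘
        second (k , k∈ , refl) = μ≢0 (∈-upTo⁻ k∈)
        value : ∀ {w v} → (∃ λ k → k ∈ upTo L × w ≡ u k) → v ∈ V → dot 𝔽 w v ∈ A
        value (k , _ , refl) v∈ = form∈A (suc (suc k)) v∈

-- Primitive roots

∑-tight : ∀ {A : Set} (xs : List A) {f g : A → ℕ} → (∀ {x} → x ∈ xs → f x ≤ g x) → ∑ xs g ≤ ∑ xs f → ∀ {x} → x ∈ xs → g x ≤ f x
∑-tight (y ∷ ys) {f} {g} f≤g tot (here refl) = +-cancelʳ-≤ (∑ ys g) _ _ (≤-trans tot (+-monoʳ-≤ (f y) (∑-mono ys (f≤g ∘ there))))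
∑-tight (y ∷ ys) {f} {g} f≤g tot (there x∈) = ∑-tight ys (f≤g ∘ there) (+-cancelˡ-≤ (g y) _ _ (≤-trans tot (+-monoˡ-≤ (∑ ys f) (f≤g (here refl))))) x∈

prime≢1 : ∀ {l} → Prime l → ¬ l ∣ 1
prime≢1 pl l∣1 = <⇒≱ (prime≥2 pl) (≤-reflexive (∣1⇒≡1 l∣1))

-- m is divided by gcd (m , u) until the gcd is 1; r is what remains, and each prime of m that is
-- lost divides u.
coprime-part : ∀ u m → 1 ≤ m → ∃ λ r → Coprime r u × (∀ {l} → Prime l → l ∣ m → l ∣ u ⊎ l ∣ r)
coprime-part u = <-rec _ go
  where
  go : ∀ m → (∀ {k} → k < m → 1 ≤ k → ∃ λ r → Coprime r u × (∀ {l} → Prime l → l ∣ k → l ∣ u ⊎ l ∣ r)) →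
       1 ≤ m → ∃ λ r → Coprime r u × (∀ {l} → Prime l → l ∣ m → l ∣ u ⊎ l ∣ r)
  go m rec 1≤m with gcd m u ≟ 1
  ... | yes g≡1 = m , gcd≡1⇒coprime g≡1 , λ _ → inj₂
  ... | no  g≢1 with gcd[m,n]∣m m u
  ...   | divides k m≡kg with rec k<m 1≤k
    where
    1≤k : 1 ≤ k
    1≤k = n≢0⇒n>0 λ { refl → <⇒≱ 1≤m (≤-reflexive m≡kg) }
    2≤g : 2 ≤ gcd m u
    2≤g = ≤∧≢⇒< (n≢0⇒n>0 λ g≡0 → <⇒≱ 1≤m (≤-reflexive (m≡kg ⨾ cong (k *_) g≡0 ⨾ *-zeroʳ k))) (g≢1 ∘ sym)
    k<m : k < m
    k<m = subst (k <_) (sym m≡kg) (m<m*n k (gcd m u) ⦃ >-nonZero 1≤k ⦄ 2≤g)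
  ...     | r , cop , primes = r , cop , λ {l} pl l∣m → Sum.[ primes pl , (λ l∣g → inj₁ (∣-trans l∣g (gcd[m,n]∣n m u))) ]′
             (euclidsLemma k (gcd m u) pl (subst (l ∣_) m≡kg l∣m))

coprime-by-primes : ∀ {a b} → 1 ≤ b → (∀ {l} → Prime l → l ∣ a → l ∣ b → ⊥) → Coprime a b
coprime-by-primes {a} {b} 1≤b h {d} (d∣a , d∣b) with d ≟ 1
... | yes d≡1 = d≡1
... | no  d≢1 = let l , pl , l∣d = prime-factor d (≤∧≢⇒< (n≢0⇒n>0 (λ { refl → <⇒≱ 1≤b (≤-reflexive (0∣⇒≡0 d∣b)) })) (d≢1 ∘ sym))
                in ⊥-elim (h pl (∣-trans l∣d d∣a) (∣-trans l∣d d∣b))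

-- The units modulo a multiple m of n map onto the units modulo n. With r from `coprime-part`, a
-- prime of m divides exactly one of the summands u and n r.
coprime-lift : ∀ u n m → Coprime u n → 1 ≤ m → ∃ λ r → Coprime (u + n * r) m
coprime-lift u n m cop 1≤m with r , cop-r , primes ← coprime-part u m 1≤m = r , coprime-by-primes 1≤m bad
  where
  clash : ∀ {l} → Prime l → l ∣ r → l ∣ u → ⊥
  clash {l} pl l∣r l∣u = prime≢1 pl (subst (l ∣_) (cop-r (l∣r , l∣u)) ∣-refl)
  bad : ∀ {l} → Prime l → l ∣ u + n * r → l ∣ m → ⊥
  bad {l} pl l∣c l∣m with primes pl l∣m
  ... | inj₂ l∣r = clash pl l∣r (∣m+n∣m⇒∣n (subst (l ∣_) (+-comm u (n * r)) l∣c) (∣n⇒∣m*n n l∣r))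
  ... | inj₁ l∣u with euclidsLemma n r pl (∣m+n∣m⇒∣n l∣c l∣u)
  ...   | inj₁ l∣n = prime≢1 pl (subst (l ∣_) (cop (l∣u , l∣n)) ∣-refl)
  ...   | inj₂ l∣r = clash pl l∣r l∣u

module PrimitiveRoots {q : ℕ} (𝔽 : PrimeField (suc q)) (2≤q : 2 ≤ q) (2≢0 : FieldTheory.lit 𝔽 2 ≢ PrimeField.𝟘 𝔽) where
  open FieldTheory 𝔽
  open Polynomials 𝔽
  open FermatTheory 𝔽 2≢0
  open ≤-Reasoning

  ^ᶠ-+ : ∀ x i j → x ^ᶠ (i + j) ≡ x ^ᶠ i ⊗ x ^ᶠ j
  ^ᶠ-+ x zero    j = sym (⊗-identityˡ _)
  ^ᶠ-+ x (suc i) j = cong (x ⊗_) (^ᶠ-+ x i j) ⨾ sym (⊗-assoc x _ _)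

  ^ᶠ-* : ∀ x i j → (x ^ᶠ j) ^ᶠ i ≡ x ^ᶠ (i * j)
  ^ᶠ-* x zero    j = refl
  ^ᶠ-* x (suc i) j = cong (x ^ᶠ j ⊗_) (^ᶠ-* x i j) ⨾ sym (^ᶠ-+ x j (i * j))

  𝟏^ᶠ : ∀ k → 𝟏 ^ᶠ k ≡ 𝟏
  𝟏^ᶠ zero    = refl
  𝟏^ᶠ (suc k) = ⊗-identityˡ _ ⨾ 𝟏^ᶠ k

  ^ᶠ-≢𝟘 : ∀ {x} → x ≢ 𝟘 → ∀ k → x ^ᶠ k ≢ 𝟘
  ^ᶠ-≢𝟘 x≢0 zero    = 𝟏≢𝟘
  ^ᶠ-≢𝟘 x≢0 (suc k) = ⊗-≢𝟘 x≢0 (^ᶠ-≢𝟘 x≢0 k)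

  multiple^ᶠ : ∀ x n k → x ^ᶠ n ≡ 𝟏 → x ^ᶠ (k * n) ≡ 𝟏
  multiple^ᶠ x n k e = sym (^ᶠ-* x k n) ⨾ cong (_^ᶠ k) e ⨾ 𝟏^ᶠ k

  HasOrder : F → ℕ → Set
  HasOrder x n = 1 ≤ n × x ^ᶠ n ≡ 𝟏 × (∀ k → x ^ᶠ k ≡ 𝟏 → n ∣ k)

  1≤q : 1 ≤ q
  1≤q = ≤-trans (n≤1+n 1) 2≤q

  abstract
    order* : ∀ x → Σ ℕ λ n → x ≢ 𝟘 → HasOrder x n
    order* x = go (x ≟ᶠ 𝟘)
      where
      go : Dec (x ≡ 𝟘) → Σ ℕ λ n → x ≢ 𝟘 → HasOrder x n
      go (yes x≡0) = 0 , λ x≢0 → ⊥-elim (x≢0 x≡0)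
      go (no x≢0) = let n , h = least-period (λ k → x ^ᶠ k ≟ᶠ 𝟏) (λ n k r e e′ →
                          sym (⊗-identityʳ _) ⨾ cong (x ^ᶠ r ⊗_) (sym (multiple^ᶠ x n k e)) ⨾ sym (^ᶠ-+ x r (k * n)) ⨾ e′) q 1≤q (fermat x≢0)
                    in n , λ _ → h

  ord : F → ℕ
  ord x = proj₁ (order* x)

  hasOrder : ∀ {x} → x ≢ 𝟘 → HasOrder x (ord x)
  hasOrder {x} = proj₂ (order* x)

  ord∈ : ∀ {x} → x ∈ nonzeros → ord x ∈ divisors q
  ord∈ x∈ = ∈-divisors⁺ 1≤q (proj₂ (proj₂ (hasOrder (∈-nonzeros⁻ x∈))) q (fermat (∈-nonzeros⁻ x∈)))

  power-injective< : ∀ {x n i j} → x ≢ 𝟘 → HasOrder x n → i < j → j < n → x ^ᶠ i ≢ x ^ᶠ j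
  power-injective< {x} {n} {i} {j} x≢0 (_ , _ , divs) i<j j<n e =
    <⇒≱ (≤-<-trans (m∸n≤m j i) j<n) (∣⇒≤ ⦃ >-nonZero (m<n⇒0<n∸m i<j) ⦄ (divs (j ∸ i)
      (cancelˡ (^ᶠ-≢𝟘 x≢0 i) (⊗-comm _ _ ⨾ sym (^ᶠ-+ x (j ∸ i) i) ⨾ cong (x ^ᶠ_) (m∸n+n≡m (<⇒≤ i<j)) ⨾ sym e ⨾ sym (⊗-identityʳ _)))))

  powers : F → ℕ → List F
  powers x n = map (x ^ᶠ_) (upTo n)

  powers-unique : ∀ {x n} → x ≢ 𝟘 → HasOrder x n → Unique (powers x n)
  powers-unique {x} {n} x≢0 h = map-unique (λ {i} {j} i∈ j∈ e → compare i j (∈-upTo⁻ i∈) (∈-upTo⁻ j∈) e (<-cmp i j)) (Uniq.upTo⁺ n)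
    where
    compare : ∀ i j → i < n → j < n → x ^ᶠ i ≡ x ^ᶠ j → Tri (i < j) (i ≡ j) (j < i) → i ≡ j
    compare i j i<n j<n e (tri< i<j _ _) = ⊥-elim (power-injective< x≢0 h i<j j<n e)
    compare i j i<n j<n e (tri≈ _ i≡j _) = i≡j
    compare i j i<n j<n e (tri> _ _ j<i) = ⊥-elim (power-injective< x≢0 h j<i i<n (sym e))

  powers-length : ∀ x n → length (powers x n) ≡ n
  powers-length x n = length-map (x ^ᶠ_) (upTo n) ⨾ length-upTo n

  power-poly : ∀ n → Poly n 𝟏 (_^ᶠ n)
  power-poly zero    _ = refl
  power-poly (suc n) = poly-x n (power-poly n)

  const-raise : ∀ c n → Poly (suc n) 𝟘 (λ _ → c)
  const-raise c zero    = poly-raise 0 {f = λ _ → c} (λ _ → refl)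
  const-raise c (suc n) = poly-raise (suc n) (const-raise c n)

  unity-roots : ∀ n → 1 ≤ n → ∀ {X} → Unique X → (∀ {x} → x ∈ X → x ^ᶠ n ≡ 𝟏) → length X ≤ n
  unity-roots (suc n) _ u h = poly-roots (suc n) (poly-resp (suc n) (⊕-identityʳ 𝟏) (λ _ → refl) (poly-⊕ (suc n) (power-poly (suc n)) (const-raise (⊝ 𝟏) n)))
    𝟏≢𝟘 u (λ x∈ → ≡⇒⊟≡𝟘 (h x∈))

  log : ∀ {x n} → x ≢ 𝟘 → HasOrder x n → ∀ {y} → y ^ᶠ n ≡ 𝟏 → ∃ λ j → j < n × x ^ᶠ j ≡ y
  log {x} {n} x≢0 h {y} e = go (DecMembership._∈?_ _≟ᶠ_ y (powers x n))
    where
    roots : ∀ {z} → z ∈ y ∷ powers x n → z ^ᶠ n ≡ 𝟏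
    roots (here refl) = e
    roots (there z∈) with i , _ , refl ← ∈-map⁻ (x ^ᶠ_) z∈ = ^ᶠ-* x n i ⨾ cong (x ^ᶠ_) (*-comm n i) ⨾ multiple^ᶠ x n i (proj₁ (proj₂ h))
    go : Dec (y ∈ powers x n) → ∃ λ j → j < n × x ^ᶠ j ≡ y
    go (yes y∈) = let j , j∈ , y≡ = ∈-map⁻ (x ^ᶠ_) y∈ in j , ∈-upTo⁻ j∈ , sym y≡
    go (no y∉) = ⊥-elim (<-irrefl refl (subst (λ k → suc k ≤ n) (powers-length x n)
      (unity-roots n (proj₁ h) (All.tabulate (λ { z∈ refl → y∉ z∈ }) ∷ powers-unique x≢0 h) roots)))

  ofOrder : ℕ → List F
  ofOrder n = filter (λ x → ord x ≟ n) nonzeros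

  ∈-ofOrder : ∀ {n x} → x ∈ ofOrder n → x ≢ 𝟘 × HasOrder x n
  ∈-ofOrder {n} x∈ = let x∈* , e = ∈-filter⁻ (λ x → ord x ≟ n) {xs = nonzeros} x∈
                     in ∈-nonzeros⁻ x∈* , subst (HasOrder _) e (hasOrder (∈-nonzeros⁻ x∈*))

  class? : ∀ n i → Dec (gcd i q * n ≡ q)
  class? n i = gcd i q * n ≟ q

  -- These residues i modulo q have additive order n. For different n the classes are disjoint, and
  -- they are the model with which the elements of multiplicative order n are compared.
  class : ℕ → List ℕ
  class n = filter (class? n) (upTo q)

  -- The elements of order n are the x^j with j coprime to n; they correspond to the i = j (q / n), whose gcd with q is q / n.
  ofOrder≤class : ∀ {n} → n ∈ divisors q → length (ofOrder n) ≤ length (class n)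
  ofOrder≤class {n} n∈ = go (ofOrder n) refl (∈-divisors⁻ n∈)
    where
    go : ∀ X → X ≡ ofOrder n → n ∣ q → length X ≤ length (class n)
    go [] _ _ = z≤n
    go (x ∷ X) X≡ (divides k q≡kn) = subst (_≤ length (class n)) (sym (cong length X≡)) (length-inj {f = f} (Uniq.filter⁺ _ nonzeros-unique) into inj)
      where
      x≢0,h : x ≢ 𝟘 × HasOrder x n
      x≢0,h = ∈-ofOrder (subst (x ∈_) X≡ (here refl))
      1≤n : 1 ≤ n
      1≤n = proj₁ (proj₂ x≢0,h)
      instance
        k-nonZero : NonZero k
        k-nonZero = >-nonZero (n≢0⇒n>0 λ { refl → <⇒≱ 1≤q (≤-reflexive q≡kn) })
      logs : ∀ y → Σ ℕ λ j → y ∈ ofOrder n → j < n × x ^ᶠ j ≡ y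
      logs y = look (DecMembership._∈?_ _≟ᶠ_ y (ofOrder n))
        where
        look : Dec (y ∈ ofOrder n) → Σ ℕ λ j → y ∈ ofOrder n → j < n × x ^ᶠ j ≡ y
        look (yes y∈) = let j , h = log (proj₁ x≢0,h) (proj₂ x≢0,h) (proj₁ (proj₂ (proj₂ (∈-ofOrder y∈)))) in j , λ _ → h
        look (no y∉) = 0 , λ y∈ → ⊥-elim (y∉ y∈)
      f : F → ℕ
      f y = k * proj₁ (logs y)
      coprime : ∀ {y} → y ∈ ofOrder n → gcd (proj₁ (logs y)) n ≡ 1
      coprime {y} y∈ = *-cancelˡ-≡ e 1 n′ ⦃ >-nonZero 1≤n′ ⦄ (≤-antisym e≤ (*-monoʳ-≤ n′ 1≤e))
        where
        j = proj₁ (logs y)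
        e = gcd j n
        e∣j = gcd[m,n]∣m j n
        e∣n = gcd[m,n]∣n j n
        n′ = quotient e∣n
        n≡ : n ≡ n′ * e
        n≡ = _∣_.equality e∣n
        1≤n′ : 1 ≤ n′
        1≤n′ = n≢0⇒n>0 λ z → <⇒≱ 1≤n (≤-reflexive (n≡ ⨾ cong (_* e) z))
        1≤e : 1 ≤ e
        1≤e = n≢0⇒n>0 λ z → <⇒≱ 1≤n (≤-reflexive (n≡ ⨾ cong (n′ *_) z ⨾ *-zeroʳ n′))
        unit : y ^ᶠ n′ ≡ 𝟏
        unit = cong (_^ᶠ n′) (sym (proj₂ (proj₂ (logs y) y∈))) ⨾ ^ᶠ-* x n′ j ⨾ cong (x ^ᶠ_) rearrange
          ⨾ multiple^ᶠ x n (quotient e∣j) (proj₁ (proj₂ (proj₂ x≢0,h)))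
          where
          swap : ∀ a b c → a * (b * c) ≡ b * (a * c)
          swap = solve-∀
          rearrange : n′ * j ≡ quotient e∣j * n
          rearrange = cong (n′ *_) (_∣_.equality e∣j) ⨾ swap n′ (quotient e∣j) e ⨾ cong (quotient e∣j *_) (sym n≡)
        e≤ : n′ * e ≤ n′ * 1
        e≤ = ≤-trans (≤-reflexive (sym n≡)) (≤-trans (∣⇒≤ ⦃ >-nonZero 1≤n′ ⦄ (proj₂ (proj₂ (proj₂ (∈-ofOrder y∈))) n′ unit)) (≤-reflexive (sym (*-identityʳ n′))))
      into : ∀ {y} → y ∈ ofOrder n → f y ∈ class n
      into {y} y∈ = ∈-filter⁺ (class? n) (∈-upTo⁺ (subst (f y <_) (sym q≡kn) (*-monoʳ-< k (proj₁ (proj₂ (logs y) y∈)))))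
        (cong (_* n) (cong (gcd (f y)) q≡kn ⨾ sym (c*gcd[m,n]≡gcd[cm,cn] k (proj₁ (logs y)) n) ⨾ cong (k *_) (coprime y∈) ⨾ *-identityʳ k) ⨾ sym q≡kn)
      inj : ∀ {y z} → y ∈ ofOrder n → z ∈ ofOrder n → f y ≡ f z → y ≡ z
      inj {y} {z} y∈ z∈ e = sym (proj₂ (proj₂ (logs y) y∈)) ⨾ cong (x ^ᶠ_) (*-cancelˡ-≡ (proj₁ (logs y)) (proj₁ (logs z)) k e) ⨾ proj₂ (proj₂ (logs z) z∈)

  ∑class≤q : ∑ (divisors q) (λ n → length (class n)) ≤ q
  ∑class≤q = begin
    ∑ (divisors q) (λ n → length (class n))                        ≡⟨ ∑-cong (divisors q) (λ {n} _ → length-filter≡∑ (class? n) (upTo q)) ⟩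
    ∑ (divisors q) (λ n → ∑ (upTo q) (λ i → 𝟙 (class? n i)))       ≡⟨ ∑-swap (divisors q) (upTo q) _ ⟩
    ∑ (upTo q) (λ i → ∑ (divisors q) (λ n → 𝟙 (class? n i)))       ≤⟨ ∑-mono (upTo q) (λ {i} _ → ∑-𝟙-unique (λ n → class? n i) (divisors-unique q) (λ {n} {n′} _ _ → same i n n′)) ⟩
    ∑ (upTo q) (λ _ → 1)                                           ≡⟨ sym (length≡∑ (upTo q)) ⨾ length-upTo q ⟩
    q                                                              ∎
    where
    same : ∀ i n n′ → gcd i q * n ≡ q → gcd i q * n′ ≡ q → n ≡ n′
    same i n n′ e e′ = *-cancelˡ-≡ n n′ (gcd i q) ⦃ >-nonZero (n≢0⇒n>0 λ z → <⇒≱ 1≤q (≤-reflexive (sym e ⨾ cong (_* n) z))) ⦄ (e ⨾ sym e′)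

  q≤∑ofOrder : q ≤ ∑ (divisors q) (λ n → length (ofOrder n))
  q≤∑ofOrder = subst (_≤ ∑ (divisors q) (λ n → length (ofOrder n))) length-nonzeros
    (length≤∑fibres _≟_ ord nonzeros (divisors q) ord∈)

  generators : List F
  generators = ofOrder q

  abstract
    -- Termwise |ofOrder n| ≤ |class n|, while ∑ |class n| ≤ q ≤ ∑ |ofOrder n|. Hence no term is
    -- smaller, and class q is not empty because it contains 1.
    primitive-root : ∃ λ g → g ∈ generators
    primitive-root = go generators (≤-trans (∈-length (∈-filter⁺ (class? q) (∈-upTo⁺ 2≤q) (cong (_* q) (gcd1 q) ⨾ *-identityˡ q)))
        (∑-tight (divisors q) ofOrder≤class (≤-trans ∑class≤q q≤∑ofOrder) (∈-divisors⁺ 1≤q ∣-refl)))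
      where
      gcd1 : ∀ q → gcd 1 q ≡ 1
      gcd1 q = ∣1⇒≡1 (gcd[m,n]∣m 1 q)
      go : (X : List F) → 1 ≤ length X → ∃ λ g → g ∈ X
      go (g ∷ _) _ = g , here refl

  generates : ∀ {x} → x ∈ generators → ∀ {z} → z ≢ 𝟘 → ∃ λ k → k < q × x ^ᶠ k ≡ z
  generates x∈ z≢0 = log (proj₁ (∈-ofOrder x∈)) (proj₂ (∈-ofOrder x∈)) (fermat z≢0)

  -- Every nonzero x is y^e with y a generator and e ∣ q. Indeed x = g^j with e = gcd (j , q), and j
  -- / e is congruent modulo q / e to some c prime to q, so y = g^c will do. This stands in for a
  -- lower bound on Euler's function.
  q≤τ*generators : q ≤ τ q * length generators
  q≤τ*generators = begin
    q                                                          ≡⟨ sym length-nonzeros ⟩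
    length nonzeros                                            ≤⟨ unique-⊆-length nonzeros-unique (λ x∈ → cover (∈-nonzeros⁻ x∈)) ⟩
    length (map f (cartesianProduct (divisors q) generators))  ≡⟨ length-map f (cartesianProduct (divisors q) generators) ⨾ length-× (divisors q) generators ⟩
    τ q * length generators                                    ∎
    where
    f : ℕ × F → F
    f (e , y) = y ^ᶠ e
    g = proj₁ primitive-root
    g≢0 = proj₁ (∈-ofOrder (proj₂ primitive-root))
    hg = proj₂ (∈-ofOrder (proj₂ primitive-root))
    generator : ∀ c → Coprime c q → g ^ᶠ c ∈ generators
    generator c cop = ∈-filter⁺ (λ x → ord x ≟ q) (∈-nonzeros⁺ y≢0) (∣-antisym (proj₂ (proj₂ h) q (fermat y≢0))
        (coprime-divisor {n = c} (Coprimality.sym cop) (subst (q ∣_) (*-comm (ord (g ^ᶠ c)) c) (proj₂ (proj₂ hg) (ord (g ^ᶠ c) * c) (sym (^ᶠ-* g (ord (g ^ᶠ c)) c) ⨾ proj₁ (proj₂ h))))))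
      where
      y≢0 = ^ᶠ-≢𝟘 g≢0 c
      h = hasOrder y≢0
    cover : ∀ {x} → x ≢ 𝟘 → x ∈ map f (cartesianProduct (divisors q) generators)
    cover {x} x≢0 = subst (_∈ map f (cartesianProduct (divisors q) generators)) value
        (∈-map⁺ f (∈-cartesianProduct⁺ (∈-divisors⁺ 1≤q e∣q) (generator c (proj₂ lift))))
      where
      j = proj₁ (generates (proj₂ primitive-root) x≢0)
      e = gcd j q
      e∣j = gcd[m,n]∣m j q
      e∣q = gcd[m,n]∣n j q
      u = quotient e∣j
      n = quotient e∣q
      1≤e : 1 ≤ e
      1≤e = n≢0⇒n>0 λ z → <⇒≱ 1≤q (≤-reflexive (_∣_.equality e∣q ⨾ cong (n *_) z ⨾ *-zeroʳ n))
      cop : Coprime u n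
      cop = gcd≡1⇒coprime (*-cancelˡ-≡ (gcd u n) 1 e ⦃ >-nonZero 1≤e ⦄ (c*gcd[m,n]≡gcd[cm,cn] e u n
        ⨾ cong₂ gcd (*-comm e u ⨾ sym (_∣_.equality e∣j)) (*-comm e n ⨾ sym (_∣_.equality e∣q)) ⨾ sym (*-identityʳ e)))
      lift = coprime-lift u n q cop 1≤q
      r = proj₁ lift
      c = u + n * r
      ec : e * c ≡ j + r * q
      ec = distribute e u n r ⨾ cong₂ (λ a b → a + r * b) (sym (_∣_.equality e∣j)) (sym (_∣_.equality e∣q))
        where
        distribute : ∀ e u n r → e * (u + n * r) ≡ u * e + r * (n * e)
        distribute = solve-∀
      value : f (e , g ^ᶠ c) ≡ x
      value = ^ᶠ-* g e c ⨾ cong (g ^ᶠ_) ec ⨾ ^ᶠ-+ g j (r * q)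
        ⨾ cong₂ _⊗_ (proj₂ (proj₂ (generates (proj₂ primitive-root) x≢0))) (multiple^ᶠ g q r (proj₁ (proj₂ hg))) ⨾ ⊗-identityʳ x

-- Coordinates whose rotation is transitive on the conic

module Cage {q : ℕ} (𝔽 : PrimeField (suc q)) (4<q : 4 < q) (2≢0 : FieldTheory.lit 𝔽 2 ≢ PrimeField.𝟘 𝔽) (3≢0 : FieldTheory.lit 𝔽 3 ≢ PrimeField.𝟘 𝔽) where
  open FieldTheory 𝔽
  open MarkoffOrbits 𝔽
  open FermatTheory 𝔽 2≢0 using (_^ᶠ_)

  2≤q : 2 ≤ q
  2≤q = ≤-trans (m≤m+n 2 3) 4<q

  1≤q : 1 ≤ q
  1≤q = ≤-trans (m≤m+n 1 4) 4<q

  open PrimitiveRoots 𝔽 2≤q 2≢0 using (generators; generates; q≤τ*generators; ∈-ofOrder; HasOrder; ^ᶠ-≢𝟘; ofOrder)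

  coordinate : F → F
  coordinate x = (x ⊕ inv x) ⊗ inv (lit 3)

  thrice-coordinate : ∀ x → lit 3 ⊗ coordinate x ≡ x ⊕ inv x
  thrice-coordinate x = solve 3 (λ t s i → t :* (s :* i) := s :* (t :* i)) refl (lit 3) (x ⊕ inv x) (inv (lit 3))
    ⨾ cong ((x ⊕ inv x) ⊗_) (inverseʳ 3≢0) ⨾ ⊗-identityʳ _

  same-sum : ∀ {x y} → x ≢ 𝟘 → y ≢ 𝟘 → x ⊕ inv x ≡ y ⊕ inv y → y ≡ x ⊎ y ≡ inv x
  same-sum {x} {y} x≢0 y≢0 e = Sum.map ⊟≡𝟘⇒≡ ⊟≡𝟘⇒≡ (no-zero-divisors {y ⊟ x} {y ⊟ inv x}
    (factor y x (inv x) (inv y) (inverseʳ x≢0) (inverseʳ y≢0) ⨾ cong (λ s → y ⊗ (y ⊕ inv y ⊟ s)) e ⨾ cong (y ⊗_) (⊝-inverseʳ _) ⨾ zeroʳ y))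
    where
    factor : ∀ y x i j → x ⊗ i ≡ 𝟏 → y ⊗ j ≡ 𝟏 → (y ⊟ x) ⊗ (y ⊟ i) ≡ y ⊗ (y ⊕ j ⊟ (x ⊕ i))
    factor y x i j e e′ = solve 3 (λ y x i → (y :- x) :* (y :- i) := y :* y :+ x :* i :- y :* (x :+ i)) refl y x i
      ⨾ cong (λ z → y ⊗ y ⊕ z ⊟ y ⊗ (x ⊕ i)) (e ⨾ sym e′)
      ⨾ solve 4 (λ y x i j → y :* y :+ y :* j :- y :* (x :+ i) := y :* (y :+ j :- (x :+ i))) refl y x i j

  cage : List F
  cage = deduplicate _≟ᶠ_ (map coordinate generators)

  cage-unique : Unique cage
  cage-unique = UniqDec.deduplicate-! _≟ᶠ_ (map coordinate generators)

  generator≢0 : ∀ {x} → x ∈ generators → x ≢ 𝟘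
  generator≢0 x∈ = proj₁ (∈-ofOrder x∈)

  generators≤2cage : length generators ≤ length cage * 2
  generators≤2cage = fibre-upper _≟ᶠ_ coordinate {xs = generators} {ys = cage} (λ x∈ → ∈-deduplicate⁺ _≟ᶠ_ (∈-map⁺ coordinate x∈)) (λ {a} _ →
    at-most-two inv (Uniq.filter⁺ _ u-generators) (λ x∈ y∈ →
      let x∈g , ex = ∈-filter⁻ (λ x → coordinate x ≟ᶠ a) {xs = generators} x∈
          y∈g , ey = ∈-filter⁻ (λ x → coordinate x ≟ᶠ a) {xs = generators} y∈
      in same-sum (generator≢0 x∈g) (generator≢0 y∈g) (sym (thrice-coordinate _) ⨾ cong (lit 3 ⊗_) (ex ⨾ sym ey) ⨾ thrice-coordinate _)))
    where
    u-generators : Unique generators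
    u-generators = Uniq.filter⁺ _ (FermatTheory.nonzeros-unique 𝔽 2≢0)

  order-small : ∀ {x} → x ∈ generators → ∀ k .⦃ _ : NonZero k ⦄ → k < q → x ^ᶠ k ≢ 𝟏
  order-small x∈ k k<q e = <⇒≱ k<q (∣⇒≤ (proj₂ (proj₂ (proj₂ (∈-ofOrder x∈))) k e))

  module _ {x : F} (x∈ : x ∈ generators) where
    a : F
    a = coordinate x

    x≢0 : x ≢ 𝟘
    x≢0 = generator≢0 x∈

    fourth : ∀ x → x ⊗ x ≡ ⊝ 𝟏 → x ^ᶠ 4 ≡ 𝟏
    fourth x e = solve 1 (λ x → x :* (x :* (x :* (x :* con (⁺ 1)))) := (x :* x) :* (x :* x)) refl x
      ⨾ cong₂ _⊗_ e e ⨾ solve 0 ((:- con (⁺ 1)) :* (:- con (⁺ 1)) := con (⁺ 1)) refl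

    second : ∀ x → x ⊗ x ≡ 𝟏 → x ^ᶠ 2 ≡ 𝟏
    second x e = solve 1 (λ x → x :* (x :* con (⁺ 1)) := x :* x) refl x ⨾ e

    -- a = 0 would mean 1 / x = -x, hence x⁴ = 1, although x has order q > 4.
    a≢0 : a ≢ 𝟘
    a≢0 a≡0 = order-small x∈ 4 4<q (fourth x (lem x (inv x) (inverseʳ x≢0) (sym (thrice-coordinate x) ⨾ cong (lit 3 ⊗_) a≡0 ⨾ zeroʳ (lit 3))))
      where
      lem : ∀ x i → x ⊗ i ≡ 𝟏 → x ⊕ i ≡ 𝟘 → x ⊗ x ≡ ⊝ 𝟏
      lem x i e e′ = solve 2 (λ x i → x :* x := x :* (x :+ i) :- x :* i) refl x i ⨾ cong₂ (λ s t → x ⊗ s ⊟ t) e′ e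
        ⨾ solve 1 (λ x → x :* con (⁺ 0) :- con (⁺ 1) := :- con (⁺ 1)) refl x

    x≢inv : x ⊟ inv x ≢ 𝟘
    x≢inv e = order-small x∈ 2 (≤-trans (m≤m+n 3 2) 4<q) (second x (cong (x ⊗_) (⊟≡𝟘⇒≡ e) ⨾ inverseʳ x≢0))

    -- The linear factors of the conic's quadratic form. In these coordinates the conic is the
    -- hyperbola ξ η = -a², and the rotation multiplies ξ by x.
    ξ η : F → F → F
    ξ b c = b ⊟ x ⊗ c
    η b c = b ⊟ inv x ⊗ c

    ξη : ∀ b c → Markoff (a , b , c) → ξ b c ⊗ η b c ≡ ⊝ (a ⊗ a)
    ξη b c e = lem x (inv x) (inverseʳ x≢0) ⨾ cong (λ t → b ⊗ b ⊕ c ⊗ c ⊟ t ⊗ (b ⊗ c)) (sym (thrice-coordinate x)) ⨾ markoff-form a b c e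
      where
      lem : ∀ x i → x ⊗ i ≡ 𝟏 → (b ⊟ x ⊗ c) ⊗ (b ⊟ i ⊗ c) ≡ b ⊗ b ⊕ c ⊗ c ⊟ (x ⊕ i) ⊗ (b ⊗ c)
      lem x i e = solve 4 (λ x i b c → (b :- x :* c) :* (b :- i :* c) := b :* b :+ (x :* i) :* (c :* c) :- (x :+ i) :* (b :* c)) refl x i b c
        ⨾ cong (λ z → b ⊗ b ⊕ z ⊗ (c ⊗ c) ⊟ (x ⊕ i) ⊗ (b ⊗ c)) e
        ⨾ cong (λ z → b ⊗ b ⊕ z ⊟ (x ⊕ i) ⊗ (b ⊗ c)) (⊗-identityˡ (c ⊗ c))

    ξ≢0 : ∀ {b c} → Markoff (a , b , c) → ξ b c ≢ 𝟘
    ξ≢0 {b} {c} e z = a≢0 (square≡𝟘 (solve 1 (λ a → a :* a := :- (:- (a :* a))) refl a ⨾ cong ⊝_ (sym (ξη b c e) ⨾ cong (_⊗ η b c) z ⨾ zeroˡ (η b c))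
      ⨾ solve 0 (:- con (⁺ 0) := con (⁺ 0)) refl))

    ξ-rotate : ∀ b c → ξ c ((lit 3 ⊗ a) ⊗ c ⊟ b) ≡ x ⊗ ξ b c
    ξ-rotate b c = cong (λ t → c ⊟ x ⊗ (t ⊗ c ⊟ b)) (thrice-coordinate x) ⨾ lem x (inv x) (inverseʳ x≢0)
      where
      lem : ∀ x i → x ⊗ i ≡ 𝟏 → c ⊟ x ⊗ ((x ⊕ i) ⊗ c ⊟ b) ≡ x ⊗ (b ⊟ x ⊗ c)
      lem x i e = solve 4 (λ x i b c → c :- x :* ((x :+ i) :* c :- b) := c :- (x :* i) :* c :+ x :* (b :- x :* c)) refl x i b c
        ⨾ cong (λ z → c ⊟ z ⊗ c ⊕ x ⊗ (b ⊟ x ⊗ c)) e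
        ⨾ solve 2 (λ c s → c :- con (⁺ 1) :* c :+ s := s) refl c (x ⊗ (b ⊟ x ⊗ c))

    determined : ∀ {b c b′ c′} → ξ b c ≡ ξ b′ c′ → η b c ≡ η b′ c′ → (b , c) ≡ (b′ , c′)
    determined {b} {c} {b′} {c′} e₁ e₂ = cong₂ _,_ b≡ c≡
      where
      c≡ : c ≡ c′
      c≡ = cancelˡ x≢inv (solve 4 (λ x i b c → (x :- i) :* c := (b :- i :* c) :- (b :- x :* c)) refl x (inv x) b c ⨾ cong₂ _⊟_ e₂ e₁
        ⨾ solve 4 (λ x i b c → (b :- i :* c) :- (b :- x :* c) := (x :- i) :* c) refl x (inv x) b′ c′)
      b≡ : b ≡ b′
      b≡ = solve 3 (λ x b c → b := (b :- x :* c) :+ x :* c) refl x b c ⨾ cong₂ (λ s c → s ⊕ x ⊗ c) e₁ c≡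
        ⨾ solve 3 (λ x b c → (b :- x :* c) :+ x :* c := b) refl x b′ c′

    -- On the hyperbola ξ is nonzero and determines the point. Any quotient of two values of ξ is a
    -- power of the primitive root x, so enough rotations reach every point.
    conic-transitive : ∀ {O} → Invariant O → ∀ {b c} → (a , b , c) ∈ O → ∀ {b′ c′} → Markoff (a , b′ , c′) → (a , b′ , c′) ∈ O
    conic-transitive {O} inv-O {b} {c} p∈ {b′} {c′} m′ = subst (λ y → (a , y) ∈ O) same q∈
      where
      open Invariant inv-O using (markoff)
      open OrbitSlices 𝔽 1≤q 2≢0 3≢0 O inv-O using (rotate∈)
      rotations : ∀ k {b c} → (a , b , c) ∈ O → Σ F λ b₁ → Σ F λ c₁ → (a , b₁ , c₁) ∈ O × ξ b₁ c₁ ≡ x ^ᶠ k ⊗ ξ b c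
      rotations zero {b} {c} h = b , c , h , sym (⊗-identityˡ _)
      rotations (suc k) {b} {c} h = let b₁ , c₁ , h₁ , e = rotations k (rotate∈ h) in b₁ , c₁ , h₁ ,
        (e ⨾ cong (x ^ᶠ k ⊗_) (ξ-rotate b c) ⨾ solve 3 (λ p x s → p :* (x :* s) := x :* p :* s) refl (x ^ᶠ k) x (ξ b c))
      z = ξ b′ c′ ⊗ inv (ξ b c)
      power = generates x∈ {z} (⊗-≢𝟘 (ξ≢0 m′) (inv-≢𝟘 (ξ≢0 (markoff p∈))))
      reached = rotations (proj₁ power) p∈
      b₁ = proj₁ reached
      c₁ = proj₁ (proj₂ reached)
      q∈ = proj₁ (proj₂ (proj₂ reached))
      ξ≡ : ξ b₁ c₁ ≡ ξ b′ c′
      ξ≡ = proj₂ (proj₂ (proj₂ reached)) ⨾ cong (_⊗ ξ b c) (proj₂ (proj₂ power))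
        ⨾ ⊗-assoc _ _ _ ⨾ cong (ξ b′ c′ ⊗_) (inverseˡ (ξ≢0 (markoff p∈))) ⨾ ⊗-identityʳ _
      η≡ : η b₁ c₁ ≡ η b′ c′
      η≡ = cancelˡ (ξ≢0 m′) (cong (_⊗ η b₁ c₁) (sym ξ≡) ⨾ ξη b₁ c₁ (markoff q∈) ⨾ sym (ξη b′ c′ m′))
      same : (b₁ , c₁) ≡ (b′ , c′)
      same = determined ξ≡ η≡

  τq≤T : τ q ≤ τ (q * (q + 2))
  τq≤T = unique-⊆-length (divisors-unique q) (λ d∈ → ∈-divisors⁺ (*-mono-≤ 1≤q (≤-trans 1≤q (m≤m+n q 2))) (∣-trans (∈-divisors⁻ {q} d∈) (m∣m*n (q + 2))))

  module _ (K : ℕ) (K≡ : τ (q * (q + 2)) * τ (q * (q + 2)) * (τ (q * (q + 2)) * τ (q * (q + 2))) * 8192 ≡ K)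
           (hyp₁ : (K + Constants.B K) * ((K + Constants.B K) * 2) < suc q)
           (hyp₂ : τ (q * (q + 2)) * (4 * (Constants.B K * Constants.B K * Constants.B K * (K * K))) < q) where
    T Bq M G : ℕ
    T  = τ (q * (q + 2))
    Bq = Constants.B K
    M  = K + Bq
    G  = Bq * Bq * Bq * (K * K)

    open ≤-Reasoning

    coordinates : ∀ {O} → Invariant O → List F
    coordinates {O} inv-O = OrbitSlices.A 𝔽 1≤q 2≢0 3≢0 O inv-O

    -- From p ≤ |O| ≤ 2 α² and `hyp₁` it follows that α ≥ M = K + Bq, which covers both lower bounds
    -- that the sum-product argument asks for.
    few-missing-coordinates : ∀ {O x₀} → (inv-O : Invariant O) → x₀ ∈ O →
                              length (filter (λ x → ¬? (DecMembership._∈?_ _≟ᶠ_ x (coordinates inv-O))) elems) ≤ G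
    few-missing-coordinates {O} {x₀} inv-O x₀∈ = LargeOrbit.few-missing 𝔽 1≤q 2≢0 3≢0 O inv-O x₀∈ K K≡ (≤-trans (m≤m+n K Bq) M≤α) (≤-trans (m≤n+m Bq K) M≤α)
      where
      open OrbitSlices 𝔽 1≤q 2≢0 3≢0 O inv-O using (α; ω≤2α²)
      M≤α : M ≤ α
      M≤α = ≮⇒≥ λ α<M → <⇒≱ hyp₁ (begin
        suc q            ≤⟨ orbit-size 3≢0 inv-O x₀∈ ⟩
        length O         ≤⟨ ω≤2α² ⟩
        α * (α * 2)      ≤⟨ *-mono-≤ (<⇒≤ α<M) (*-monoˡ-≤ 2 (<⇒≤ α<M)) ⟩
        M * (M * 2)      ∎)

    -- Each of two invariant sets misses at most G elements of the field. A cage of more than 2 G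
    -- elements thus contains a coordinate common to both.
    2G<cage : G + G < length cage
    2G<cage = ≰⇒> λ cage≤ → <⇒≱ hyp₂ (begin
      q                                ≤⟨ q≤τ*generators ⟩
      τ q * length generators          ≤⟨ *-mono-≤ τq≤T (≤-trans generators≤2cage (*-monoˡ-≤ 2 cage≤)) ⟩
      T * ((G + G) * 2)                ≡⟨ cong (T *_) (lem G) ⟩
      T * (4 * G)                      ∎)
      where
      lem : ∀ g → (g + g) * 2 ≡ 4 * g
      lem = solve-∀

    orbits-meet : ∀ {O O′ x₀ y₀} → Invariant O → Invariant O′ → x₀ ∈ O → y₀ ∈ O′ → ∃ λ z → z ∈ O × z ∈ O′
    orbits-meet {O} {O′} {x₀} {y₀} inv-O inv-O′ x₀∈ y₀∈ = go (any? (λ a → (a ∈? A) ×-dec (a ∈? A′)) cage)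
      where
      open DecMembership _≟ᶠ_ using (_∈?_)
      A = coordinates inv-O
      A′ = coordinates inv-O′
      missing : List F → List F
      missing X = filter (λ x → ¬? (x ∈? X)) elems
      through : ∀ {a} → (∃ λ x → x ∈ generators × a ≡ coordinate x) → a ∈ A → a ∈ A′ → ∃ λ z → z ∈ O × z ∈ O′
      through (x , x∈ , refl) a∈A a∈A′ =
        let b , c , p∈ = OrbitSlices.A⁻ 𝔽 1≤q 2≢0 3≢0 O inv-O a∈A
            b′ , c′ , p′∈ = OrbitSlices.A⁻ 𝔽 1≤q 2≢0 3≢0 O′ inv-O′ a∈A′
        in (coordinate x , b′ , c′) , conic-transitive x∈ inv-O p∈ (Invariant.markoff inv-O′ p′∈) , p′∈
      go : Dec (Any (λ a → a ∈ A × a ∈ A′) cage) → ∃ λ z → z ∈ O × z ∈ O′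
      go (yes h) = let a , a∈ , a∈A , a∈A′ = find h in
        through (∈-map⁻ coordinate (∈-deduplicate⁻ _≟ᶠ_ (map coordinate generators) a∈)) a∈A a∈A′
      go (no ¬h) = ⊥-elim (<⇒≱ 2G<cage (begin
        length cage                                    ≤⟨ unique-⊆-length cage-unique sub ⟩
        length (missing A ++ missing A′)               ≡⟨ length-++ (missing A) ⟩
        length (missing A) + length (missing A′)       ≤⟨ +-mono-≤ (few-missing-coordinates inv-O x₀∈) (few-missing-coordinates inv-O′ y₀∈) ⟩
        G + G                                          ∎))
        where
        sub : ∀ {a} → a ∈ cage → a ∈ missing A ++ missing A′
        sub {a} a∈ = place (a ∈? A) (a ∈? A′)
          where
          place : Dec (a ∈ A) → Dec (a ∈ A′) → a ∈ missing A ++ missing A′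
          place (no a∉) _ = ∈-++⁺ˡ (∈-filter⁺ (λ x → ¬? (x ∈? A)) (∈-elems a) a∉)
          place (yes _) (no a∉) = ∈-++⁺ʳ (missing A) (∈-filter⁺ (λ x → ¬? (x ∈? A′)) (∈-elems a) a∉)
          place (yes p) (yes p′) = ⊥-elim (¬h (lose a∈ (p , p′)))

-- Residues modulo p

module Residues {q : ℕ} (prime : Prime (suc q)) (1≤q : 1 ≤ q) where
  p : ℕ
  p = suc q

  R : Set
  R = Fin p

  mk : ℕ → R
  mk n = fromℕ< (m%n<n n p)

  toℕ-mk : ∀ n → toℕ (mk n) ≡ n % p
  toℕ-mk n = toℕ-fromℕ< (m%n<n n p)

  mk-cong : ∀ m n → m % p ≡ n % p → mk m ≡ mk n
  mk-cong m n e = toℕ-injective (toℕ-mk m ⨾ e ⨾ sym (toℕ-mk n))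

  mk-cong⁻ : ∀ m n → mk m ≡ mk n → m % p ≡ n % p
  mk-cong⁻ m n e = sym (toℕ-mk m) ⨾ cong toℕ e ⨾ toℕ-mk n

  mk-toℕ : ∀ x → mk (toℕ x) ≡ x
  mk-toℕ x = toℕ-injective (toℕ-mk (toℕ x) ⨾ m<n⇒m%n≡m (toℕ<n x))

  infixl 6 _+ᴿ_
  infixl 7 _*ᴿ_
  _+ᴿ_ _*ᴿ_ : R → R → R
  x +ᴿ y = mk (toℕ x + toℕ y)
  x *ᴿ y = mk (toℕ x * toℕ y)

  -ᴿ_ : R → R
  -ᴿ x = mk (p ∸ toℕ x)

  mk-+ : ∀ m n → mk m +ᴿ mk n ≡ mk (m + n)
  mk-+ m n = mk-cong (toℕ (mk m) + toℕ (mk n)) (m + n) (cong₂ (λ a b → (a + b) % p) (toℕ-mk m) (toℕ-mk n) ⨾ sym (%-distribˡ-+ m n p))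

  mk-* : ∀ m n → mk m *ᴿ mk n ≡ mk (m * n)
  mk-* m n = mk-cong (toℕ (mk m) * toℕ (mk n)) (m * n) (cong₂ (λ a b → (a * b) % p) (toℕ-mk m) (toℕ-mk n) ⨾ sym (%-distribˡ-* m n p))

  -- Presenting every residue as `mk n` reduces the ring laws to those of natural numbers.
  data View : R → Set where
    residue : ∀ n → View (mk n)

  view : ∀ x → View x
  view x = subst View (mk-toℕ x) (residue (toℕ x))

  +ᴿ-assoc : ∀ x y z → (x +ᴿ y) +ᴿ z ≡ x +ᴿ (y +ᴿ z)
  +ᴿ-assoc x y z with residue a ← view x | residue b ← view y | residue c ← view z =
    cong (_+ᴿ mk c) (mk-+ a b) ⨾ mk-+ (a + b) c ⨾ cong mk (+-assoc a b c) ⨾ sym (mk-+ a (b + c)) ⨾ cong (mk a +ᴿ_) (sym (mk-+ b c))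

  *ᴿ-assoc : ∀ x y z → (x *ᴿ y) *ᴿ z ≡ x *ᴿ (y *ᴿ z)
  *ᴿ-assoc x y z with residue a ← view x | residue b ← view y | residue c ← view z =
    cong (_*ᴿ mk c) (mk-* a b) ⨾ mk-* (a * b) c ⨾ cong mk (*-assoc a b c) ⨾ sym (mk-* a (b * c)) ⨾ cong (mk a *ᴿ_) (sym (mk-* b c))

  +ᴿ-comm : ∀ x y → x +ᴿ y ≡ y +ᴿ x
  +ᴿ-comm x y = cong mk (+-comm (toℕ x) (toℕ y))

  *ᴿ-comm : ∀ x y → x *ᴿ y ≡ y *ᴿ x
  *ᴿ-comm x y = cong mk (*-comm (toℕ x) (toℕ y))

  +ᴿ-identityˡ : ∀ x → mk 0 +ᴿ x ≡ x
  +ᴿ-identityˡ x with residue a ← view x = mk-+ 0 a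

  *ᴿ-identityˡ : ∀ x → mk 1 *ᴿ x ≡ x
  *ᴿ-identityˡ x with residue a ← view x = mk-* 1 a ⨾ cong mk (*-identityˡ a)

  distribˡᴿ : ∀ x y z → x *ᴿ (y +ᴿ z) ≡ x *ᴿ y +ᴿ x *ᴿ z
  distribˡᴿ x y z with residue a ← view x | residue b ← view y | residue c ← view z =
    cong (mk a *ᴿ_) (mk-+ b c) ⨾ mk-* a (b + c) ⨾ cong mk (*-distribˡ-+ a b c) ⨾ sym (mk-+ (a * b) (a * c)) ⨾ cong₂ _+ᴿ_ (sym (mk-* a b)) (sym (mk-* a c))

  mk-p : mk p ≡ mk 0
  mk-p = mk-cong p 0 (n%n≡0 p)

  inverseᴿ : ∀ x → x +ᴿ (-ᴿ x) ≡ mk 0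
  inverseᴿ x = cong (_+ᴿ (-ᴿ x)) (sym (mk-toℕ x)) ⨾ mk-+ (toℕ x) (p ∸ toℕ x) ⨾ cong mk (m+[n∸m]≡n (<⇒≤ (toℕ<n x))) ⨾ mk-p

  isCommutativeRingᴿ : IsCommutativeRing _≡_ _+ᴿ_ _*ᴿ_ -ᴿ_ (mk 0) (mk 1)
  isCommutativeRingᴿ = record
    { isRing = record
      { +-isAbelianGroup = record
        { isGroup = record
          { isMonoid = record
            { isSemigroup = record { isMagma = record { isEquivalence = isEquivalence ; ∙-cong = cong₂ _+ᴿ_ } ; assoc = +ᴿ-assoc }
            ; identity = +ᴿ-identityˡ , λ x → +ᴿ-comm x (mk 0) ⨾ +ᴿ-identityˡ x }
          ; inverse = (λ x → +ᴿ-comm (-ᴿ x) x ⨾ inverseᴿ x) , inverseᴿ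
          ; ⁻¹-cong = cong -ᴿ_ }
        ; comm = +ᴿ-comm }
      ; *-cong = cong₂ _*ᴿ_
      ; *-assoc = *ᴿ-assoc
      ; *-identity = *ᴿ-identityˡ , λ x → *ᴿ-comm x (mk 1) ⨾ *ᴿ-identityˡ x
      ; distrib = distribˡᴿ , λ x y z → *ᴿ-comm (y +ᴿ z) x ⨾ distribˡᴿ x y z ⨾ cong₂ _+ᴿ_ (*ᴿ-comm x y) (*ᴿ-comm x z) }
    ; *-comm = *ᴿ-comm }

  mk-inverse : ∀ a → 0 < a → a < p → Σ R λ i → mk a *ᴿ i ≡ mk 1
  mk-inverse a 0<a a<p with coprime-Bézout (Coprimality.sym (prime⇒coprime prime ⦃ >-nonZero 0<a ⦄ a<p))
  ... | Bézout.+- u v eq = mk u , (mk-* a u ⨾ cong mk (*-comm a u ⨾ sym eq) ⨾ mk-cong (1 + v * p) 1 ([m+kn]%n≡m%n 1 v p))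
  -- Here 1 + u a = v p, so the inverse is the negative of u.
  ... | Bézout.-+ u v eq = -ᴿ mk u , neg
    where
    +ᴿ-identityʳ : ∀ x → x +ᴿ mk 0 ≡ x
    +ᴿ-identityʳ x = +ᴿ-comm x (mk 0) ⨾ +ᴿ-identityˡ x
    ua : mk 1 +ᴿ mk a *ᴿ mk u ≡ mk 0
    ua = cong (mk 1 +ᴿ_) (mk-* a u) ⨾ mk-+ 1 (a * u) ⨾ cong mk (cong suc (*-comm a u) ⨾ eq) ⨾ mk-cong (v * p) 0 ([m+kn]%n≡m%n 0 v p)
    cancel : mk a *ᴿ mk u +ᴿ mk a *ᴿ (-ᴿ mk u) ≡ mk 0
    cancel = sym (distribˡᴿ (mk a) (mk u) (-ᴿ mk u)) ⨾ cong (mk a *ᴿ_) (inverseᴿ (mk u)) ⨾ mk-* a 0 ⨾ cong mk (*-zeroʳ a)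
    neg : mk a *ᴿ (-ᴿ mk u) ≡ mk 1
    neg = sym (+ᴿ-identityˡ (mk a *ᴿ (-ᴿ mk u))) ⨾ cong (_+ᴿ mk a *ᴿ (-ᴿ mk u)) (sym ua) ⨾ +ᴿ-assoc (mk 1) (mk a *ᴿ mk u) (mk a *ᴿ (-ᴿ mk u)) ⨾ cong (mk 1 +ᴿ_) cancel ⨾ +ᴿ-identityʳ (mk 1)

  abstract
    inverse : ∀ x → Σ R λ i → (x ≢ mk 0 → x *ᴿ i ≡ mk 1) × (x ≡ mk 0 → i ≡ mk 0)
    inverse x = go (toℕ x ≟ 0)
      where
      go : Dec (toℕ x ≡ 0) → Σ R λ i → (x ≢ mk 0 → x *ᴿ i ≡ mk 1) × (x ≡ mk 0 → i ≡ mk 0)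
      go (yes x≡0) = mk 0 , (λ x≢0 → ⊥-elim (x≢0 (toℕ-injective x≡0))) , λ _ → refl
      go (no  x≢0) = let i , e = mk-inverse (toℕ x) (n≢0⇒n>0 x≢0) (toℕ<n x) in
        i , (λ _ → cong (_*ᴿ i) (sym (mk-toℕ x)) ⨾ e) , λ x≡0 → ⊥-elim (x≢0 (cong toℕ x≡0))

  iter-mk : ∀ n → iter (mk 1 +ᴿ_) (mk 0) n ≡ mk n
  iter-mk zero    = refl
  iter-mk (suc n) = cong (mk 1 +ᴿ_) (iter-mk n) ⨾ mk-+ 1 n

  residueField : PrimeField p
  residueField = record
    { F = R ; _⊕_ = _+ᴿ_ ; _⊗_ = _*ᴿ_ ; ⊝_ = -ᴿ_ ; inv = λ x → proj₁ (inverse x) ; 𝟘 = mk 0 ; 𝟏 = mk 1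
    ; isCommutativeRing = isCommutativeRingᴿ
    ; inverseʳ = λ {x} → proj₁ (proj₂ (inverse x))
    ; inv-𝟘 = proj₂ (proj₂ (inverse (mk 0))) refl
    ; 𝟏≢𝟘 = λ e → 1≢0 (sym (m<n⇒m%n≡m (s≤s 1≤q)) ⨾ mk-cong⁻ 1 0 e)
    ; _≟ᶠ_ = Fin._≟_
    ; elems = allFin p
    ; elems-unique = Uniq.allFin⁺ p
    ; ∈-elems = ∈-allFin
    ; elems-length = length-tabulate {n = p} id
    ; nat-surjective = λ x → toℕ x , (iter-mk (toℕ x) ⨾ mk-toℕ x)
    ; characteristic = λ n e → m%n≡0⇒n∣m n p (mk-cong⁻ n 0 (sym (iter-mk n) ⨾ e))
    }
    where
    1≢0 : 1 ≢ 0
    1≢0 ()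

-- The theorem

module Closure {A : Set} (_≟ᴬ_ : DecidableEquality A) (all : List A) (∈-all : ∀ x → x ∈ all) (fs : List (A → A)) where
  open DecMembership _≟ᴬ_ using (_∈?_)

  -- Missing images are added one at a time; `bound` limits how many can still be added. `P` travels
  -- along, so that anything preserved by the moves is known on the whole closure.
  closure : (P : A → Set) → (∀ {f x} → f ∈ fs → P x → P (f x)) → ∀ x → P x →
            Σ (List A) λ S → Unique S × x ∈ S × (∀ {z} → z ∈ S → P z) × (∀ {f z} → f ∈ fs → z ∈ S → f z ∈ S)
  closure P step x px = grow (length all) [ x ] ([] ∷ []) (here refl) (λ { (here refl) → px }) (m≤m+n (length all) 1)
    where
    grow : ∀ bound S → Unique S → x ∈ S → (∀ {z} → z ∈ S → P z) → length all ≤ bound + length S →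
           Σ (List A) λ S → Unique S × x ∈ S × (∀ {z} → z ∈ S → P z) × (∀ {f z} → f ∈ fs → z ∈ S → f z ∈ S)
    grow bound S uS x∈ good enough with any? (λ fz → ¬? (proj₁ fz (proj₂ fz) ∈? S)) (cartesianProduct fs S)
    ... | no none = S , uS , x∈ , good , λ {f} {z} f∈ z∈ → decidable-stable (f z ∈? S) (λ ∉S → none (lose (∈-cartesianProduct⁺ f∈ z∈) ∉S))
    ... | yes some with (f , z) , fz∈ , ∉S ← find some with f∈ , z∈ ← ∈-cartesianProduct⁻ fs S fz∈ = extend bound enough
      where
      uS′ : Unique (f z ∷ S)
      uS′ = All.tabulate (λ { w∈ refl → ∉S w∈ }) ∷ uS
      good′ : ∀ {w} → w ∈ f z ∷ S → P w
      good′ (here refl) = step f∈ (good z∈)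
      good′ (there w∈)  = good w∈
      extend : ∀ bound → length all ≤ bound + length S →
               Σ (List A) λ S → Unique S × x ∈ S × (∀ {z} → z ∈ S → P z) × (∀ {f z} → f ∈ fs → z ∈ S → f z ∈ S)
      extend zero     le = ⊥-elim (<⇒≱ (unique-⊆-length uS′ (λ {w} _ → ∈-all w)) le)
      extend (suc bound) le = grow bound (f z ∷ S) uS′ (there x∈) good′ (≤-trans le (≤-reflexive (sym (+-suc bound (length S)))))

_∘-poly_ : ∀ {f g} → PolyBounded f → PolyBounded g → (∀ K → 2 ≤ K → 2 ≤ g K) → PolyBounded (λ K → f (g K))
_∘-poly_ {f} {g} (e , le) (e′ , le′) h = e′ * e , λ K 2≤K →
  ≤-trans (le (g K) (h K 2≤K)) (≤-trans (^-monoˡ-≤ e (le′ K 2≤K)) (≤-reflexive (^-*-assoc K e′ e)))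

scale : ℕ → ℕ
scale T = T * T * (T * T) * 8192

-- The left-hand sides of the two hypotheses of `Cage` as functions of K; the second still lacks its
-- factor τ(p² - 1).
threshold₁ threshold₂ : ℕ → ℕ
threshold₁ K = (K + Constants.B K) * ((K + Constants.B K) * 2)
threshold₂ K = 4 * (Constants.B K * Constants.B K * Constants.B K * (K * K))

threshold-poly : PolyBounded (λ T → threshold₁ (scale T) + T * threshold₂ (scale T))
threshold-poly = compose (sum *-poly (sum *-poly const-poly 2)) +-poly id-poly *-poly compose (const-poly 4 *-poly (B-poly *-poly B-poly *-poly B-poly *-poly (id-poly *-poly id-poly)))
  where
  sum : PolyBounded (λ K → K + Constants.B K)
  sum = id-poly +-poly B-poly
  scale-poly : PolyBounded scale
  scale-poly = id-poly *-poly id-poly *-poly (id-poly *-poly id-poly) *-poly const-poly 8192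
  scale≥2 : ∀ T → 2 ≤ T → 2 ≤ scale T
  scale≥2 T 2≤T = *-mono-≤ (*-mono-≤ (*-mono-≤ 1≤T 1≤T) (*-mono-≤ 1≤T 1≤T)) (m≤m+n 2 8190)
    where 1≤T = ≤-trans (n≤1+n 1) 2≤T
  compose : ∀ {f} → PolyBounded f → PolyBounded (λ T → f (scale T))
  compose pf = (pf ∘-poly scale-poly) scale≥2

-- The degree E comes first and the divisor bound second, with an exponent that exceeds 4 E.
absorb : ∀ {f} → PolyBounded f → Σ ℕ λ E → Σ ℕ λ c → (∀ T → 2 ≤ T → f T ≤ T ^ E) × (∀ m → 1 ≤ m → τ m ^ suc (E * 4) ≤ c * m)
absorb (E , le) = let c , bound = divisor-bound (E * 4) in E , c , le , bound

abstract
  constants : Σ ℕ λ E → Σ ℕ λ c → (∀ T → 2 ≤ T → threshold₁ (scale T) + T * threshold₂ (scale T) ≤ T ^ E) × (∀ m → 1 ≤ m → τ m ^ suc (E * 4) ≤ c * m)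
  constants = absorb threshold-poly

exponent₀ c₀ : ℕ
exponent₀ = proj₁ constants
c₀ = proj₁ (proj₂ constants)

τ-large : ∀ q → 1 ≤ q → 2 ≤ τ (q * (q + 2))
τ-large q 1≤q = unique-⊆-length {xs = 1 ∷ m ∷ []} (((<⇒≢ 1<m) ∷ []) ∷ [] ∷ []) sub
  where
  m = q * (q + 2)
  1<m : 1 < m
  1<m = ≤-trans (m≤n+m 2 q) (m≤n*m (q + 2) q ⦃ >-nonZero 1≤q ⦄)
  sub : ∀ {d} → d ∈ 1 ∷ m ∷ [] → d ∈ divisors m
  sub (here refl)         = ∈-divisors⁺ (<⇒≤ 1<m) (1∣ m)
  sub (there (here refl)) = ∈-divisors⁺ (<⇒≤ 1<m) ∣-refl

-- With e = exponent₀: if q ≤ τ^e then q⁴ ≤ τ^(4e) ≤ c₀ q (q + 2) ≤ 4 c₀ q².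
threshold-small : ∀ q → 4 * c₀ < q → let T = τ (q * (q + 2)) in threshold₁ (scale T) + T * threshold₂ (scale T) < q
threshold-small q 4c<q = ≤-<-trans (proj₁ (proj₂ (proj₂ constants)) T (τ-large q 1≤q)) (≰⇒> λ q≤T^E → <⇒≱ 4c<q (begin
    q                ≤⟨ m≤m*n q q ⟩
    q * q            ≤⟨ *-cancelʳ-≤ (q * q) (4 * c₀) (q * q) ⦃ m*n≢0 q q ⦄ (begin
      q * q * (q * q)          ≡⟨ lem₁ q ⟩
      q ^ 4                    ≤⟨ ^-monoˡ-≤ 4 q≤T^E ⟩
      (T ^ exponent₀) ^ 4              ≡⟨ ^-*-assoc T exponent₀ 4 ⟩
      T ^ (exponent₀ * 4)              ≤⟨ ^-monoʳ-≤ T ⦃ >-nonZero (≤-trans (n≤1+n 1) (τ-large q 1≤q)) ⦄ (n≤1+n (exponent₀ * 4)) ⟩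
      T ^ suc (exponent₀ * 4)          ≤⟨ proj₂ (proj₂ (proj₂ constants)) (q * (q + 2)) (*-mono-≤ 1≤q (≤-trans 1≤q (m≤m+n q 2))) ⟩
      c₀ * (q * (q + 2))        ≤⟨ *-monoʳ-≤ c₀ (*-monoʳ-≤ q (≤-trans (+-monoʳ-≤ q (≤-trans (*-monoʳ-≤ 2 1≤q) (m≤n+m (2 * q) q))) (≤-reflexive (lem₂ q)))) ⟩
      c₀ * (q * (4 * q))        ≡⟨ lem₃ c₀ q ⟩
      4 * c₀ * (q * q)          ∎) ⟩
    4 * c₀            ∎))
  where
  open ≤-Reasoning
  T = τ (q * (q + 2))
  1≤q : 1 ≤ q
  1≤q = ≤-trans (s≤s z≤n) 4c<q
  instance
    q-nonZero : NonZero q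
    q-nonZero = >-nonZero 1≤q
  lem₁ : ∀ q → q * q * (q * q) ≡ q * (q * (q * (q * 1)))
  lem₁ = solve-∀
  lem₂ : ∀ q → q + (q + 2 * q) ≡ 4 * q
  lem₂ = solve-∀
  lem₃ : ∀ c q → c * (q * (4 * q)) ≡ 4 * c * (q * q)
  lem₃ = solve-∀

-- Reachability between triples of natural numbers

module Connected {q : ℕ} (prime : Prime (suc q)) (4<q : 4 < q) where

  1≤q : 1 ≤ q
  1≤q = ≤-trans (m≤m+n 1 4) 4<q

  open Residues prime 1≤q
  𝔽 : PrimeField p
  𝔽 = residueField
  open FieldTheory 𝔽
  open MarkoffOrbits 𝔽

  lit≢0 : ∀ n .⦃ _ : NonZero n ⦄ → n < p → lit n ≢ 𝟘
  lit≢0 n n<p e = <⇒≱ n<p (∣⇒≤ (characteristic n (sym (lit≡nat n) ⨾ e)))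

  2≢0 : lit 2 ≢ 𝟘
  2≢0 = lit≢0 2 (≤-trans (m≤m+n 3 3) (s≤s 4<q))

  3≢0 : lit 3 ≢ 𝟘
  3≢0 = lit≢0 3 (≤-trans (m≤m+n 4 2) (s≤s 4<q))

  toPt : Point → Pt
  toPt (a , b , c) = toℕ a , toℕ b , toℕ c

  fromPt : Pt → Point
  fromPt (a , b , c) = mk a , mk b , mk c

  toPt-injective : ∀ {x y} → toPt x ≡ toPt y → x ≡ y
  toPt-injective e = cong₂ _,_ (toℕ-injective (cong proj₁ e)) (cong₂ _,_ (toℕ-injective (cong (proj₁ ∘ proj₂) e)) (toℕ-injective (cong (proj₂ ∘ proj₂) e)))

  toPt-fromPt : ∀ x → OnMarkoff p x → toPt (fromPt x) ≡ x
  toPt-fromPt (a , b , c) (a<p , b<p , c<p , _) = cong₂ _,_ (toℕ-mk a ⨾ m<n⇒m%n≡m a<p) (cong₂ _,_ (toℕ-mk b ⨾ m<n⇒m%n≡m b<p) (toℕ-mk c ⨾ m<n⇒m%n≡m c<p))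

  mk3 : lit 3 ≡ mk 3
  mk3 = cong (mk 1 +ᴿ_) (mk-+ 1 1) ⨾ mk-+ 1 2

  squares-mk : ∀ a b c → mk a ⊗ mk a ⊕ mk b ⊗ mk b ⊕ mk c ⊗ mk c ≡ mk (a * a + b * b + c * c)
  squares-mk a b c = cong₂ _⊕_ (cong₂ _⊕_ (mk-* a a) (mk-* b b) ⨾ mk-+ (a * a) (b * b)) (mk-* c c) ⨾ mk-+ (a * a + b * b) (c * c)

  product-mk : ∀ a b c → lit 3 ⊗ (mk a ⊗ (mk b ⊗ mk c)) ≡ mk (3 * a * b * c)
  product-mk a b c = cong₂ _⊗_ mk3 (cong (mk a ⊗_) (mk-* b c) ⨾ mk-* a (b * c)) ⨾ mk-* 3 (a * (b * c)) ⨾ cong mk (lem a b c)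
    where
    lem : ∀ a b c → 3 * (a * (b * c)) ≡ 3 * a * b * c
    lem = solve-∀

  markoff-mk : ∀ x → OnMarkoff p x → Markoff (fromPt x)
  markoff-mk (a , b , c) (_ , _ , _ , e) = squares-mk a b c ⨾ mk-cong (a * a + b * b + c * c) (3 * a * b * c) e ⨾ sym (product-mk a b c)

  toPt-vieta : ∀ x → toPt (vieta x) ≡ R1 p (toPt x)
  toPt-vieta (a , b , c) = cong (_, toℕ b , toℕ c) (cong toℕ value ⨾ toℕ-mk (3 * toℕ b * toℕ c + (p ∸ toℕ a)))
    where
    value : lit 3 ⊗ (b ⊗ c) ⊟ a ≡ mk (3 * toℕ b * toℕ c + (p ∸ toℕ a))
    value = cong (_⊟ a) (cong (_⊗ (b ⊗ c)) mk3 ⨾ mk-* 3 (toℕ b * toℕ c) ⨾ cong mk (sym (*-assoc 3 (toℕ b) (toℕ c))))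
      ⨾ mk-+ (3 * toℕ b * toℕ c) (p ∸ toℕ a)

  reach-move : ∀ x {f z} → f ∈ moves → Reach p x (toPt z) → Reach p x (toPt (f z))
  reach-move x {z = z} (here refl) r = r ◅◅ subst (Reach p (toPt z)) (sym (toPt-vieta z)) (stepR1 (toPt z) ◅ ε)
  reach-move x {z = z} (there (here refl)) r = r ◅◅ (step12 (toPt z) ◅ ε)
  reach-move x {z = z} (there (there (here refl))) r = r ◅◅ (step13 (toPt z) ◅ ε)
  reach-move x {z = z} (there (there (there (here refl)))) r = r ◅◅ (step23 (toPt z) ◅ ε)

  points : List Point
  points = cartesianProduct elems (cartesianProduct elems elems)

  ∈-points : ∀ x → x ∈ points
  ∈-points (a , b , c) = ∈-cartesianProduct⁺ (∈-elems a) (∈-cartesianProduct⁺ (∈-elems b) (∈-elems c))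

  open Closure (≡-dec _≟ᶠ_ (≡-dec _≟ᶠ_ _≟ᶠ_)) points ∈-points moves

  abstract
    -- The closure under the moves carries membership in the surface, being nonzero and reachability
    -- from x, together with a predicate `P` that is left free for `all-reachable`.
    orbit : (P : Point → Set) → (∀ {f x} → f ∈ moves → P x → P (f x)) → ∀ x → Xstar p x → P (fromPt x) →
            Σ (List Point) λ O → Invariant O × fromPt x ∈ O × (∀ {z} → z ∈ O → Reach p x (toPt z) × P z)
    orbit P step x (on , x≢0) px =
      let O , u , x∈ , good , closed = closure Q step′ (fromPt x)
            (subst (Reach p x) (sym (toPt-fromPt x on)) ε , markoff-mk x on , (λ e → x≢0 (sym (toPt-fromPt x on) ⨾ cong toPt e)) , px)
      in O , record
           { unique = u ; markoff = λ z∈ → proj₁ (proj₂ (good z∈)) ; nonzero = λ z∈ → proj₁ (proj₂ (proj₂ (good z∈)))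
           ; vieta∈ = closed (here refl) ; swap₁₂∈ = closed (there (here refl)) ; swap₁₃∈ = closed (there (there (here refl)))
           ; swap₂₃∈ = closed (there (there (there (here refl)))) } , x∈ , λ z∈ → proj₁ (good z∈) , proj₂ (proj₂ (proj₂ (good z∈)))
      where
      Q : Point → Set
      Q z = Reach p x (toPt z) × Markoff z × z ≢ origin × P z
      step′ : ∀ {f z} → f ∈ moves → Q z → Q (f z)
      step′ {f} {z} f∈ (r , m , n , pz) = reach-move x {f} {z} f∈ r , markoff-move {f} {z} f∈ m , nonzero-move f∈ n , step f∈ pz

  large-orbit : ∀ x → Xstar p x → Σ (List Pt) λ ys → Unique ys × All (Reach p x) ys × p ≤ length ys
  large-orbit x xs = let O , inv-O , x∈ , reach = orbit (λ _ → ⊤) (λ _ i → i) x xs _ in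
    map toPt O , map-unique (λ _ _ → toPt-injective) (Invariant.unique inv-O) ,
    All.tabulate (λ y∈ → let z , z∈ , y≡ = ∈-map⁻ toPt y∈ in subst (Reach p x) (sym y≡) (proj₁ (reach z∈))) ,
    ≤-trans (orbit-size 3≢0 inv-O x∈) (≤-reflexive (sym (length-map toPt O)))

  -- Paths are never reversed. Along the orbit of y the property "z ∈ O implies y ∈ O" is carried,
  -- which passes from z to f z since each move is an involution preserving O. A common point of the
  -- two orbits then puts y itself into O.
  all-reachable : 4 * c₀ < q → ∀ x y → Xstar p x → Xstar p y → Reach p x y
  all-reachable 4c<q x y xs ys =
    let O , inv-O , x∈ , reach = orbit (λ _ → ⊤) (λ _ i → i) x xs _
        O′ , inv-O′ , y∈ , back = orbit (λ z → z ∈ O → fromPt y ∈ O)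
          (λ {f} {z} f∈ h fz∈ → h (subst (_∈ O) (move-involutive f∈ z) (closed inv-O f∈ fz∈))) y ys id
        z , z∈O , z∈O′ = Cage.orbits-meet 𝔽 4<q 2≢0 3≢0 K refl hyp₁ hyp₂ inv-O inv-O′ x∈ y∈
    in subst (Reach p x) (toPt-fromPt y (proj₁ ys)) (proj₁ (reach (proj₂ (back z∈O′) z∈O)))
    where
    T = τ (q * (q + 2))
    K = scale T
    hyp₁ : threshold₁ K < suc q
    hyp₁ = ≤-trans (s≤s (m≤m+n (threshold₁ K) (T * threshold₂ K))) (≤-trans (threshold-small q 4c<q) (n≤1+n q))
    hyp₂ : T * threshold₂ K < q
    hyp₂ = ≤-<-trans (m≤n+m (T * threshold₂ K) (threshold₁ K)) (threshold-small q 4c<q)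
    closed : ∀ {O} → Invariant O → ∀ {f z} → f ∈ moves → z ∈ O → f z ∈ O
    closed inv-O (here refl) = Invariant.vieta∈ inv-O
    closed inv-O (there (here refl)) = Invariant.swap₁₂∈ inv-O
    closed inv-O (there (there (here refl))) = Invariant.swap₁₃∈ inv-O
    closed inv-O (there (there (there (here refl)))) = Invariant.swap₂₃∈ inv-O

log≤ : ∀ n → ⌊log₂ n ⌋ ≤ n
log≤ n = ≤-trans (⌊log₂⌋-mono-≤ (n≤2^n n)) (≤-reflexive (⌊log₂[2^n]⌋≡n n))

theorem1 : Σ ℕ λ k → (a b : ℕ) → 1 ≤ a → 1 ≤ b → Σ ℕ λ P₀ → (p : ℕ) → P₀ ≤ p → Prime p →
    (Σ Pt λ x → Xstar p x × CardPowLe (λ y → Xstar p y × ¬ Reach p x y) b (p ^ a))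
    × ((x : Pt) → Xstar p x → Σ (List Pt) λ ys →
    Unique ys × All (Reach p x) ys × ⌊log₂ p ⌋ ≤ k * length ys ^ 3)
-- `large-orbit` gives log₂ p ≤ p ≤ ℓ ≤ ℓ³ for the length ℓ, so k = 1 works. The threshold 4 c₀ + 6
-- ensures both q > 4 and q > 4 c₀ for q = p - 1.
theorem1 = 1 , λ a b 1≤a 1≤b → 4 * c₀ + 6 , λ p P₀≤p prime → proof a b 1≤b p P₀≤p prime
  where
  proof : ∀ a b → 1 ≤ b → ∀ p → 4 * c₀ + 6 ≤ p → Prime p →
    (Σ Pt λ x → Xstar p x × CardPowLe (λ y → Xstar p y × ¬ Reach p x y) b (p ^ a))
    × ((x : Pt) → Xstar p x → Σ (List Pt) λ ys →
    Unique ys × All (Reach p x) ys × ⌊log₂ p ⌋ ≤ 1 * length ys ^ 3)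
  proof a b 1≤b zero le _ = ⊥-elim (<⇒≱ (≤-trans (s≤s z≤n) (m≤n+m 6 (4 * c₀))) le)
  proof a b 1≤b (suc q) le p-prime = ((1 , 1 , 1) , star , exceptional) , λ x xs →
      let ys , u , r , p≤ = large-orbit x xs in ys , u , r , ≤-trans (log≤ (suc q)) (≤-trans p≤ (≤-trans (cube (length ys)) (≤-reflexive (sym (*-identityˡ _)))))
    where
    4<q : 4 < q
    4<q = ≤-pred (≤-trans (m≤n+m 6 (4 * c₀)) le)
    4c<q : 4 * c₀ < q
    4c<q = ≤-pred (≤-trans (≤-trans (m≤m+n (2 + 4 * c₀) 4) (≤-reflexive (lem (4 * c₀)))) le)
      where
      lem : ∀ n → 2 + n + 4 ≡ n + 6
      lem = solve-∀
    open Connected p-prime 4<q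
    1<p : 1 < suc q
    1<p = s≤s (≤-trans (m≤m+n 1 4) 4<q)
    star : Xstar (suc q) (1 , 1 , 1)
    star = (1<p , 1<p , 1<p , refl) , λ ()
    cube : ∀ n → n ≤ n ^ 3
    cube zero    = z≤n
    cube n@(suc _) = ≤-trans (≤-reflexive (sym (^-identityʳ n))) (^-monoʳ-≤ n {1} {3} (s≤s z≤n))
    exceptional : CardPowLe (λ y → Xstar (suc q) y × ¬ Reach (suc q) (1 , 1 , 1) y) b (suc q ^ a)
    -- A nonempty list would contradict `all-reachable`. Only the empty list remains, and its length
    -- satisfies 0^b = 0 because b ≥ 1.
    exceptional []      _ _ = subst (_≤ suc q ^ a) (sym (zero-power b 1≤b)) z≤n
      where
      zero-power : ∀ b → 1 ≤ b → 0 ^ b ≡ 0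
      zero-power (suc b) _ = refl
    exceptional (y ∷ _) _ ((ys , ¬r) ∷ _) = ⊥-elim (¬r (all-reachable 4c<q (1 , 1 , 1) y star ys))
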